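{- Let $n$ be a nonzero integer, let $k=\mathbb{Q}(\sqrt n)$ if $n$ is not the square of an integer and $k=\mathbb{Q}\oplus\mathbb{Q}$ otherwise. Let $S(n)=\bigsqcup_{b,c\ge1,\ (bc)^2=n/\Delta_k} S_k(b,c)/\!\sim$ and $L^\vee(n)=\{x\in L^\vee:\mathrm{disc}(x)=-27n\}$. Then the map $\Psi_n:S(n)\to\Gamma\backslash L^\vee(n)$ defined below is a bijection.
   Context: $L$ is the lattice of integral binary cubic forms $x(u,v)=x_0u^3+x_1u^2v+x_2uv^2+x_3v^3$, $x_i\in\mathbb{Z}$; $L^\vee=\{x\in L: x_1,x_2\in3\mathbb{Z}\}$. $\Gamma=SL(2,\mathbb{Z})$ acts by $(\gamma x)(u,v)=x((u,v)\gamma)$. $\mathrm{disc}(x)=x_1^2x_2^2+18x_0x_1x_2x_3-4x_0x_2^3-4x_1^3x_3-27x_0^2x_3^2$. For $k$ as in the claim: $\tau$ is the nontrivial automorphism of $k$ (for $\mathbb{Q}\oplus\mathbb{Q}$ it swaps coordinates, and $\mathbb{Q}$ is embedded diagonally); $\Delta_k$ is the discriminant ($\Delta_{\mathbb{Q}\oplus\mathbb{Q}}=1$); $\sqrt{\Delta_k}$ is the positive square root if $\Delta_k>0$, the square root with positive imaginary part if $\Delta_k<0$, and $(-1,1)$ if $k=\mathbb{Q}\oplus\mathbb{Q}$. $\mathcal{O}_k$ is the maximal order, $\mathcal{O}_{k,c}=\mathbb{Z}\cdot1+c\mathcal{O}_k$. Fractional ideals of an order are rank-2 $\mathbb{Z}$-submodules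 stable under the order; invertible ones have an inverse; $\mathbf N$ is the ideal norm ($[\mathcal{O}:\mathfrak a]$ for integral invertible $\mathfrak a$, extended multiplicatively), and $\mathrm{N}_{k/\mathbb{Q}}$ is the algebra norm. For $b,c\ge1$, $S_k(b,c)$ is the set of pairs $(\mathfrak a,\beta)$ with $\mathfrak a$ an invertible $\mathcal{O}_{k,c}$-ideal, $\beta\in\mathfrak a^3$ and $\mathbf N(\beta\mathfrak a^{ -3})=b$; $(\mathfrak a_1,\beta_1)\sim(\mathfrak a_2,\beta_2)$ if there is $\rho\in k^*$ with $\rho\mathfrak a_1=\mathfrak a_2$ and $\rho^3\beta_1=\beta_2$. Definition of $\Psi_n$: for $(\mathfrak a,\beta)\in S_k(b,c)$ with $(bc)^2\Delta_k=n$, choose a $\mathbb{Z}$-basis $\alpha_1,\alpha_2$ of $\mathfrak a$ with $\mathrm{N}_{k/\mathbb{Q}}(\beta)(\alpha_1\alpha_2^\tau-\alpha_2\alpha_1^\tau)/\sqrt{\Delta_k}<0$, and put $x(u,v)=\mathrm{Tr}_{k/\mathbb{Q}}\big(\frac{\beta}{c\sqrt{\Delta_k}\,\mathbf N\mathfrak a^3}(\alpha_1^\tau u+\alpha_2^\tau v)^3\big)$. Then $x\in L^\vee(n)$ and its $\Gamma$-orbit depends only on the class $[\mathfrak a,\beta]$; $\Psi_n$ sends $[\mathfrak a,\beta]$ to this $\Gamma$-orbit. -}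

module Defs where

open import Data.Nat as ℕ using (ℕ; suc)
open import Data.Integer as Int using (ℤ; +_; +[1+_]; -[1+_])
open import Data.Rational as Rat using (ℚ; mkℚ; 0ℚ; 1ℚ)
open import Data.Vec using (Vec; []; _∷_; zipWith; foldr; map; allPairs)
open import Data.Integer.Divisibility using (_∣_)
open Int using () renaming (_+_ to _+ℤ_; _*_ to _*ℤ_; _-_ to _-ℤ_; -_ to negℤ)
open import Data.Product using (Σ; ∃; ∃-syntax; _×_; _,_)
open import Data.Sum using (_⊎_)
open import Relation.Binary.PropositionalEquality using (_≡_; _≢_)
open import Function.Bundles using (_⇔_)

SquareFree : ℤ → Set
SquareFree m = ∀ (d : ℕ) → (+ d *ℤ + d) ∣ m → d ≡ 1

-- D is the discriminant of the maximal order of a quadratic étale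
-- Q-algebra: either a fundamental discriminant, or D = 1 (for Q ⊕ Q).
IsDiscriminant : ℤ → Set
IsDiscriminant D =
  (SquareFree D × (∃[ t ] D ≡ + 4 *ℤ t +ℤ + 1))
  ⊎ (∃[ m ] (D ≡ + 4 *ℤ m × SquareFree m
              × ((∃[ t ] m ≡ + 4 *ℤ t +ℤ + 2) ⊎ (∃[ t ] m ≡ + 4 *ℤ t +ℤ + 3))))

IsSquareℤ : ℤ → Set
IsSquareℤ z = ∃[ m ] z ≡ m *ℤ m

toℚ : ℤ → ℚ
toℚ z = z Rat./ 1

-- total reciprocal (value 0 at 0; only ever used at nonzero arguments)
recip : ℚ → ℚ
recip (mkℚ (+ 0) d prf) = 0ℚ
recip p@(mkℚ +[1+ n ] d prf) = Rat.1/ p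
recip p@(mkℚ -[1+ n ] d prf) = Rat.1/ p

-- Binary cubic forms x0 u³ + x1 u²v + x2 uv² + x3 v³

record Form (A : Set) : Set where
  constructor form
  field
    x0 x1 x2 x3 : A
open Form public

L : Set
L = Form ℤ

embed : L → Form ℚ
embed (form a b c d) = form (toℚ a) (toℚ b) (toℚ c) (toℚ d)

disc : L → ℤ
disc (form a b c d) =
  b * b * c * c + + 18 * a * b * c * d - + 4 * a * c * c * c
  - + 4 * b * b * b * d - + 27 * a * a * d * d
  where open Int using (_+_; _*_; _-_)

InLvee : ℤ → L → Set
InLvee n x = (+ 3 ∣ x1 x) × (+ 3 ∣ x2 x) × (disc x ≡ negℤ (+ 27 *ℤ n))

record SL2Z : Set where
  constructor mat
  field
    p q r s : ℤ
    det1 : p *ℤ s -ℤ q *ℤ r ≡ + 1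

-- (γ x)(u,v) = x((u,v)γ) = x(p u + r v , q u + s v), computed by
-- multiplying out linear forms in (u,v).
private
  module Poly where
    open Int using (_+_; _*_)
    -- linear form a u + b v as (a , b); quadratic (u², uv, v²); cubic
    Lin = ℤ × ℤ
    record Quad : Set where
      constructor qd
      field e f g : ℤ
    mulLL : Lin → Lin → Quad
    mulLL (a , b) (c , d) = qd (a * c) (a * d + b * c) (b * d)
    mulQL : Quad → Lin → Form ℤ
    mulQL (qd e f g) (c , d) = form (e * c) (e * d + f * c) (f * d + g * c) (g * d)
    scal : ℤ → Form ℤ → Form ℤ
    scal k (form a b c d) = form (k * a) (k * b) (k * c) (k * d)
    add : Form ℤ → Form ℤ → Form ℤ
    add (form a b c d) (form a' b' c' d') = form (a + a') (b + b') (c + c') (d + d')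

act : SL2Z → L → L
act (mat p q r s _) (form a b c d) =
  add (scal a (mulQL (mulLL U U) U))
  (add (scal b (mulQL (mulLL U U) V))
  (add (scal c (mulQL (mulLL U V) V))
       (scal d (mulQL (mulLL V V) V))))
  where
    open Poly
    U : Lin
    U = (p , r)
    V : Lin
    V = (q , s)

_∼Γ_ : L → L → Set
x ∼Γ y = ∃[ γ ] act γ x ≡ y

-- The quadratic algebra k = Q[√Δ] = Q[s]/(s² - Δ), Δ = D.
-- An element a + b s is represented by (a , b); s plays the role of √Δ_k.
-- (For D = 1, a + b s ↦ (a - b , a + b) identifies this with Q ⊕ Q,
--  with s ↦ (-1 , 1) and τ the coordinate swap.)

record K : Set where
  constructor _+s_
  field
    re im : ℚ
open K public

module Alg (D : ℤ) where
  open Rat using (_+_; _*_; -_; _-_)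

  Dq : ℚ
  Dq = toℚ D

  infixl 6 _⊕_ _⊖_
  infixl 7 _⊗_

  _⊕_ : K → K → K
  (a +s b) ⊕ (c +s d) = (a + c) +s (b + d)

  neg : K → K
  neg (a +s b) = (- a) +s (- b)

  _⊖_ : K → K → K
  x ⊖ y = x ⊕ neg y

  _⊗_ : K → K → K
  (a +s b) ⊗ (c +s d) = (a * c + Dq * b * d) +s (a * d + b * c)

  scale : ℚ → K → K
  scale q (a +s b) = (q * a) +s (q * b)

  fromℚ : ℚ → K
  fromℚ q = q +s 0ℚ

  fromℤ : ℤ → K
  fromℤ z = fromℚ (toℚ z)

  one : K
  one = fromℚ 1ℚ

  sqrtΔ : K
  sqrtΔ = 0ℚ +s 1ℚ

  τ : K → K
  τ (a +s b) = a +s (- b)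

  Tr : K → ℚ
  Tr x = re (x ⊕ τ x)

  Nm : K → ℚ
  Nm x = re (x ⊗ τ x)

  -- inverse (for elements of nonzero norm, i.e. units of k)
  inv : K → K
  inv x = scale (recip (Nm x)) (τ x)

  cube : K → K
  cube x = x ⊗ x ⊗ x

  Unit : K → Set
  Unit ρ = Nm ρ ≢ 0ℚ

  ω : K
  ω = scale (Rat.½) (fromℤ D ⊕ sqrtΔ)       -- (Δ + √Δ)/2, O_k = ℤ + ℤω

  Sub : Set₁
  Sub = K → Set

  _≐_ : Sub → Sub → Set
  A ≐ B = ∀ x → (A x ⇔ B x)

  linComb : ∀ {m} → Vec ℤ m → Vec K m → K
  linComb ms gs = foldr (λ _ → K) _⊕_ (fromℚ 0ℚ) (zipWith (λ z g → fromℤ z ⊗ g) ms gs)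

  Gen : ∀ {m} → Vec K m → Sub
  Gen gs x = ∃[ ms ] linComb ms gs ≡ x

  span : K → K → Sub
  span α₁ α₂ = Gen (α₁ ∷ α₂ ∷ [])

  _·g_ : ∀ {m p} → Vec K m → Vec K p → Vec K (m ℕ.* p)
  gs ·g hs = map (λ { (g , h) → g ⊗ h }) (allPairs gs hs)

  _•_ : K → Sub → Sub
  (ρ • A) x = ∃[ y ] (A y × ρ ⊗ y ≡ x)

  det : K → K → ℚ
  det (a +s b) (c +s d) = a * d - b * c

  Indep : K → K → Set
  Indep α₁ α₂ = det α₁ α₂ ≢ 0ℚ

  -- the order O_{k,c} = ℤ + c O_k = ℤ·1 + ℤ·cω

  ordBasis₂ : ℕ → K
  ordBasis₂ c = scale (toℚ (+ c)) ω

  Order : ℕ → Sub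
  Order c = span one (ordBasis₂ c)

  IsIdeal : ℕ → K → K → Set
  IsIdeal c α₁ α₂ = Indep α₁ α₂ ×
    (∀ o x → Order c o → span α₁ α₂ x → span α₁ α₂ (o ⊗ x))

  IsInverse : ℕ → K → K → K → K → Set
  IsInverse c α₁ α₂ γ₁ γ₂ =
    IsIdeal c γ₁ γ₂ × (Gen ((α₁ ∷ α₂ ∷ []) ·g (γ₁ ∷ γ₂ ∷ [])) ≐ Order c)

  Invertible : ℕ → K → K → Set
  Invertible c α₁ α₂ = ∃[ γ₁ ] ∃[ γ₂ ] IsInverse c α₁ α₂ γ₁ γ₂

  -- ideal norm of the O_{k,c}-lattice with basis δ₁, δ₂ :
  -- covolume ratio [O_{k,c} : 𝔡] = |det(δ)| / |det(1, cω)|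
  𝐍 : ℕ → K → K → ℚ
  𝐍 c δ₁ δ₂ = Rat.∣ det δ₁ δ₂ ∣ * recip (Rat.∣ det one (ordBasis₂ c) ∣)

  cubeGens : K → K → Vec K 8
  cubeGens α₁ α₂ = ((α₁ ∷ α₂ ∷ []) ·g (α₁ ∷ α₂ ∷ [])) ·g (α₁ ∷ α₂ ∷ [])

  InCube : K → K → K → Set
  InCube α₁ α₂ β = Gen (cubeGens α₁ α₂) β

  -- 𝐍(β 𝔞⁻³) = b
  NormCond : ℕ → ℕ → K → K → K → Set
  NormCond b c α₁ α₂ β =
    ∃[ γ₁ ] ∃[ γ₂ ] (IsInverse c α₁ α₂ γ₁ γ₂ ×
      ∃[ δ₁ ] ∃[ δ₂ ] (Indep δ₁ δ₂ ×
        (span δ₁ δ₂ ≐ Gen (map (β ⊗_) (cubeGens γ₁ γ₂))) ×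
        𝐍 c δ₁ δ₂ ≡ toℚ (+ b)))

  -- S(n): disjoint union over b, c ≥ 1 with (bc)² Δ = n of S_k(b,c).
  -- An element records b, c and (𝔞, β) where 𝔞 is given by a ℤ-basis.

  record S (n : ℤ) : Set where
    constructor sElt
    field
      b c : ℕ
      b≥1 : 1 ℕ.≤ b
      c≥1 : 1 ℕ.≤ c
      bcΔ : + (b ℕ.* c) *ℤ + (b ℕ.* c) *ℤ D ≡ n
      α₁ α₂ β : K
      ideal : IsIdeal c α₁ α₂
      invertible : Invertible c α₁ α₂
      β∈𝔞³ : InCube α₁ α₂ β
      norm : NormCond b c α₁ α₂ β

  open S public

  _∼S_ : ∀ {n} → S n → S n → Set
  s ∼S t = (b s ≡ b t) × (c s ≡ c t) ×
    ∃[ ρ ] (Unit ρ × ((ρ • span (α₁ s) (α₂ s)) ≐ span (α₁ t) (α₂ t))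
             × cube ρ ⊗ β s ≡ β t)

  IsNegRational : K → Set
  IsNegRational x = (im x ≡ 0ℚ) × (re x Rat.< 0ℚ)

  -- (α₁', α₂') is a ℤ-basis of 𝔞 (of s) with the required orientation
  AdmBasis : ∀ {n} → S n → K → K → Set
  AdmBasis s a₁ a₂ =
    (span a₁ a₂ ≐ span (α₁ s) (α₂ s)) ×
    IsNegRational (fromℚ (Nm (β s)) ⊗ (a₁ ⊗ τ a₂ ⊖ a₂ ⊗ τ a₁) ⊗ inv sqrtΔ)

  -- x(u,v) = Tr( β/(c √Δ 𝐍𝔞³) (α₁^τ u + α₂^τ v)³ ), expanded binomially
  ΨForm : ℕ → K → K → K → Form ℚ
  ΨForm c a₁ a₂ β = form (Tr (γ ⊗ A ⊗ A ⊗ A))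
                          (Tr (γ ⊗ fromℤ (+ 3) ⊗ A ⊗ A ⊗ B))
                          (Tr (γ ⊗ fromℤ (+ 3) ⊗ A ⊗ B ⊗ B))
                          (Tr (γ ⊗ B ⊗ B ⊗ B))
    where
      A = τ a₁
      B = τ a₂
      N𝔞 = 𝐍 c a₁ a₂
      γ = scale (recip (toℚ (+ c) * (N𝔞 * N𝔞 * N𝔞))) (β ⊗ inv sqrtΔ)

  ΨRel : ∀ {n} → S n → L → Set
  ΨRel s x = ∃[ a₁ ] ∃[ a₂ ] (AdmBasis s a₁ a₂ × embed x ≡ ΨForm (c s) a₁ a₂ (β s))

-- Put θ = cω. If ℤα₁ + ℤα₂ is an invertible ideal of O = ℤ[θ], let ν be its norm, with the sign
-- of det(α₁, α₂), and ᾱᵢ = τ(αᵢ)/ν. The ᾱᵢ span the inverse ideal, and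
-- αᵢᾱᵢ ∈ ℤ, α₂ᾱ₁ = h + θ, α₁ᾱ₂ = h + τ(θ): the ideal is described by the primitive quadratic
-- form N(α₁u + α₂v)/ν of discriminant c²Δ. The cubic form of (𝔞, β) is
-- Tr(β(ᾱ₁u + ᾱ₂v)³/(c√Δ)) up to a sign of the basis. Its coefficients are the θ-coordinates of
-- the elements βᾱᵢᾱⱼᾱₖ of O (up to the factors 3), and its Hessian is b times the quadratic
-- form. Hence b, c and the quadratic form are invariants of the cubic form. The quadratic form
-- determines 𝔞 up to a factor ρ, and nondegeneracy of the trace then determines β.
-- Conversely, given a cubic form with q₁² − q₀q₂ ≠ 0, which is no restriction up to SL₂(ℤ),
-- its Hessian divided by its content b is primitive of discriminant c²Δ, with leading
-- coefficient f₀ and middle coefficient 2h + cΔ, say; the form comes from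
-- 𝔞 = ℤf₀ + ℤ(h + θ) and β = q₀(h + θ) − q₁f₀.
module Submission where

open import Defs
open import Algebra.Structures using (IsCommutativeRing)
import Algebra.Solver.Ring as RingSolver
import Algebra.Solver.Ring.AlmostCommutativeRing as SolverACR
open import Data.Empty using (⊥; ⊥-elim)
open import Data.Fin using (zero; suc; #_)
open import Data.Integer as ℤ using (ℤ; +_; -[1+_]; +[1+_])
import Data.Integer.Divisibility as Unsigned
open import Data.Integer.Divisibility.Signed using (divides; ∣⇒∣ᵤ; ∣ᵤ⇒∣)
import Data.Integer.Properties as ℤ
import Data.Integer.Tactic.RingSolver as ℤ-Tactic
open import Data.Maybe using (Maybe; just; nothing)
open import Data.Nat as ℕ using (ℕ; zero; suc; s≤s; z≤n)
import Data.Nat.Coprimality as Coprimality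
import Data.Nat.Divisibility as ℕ
open import Data.Nat.GCD using (module Bézout; module GCD)
import Data.Nat.Properties as ℕ
open import Data.Product using (Σ; ∃-syntax; _×_; _,_; proj₁; proj₂)
open import Data.Rational as ℚ using (ℚ; mkℚ; 0ℚ; 1ℚ; ½)
import Data.Rational.Properties as ℚ
open import Data.Sum using (_⊎_; inj₁; inj₂)
open import Data.Vec using (Vec; []; _∷_; map; lookup)
open import Data.Vec.Relation.Unary.All using (All; []; _∷_)
open import Function.Bundles using (_⇔_; mk⇔; module Equivalence)
open import Level using (0ℓ)
open import Relation.Binary.Definitions using (Tri; tri<; tri≈; tri>)
open import Relation.Binary.PropositionalEquality
open import Relation.Nullary using (Dec; yes; no; ¬_)
open import Relation.Nullary.Decidable using (from-no)
open import Tactic.RingSolver using (solve-∀)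
import Tactic.RingSolver.Core.AlmostCommutativeRing as ACR

-- For D = 1 the algebra has zero divisors, so a nonzero element of `K` cannot in general be
-- cancelled. What replaces cancellation is a witness of primitivity: integers `u₀`, `u₁`, `u₂` with
-- u₀·α₁ᾱ₁ + u₁·(α₁ᾱ₂ + α₂ᾱ₁) + u₂·α₂ᾱ₂ = 1. This one identity makes O the additive span of the
-- products of 𝔞 with its inverse, so that a property need only be checked on such products; it
-- shows that z = 0 as soon as zᾱ₁ = zᾱ₂ = 0; and it produces the factor ρ. The sign of ν spares the
-- relations between the αᵢ and ᾱⱼ any case distinction. The norm condition alone gives |N(β)/ν³| =
-- b, and the orientation of the basis is exactly what turns this into N(β)/ν³ = b, so that the
-- Hessian is +b times the quadratic form. In the converse direction the primitive part of the
-- Hessian has a discriminant m for which mD is a square. That m is c²D with an integer c uses that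
-- D is fundamental, and for even D also that m is 0 or 1 mod 4.

-- Rational arithmetic: the embedding of ℤ, reciprocals, signs

module RationalLemmas where
  open import Data.Rational using (_+_; _*_; -_; _-_; _<_)

  private
    isZero? : ∀ q → Maybe (0ℚ ≡ q)
    isZero? q with 0ℚ ℚ.≟ q
    ... | yes p = just p
    ... | no _  = nothing

  ℚ-ring : ACR.AlmostCommutativeRing 0ℓ 0ℓ
  ℚ-ring = ACR.fromCommutativeRing ℚ.+-*-commutativeRing isZero?

  private
    -- `toℚ m` normalises m / 1 by a gcd and does not compute for a variable m. This literal
    -- fraction does, so identities are checked on it and carried back.
    integral : ℤ → ℚ
    integral m = mkℚ m 0 (Coprimality.sym (Coprimality.1-coprimeTo _))

    toℚ≡integral : ∀ m → toℚ m ≡ integral m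
    toℚ≡integral m = ℚ.↥p/↧p≡p (integral m)

  toℚ-injective : ∀ {m n} → toℚ m ≡ toℚ n → m ≡ n
  toℚ-injective {m} {n} eq =
    cong ℚ.numerator (trans (sym (toℚ≡integral m)) (trans eq (toℚ≡integral n)))

  toℚ-+ : ∀ m n → toℚ (m ℤ.+ n) ≡ toℚ m + toℚ n
  toℚ-+ m n = sym (trans (cong₂ _+_ (toℚ≡integral m) (toℚ≡integral n))
    (cong toℚ (cong₂ ℤ._+_ (ℤ.*-identityʳ m) (ℤ.*-identityʳ n))))

  toℚ-* : ∀ m n → toℚ (m ℤ.* n) ≡ toℚ m * toℚ n
  toℚ-* m n = sym (cong₂ _*_ (toℚ≡integral m) (toℚ≡integral n))

  toℚ-neg : ∀ m → toℚ (ℤ.- m) ≡ - toℚ m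
  toℚ-neg m = trans (toℚ≡integral (ℤ.- m)) (trans (helper m) (cong -_ (sym (toℚ≡integral m))))
    where
    helper : ∀ m → integral (ℤ.- m) ≡ - integral m
    helper (+ zero)    = refl
    helper +[1+ n ]    = refl
    helper (-[1+ n ])  = refl

  toℚ-mono-< : ∀ {m n} → m ℤ.< n → toℚ m < toℚ n
  toℚ-mono-< {m} {n} m<n = subst₂ _<_ (sym (toℚ≡integral m)) (sym (toℚ≡integral n))
    (ℚ.*<* (subst₂ ℤ._<_ (sym (ℤ.*-identityʳ m)) (sym (ℤ.*-identityʳ n)) m<n))

  toℚ-nonzero : ∀ {m} → m ≢ + 0 → toℚ m ≢ 0ℚ
  toℚ-nonzero m≢0 eq = m≢0 (toℚ-injective eq)

  toℚ-pos : ∀ {n} → 1 ℕ.≤ n → 0ℚ < toℚ (+ n)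
  toℚ-pos 1≤n = toℚ-mono-< {+ 0} (ℤ.+<+ 1≤n)

  <⇒≢0 : ∀ {p} → 0ℚ < p → p ≢ 0ℚ
  <⇒≢0 0<p p≡0 = ℚ.<-irrefl (sym p≡0) 0<p

  recip-inverse : ∀ {p} → p ≢ 0ℚ → p * recip p ≡ 1ℚ
  recip-inverse {p@(mkℚ (+ 0) d prf)} p≢0 = ⊥-elim (p≢0 (ℚ.↥p≡0⇒p≡0 p refl))
  recip-inverse {p@(mkℚ +[1+ n ] d prf)} p≢0 = ℚ.*-inverseʳ p
  recip-inverse {p@(mkℚ -[1+ n ] d prf)} p≢0 = ℚ.*-inverseʳ p

  *-cancelˡ : ∀ {p q r} → p ≢ 0ℚ → p * q ≡ p * r → q ≡ r
  *-cancelˡ {p} {q} {r} p≢0 eq = begin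
    q ≡⟨ ℚ.*-identityˡ q ⟨
    1ℚ * q ≡⟨ cong (_* q) (recip-inverse p≢0) ⟨
    (p * recip p) * q ≡⟨ shuffle p (recip p) q ⟩
    recip p * (p * q) ≡⟨ cong (recip p *_) eq ⟩
    recip p * (p * r) ≡⟨ shuffle p (recip p) r ⟨
    (p * recip p) * r ≡⟨ cong (_* r) (recip-inverse p≢0) ⟩
    1ℚ * r ≡⟨ ℚ.*-identityˡ r ⟩
    r ∎
    where
    open ≡-Reasoning
    shuffle : ∀ p p' q → (p * p') * q ≡ p' * (p * q)
    shuffle = solve-∀ ℚ-ring

  p*q≡0⇒q≡0 : ∀ {p q} → p ≢ 0ℚ → p * q ≡ 0ℚ → q ≡ 0ℚ
  p*q≡0⇒q≡0 {p} p≢0 eq = *-cancelˡ p≢0 (trans eq (sym (ℚ.*-zeroʳ p)))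

  *-≢0 : ∀ {p q} → p ≢ 0ℚ → q ≢ 0ℚ → p * q ≢ 0ℚ
  *-≢0 p≢0 q≢0 eq = q≢0 (p*q≡0⇒q≡0 p≢0 eq)

  recip-unique : ∀ {p q} → p * q ≡ 1ℚ → recip p ≡ q
  recip-unique {p} {q} eq = *-cancelˡ p≢0 (trans (recip-inverse p≢0) (sym eq))
    where
    p≢0 : p ≢ 0ℚ
    p≢0 refl with trans (sym (ℚ.*-zeroˡ q)) eq
    ... | ()

  *-pos : ∀ {p q} → 0ℚ < p → 0ℚ < q → 0ℚ < p * q
  *-pos {p} {q} 0<p 0<q = subst (_< p * q) (ℚ.*-zeroʳ p) (ℚ.*-monoʳ-<-pos p 0<q)
    where instance _ = ℚ.positive 0<p

  neg-pos : ∀ {p} → p < 0ℚ → 0ℚ < - p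
  neg-pos = ℚ.neg-antimono-<

  square-pos : ∀ {p} → p ≢ 0ℚ → 0ℚ < p * p
  square-pos {p} p≢0 with ℚ.<-cmp p 0ℚ
  ... | tri< p<0 _ _ = subst (0ℚ <_) (lemma p) (*-pos (neg-pos p<0) (neg-pos p<0))
    where
    lemma : ∀ p → - p * - p ≡ p * p
    lemma = solve-∀ ℚ-ring
  ... | tri≈ _ p≡0 _ = ⊥-elim (p≢0 p≡0)
  ... | tri> _ _ 0<p = *-pos 0<p 0<p

  pos-cancelʳ : ∀ {p q} → 0ℚ < p → 0ℚ < q * p → 0ℚ < q
  pos-cancelʳ {p} {q} 0<p 0<qp with ℚ.<-cmp q 0ℚ
  ... | tri> _ _ 0<q = 0<q
  ... | tri≈ _ q≡0 _ = ⊥-elim (<⇒≢0 0<qp (trans (cong (_* p) q≡0) (ℚ.*-zeroˡ p)))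
  ... | tri< q<0 _ _ = ⊥-elim (ℚ.<-asym 0<qp (subst (_< 0ℚ) (lemma q p) (ℚ.neg-antimono-< (*-pos (neg-pos q<0) 0<p))))
    where
    lemma : ∀ q p → - (- q * p) ≡ q * p
    lemma = solve-∀ ℚ-ring

  ∣p∣-pos : ∀ {p} → 0ℚ < p → ℚ.∣ p ∣ ≡ p
  ∣p∣-pos 0<p = ℚ.0≤p⇒∣p∣≡p (ℚ.<⇒≤ 0<p)

  ∣p∣-neg : ∀ {p} → p < 0ℚ → ℚ.∣ p ∣ ≡ - p
  ∣p∣-neg {p} p<0 = trans (sym (ℚ.∣-p∣≡∣p∣ p)) (∣p∣-pos (neg-pos p<0))

-- The quadratic algebra as a commutative ring with conjugation

module QuadraticAlgebra (D : ℤ) where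
  open import Data.Rational using (_+_; _*_; -_; _-_; _<_)
  open RationalLemmas
  open Alg D

  K-≡ : ∀ {a b c d} → a ≡ c → b ≡ d → (a +s b) ≡ (c +s d)
  K-≡ = cong₂ _+s_

  ⊕-assoc : ∀ x y z → (x ⊕ y) ⊕ z ≡ x ⊕ (y ⊕ z)
  ⊕-assoc (a +s b) (c +s d) (e +s f) = K-≡ (ℚ.+-assoc a c e) (ℚ.+-assoc b d f)

  ⊕-comm : ∀ x y → x ⊕ y ≡ y ⊕ x
  ⊕-comm (a +s b) (c +s d) = K-≡ (ℚ.+-comm a c) (ℚ.+-comm b d)

  ⊕-identityˡ : ∀ x → fromℚ 0ℚ ⊕ x ≡ x
  ⊕-identityˡ (a +s b) = K-≡ (ℚ.+-identityˡ a) (ℚ.+-identityˡ b)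

  ⊕-inverseˡ : ∀ x → neg x ⊕ x ≡ fromℚ 0ℚ
  ⊕-inverseˡ (a +s b) = K-≡ (ℚ.+-inverseˡ a) (ℚ.+-inverseˡ b)

  ⊗-comm : ∀ x y → x ⊗ y ≡ y ⊗ x
  ⊗-comm (a +s b) (c +s d) = K-≡ (re-comm Dq a b c d) (im-comm a b c d)
    where
    re-comm : ∀ D a b c d → a * c + D * b * d ≡ c * a + D * d * b
    re-comm = solve-∀ ℚ-ring
    im-comm : ∀ a b c d → a * d + b * c ≡ c * b + d * a
    im-comm = solve-∀ ℚ-ring

  ⊗-assoc : ∀ x y z → (x ⊗ y) ⊗ z ≡ x ⊗ (y ⊗ z)
  ⊗-assoc (a +s b) (c +s d) (e +s f) = K-≡ (re-assoc Dq a b c d e f) (im-assoc Dq a b c d e f)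
    where
    re-assoc : ∀ D a b c d e f → (a * c + D * b * d) * e + D * (a * d + b * c) * f
             ≡ a * (c * e + D * d * f) + D * b * (c * f + d * e)
    re-assoc = solve-∀ ℚ-ring
    im-assoc : ∀ D a b c d e f → (a * c + D * b * d) * f + (a * d + b * c) * e
             ≡ a * (c * f + d * e) + b * (c * e + D * d * f)
    im-assoc = solve-∀ ℚ-ring

  ⊗-identityˡ : ∀ x → one ⊗ x ≡ x
  ⊗-identityˡ (a +s b) = K-≡ (re-id Dq a b) (im-id a b)
    where
    re-id : ∀ D a b → 1ℚ * a + D * 0ℚ * b ≡ a
    re-id = solve-∀ ℚ-ring
    im-id : ∀ a b → 1ℚ * b + 0ℚ * a ≡ b
    im-id = solve-∀ ℚ-ring

  ⊗-distribˡ : ∀ x y z → x ⊗ (y ⊕ z) ≡ (x ⊗ y) ⊕ (x ⊗ z)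
  ⊗-distribˡ (a +s b) (c +s d) (e +s f) = K-≡ (re-distrib Dq a b c d e f) (im-distrib a b c d e f)
    where
    re-distrib : ∀ D a b c d e f → a * (c + e) + D * b * (d + f)
               ≡ (a * c + D * b * d) + (a * e + D * b * f)
    re-distrib = solve-∀ ℚ-ring
    im-distrib : ∀ a b c d e f → a * (d + f) + b * (c + e) ≡ (a * d + b * c) + (a * f + b * e)
    im-distrib = solve-∀ ℚ-ring

  K-isCommutativeRing : IsCommutativeRing _≡_ _⊕_ _⊗_ neg (fromℚ 0ℚ) one
  K-isCommutativeRing = record
    { isRing = record
      { +-isAbelianGroup = record
        { isGroup = record
          { isMonoid = record
            { isSemigroup = record
              { isMagma = isMagma _⊕_
              ; assoc = ⊕-assoc }
            ; identity = comm∧idˡ⇒id ⊕-comm ⊕-identityˡ }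
          ; inverse = comm∧invˡ⇒inv ⊕-comm ⊕-inverseˡ
          ; ⁻¹-cong = cong neg }
        ; comm = ⊕-comm }
      ; *-cong = cong₂ _⊗_
      ; *-assoc = ⊗-assoc
      ; *-identity = comm∧idˡ⇒id ⊗-comm ⊗-identityˡ
      ; distrib = ⊗-distribˡ , comm∧distrˡ⇒distrʳ ⊗-comm ⊗-distribˡ }
    ; *-comm = ⊗-comm }
    where
    open import Algebra.Consequences.Propositional
    open import Relation.Binary.PropositionalEquality.Algebra using (isMagma)

  ⊗-identityʳ : ∀ x → x ⊗ one ≡ x
  ⊗-identityʳ x = trans (⊗-comm x one) (⊗-identityˡ x)

  ⊗-one³ : ∀ x → x ⊗ (one ⊗ one ⊗ one) ≡ x
  ⊗-one³ x = trans (cong (x ⊗_) (trans (⊗-identityʳ (one ⊗ one)) (⊗-identityʳ one))) (⊗-identityʳ x)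

  ⊗-swap : ∀ x y z → x ⊗ (y ⊗ z) ≡ y ⊗ (x ⊗ z)
  ⊗-swap x y z = trans (sym (⊗-assoc x y z)) (trans (cong (_⊗ z) (⊗-comm x y)) (⊗-assoc y x z))

  fromℚ-+ : ∀ p q → fromℚ (p + q) ≡ fromℚ p ⊕ fromℚ q
  fromℚ-+ p q = K-≡ refl (sym (ℚ.+-identityˡ 0ℚ))

  fromℚ-* : ∀ p q → fromℚ (p * q) ≡ fromℚ p ⊗ fromℚ q
  fromℚ-* p q = K-≡ (re-* Dq p q) (im-* p q)
    where
    re-* : ∀ D p q → p * q ≡ p * q + D * 0ℚ * 0ℚ
    re-* = solve-∀ ℚ-ring
    im-* : ∀ p q → 0ℚ ≡ p * 0ℚ + 0ℚ * q
    im-* = solve-∀ ℚ-ring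

  im-⊕ : ∀ x y → im (x ⊕ y) ≡ im x + im y
  im-⊕ x y = refl

  fromℤ-+ : ∀ m n → fromℤ (m ℤ.+ n) ≡ fromℤ m ⊕ fromℤ n
  fromℤ-+ m n = trans (cong fromℚ (toℚ-+ m n)) (fromℚ-+ (toℚ m) (toℚ n))

  fromℤ-* : ∀ m n → fromℤ (m ℤ.* n) ≡ fromℤ m ⊗ fromℤ n
  fromℤ-* m n = trans (cong fromℚ (toℚ-* m n)) (fromℚ-* (toℚ m) (toℚ n))

  fromℤ-neg : ∀ m → fromℤ (ℤ.- m) ≡ neg (fromℤ m)
  fromℤ-neg m = cong fromℚ (toℚ-neg m)

  τ-⊕ : ∀ x y → τ (x ⊕ y) ≡ τ x ⊕ τ y
  τ-⊕ (a +s b) (c +s d) = K-≡ refl (ℚ.neg-distrib-+ b d)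

  τ-⊗ : ∀ x y → τ (x ⊗ y) ≡ τ x ⊗ τ y
  τ-⊗ (a +s b) (c +s d) = K-≡ (re-τ Dq a b c d) (im-τ a b c d)
    where
    re-τ : ∀ D a b c d → a * c + D * b * d ≡ a * c + D * - b * - d
    re-τ = solve-∀ ℚ-ring
    im-τ : ∀ a b c d → - (a * d + b * c) ≡ a * - d + - b * c
    im-τ = solve-∀ ℚ-ring

  τ-involutive : ∀ x → τ (τ x) ≡ x
  τ-involutive (a +s b) = K-≡ refl (neg-involutive b)
    where
    neg-involutive : ∀ b → - (- b) ≡ b
    neg-involutive = solve-∀ ℚ-ring

  -- Rewritten as a product, a rational scalar becomes accessible to ring identities in `K`.
  scale≡⊗ : ∀ q x → scale q x ≡ fromℚ q ⊗ x
  scale≡⊗ q (a +s b) = K-≡ (re-scale Dq q a b) (im-scale q a b)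
    where
    re-scale : ∀ D q a b → q * a ≡ q * a + D * 0ℚ * b
    re-scale = solve-∀ ℚ-ring
    im-scale : ∀ q a b → q * b ≡ q * b + 0ℚ * a
    im-scale = solve-∀ ℚ-ring

  im-fromℚ⊗ : ∀ q x → im (fromℚ q ⊗ x) ≡ q * im x
  im-fromℚ⊗ q x = cong im (sym (scale≡⊗ q x))

  re-fromℚ⊗ : ∀ q x → re (fromℚ q ⊗ x) ≡ q * re x
  re-fromℚ⊗ q x = cong re (sym (scale≡⊗ q x))

  fromℚ-Nm : ∀ x → x ⊗ τ x ≡ fromℚ (Nm x)
  fromℚ-Nm (a +s b) = K-≡ refl (im-Nm a b)
    where
    im-Nm : ∀ a b → a * - b + b * a ≡ 0ℚ
    im-Nm = solve-∀ ℚ-ring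

  fromℚ-Tr : ∀ x → x ⊕ τ x ≡ fromℚ (Tr x)
  fromℚ-Tr (a +s b) = K-≡ refl (ℚ.+-inverseʳ b)

  -- Turns determinants, hence covolumes, into imaginary parts of products, to which
  -- multiplicativity in `K` applies.
  det≡im : ∀ x y → det x y ≡ im (τ x ⊗ y)
  det≡im (a +s b) (c +s d) = lemma a b c d
    where
    lemma : ∀ a b c d → a * d - b * c ≡ a * d + - b * c
    lemma = solve-∀ ℚ-ring

  fromℤ-*₃ : ∀ i j k → fromℤ (i ℤ.* j ℤ.* k) ≡ fromℤ i ⊗ fromℤ j ⊗ fromℤ k
  fromℤ-*₃ i j k = trans (fromℤ-* (i ℤ.* j) k) (cong (_⊗ fromℤ k) (fromℤ-* i j))

  fromℤ-sum-of-products : ∀ i j k l → fromℤ (i ℤ.* j ℤ.+ k ℤ.* l) ≡ fromℤ i ⊗ fromℤ j ⊕ fromℤ k ⊗ fromℤ l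
  fromℤ-sum-of-products i j k l = trans (fromℤ-+ (i ℤ.* j) (k ℤ.* l)) (cong₂ _⊕_ (fromℤ-* i j) (fromℤ-* k l))

  fromℤ-minor : ∀ i j k l → fromℤ (i ℤ.* j ℤ.- k ℤ.* l) ≡ fromℤ i ⊗ fromℤ j ⊖ fromℤ k ⊗ fromℤ l
  fromℤ-minor i j k l = trans (fromℤ-+ (i ℤ.* j) (ℤ.- (k ℤ.* l)))
    (cong₂ _⊕_ (fromℤ-* i j) (trans (fromℤ-neg (k ℤ.* l)) (cong neg (fromℤ-* k l))))

  fromℤ-pos : ∀ m n → fromℤ (+ (m ℕ.+ n)) ≡ fromℤ (+ m) ⊕ fromℤ (+ n)
  fromℤ-pos m n = fromℤ-+ (+ m) (+ n)

  private
    weaklyDecidable : ∀ m n → Maybe (fromℤ m ≡ fromℤ n)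
    weaklyDecidable m n with m ℤ.≟ n
    ... | yes m≡n = just (cong fromℤ m≡n)
    ... | no  _   = nothing

    K-ring : SolverACR.AlmostCommutativeRing _ _
    K-ring = SolverACR.fromCommutativeRing (record { isCommutativeRing = K-isCommutativeRing })

    fromℤ-morphism : ℤ.+-*-rawRing SolverACR.-Raw-AlmostCommutative⟶ K-ring
    fromℤ-morphism = record
      { ⟦_⟧ = fromℤ ; +-homo = fromℤ-+ ; *-homo = fromℤ-* ; -‿homo = fromℤ-neg ; 0-homo = refl ; 1-homo = refl }

  -- The coefficients are integers embedded by `fromℤ`: `con (+ 3)` denotes `fromℤ (+ 3)`, and
  -- equality of coefficients is decided in ℤ although D is a variable.
  module K-Solver = RingSolver ℤ.+-*-rawRing K-ring fromℤ-morphism weaklyDecidable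

-- Additive subgroups of the algebra and their generators

module Subgroups (D : ℤ) where
  open import Data.Rational using (_+_; _*_; -_; _-_; _<_)
  open RationalLemmas
  open Alg D
  open QuadraticAlgebra D
  open K-Solver using (solve; _:=_; _:+_; _:*_; _:-_; :-_; con)

  -- Inclusions of lattices are proved by closure: a subgroup that contains the generators contains
  -- the lattice. Preimages under multiplications and under τ are again subgroups, so a statement
  -- about products reduces to generators one factor at a time.
  record IsSubgroup (P : Sub) : Set where
    field
      0-closed   : P (fromℚ 0ℚ)
      ⊕-closed   : ∀ x y → P x → P y → P (x ⊕ y)
      neg-closed : ∀ x → P x → P (neg x)

    ⊖-closed : ∀ x y → P x → P y → P (x ⊖ y)
    ⊖-closed x y px py = ⊕-closed x (neg y) px (neg-closed y py)

    ℤ-closed : ∀ m x → P x → P (fromℤ m ⊗ x)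
    ℤ-closed (+ n) x px = ℕ-closed n
      where
      ℕ-closed : ∀ n → P (fromℤ (+ n) ⊗ x)
      ℕ-closed zero = subst P
        (solve 1 (λ x → con (+ 0) := con (+ 0) :* x) refl x) 0-closed
      ℕ-closed (suc n) = subst P
        (trans (solve 2 (λ n x → x :+ n :* x := (con (+ 1) :+ n) :* x) refl (fromℤ (+ n)) x)
               (cong (_⊗ x) (sym (fromℤ-pos 1 n))))
        (⊕-closed x (fromℤ (+ n) ⊗ x) px (ℕ-closed n))
    ℤ-closed -[1+ n ] x px = subst P
      (trans (solve 2 (λ n x → :- (n :* x) := (:- n) :* x) refl (fromℤ +[1+ n ]) x)
             (cong (_⊗ x) (sym (fromℤ-neg +[1+ n ]))))
      (neg-closed (fromℤ +[1+ n ] ⊗ x) (ℤ-closed +[1+ n ] x px))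

  open IsSubgroup public

  module _ {P : Sub} (P-subgroup : IsSubgroup P) where

    ⊗ʳ-preimage : ∀ w → IsSubgroup (λ x → P (x ⊗ w))
    ⊗ʳ-preimage w = record
      { 0-closed = subst P (solve 1 (λ w → con (+ 0) := con (+ 0) :* w) refl w) (0-closed P-subgroup)
      ; ⊕-closed = λ x y px py → subst P
          (solve 3 (λ x y w → x :* w :+ y :* w := (x :+ y) :* w) refl x y w)
          (⊕-closed P-subgroup (x ⊗ w) (y ⊗ w) px py)
      ; neg-closed = λ x px → subst P (solve 2 (λ x w → :- (x :* w) := (:- x) :* w) refl x w)
          (neg-closed P-subgroup (x ⊗ w) px) }

    ⊗ˡ-preimage : ∀ w → IsSubgroup (λ x → P (w ⊗ x))
    ⊗ˡ-preimage w = record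
      { 0-closed = subst P (solve 1 (λ w → con (+ 0) := w :* con (+ 0)) refl w) (0-closed P-subgroup)
      ; ⊕-closed = λ x y px py → subst P
          (solve 3 (λ x y w → w :* x :+ w :* y := w :* (x :+ y)) refl x y w)
          (⊕-closed P-subgroup (w ⊗ x) (w ⊗ y) px py)
      ; neg-closed = λ x px → subst P (solve 2 (λ x w → :- (w :* x) := w :* (:- x)) refl x w)
          (neg-closed P-subgroup (w ⊗ x) px) }

    τ-preimage : IsSubgroup (λ x → P (τ x))
    τ-preimage = record
      { 0-closed = 0-closed P-subgroup
      ; ⊕-closed = λ x y px py → subst P (sym (τ-⊕ x y)) (⊕-closed P-subgroup (τ x) (τ y) px py)
      ; neg-closed = λ { (a +s b) px → neg-closed P-subgroup (τ (a +s b)) px } }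

    Gen-⊆ : ∀ {m} {gs : Vec K m} → All P gs → ∀ x → Gen gs x → P x
    Gen-⊆ all x (ms , refl) = go ms all
      where
      go : ∀ {m} {gs : Vec K m} (ms : Vec ℤ m) → All P gs → P (linComb ms gs)
      go [] [] = 0-closed P-subgroup
      go {gs = g ∷ gs} (m ∷ ms) (pg ∷ pgs) =
        ⊕-closed P-subgroup (fromℤ m ⊗ g) (linComb ms gs) (ℤ-closed P-subgroup m g pg) (go ms pgs)

    span-⊆ : ∀ {α₁ α₂} → P α₁ → P α₂ → ∀ x → span α₁ α₂ x → P x
    span-⊆ p₁ p₂ = Gen-⊆ (p₁ ∷ p₂ ∷ [])

  Gen-isSubgroup : ∀ {m} (gs : Vec K m) → IsSubgroup (Gen gs)
  Gen-isSubgroup gs = record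
    { 0-closed = zeros gs
    ; ⊕-closed = λ { x y (ms , refl) (ns , refl) → sums gs ms ns }
    ; neg-closed = λ { x (ms , refl) → negs gs ms } }
    where
    zeros : ∀ {m} (gs : Vec K m) → Gen gs (fromℚ 0ℚ)
    zeros [] = [] , refl
    zeros (g ∷ gs) with zeros gs
    ... | ms , eq = + 0 ∷ ms , trans (cong (fromℤ (+ 0) ⊗ g ⊕_) eq)
      (solve 1 (λ g → con (+ 0) :* g :+ con (+ 0) := con (+ 0)) refl g)
    sums : ∀ {m} (gs : Vec K m) ms ns → Gen gs (linComb ms gs ⊕ linComb ns gs)
    sums [] [] [] = [] , refl
    sums (g ∷ gs) (m ∷ ms) (n ∷ ns) with sums gs ms ns
    ... | ls , eq = m ℤ.+ n ∷ ls , trans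
      (cong₂ _⊕_ (cong (_⊗ g) (fromℤ-+ m n)) eq)
      (solve 5 (λ m n g M N → (m :+ n) :* g :+ (M :+ N) := (m :* g :+ M) :+ (n :* g :+ N)) refl
        (fromℤ m) (fromℤ n) g (linComb ms gs) (linComb ns gs))
    negs : ∀ {m} (gs : Vec K m) ms → Gen gs (neg (linComb ms gs))
    negs [] [] = [] , refl
    negs (g ∷ gs) (m ∷ ms) with negs gs ms
    ... | ls , eq = ℤ.- m ∷ ls , trans
      (cong₂ _⊕_ (cong (_⊗ g) (fromℤ-neg m)) eq)
      (solve 3 (λ m g M → (:- m) :* g :+ (:- M) := :- (m :* g :+ M)) refl (fromℤ m) g (linComb ms gs))

  Gen-there : ∀ {m} g {gs : Vec K m} {x} → Gen gs x → Gen (g ∷ gs) x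
  Gen-there g {x = x} (ms , refl) = + 0 ∷ ms ,
    solve 2 (λ g x → con (+ 0) :* g :+ x := x) refl g x

  Gen-lookup : ∀ {m} (gs : Vec K m) i → Gen gs (lookup gs i)
  Gen-lookup (g ∷ gs) zero with 0-closed (Gen-isSubgroup gs)
  ... | ms , eq = + 1 ∷ ms , trans (cong (fromℤ (+ 1) ⊗ g ⊕_) eq)
    (solve 1 (λ g → con (+ 1) :* g :+ con (+ 0) := g) refl g)
  Gen-lookup (g ∷ gs) (suc i) = Gen-there g (Gen-lookup gs i)

  α₁∈span : ∀ α₁ α₂ → span α₁ α₂ α₁
  α₁∈span α₁ α₂ = Gen-lookup (α₁ ∷ α₂ ∷ []) zero

  α₂∈span : ∀ α₁ α₂ → span α₁ α₂ α₂
  α₂∈span α₁ α₂ = Gen-lookup (α₁ ∷ α₂ ∷ []) (suc zero)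

  span-isSubgroup : ∀ α₁ α₂ → IsSubgroup (span α₁ α₂)
  span-isSubgroup α₁ α₂ = Gen-isSubgroup (α₁ ∷ α₂ ∷ [])

  span-elim : ∀ α₁ α₂ x → span α₁ α₂ x → ∃[ m ] ∃[ n ] x ≡ fromℤ m ⊗ α₁ ⊕ fromℤ n ⊗ α₂
  span-elim α₁ α₂ x (m ∷ n ∷ [] , refl) = m , n ,
    solve 4 (λ m n a b → m :* a :+ (n :* b :+ con (+ 0)) := m :* a :+ n :* b) refl
      (fromℤ m) (fromℤ n) α₁ α₂

  span-intro : ∀ α₁ α₂ m n → span α₁ α₂ (fromℤ m ⊗ α₁ ⊕ fromℤ n ⊗ α₂)
  span-intro α₁ α₂ m n = m ∷ n ∷ [] ,
    solve 4 (λ m n a b → m :* a :+ (n :* b :+ con (+ 0)) := m :* a :+ n :* b) refl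
      (fromℤ m) (fromℤ n) α₁ α₂

  ≐-intro : ∀ {A B : Sub} → (∀ x → A x → B x) → (∀ x → B x → A x) → A ≐ B
  ≐-intro A⊆B B⊆A x = mk⇔ (A⊆B x) (B⊆A x)

  ≐⇒⊆ : ∀ {A B : Sub} → A ≐ B → ∀ x → A x → B x
  ≐⇒⊆ A≐B x = Equivalence.to (A≐B x)

  ≐⇒⊇ : ∀ {A B : Sub} → A ≐ B → ∀ x → B x → A x
  ≐⇒⊇ A≐B x = Equivalence.from (A≐B x)

  ≐-sym : ∀ {A B : Sub} → A ≐ B → B ≐ A
  ≐-sym A≐B = ≐-intro (≐⇒⊇ A≐B) (≐⇒⊆ A≐B)

  ≐-trans : ∀ {A B C : Sub} → A ≐ B → B ≐ C → A ≐ C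
  ≐-trans A≐B B≐C = ≐-intro (λ x p → ≐⇒⊆ B≐C x (≐⇒⊆ A≐B x p)) (λ x p → ≐⇒⊇ A≐B x (≐⇒⊇ B≐C x p))

  module _ (α₁ α₂ γ₁ γ₂ : K) where

    private
      gens : Vec K 4
      gens = (α₁ ∷ α₂ ∷ []) ·g (γ₁ ∷ γ₂ ∷ [])

      gens-isSubgroup : IsSubgroup (Gen gens)
      gens-isSubgroup = Gen-isSubgroup gens

    product-intro : ∀ x y → span α₁ α₂ x → span γ₁ γ₂ y → Gen gens (x ⊗ y)
    product-intro x y x∈α y∈γ = span-⊆ (⊗ˡ-preimage gens-isSubgroup x)
      (span-⊆ (⊗ʳ-preimage gens-isSubgroup γ₁)
        (Gen-lookup gens zero) (Gen-lookup gens (# 2)) x x∈α)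
      (span-⊆ (⊗ʳ-preimage gens-isSubgroup γ₂)
        (Gen-lookup gens (suc zero)) (Gen-lookup gens (# 3)) x x∈α) y y∈γ

    product-⊆ : ∀ {P} → IsSubgroup P → (∀ x y → span α₁ α₂ x → span γ₁ γ₂ y → P (x ⊗ y)) →
      ∀ z → Gen gens z → P z
    product-⊆ P-subgroup p = Gen-⊆ P-subgroup
      ( p α₁ γ₁ (α₁∈span α₁ α₂) (α₁∈span γ₁ γ₂)
      ∷ p α₁ γ₂ (α₁∈span α₁ α₂) (α₂∈span γ₁ γ₂)
      ∷ p α₂ γ₁ (α₂∈span α₁ α₂) (α₁∈span γ₁ γ₂)
      ∷ p α₂ γ₂ (α₂∈span α₁ α₂) (α₂∈span γ₁ γ₂) ∷ [])

  module _ (α₁ α₂ : K) where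

    private
      a₁ = α₁∈span α₁ α₂
      a₂ = α₂∈span α₁ α₂

    cube-⊆ : ∀ {P} → IsSubgroup P →
      (∀ x y z → span α₁ α₂ x → span α₁ α₂ y → span α₁ α₂ z → P (x ⊗ y ⊗ z)) →
      ∀ w → Gen (cubeGens α₁ α₂) w → P w
    cube-⊆ P-subgroup p = Gen-⊆ P-subgroup
      ( p α₁ α₁ α₁ a₁ a₁ a₁ ∷ p α₁ α₁ α₂ a₁ a₁ a₂ ∷ p α₁ α₂ α₁ a₁ a₂ a₁ ∷ p α₁ α₂ α₂ a₁ a₂ a₂
      ∷ p α₂ α₁ α₁ a₂ a₁ a₁ ∷ p α₂ α₁ α₂ a₂ a₁ a₂ ∷ p α₂ α₂ α₁ a₂ a₂ a₁ ∷ p α₂ α₂ α₂ a₂ a₂ a₂ ∷ [])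

    scaledCube-⊆ : ∀ β {P} → IsSubgroup P →
      (∀ x y z → span α₁ α₂ x → span α₁ α₂ y → span α₁ α₂ z → P (β ⊗ (x ⊗ y ⊗ z))) →
      ∀ w → Gen (map (β ⊗_) (cubeGens α₁ α₂)) w → P w
    scaledCube-⊆ β P-subgroup p = Gen-⊆ P-subgroup
      ( p α₁ α₁ α₁ a₁ a₁ a₁ ∷ p α₁ α₁ α₂ a₁ a₁ a₂ ∷ p α₁ α₂ α₁ a₁ a₂ a₁ ∷ p α₁ α₂ α₂ a₁ a₂ a₂
      ∷ p α₂ α₁ α₁ a₂ a₁ a₁ ∷ p α₂ α₁ α₂ a₂ a₁ a₂ ∷ p α₂ α₂ α₁ a₂ a₂ a₁ ∷ p α₂ α₂ α₂ a₂ a₂ a₂ ∷ [])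

    trilinear : ∀ {P} → IsSubgroup P →
      P (α₁ ⊗ α₁ ⊗ α₁) → P (α₁ ⊗ α₁ ⊗ α₂) → P (α₁ ⊗ α₂ ⊗ α₁) → P (α₁ ⊗ α₂ ⊗ α₂) →
      P (α₂ ⊗ α₁ ⊗ α₁) → P (α₂ ⊗ α₁ ⊗ α₂) → P (α₂ ⊗ α₂ ⊗ α₁) → P (α₂ ⊗ α₂ ⊗ α₂) →
      ∀ x y z → span α₁ α₂ x → span α₁ α₂ y → span α₁ α₂ z → P (x ⊗ y ⊗ z)
    trilinear {P} P-subgroup p₁₁₁ p₁₁₂ p₁₂₁ p₁₂₂ p₂₁₁ p₂₁₂ p₂₂₁ p₂₂₂ x y z x∈ y∈ z∈ =
      span-⊆ (⊗ʳ-preimage (⊗ʳ-preimage P-subgroup z) y)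
        (middle α₁ p₁₁₁ p₁₁₂ p₁₂₁ p₁₂₂) (middle α₂ p₂₁₁ p₂₁₂ p₂₂₁ p₂₂₂) x x∈
      where
      last : ∀ w → P (w ⊗ α₁) → P (w ⊗ α₂) → P (w ⊗ z)
      last w q₁ q₂ = span-⊆ (⊗ˡ-preimage P-subgroup w) q₁ q₂ z z∈
      middle : ∀ w → P (w ⊗ α₁ ⊗ α₁) → P (w ⊗ α₁ ⊗ α₂) → P (w ⊗ α₂ ⊗ α₁) → P (w ⊗ α₂ ⊗ α₂) →
        P (w ⊗ y ⊗ z)
      middle w q₁₁ q₁₂ q₂₁ q₂₂ = span-⊆ (⊗ˡ-preimage (⊗ʳ-preimage P-subgroup z) w)
        (last (w ⊗ α₁) q₁₁ q₁₂) (last (w ⊗ α₂) q₂₁ q₂₂) y y∈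

    private
      g = λ i → Gen-lookup (cubeGens α₁ α₂) i

    cube-intro : ∀ x y z → span α₁ α₂ x → span α₁ α₂ y → span α₁ α₂ z → Gen (cubeGens α₁ α₂) (x ⊗ y ⊗ z)
    cube-intro = trilinear (Gen-isSubgroup (cubeGens α₁ α₂))
      (g zero) (g (suc zero)) (g (# 2)) (g (# 3))
      (g (# 4)) (g (# 5))
      (g (# 6)) (g (# 7))

    scaledCube-intro : ∀ β x y z → span α₁ α₂ x → span α₁ α₂ y → span α₁ α₂ z →
      Gen (map (β ⊗_) (cubeGens α₁ α₂)) (β ⊗ (x ⊗ y ⊗ z))
    scaledCube-intro β = trilinear
      (⊗ˡ-preimage (Gen-isSubgroup (map (β ⊗_) (cubeGens α₁ α₂))) β)
      (h zero) (h (suc zero)) (h (# 2)) (h (# 3))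
      (h (# 4)) (h (# 5))
      (h (# 6)) (h (# 7))
      where h = λ i → Gen-lookup (map (β ⊗_) (cubeGens α₁ α₂)) i

-- Integer arithmetic: gcds, squarefree divisors, residues mod 4, discriminants

module IntegerLemmas where
  open import Data.Integer using (_+_; _*_; _-_; -_)

  *-cancelˡℤ : ∀ {i j k} → i ≢ + 0 → i * j ≡ i * k → j ≡ k
  *-cancelˡℤ {i} {j} {k} i≢0 = ℤ.*-cancelˡ-≡ i j k {{ℤ.≢-nonZero i≢0}}

  unit-abs : ∀ m n → m * n ≡ + 1 → ℤ.∣ m ∣ ≡ 1
  unit-abs m n eq = ℕ.m*n≡1⇒m≡1 ℤ.∣ m ∣ ℤ.∣ n ∣ (trans (sym (ℤ.abs-* m n)) (cong ℤ.∣_∣ eq))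

  abs≡1⇒±1 : ∀ m → ℤ.∣ m ∣ ≡ 1 → m ≡ + 1 ⊎ m ≡ - + 1
  abs≡1⇒±1 (+ n) refl = inj₁ refl
  abs≡1⇒±1 -[1+ zero ] refl = inj₂ refl

  bezout : ∀ a b → ∃[ g ] ∃[ u ] ∃[ v ] ∃[ r ] ∃[ s ]
    (a ≡ + g * u × b ≡ + g * v × r * u + s * v ≡ + 1)
  bezout a b with Bézout.lemma ℤ.∣ a ∣ ℤ.∣ b ∣
  -- The gcd is 0 only for a = b = 0. The cofactors are then free, and the choice (1, 0) keeps r·u +
  -- s·v = 1 true.
  ... | Bézout.result zero g∣ _ = 0 , + 1 , + 0 , + 1 , + 0 ,
    ℤ.∣i∣≡0⇒i≡0 (ℕ.0∣⇒≡0 (GCD.gcd∣m g∣)) , ℤ.∣i∣≡0⇒i≡0 (ℕ.0∣⇒≡0 (GCD.gcd∣n g∣)) , refl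
  ... | Bézout.result g@(suc _) g∣ identity = g , u , v , r , s , a≡gu , b≡gv ,
        *-cancelˡℤ {+ g} (λ ()) (begin
          + g * (r * u + s * v) ≡⟨ distribute (+ g) r u s v ⟩
          r * (+ g * u) + s * (+ g * v) ≡⟨ cong₂ (λ a b → r * a + s * b) a≡gu b≡gv ⟨
          r * a + s * b ≡⟨ ra+sb≡g ⟩
          + g ≡⟨ ℤ.*-identityʳ (+ g) ⟨
          + g * + 1 ∎)
    where
    open ≡-Reasoning
    distribute : ∀ g r u s v → g * (r * u + s * v) ≡ r * (g * u) + s * (g * v)
    distribute = ℤ-Tactic.solve-∀
    quotientOf : ∀ i → g ℕ.∣ ℤ.∣ i ∣ → ∃[ q ] i ≡ + g * q
    quotientOf i g∣i with ∣ᵤ⇒∣ {+ g} {i} g∣i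
    ... | divides q eq = q , trans eq (ℤ.*-comm q (+ g))
    u = proj₁ (quotientOf a (GCD.gcd∣m g∣))
    a≡gu = proj₂ (quotientOf a (GCD.gcd∣m g∣))
    v = proj₁ (quotientOf b (GCD.gcd∣n g∣))
    b≡gv = proj₂ (quotientOf b (GCD.gcd∣n g∣))
    abs-multiple : ∀ i → ∃[ ε ] + ℤ.∣ i ∣ ≡ ε * i
    abs-multiple (+ n) = + 1 , sym (ℤ.*-identityˡ (+ n))
    abs-multiple -[1+ n ] = - + 1 , sym (ℤ.-1*i≡-i -[1+ n ])
    εa = proj₁ (abs-multiple a)
    εb = proj₁ (abs-multiple b)
    combination : Bézout.Identity g ℤ.∣ a ∣ ℤ.∣ b ∣ → ∃[ x ] ∃[ y ] x * + ℤ.∣ a ∣ + y * + ℤ.∣ b ∣ ≡ + g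
    combination (Bézout.+- x y eq) = + x , - + y , rearrange (+ x) (+ y) (+ ℤ.∣ a ∣) (+ ℤ.∣ b ∣) (+ g) (lift x y eq)
      where
      lift : ∀ x y {m n} → g ℕ.+ y ℕ.* n ≡ x ℕ.* m → + x * + m ≡ + g + + y * + n
      lift x y {m} {n} eq = trans (sym (ℤ.pos-* x m)) (trans (cong +_ (sym eq))
        (cong (λ i → + g + i) (ℤ.pos-* y n)))
      rearrange : ∀ x y m n d → x * m ≡ d + y * n → x * m + (- y) * n ≡ d
      rearrange x y m n d eq = trans (cong (λ i → i + (- y) * n) eq) (cancel d y n)
        where
        cancel : ∀ d y n → d + y * n + (- y) * n ≡ d
        cancel = ℤ-Tactic.solve-∀
    combination (Bézout.-+ x y eq) = - + x , + y , rearrange (+ x) (+ y) (+ ℤ.∣ a ∣) (+ ℤ.∣ b ∣) (+ g) (lift x y eq)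
      where
      lift : ∀ x y {m n} → g ℕ.+ x ℕ.* m ≡ y ℕ.* n → + y * + n ≡ + g + + x * + m
      lift x y {m} {n} eq = trans (sym (ℤ.pos-* y n)) (trans (cong +_ (sym eq))
        (cong (λ i → + g + i) (ℤ.pos-* x m)))
      rearrange : ∀ x y m n d → y * n ≡ d + x * m → (- x) * m + y * n ≡ d
      rearrange x y m n d eq = trans (cong (λ i → (- x) * m + i) eq) (cancel d x m)
        where
        cancel : ∀ d x m → (- x) * m + (d + x * m) ≡ d
        cancel = ℤ-Tactic.solve-∀
    x = proj₁ (combination identity)
    y = proj₁ (proj₂ (combination identity))
    r = x * εa
    s = y * εb
    ra+sb≡g : r * a + s * b ≡ + g
    ra+sb≡g = trans (cong₂ _+_
        (trans (ℤ.*-assoc x εa a) (cong (x *_) (sym (proj₂ (abs-multiple a)))))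
        (trans (ℤ.*-assoc y εb b) (cong (y *_) (sym (proj₂ (abs-multiple b))))))
      (proj₂ (proj₂ (combination identity)))

  bezout₃ : ∀ a b c → ∃[ g ] ∃[ u ] ∃[ v ] ∃[ w ] ∃[ r ] ∃[ s ] ∃[ t ]
    (a ≡ + g * u × b ≡ + g * v × c ≡ + g * w × r * u + s * v + t * w ≡ + 1)
  bezout₃ a b c with bezout a b
  ... | g₁ , u , v , r , s , a≡ , b≡ , eq₁ with bezout (+ g₁) c
  ... | g , k , w , x , y , g₁≡ , c≡ , eq =
    g , k * u , k * v , w , x * r , x * s , y ,
    trans a≡ (trans (cong (_* u) g₁≡) (ℤ.*-assoc (+ g) k u)) ,
    trans b≡ (trans (cong (_* v) g₁≡) (ℤ.*-assoc (+ g) k v)) ,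
    c≡ ,
    trans (factor x r k u s v y w)
      (trans (cong (λ i → x * k * i + y * w) eq₁) (trans (cong (λ i → i + y * w) (ℤ.*-identityʳ (x * k))) eq))
    where
    factor : ∀ x r k u s v y w →
      x * r * (k * u) + x * s * (k * v) + y * w ≡ x * k * (r * u + s * v) + y * w
    factor = ℤ-Tactic.solve-∀

  -- The square 2² divides 0.
  squareFree≢0 : ∀ {m} → SquareFree m → m ≢ + 0
  squareFree≢0 sf refl with sf 2 (∣⇒∣ᵤ {+ 4} {+ 0} (divides (+ 0) refl))
  ... | ()

  -- With m = gu, z = gv and u prime to v the hypothesis becomes uw = gv². Hence u divides g, so u²
  -- divides m = gu, and squarefreeness gives u = ±1.
  squareFree-∣-square : ∀ {m w z} → SquareFree m → m * w ≡ z * z → ∃[ y ] z ≡ m * y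
  squareFree-∣-square {m} {w} {z} sf mw≡zz with bezout m z
  ... | g , u , v , r , s , m≡gu , z≡gv , ru+sv≡1 = u * v , z≡muv
    where
    open ≡-Reasoning
    g≢0 : + g ≢ + 0
    g≢0 g≡0 = squareFree≢0 sf (trans m≡gu (trans (cong (_* u) g≡0) (ℤ.*-zeroˡ u)))
    uw≡gvv : u * w ≡ + g * (v * v)
    uw≡gvv = *-cancelˡℤ {+ g} g≢0 (begin
      + g * (u * w) ≡⟨ ℤ.*-assoc (+ g) u w ⟨
      + g * u * w ≡⟨ cong (_* w) m≡gu ⟨
      m * w ≡⟨ mw≡zz ⟩
      z * z ≡⟨ cong (λ i → i * i) z≡gv ⟩
      (+ g * v) * (+ g * v) ≡⟨ regroup (+ g) v ⟩
      + g * (+ g * (v * v)) ∎)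
      where
      regroup : ∀ g v → (g * v) * (g * v) ≡ g * (g * (v * v))
      regroup = ℤ-Tactic.solve-∀
    -- The cofactor of u in g is read off from g = g(ru + sv)²: every term has a factor u except
    -- s²·gv², and that one is s²·uw.
    k = + g * (r * r * u + + 2 * (r * s * v)) + s * s * w
    g≡ku : + g ≡ k * u
    g≡ku = begin
      + g ≡⟨ one-square (+ g) ⟩
      + g * (+ 1 * + 1) ≡⟨ cong (λ i → + g * (i * i)) ru+sv≡1 ⟨
      + g * ((r * u + s * v) * (r * u + s * v)) ≡⟨ expand (+ g) r u s v ⟩
      + g * (r * r * u + + 2 * (r * s * v)) * u + s * s * (+ g * (v * v)) ≡⟨ cong (λ i → + g * (r * r * u + + 2 * (r * s * v)) * u + s * s * i) uw≡gvv ⟨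
      + g * (r * r * u + + 2 * (r * s * v)) * u + s * s * (u * w) ≡⟨ collect (+ g * (r * r * u + + 2 * (r * s * v))) s u w ⟩
      k * u ∎
      where
      one-square : ∀ g → g ≡ g * (+ 1 * + 1)
      one-square = ℤ-Tactic.solve-∀
      expand : ∀ g r u s v → g * ((r * u + s * v) * (r * u + s * v))
        ≡ g * (r * r * u + + 2 * (r * s * v)) * u + s * s * (g * (v * v))
      expand = ℤ-Tactic.solve-∀
      collect : ∀ x s u w → x * u + s * s * (u * w) ≡ (x + s * s * w) * u
      collect = ℤ-Tactic.solve-∀
    abs-square : ∀ i → + ℤ.∣ i ∣ * + ℤ.∣ i ∣ ≡ i * i
    abs-square (+ n) = refl
    abs-square -[1+ n ] = refl
    ∣u∣≡1 : ℤ.∣ u ∣ ≡ 1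
    ∣u∣≡1 = sf ℤ.∣ u ∣ (∣⇒∣ᵤ {+ ℤ.∣ u ∣ * + ℤ.∣ u ∣} {m} (divides k
      (trans m≡gu (trans (cong (_* u) g≡ku) (trans (ℤ.*-assoc k u u) (cong (k *_) (sym (abs-square u))))))))
    z≡muv : z ≡ m * (u * v)
    z≡muv = begin
      z ≡⟨ z≡gv ⟩
      + g * v ≡⟨ insert (+ g) v ⟩
      + g * ((+ 1 * + 1) * v) ≡⟨ cong (λ i → + g * ((+ i * + i) * v)) ∣u∣≡1 ⟨
      + g * ((+ ℤ.∣ u ∣ * + ℤ.∣ u ∣) * v) ≡⟨ cong (λ i → + g * (i * v)) (abs-square u) ⟩
      + g * ((u * u) * v) ≡⟨ regroup (+ g) u v ⟩
      + g * u * (u * v) ≡⟨ cong (_* (u * v)) m≡gu ⟨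
      m * (u * v) ∎
      where
      insert : ∀ g v → g * v ≡ g * ((+ 1 * + 1) * v)
      insert = ℤ-Tactic.solve-∀
      regroup : ∀ g u v → g * ((u * u) * v) ≡ g * u * (u * v)
      regroup = ℤ-Tactic.solve-∀

  parity : ∀ z → ∃[ j ] (z ≡ + 2 * j ⊎ z ≡ + 2 * j + + 1)
  parity (+ n) = parityℕ n
    where
    parityℕ : ∀ n → ∃[ j ] (+ n ≡ + 2 * j ⊎ + n ≡ + 2 * j + + 1)
    parityℕ zero = + 0 , inj₁ refl
    parityℕ (suc n) with parityℕ n
    ... | j , inj₁ eq = j , inj₂ (trans (cong (λ i → + 1 + i) eq) (ℤ.+-comm (+ 1) (+ 2 * j)))
    ... | j , inj₂ eq = j + + 1 , inj₁ (trans (cong (λ i → + 1 + i) eq) (double j))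
      where
      double : ∀ j → + 1 + (+ 2 * j + + 1) ≡ + 2 * (j + + 1)
      double = ℤ-Tactic.solve-∀
  parity -[1+ n ] with parity +[1+ n ]
  ... | j , inj₁ eq = - j , inj₁ (trans (cong -_ eq) (negate j))
    where
    negate : ∀ j → - (+ 2 * j) ≡ + 2 * - j
    negate = ℤ-Tactic.solve-∀
  ... | j , inj₂ eq = - j - + 1 , inj₂ (trans (cong -_ eq) (negate j))
    where
    negate : ∀ j → - (+ 2 * j + + 1) ≡ + 2 * (- j - + 1) + + 1
    negate = ℤ-Tactic.solve-∀

  mod4 : ∀ x y r s → + 4 * x + r ≡ + 4 * y + s → + 4 Unsigned.∣ (r - s)
  mod4 x y r s eq = ∣⇒∣ᵤ {+ 4} {r - s} (divides (y - x) (begin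
    r - s ≡⟨ add-cancel x r s ⟩
    (+ 4 * x + r) - + 4 * x - s ≡⟨ cong (λ i → i - + 4 * x - s) eq ⟩
    (+ 4 * y + s) - + 4 * x - s ≡⟨ collect x y s ⟩
    (y - x) * + 4 ∎))
    where
    open ≡-Reasoning
    add-cancel : ∀ x r s → r - s ≡ (+ 4 * x + r) - + 4 * x - s
    add-cancel = ℤ-Tactic.solve-∀
    collect : ∀ x y s → (+ 4 * y + s) - + 4 * x - s ≡ (y - x) * + 4
    collect = ℤ-Tactic.solve-∀

  discriminant≢0 : ∀ {D} → IsDiscriminant D → D ≢ + 0
  discriminant≢0 (inj₁ (sf , _)) = squareFree≢0 sf
  discriminant≢0 (inj₂ (m , refl , sf , _)) 4m≡0 =
    squareFree≢0 sf (*-cancelˡℤ {+ 4} (λ ()) 4m≡0)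

  -- κ = D(D - 1)/4 is the norm of ω = (D + √D)/2, the constant term of its minimal polynomial X² -
  -- DX + κ.
  discriminant-quarter : ∀ {D} → IsDiscriminant D → ∃[ κ ] + 4 * κ ≡ D * D - D
  discriminant-quarter (inj₁ (_ , t , refl)) = (+ 4 * t + + 1) * t , lemma t
    where
    lemma : ∀ t → + 4 * ((+ 4 * t + + 1) * t) ≡ (+ 4 * t + + 1) * (+ 4 * t + + 1) - (+ 4 * t + + 1)
    lemma = ℤ-Tactic.solve-∀
  discriminant-quarter (inj₂ (m , refl , _)) = + 4 * m * m - m , lemma m
    where
    lemma : ∀ m → + 4 * (+ 4 * m * m - m) ≡ + 4 * m * (+ 4 * m) - + 4 * m
    lemma = ℤ-Tactic.solve-∀

  private
    square≢0⇒abs≥1 : ∀ {m d} y → m ≢ + 0 → m ≡ d * (y * y) →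
      1 ℕ.≤ ℤ.∣ y ∣ × m ≡ + ℤ.∣ y ∣ * + ℤ.∣ y ∣ * d
    square≢0⇒abs≥1 {m} {d} (+ zero) m≢0 eq = ⊥-elim (m≢0 (trans eq (ℤ.*-zeroʳ d)))
    square≢0⇒abs≥1 {m} {d} +[1+ n ] m≢0 eq = s≤s z≤n , trans eq (ℤ.*-comm d _)
    square≢0⇒abs≥1 {m} {d} -[1+ n ] m≢0 eq = s≤s z≤n , trans eq (ℤ.*-comm d _)

    -- As 4 divides z², z = 2j and m₀m = j²; the squarefree m₀ then divides j.
    evenDiscriminant : ∀ {m m₀} → SquareFree m₀ → ∀ z → m * (+ 4 * m₀) ≡ z * z → ∃[ y ] m ≡ m₀ * (y * y)
    evenDiscriminant {m} {m₀} sf z eq with parity z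
    ... | j , inj₂ refl = ⊥-elim (from-no (4 ℕ.∣? 1) (mod4 (j * j + j) (m * m₀) (+ 1) (+ 0)
          (trans (odd-square j) (trans (sym eq) (multiple m m₀)))))
      where
      odd-square : ∀ j → + 4 * (j * j + j) + + 1 ≡ (+ 2 * j + + 1) * (+ 2 * j + + 1)
      odd-square = ℤ-Tactic.solve-∀
      multiple : ∀ m m₀ → m * (+ 4 * m₀) ≡ + 4 * (m * m₀) + + 0
      multiple = ℤ-Tactic.solve-∀
    ... | j , inj₁ refl = proj₁ divided , *-cancelˡℤ {m₀} (squareFree≢0 sf) (begin
        m₀ * m ≡⟨ m₀m≡jj ⟩
        j * j ≡⟨ cong (λ i → i * i) (proj₂ divided) ⟩
        m₀ * y * (m₀ * y) ≡⟨ regroup m₀ y ⟩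
        m₀ * (m₀ * (y * y)) ∎)
      where
      open ≡-Reasoning
      m₀m≡jj : m₀ * m ≡ j * j
      m₀m≡jj = *-cancelˡℤ {+ 4} (λ ()) (trans (shuffle m m₀) (trans eq (even-square j)))
        where
        shuffle : ∀ m m₀ → + 4 * (m₀ * m) ≡ m * (+ 4 * m₀)
        shuffle = ℤ-Tactic.solve-∀
        even-square : ∀ j → (+ 2 * j) * (+ 2 * j) ≡ + 4 * (j * j)
        even-square = ℤ-Tactic.solve-∀
      divided : ∃[ y ] j ≡ m₀ * y
      divided = squareFree-∣-square {m₀} {m} {j} sf m₀m≡jj
      y = proj₁ divided
      regroup : ∀ m₀ y → m₀ * y * (m₀ * y) ≡ m₀ * (m₀ * (y * y))
      regroup = ℤ-Tactic.solve-∀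

    square-mod4 : ∀ f → ∃[ x ] (f * f ≡ + 4 * x + + 0 ⊎ f * f ≡ + 4 * x + + 1)
    square-mod4 f with parity f
    ... | k , inj₁ refl = k * k , inj₁ (lemma k)
      where
      lemma : ∀ k → (+ 2 * k) * (+ 2 * k) ≡ + 4 * (k * k) + + 0
      lemma = ℤ-Tactic.solve-∀
    ... | k , inj₂ refl = k * k + k , inj₂ (lemma k)
      where
      lemma : ∀ k → (+ 2 * k + + 1) * (+ 2 * k + + 1) ≡ + 4 * (k * k + k) + + 1
      lemma = ℤ-Tactic.solve-∀

    formDiscriminant-mod4 : ∀ {m} f₀ f₁ f₂ → m ≡ f₁ * f₁ - + 4 * (f₀ * f₂) →
      ∃[ x ] (m ≡ + 4 * x + + 0 ⊎ m ≡ + 4 * x + + 1)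
    formDiscriminant-mod4 f₀ f₁ f₂ m≡ with square-mod4 f₁
    ... | x , inj₁ eq = x - f₀ * f₂ , inj₁ (trans m≡ (trans (cong (λ i → i - + 4 * (f₀ * f₂)) eq) (lemma x (f₀ * f₂))))
      where
      lemma : ∀ x y → + 4 * x + + 0 - + 4 * y ≡ + 4 * (x - y) + + 0
      lemma = ℤ-Tactic.solve-∀
    ... | x , inj₂ eq = x - f₀ * f₂ , inj₂ (trans m≡ (trans (cong (λ i → i - + 4 * (f₀ * f₂)) eq) (lemma x (f₀ * f₂))))
      where
      lemma : ∀ x y → + 4 * x + + 1 - + 4 * y ≡ + 4 * (x - y) + + 1
      lemma = ℤ-Tactic.solve-∀

    odd-square-multiple : ∀ {m₀ r} → (∃[ t ] m₀ ≡ + 4 * t + r) → ∀ l →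
      ∃[ x ] m₀ * ((+ 2 * l + + 1) * (+ 2 * l + + 1)) ≡ + 4 * x + r
    odd-square-multiple {r = r} (t , refl) l =
      t * ((+ 2 * l + + 1) * (+ 2 * l + + 1)) + r * (l * l + l) , lemma t r l
      where
      lemma : ∀ t r l → (+ 4 * t + r) * ((+ 2 * l + + 1) * (+ 2 * l + + 1))
        ≡ + 4 * (t * ((+ 2 * l + + 1) * (+ 2 * l + + 1)) + r * (l * l + l)) + r
      lemma = ℤ-Tactic.solve-∀

    -- An odd square is 1 mod 4, so m keeps the residue of m₀.
    residue-clash : ∀ {m m₀} r s → (∃[ t ] m₀ ≡ + 4 * t + r) → (∃[ x ] m ≡ + 4 * x + s) →
      ∀ l → m ≡ m₀ * ((+ 2 * l + + 1) * (+ 2 * l + + 1)) → + 4 Unsigned.∣ (r - s)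
    residue-clash r s m₀-residue (x , m-residue) l m≡ with odd-square-multiple m₀-residue l
    ... | x′ , eq′ = mod4 x′ x r s (trans (sym eq′) (trans (sym m≡) m-residue))

    odd-impossible : ∀ {m m₀} → (∃[ t ] m₀ ≡ + 4 * t + + 2) ⊎ (∃[ t ] m₀ ≡ + 4 * t + + 3) →
      ∃[ x ] (m ≡ + 4 * x + + 0 ⊎ m ≡ + 4 * x + + 1) →
      ∀ l → m ≡ m₀ * ((+ 2 * l + + 1) * (+ 2 * l + + 1)) → ⊥
    odd-impossible (inj₁ m₀≡2) (x , inj₁ m≡0) l eq = from-no (4 ℕ.∣? 2) (residue-clash (+ 2) (+ 0) m₀≡2 (x , m≡0) l eq)
    odd-impossible (inj₁ m₀≡2) (x , inj₂ m≡1) l eq = from-no (4 ℕ.∣? 1) (residue-clash (+ 2) (+ 1) m₀≡2 (x , m≡1) l eq)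
    odd-impossible (inj₂ m₀≡3) (x , inj₁ m≡0) l eq = from-no (4 ℕ.∣? 3) (residue-clash (+ 3) (+ 0) m₀≡3 (x , m≡0) l eq)
    odd-impossible (inj₂ m₀≡3) (x , inj₂ m≡1) l eq = from-no (4 ℕ.∣? 2) (residue-clash (+ 3) (+ 1) m₀≡3 (x , m≡1) l eq)

  -- Discriminants of binary quadratic forms are 0 or 1 mod 4, which rules out
  -- m = (odd)² · D/4 when D is even.
  formDiscriminant : ∀ {D m} → IsDiscriminant D → ∀ f₀ f₁ f₂ z → m ≡ f₁ * f₁ - + 4 * (f₀ * f₂) →
    m ≢ + 0 → m * D ≡ z * z → ∃[ c ] (1 ℕ.≤ c × m ≡ + c * + c * D)
  formDiscriminant {D} {m} (inj₁ (sf , _)) f₀ f₁ f₂ z _ m≢0 eq =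
    ℤ.∣ y ∣ , square≢0⇒abs≥1 {d = D} y m≢0 (*-cancelˡℤ {D} (squareFree≢0 sf) (begin
      D * m ≡⟨ ℤ.*-comm D m ⟩
      m * D ≡⟨ eq ⟩
      z * z ≡⟨ cong (λ i → i * i) (proj₂ divided) ⟩
      D * y * (D * y) ≡⟨ regroup D y ⟩
      D * (D * (y * y)) ∎))
    where
    open ≡-Reasoning
    divided : ∃[ y ] z ≡ D * y
    divided = squareFree-∣-square {D} {m} {z} sf (trans (ℤ.*-comm D m) eq)
    y = proj₁ divided
    regroup : ∀ D y → D * y * (D * y) ≡ D * (D * (y * y))
    regroup = ℤ-Tactic.solve-∀
  formDiscriminant {D} {m} (inj₂ (m₀ , D≡4m₀ , sf , residue)) f₀ f₁ f₂ z m≡ m≢0 eq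
    with evenDiscriminant {m} {m₀} sf z (trans (cong (m *_) (sym D≡4m₀)) eq)
  ... | y , m≡m₀yy with parity y
  ... | l , inj₁ y≡2l = ℤ.∣ l ∣ , square≢0⇒abs≥1 {d = D} l m≢0 (begin
      m ≡⟨ m≡m₀yy ⟩
      m₀ * (y * y) ≡⟨ cong (λ i → m₀ * (i * i)) y≡2l ⟩
      m₀ * ((+ 2 * l) * (+ 2 * l)) ≡⟨ regroup m₀ l ⟩
      + 4 * m₀ * (l * l) ≡⟨ cong (_* (l * l)) D≡4m₀ ⟨
      D * (l * l) ∎)
    where
    open ≡-Reasoning
    regroup : ∀ m₀ l → m₀ * ((+ 2 * l) * (+ 2 * l)) ≡ + 4 * m₀ * (l * l)
    regroup = ℤ-Tactic.solve-∀
  ... | l , inj₂ y≡2l+1 = ⊥-elim (odd-impossible residue (formDiscriminant-mod4 f₀ f₁ f₂ m≡) l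
      (trans m≡m₀yy (cong (λ i → m₀ * (i * i)) y≡2l+1)))

-- Invariants of a cubic form read off from its Hessian

module FormInvariance where
  open import Data.Integer using (_+_; _*_; -_; _-_)
  open IntegerLemmas
  open ≡-Reasoning

  form-≡ : ∀ {A : Set} {a b c d a′ b′ c′ d′ : A} → a ≡ a′ → b ≡ b′ → c ≡ c′ → d ≡ d′ →
    form a b c d ≡ form a′ b′ c′ d′
  form-≡ refl refl refl refl = refl

  -- The Hessian of the form is b times a primitive form of discriminant c²D.
  record FormInvariants (D : ℤ) (b c : ℕ) (x : L) (f₀ f₁ f₂ : ℤ) : Set where
    field
      q₀ q₁ q₂ q₃  : ℤ
      x≡           : x ≡ form q₀ (+ 3 * q₁) (+ 3 * q₂) q₃
      hessian₀     : q₁ * q₁ - q₀ * q₂ ≡ + b * f₀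
      hessian₁     : q₁ * q₂ - q₀ * q₃ ≡ + b * f₁
      hessian₂     : q₂ * q₂ - q₁ * q₃ ≡ + b * f₂
      u₀ u₁ u₂     : ℤ
      coprime      : u₀ * f₀ + u₁ * f₁ + u₂ * f₂ ≡ + 1
      discriminant : f₁ * f₁ - + 4 * (f₀ * f₂) ≡ + c * + c * D

  tripled-form-injective : ∀ {q₀ q₁ q₂ q₃ r₀ r₁ r₂ r₃} →
    form q₀ (+ 3 * q₁) (+ 3 * q₂) q₃ ≡ form r₀ (+ 3 * r₁) (+ 3 * r₂) r₃ →
    q₀ ≡ r₀ × q₁ ≡ r₁ × q₂ ≡ r₂ × q₃ ≡ r₃
  tripled-form-injective eq = cong x0 eq , *-cancelˡℤ {+ 3} (λ ()) (cong x1 eq) ,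
    *-cancelˡℤ {+ 3} (λ ()) (cong x2 eq) , cong x3 eq

  private
    -- By primitivity b is an integral combination of the numbers bfᵢ, all of which are multiples of
    -- b′. Used in both directions, this identifies b as the content of the Hessian.
    content-∣ : ∀ b b′ u₀ u₁ u₂ {f₀ f₁ f₂ f₀′ f₁′ f₂′} → u₀ * f₀ + u₁ * f₁ + u₂ * f₂ ≡ + 1 →
      + b * f₀ ≡ + b′ * f₀′ → + b * f₁ ≡ + b′ * f₁′ → + b * f₂ ≡ + b′ * f₂′ → b′ ℕ.∣ b
    content-∣ b b′ u₀ u₁ u₂ {f₀} {f₁} {f₂} {f₀′} {f₁′} {f₂′} coprime eq₀ eq₁ eq₂ =
      ∣⇒∣ᵤ {+ b′} {+ b} (divides (u₀ * f₀′ + u₁ * f₁′ + u₂ * f₂′) (begin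
        + b ≡⟨ ℤ.*-identityʳ (+ b) ⟨
        + b * + 1 ≡⟨ cong (λ i → + b * i) coprime ⟨
        + b * (u₀ * f₀ + u₁ * f₁ + u₂ * f₂) ≡⟨ distribute (+ b) u₀ f₀ u₁ f₁ u₂ f₂ ⟩
        u₀ * (+ b * f₀) + u₁ * (+ b * f₁) + u₂ * (+ b * f₂) ≡⟨ cong₂ _+_ (cong₂ (λ i j → u₀ * i + u₁ * j) eq₀ eq₁) (cong (u₂ *_) eq₂) ⟩
        u₀ * (+ b′ * f₀′) + u₁ * (+ b′ * f₁′) + u₂ * (+ b′ * f₂′) ≡⟨ distribute (+ b′) u₀ f₀′ u₁ f₁′ u₂ f₂′ ⟨
        + b′ * (u₀ * f₀′ + u₁ * f₁′ + u₂ * f₂′) ≡⟨ ℤ.*-comm (+ b′) (u₀ * f₀′ + u₁ * f₁′ + u₂ * f₂′) ⟩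
        (u₀ * f₀′ + u₁ * f₁′ + u₂ * f₂′) * + b′ ∎))
      where
      distribute : ∀ b u₀ f₀ u₁ f₁ u₂ f₂ → b * (u₀ * f₀ + u₁ * f₁ + u₂ * f₂)
        ≡ u₀ * (b * f₀) + u₁ * (b * f₁) + u₂ * (b * f₂)
      distribute = ℤ-Tactic.solve-∀

    square-injective : ∀ m n → m ℕ.* m ≡ n ℕ.* n → m ≡ n
    square-injective m n eq = go (ℕ.<-cmp m n)
      where
      go : _ → m ≡ n
      go (tri< m<n _ _) = ⊥-elim (ℕ.<-irrefl eq (ℕ.*-mono-< m<n m<n))
      go (tri≈ _ m≡n _) = m≡n
      go (tri> _ _ n<m) = ⊥-elim (ℕ.<-irrefl (sym eq) (ℕ.*-mono-< n<m n<m))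

  invariants-unique : ∀ {D b c b′ c′ x f₀ f₁ f₂ f₀′ f₁′ f₂′} → D ≢ + 0 → 1 ℕ.≤ b →
    FormInvariants D b c x f₀ f₁ f₂ → FormInvariants D b′ c′ x f₀′ f₁′ f₂′ →
    b ≡ b′ × c ≡ c′ × f₀ ≡ f₀′ × f₁ ≡ f₁′ × f₂ ≡ f₂′
  invariants-unique {D} {b} {c} {b′} {c′} {x} {f₀} {f₁} {f₂} {f₀′} {f₁′} {f₂′} D≢0 1≤b I J =
    b≡b′ , c≡c′ , f₀≡ , f₁≡ , f₂≡
    where
    module I = FormInvariants I
    module J = FormInvariants J
    qs = tripled-form-injective (trans (sym I.x≡) J.x≡)
    q₀≡ = proj₁ qs
    q₁≡ = proj₁ (proj₂ qs)
    q₂≡ = proj₁ (proj₂ (proj₂ qs))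
    q₃≡ = proj₂ (proj₂ (proj₂ qs))
    minor : ∀ {i j k l i′ j′ k′ l′ : ℤ} → i ≡ i′ → j ≡ j′ → k ≡ k′ → l ≡ l′ → i * j - k * l ≡ i′ * j′ - k′ * l′
    minor refl refl refl refl = refl
    bf₀≡ : + b * f₀ ≡ + b′ * f₀′
    bf₀≡ = trans (sym I.hessian₀) (trans (minor q₁≡ q₁≡ q₀≡ q₂≡) J.hessian₀)
    bf₁≡ : + b * f₁ ≡ + b′ * f₁′
    bf₁≡ = trans (sym I.hessian₁) (trans (minor q₁≡ q₂≡ q₀≡ q₃≡) J.hessian₁)
    bf₂≡ : + b * f₂ ≡ + b′ * f₂′
    bf₂≡ = trans (sym I.hessian₂) (trans (minor q₂≡ q₂≡ q₁≡ q₃≡) J.hessian₂)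
    b≡b′ : b ≡ b′
    b≡b′ = ℕ.∣-antisym (content-∣ b′ b J.u₀ J.u₁ J.u₂ J.coprime (sym bf₀≡) (sym bf₁≡) (sym bf₂≡))
      (content-∣ b b′ I.u₀ I.u₁ I.u₂ I.coprime bf₀≡ bf₁≡ bf₂≡)
    b≢0 : + b ≢ + 0
    b≢0 b≡0 = ℕ.<⇒≢ 1≤b (sym (ℤ.+-injective b≡0))
    cancel : ∀ {f f′} → + b * f ≡ + b′ * f′ → f ≡ f′
    cancel {f} {f′} eq = *-cancelˡℤ {+ b} b≢0 (trans eq (cong (λ n → + n * f′) (sym b≡b′)))
    f₀≡ : f₀ ≡ f₀′
    f₀≡ = cancel bf₀≡
    f₁≡ : f₁ ≡ f₁′
    f₁≡ = cancel bf₁≡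
    f₂≡ : f₂ ≡ f₂′
    f₂≡ = cancel bf₂≡
    ccD≡ : + c * + c * D ≡ + c′ * + c′ * D
    ccD≡ = trans (sym I.discriminant) (trans (cong₂ (λ i j → i * i - + 4 * j) f₁≡ (cong₂ _*_ f₀≡ f₂≡)) J.discriminant)
    c≡c′ : c ≡ c′
    c≡c′ = square-injective c c′ (ℤ.+-injective (trans (ℤ.pos-* c c) (trans
      (*-cancelˡℤ {D} D≢0 (trans (ℤ.*-comm D (+ c * + c)) (trans ccD≡ (ℤ.*-comm (+ c′ * + c′) D))))
      (sym (ℤ.pos-* c′ c′)))))

  -- Classical: the discriminant of a cubic is a constant times that of its Hessian. With middle
  -- coefficients 3q₁ and 3q₂ the constant is -27, which is the origin of the factor in `InLvee`.
  disc-hessian : ∀ q₀ q₁ q₂ q₃ → disc (form q₀ (+ 3 * q₁) (+ 3 * q₂) q₃) ≡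
    - (+ 27 * ((q₁ * q₂ - q₀ * q₃) * (q₁ * q₂ - q₀ * q₃) - + 4 * ((q₁ * q₁ - q₀ * q₂) * (q₂ * q₂ - q₁ * q₃))))
  disc-hessian = expand
    where
    expand : ∀ q₀ q₁ q₂ q₃ →
      (+ 3 * q₁) * (+ 3 * q₁) * (+ 3 * q₂) * (+ 3 * q₂) + + 18 * q₀ * (+ 3 * q₁) * (+ 3 * q₂) * q₃
        - + 4 * q₀ * (+ 3 * q₂) * (+ 3 * q₂) * (+ 3 * q₂)
        - + 4 * (+ 3 * q₁) * (+ 3 * q₁) * (+ 3 * q₁) * q₃ - + 27 * q₀ * q₀ * q₃ * q₃ ≡
      - (+ 27 * ((q₁ * q₂ - q₀ * q₃) * (q₁ * q₂ - q₀ * q₃) - + 4 * ((q₁ * q₁ - q₀ * q₂) * (q₂ * q₂ - q₁ * q₃))))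
    expand = ℤ-Tactic.solve-∀

  invariants⇒InLvee : ∀ {D b c x f₀ f₁ f₂ n} → FormInvariants D b c x f₀ f₁ f₂ →
    + (b ℕ.* c) * + (b ℕ.* c) * D ≡ n → InLvee n x
  invariants⇒InLvee {D} {b} {c} {x} {f₀} {f₁} {f₂} {n} I bcΔ = subst (InLvee n) (sym x≡)
    ( ∣⇒∣ᵤ {+ 3} {+ 3 * q₁} (divides q₁ (ℤ.*-comm (+ 3) q₁))
    , ∣⇒∣ᵤ {+ 3} {+ 3 * q₂} (divides q₂ (ℤ.*-comm (+ 3) q₂))
    , (begin
        disc (form q₀ (+ 3 * q₁) (+ 3 * q₂) q₃) ≡⟨ disc-hessian q₀ q₁ q₂ q₃ ⟩
        - (+ 27 * (R₁ * R₁ - + 4 * (R₀ * R₂))) ≡⟨ cong₂ (λ i j → - (+ 27 * (i * i - + 4 * j))) hessian₁ (cong₂ _*_ hessian₀ hessian₂) ⟩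
        - (+ 27 * ((+ b * f₁) * (+ b * f₁) - + 4 * ((+ b * f₀) * (+ b * f₂)))) ≡⟨ factor (+ b) f₀ f₁ f₂ ⟩
        - (+ 27 * (+ b * + b * (f₁ * f₁ - + 4 * (f₀ * f₂)))) ≡⟨ cong (λ i → - (+ 27 * (+ b * + b * i))) discriminant ⟩
        - (+ 27 * (+ b * + b * (+ c * + c * D))) ≡⟨ regroup (+ b) (+ c) D ⟩
        - (+ 27 * ((+ b * + c) * (+ b * + c) * D)) ≡⟨ cong (λ i → - (+ 27 * (i * i * D))) (ℤ.pos-* b c) ⟨
        - (+ 27 * (+ (b ℕ.* c) * + (b ℕ.* c) * D)) ≡⟨ cong (λ i → - (+ 27 * i)) bcΔ ⟩
        - (+ 27 * n) ∎))
    where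
    open FormInvariants I
    R₀ = q₁ * q₁ - q₀ * q₂
    R₁ = q₁ * q₂ - q₀ * q₃
    R₂ = q₂ * q₂ - q₁ * q₃
    factor : ∀ b f₀ f₁ f₂ → - (+ 27 * ((b * f₁) * (b * f₁) - + 4 * ((b * f₀) * (b * f₂))))
      ≡ - (+ 27 * (b * b * (f₁ * f₁ - + 4 * (f₀ * f₂))))
    factor = ℤ-Tactic.solve-∀
    regroup : ∀ b c D → - (+ 27 * (b * b * (c * c * D))) ≡ - (+ 27 * ((b * c) * (b * c) * D))
    regroup = ℤ-Tactic.solve-∀

module QuadraticOrder (D κ : ℤ) (4κ≡D²-D : + 4 ℤ.* κ ≡ D ℤ.* D ℤ.- D) (D≢0 : D ≢ + 0) (c : ℕ) (1≤c : 1 ℕ.≤ c) where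
  open import Data.Rational using (_+_; _*_; -_; _-_; _<_)
  open RationalLemmas
  open Alg D hiding (b; c; b≥1; c≥1; bcΔ; α₁; α₂; β; ideal; invertible; β∈𝔞³; norm)
  open QuadraticAlgebra D
  open Subgroups D
  open FormInvariance
  open IntegerLemmas
  open K-Solver using (solve; _:=_; _:+_; _:*_; _:-_; :-_; con)
  open ≡-Reasoning

  -- Quadratic orders

  -- Apart from the comparison with `Order` and `𝐍`, later arguments use of θ only the relations θ²
  -- = pθ - e and τ(θ) = p - θ and its coordinates p/2 and c/2.
  opaque
    C : ℚ
    C = toℚ (+ c)

    C≡toℚ : C ≡ toℚ (+ c)
    C≡toℚ = refl

    θ : K
    θ = ordBasis₂ c

    θ≡ordBasis₂ : θ ≡ ordBasis₂ c
    θ≡ordBasis₂ = refl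

    -- The minimal polynomial of θ = cω is X² − pX + e.
    p e : ℤ
    p = + c ℤ.* D
    e = + c ℤ.* + c ℤ.* κ

    p≡cD : p ≡ + c ℤ.* D
    p≡cD = refl

    e≡ccκ : e ≡ + c ℤ.* + c ℤ.* κ
    e≡ccκ = refl

  O : Sub
  O = span one θ

  O≐Order : O ≐ Order c
  O≐Order = ≐-intro (λ x → subst (λ t → span one t x) θ≡ordBasis₂)
                    (λ x → subst (λ t → span one t x) (sym θ≡ordBasis₂))

  0<C : 0ℚ < C
  0<C = subst (0ℚ <_) (sym C≡toℚ) (toℚ-pos 1≤c)

  0<½C : 0ℚ < ½ * C
  0<½C = *-pos {½} {C} (ℚ.*<* (ℤ.+<+ (s≤s z≤n))) 0<C

  ½C≢0 : ½ * C ≢ 0ℚ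
  ½C≢0 = <⇒≢0 0<½C

  θ-re : re θ ≡ ½ * toℚ p
  θ-re = trans (cong re θ≡ordBasis₂) (trans (lemma (toℚ (+ c)) Dq) (cong (½ *_) (trans (sym (toℚ-* (+ c) D)) (cong toℚ (sym p≡cD)))))
    where
    lemma : ∀ C D → C * (½ * (D + 0ℚ)) ≡ ½ * (C * D)
    lemma = solve-∀ ℚ-ring

  θ-im : im θ ≡ ½ * C
  θ-im = trans (cong im θ≡ordBasis₂) (trans (lemma (toℚ (+ c))) (cong (½ *_) (sym C≡toℚ)))
    where
    lemma : ∀ C → C * (½ * (0ℚ + 1ℚ)) ≡ ½ * C
    lemma = solve-∀ ℚ-ring

  θ-conjugate : τ θ ≡ fromℤ p ⊖ θ
  θ-conjugate = K-≡ (trans θ-re (trans (lemma (toℚ p)) (cong (λ q → toℚ p + - q) (sym θ-re))))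
                    (sym (ℚ.+-identityˡ (- im θ)))
    where
    lemma : ∀ p → ½ * p ≡ p + - (½ * p)
    lemma = solve-∀ ℚ-ring

  private
    p≡CD : toℚ p ≡ C * Dq
    p≡CD = trans (trans (cong toℚ p≡cD) (toℚ-* (+ c) D)) (cong (_* Dq) (sym C≡toℚ))

    4e≡ : toℚ (+ 4) * toℚ e ≡ C * C * (Dq * Dq - Dq)
    4e≡ = begin
      toℚ (+ 4) * toℚ e ≡⟨ cong (toℚ (+ 4) *_) (trans (trans (cong toℚ e≡ccκ) (toℚ-* (+ c ℤ.* + c) κ)) (cong (_* toℚ κ) (trans (toℚ-* (+ c) (+ c)) (cong₂ _*_ (sym C≡toℚ) (sym C≡toℚ))))) ⟩
      toℚ (+ 4) * (C * C * toℚ κ) ≡⟨ shuffle (toℚ (+ 4)) C (toℚ κ) ⟩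
      C * C * (toℚ (+ 4) * toℚ κ) ≡⟨ cong (C * C *_) (toℚ-* (+ 4) κ) ⟨
      C * C * toℚ (+ 4 ℤ.* κ) ≡⟨ cong (λ i → C * C * toℚ i) 4κ≡D²-D ⟩
      C * C * toℚ (D ℤ.* D ℤ.- D) ≡⟨ cong (C * C *_) (trans (toℚ-+ (D ℤ.* D) (ℤ.- D)) (cong₂ _+_ (toℚ-* D D) (toℚ-neg D))) ⟩
      C * C * (Dq * Dq - Dq) ∎
      where
      shuffle : ∀ f C k → f * (C * C * k) ≡ C * C * (f * k)
      shuffle = solve-∀ ℚ-ring

  θ-square : θ ⊗ θ ≡ fromℤ p ⊗ θ ⊖ fromℤ e
  θ-square = K-≡
    (begin
      re θ * re θ + Dq * im θ * im θ ≡⟨ cong₂ (λ x y → x * x + Dq * y * y) θ-re θ-im ⟩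
      ½ * toℚ p * (½ * toℚ p) + Dq * (½ * C) * (½ * C) ≡⟨ cong (λ q → ½ * q * (½ * q) + Dq * (½ * C) * (½ * C)) p≡CD ⟩
      ½ * (C * Dq) * (½ * (C * Dq)) + Dq * (½ * C) * (½ * C) ≡⟨ complete C Dq (½ * C) ⟩
      (C * Dq * (½ * (C * Dq)) + Dq * 0ℚ * (½ * C)) + - (½ * ½ * (C * C * (Dq * Dq - Dq))) ≡⟨ cong₂ (λ q f → (q * (½ * q) + Dq * 0ℚ * (½ * C)) + - (½ * ½ * f)) p≡CD 4e≡ ⟨
      (toℚ p * (½ * toℚ p) + Dq * 0ℚ * (½ * C)) + - (½ * ½ * (toℚ (+ 4) * toℚ e)) ≡⟨ cong (λ q → (toℚ p * (½ * toℚ p) + Dq * 0ℚ * (½ * C)) + - q) (quarter (toℚ e)) ⟩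
      (toℚ p * (½ * toℚ p) + Dq * 0ℚ * (½ * C)) + - toℚ e ≡⟨ cong₂ (λ x y → (toℚ p * x + Dq * 0ℚ * y) + - toℚ e) θ-re θ-im ⟨
      (toℚ p * re θ + Dq * 0ℚ * im θ) + - toℚ e ∎)
    (begin
      re θ * im θ + im θ * re θ ≡⟨ cong (λ x → x * im θ + im θ * x) θ-re ⟩
      ½ * toℚ p * im θ + im θ * (½ * toℚ p) ≡⟨ imaginary (toℚ p) (im θ) (re θ) ⟩
      (toℚ p * im θ + 0ℚ * re θ) + - 0ℚ ∎)
    where
    complete : ∀ C D H → ½ * (C * D) * (½ * (C * D)) + D * (½ * C) * (½ * C)
      ≡ (C * D * (½ * (C * D)) + D * 0ℚ * H) + - (½ * ½ * (C * C * (D * D - D)))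
    complete = solve-∀ ℚ-ring
    quarter : ∀ e → ½ * ½ * (toℚ (+ 4) * e) ≡ e
    quarter = solve-∀ ℚ-ring
    imaginary : ∀ p i r → ½ * p * i + i * (½ * p) ≡ (p * i + 0ℚ * r) + - 0ℚ
    imaginary = solve-∀ ℚ-ring

  order-intro : ∀ m n → O (fromℤ m ⊕ fromℤ n ⊗ θ)
  order-intro m n = subst (O)
    (solve 3 (λ m n t → m :* con (+ 1) :+ n :* t := m :+ n :* t) refl (fromℤ m) (fromℤ n) θ)
    (span-intro one θ m n)

  order-elim : ∀ x → O x → ∃[ m ] ∃[ n ] x ≡ fromℤ m ⊕ fromℤ n ⊗ θ
  order-elim x x∈O = let m , n , eq = span-elim one θ x x∈O in m , n , trans eq
    (solve 3 (λ m n t → m :* con (+ 1) :+ n :* t := m :+ n :* t) refl (fromℤ m) (fromℤ n) θ)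

  order-subgroup : IsSubgroup O
  order-subgroup = span-isSubgroup one θ

  1∈order : O one
  1∈order = α₁∈span one θ

  θ∈order : O θ
  θ∈order = α₂∈span one θ

  ℤ∈order : ∀ m → O (fromℤ m)
  ℤ∈order m = subst O (⊗-identityʳ (fromℤ m))
    (ℤ-closed order-subgroup m one 1∈order)

  τθ∈order : O (τ θ)
  τθ∈order = subst O (sym θ-conjugate)
    (⊖-closed order-subgroup (fromℤ p) θ (ℤ∈order p) θ∈order)

  θ²∈order : O (θ ⊗ θ)
  θ²∈order = subst O (sym θ-square) (⊖-closed order-subgroup (fromℤ p ⊗ θ) (fromℤ e)
    (ℤ-closed order-subgroup p θ θ∈order) (ℤ∈order e))

  θ⊗∈order : ∀ y → O y → O (θ ⊗ y)
  θ⊗∈order = span-⊆ (⊗ˡ-preimage order-subgroup θ) {one} {θ}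
    (subst O (sym (⊗-identityʳ θ)) θ∈order) θ²∈order

  order-⊗ : ∀ x y → O x → O y → O (x ⊗ y)
  order-⊗ x y x∈O y∈O = span-⊆ (⊗ʳ-preimage order-subgroup y) {one} {θ}
    (subst O (sym (⊗-identityˡ y)) y∈O) (θ⊗∈order y y∈O) x x∈O

  -- Integrality of traces and of determinants will be read off from imaginary parts, which for
  -- elements of O are integral multiples of im θ = c/2.
  order-im : ∀ x → O x → ∃[ n ] im x ≡ toℚ n * (½ * C)
  order-im x x∈O = let m , n , eq = order-elim x x∈O in n , (begin
    im x ≡⟨ cong im eq ⟩
    im (fromℤ m ⊕ fromℤ n ⊗ θ) ≡⟨ im-⊕ (fromℤ m) (fromℤ n ⊗ θ) ⟩
    0ℚ + im (fromℤ n ⊗ θ) ≡⟨ ℚ.+-identityˡ (im (fromℤ n ⊗ θ)) ⟩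
    im (fromℤ n ⊗ θ) ≡⟨ im-fromℚ⊗ (toℚ n) θ ⟩
    toℚ n * im θ ≡⟨ cong (toℚ n *_) θ-im ⟩
    toℚ n * (½ * C) ∎)

  private
    norm-of-shift : ∀ h p e t → t ⊗ t ≡ p ⊗ t ⊖ e → (h ⊕ t) ⊗ (h ⊕ (p ⊖ t)) ≡ h ⊗ h ⊕ h ⊗ p ⊕ e
    norm-of-shift h p e t eq = begin
      (h ⊕ t) ⊗ (h ⊕ (p ⊖ t)) ≡⟨ expand h p t ⟩
      h ⊗ h ⊕ h ⊗ p ⊕ p ⊗ t ⊖ t ⊗ t ≡⟨ cong (λ x → h ⊗ h ⊕ h ⊗ p ⊕ p ⊗ t ⊖ x) eq ⟩
      h ⊗ h ⊕ h ⊗ p ⊕ p ⊗ t ⊖ (p ⊗ t ⊖ e) ≡⟨ collect h p t e ⟩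
      h ⊗ h ⊕ h ⊗ p ⊕ e ∎
      where
      expand : ∀ h p t → (h ⊕ t) ⊗ (h ⊕ (p ⊖ t)) ≡ h ⊗ h ⊕ h ⊗ p ⊕ p ⊗ t ⊖ t ⊗ t
      expand = solve 3 (λ h p t → (h :+ t) :* (h :+ (p :- t)) := h :* h :+ h :* p :+ p :* t :- t :* t) refl
      collect : ∀ h p t e → h ⊗ h ⊕ h ⊗ p ⊕ p ⊗ t ⊖ (p ⊗ t ⊖ e) ≡ h ⊗ h ⊕ h ⊗ p ⊕ e
      collect = solve 4 (λ h p t e → h :* h :+ h :* p :+ p :* t :- (p :* t :- e) := h :* h :+ h :* p :+ e) refl

  norm-h+θ : ∀ h → (fromℤ h ⊕ θ) ⊗ (fromℤ h ⊕ τ θ) ≡ fromℤ (h ℤ.* h ℤ.+ h ℤ.* p ℤ.+ e)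
  norm-h+θ h = begin
    (fromℤ h ⊕ θ) ⊗ (fromℤ h ⊕ τ θ) ≡⟨ cong (λ t → (fromℤ h ⊕ θ) ⊗ (fromℤ h ⊕ t)) θ-conjugate ⟩
    (fromℤ h ⊕ θ) ⊗ (fromℤ h ⊕ (fromℤ p ⊖ θ)) ≡⟨ norm-of-shift (fromℤ h) (fromℤ p) (fromℤ e) θ θ-square ⟩
    fromℤ h ⊗ fromℤ h ⊕ fromℤ h ⊗ fromℤ p ⊕ fromℤ e ≡⟨ cong (_⊕ fromℤ e) (fromℤ-sum-of-products h h h p) ⟨
    fromℤ (h ℤ.* h ℤ.+ h ℤ.* p) ⊕ fromℤ e ≡⟨ fromℤ-+ (h ℤ.* h ℤ.+ h ℤ.* p) e ⟨
    fromℤ (h ℤ.* h ℤ.+ h ℤ.* p ℤ.+ e) ∎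

  det-1-θ : det one θ ≡ ½ * C
  det-1-θ = trans (lemma (re θ) (im θ)) θ-im
    where
    lemma : ∀ r i → 1ℚ * i - 0ℚ * r ≡ i
    lemma = solve-∀ ℚ-ring

  signedNorm : K → K → ℚ
  signedNorm α₁ α₂ = det α₁ α₂ * recip (½ * C)

  signedNorm-det : ∀ α₁ α₂ → signedNorm α₁ α₂ * (½ * C) ≡ det α₁ α₂
  signedNorm-det α₁ α₂ = begin
    det α₁ α₂ * recip (½ * C) * (½ * C) ≡⟨ shuffle (det α₁ α₂) (recip (½ * C)) (½ * C) ⟩
    det α₁ α₂ * (½ * C * recip (½ * C)) ≡⟨ cong (det α₁ α₂ *_) (recip-inverse ½C≢0) ⟩
    det α₁ α₂ * 1ℚ ≡⟨ ℚ.*-identityʳ (det α₁ α₂) ⟩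
    det α₁ α₂ ∎
    where
    shuffle : ∀ d r h → d * r * h ≡ d * (h * r)
    shuffle = solve-∀ ℚ-ring

  signedNorm≢0 : ∀ {α₁ α₂} → Indep α₁ α₂ → signedNorm α₁ α₂ ≢ 0ℚ
  signedNorm≢0 {α₁} {α₂} indep ν≡0 = indep
    (trans (sym (signedNorm-det α₁ α₂)) (trans (cong (_* (½ * C)) ν≡0) (ℚ.*-zeroˡ (½ * C))))

  -- Norm forms of invertible ideals

  -- The ideal ℤα₁ + ℤα₂ has the primitive norm form f₀u² + (2h+p)uv + f₂v², and
  -- N(α₁u + α₂v) = ν(f₀u² + (2h+p)uv + f₂v²); the ᾱᵢ = τ(αᵢ)/ν span the inverse ideal.
  record NormForm (α₁ α₂ : K) : Set where
    field
      ν μ        : ℚ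
      ν*μ≡1      : ν * μ ≡ 1ℚ
      ν-det      : ν * (½ * C) ≡ det α₁ α₂
      f₀ h f₂    : ℤ
      u₀ u₁ u₂   : ℤ
      coprime    : u₀ ℤ.* f₀ ℤ.+ u₁ ℤ.* (+ 2 ℤ.* h ℤ.+ p) ℤ.+ u₂ ℤ.* f₂ ≡ + 1

    ᾱ₁ : K
    ᾱ₁ = fromℚ μ ⊗ τ α₁

    ᾱ₂ : K
    ᾱ₂ = fromℚ μ ⊗ τ α₂

    field
      α₁ᾱ₁ : α₁ ⊗ ᾱ₁ ≡ fromℤ f₀
      α₁ᾱ₂ : α₁ ⊗ ᾱ₂ ≡ fromℤ h ⊕ τ θ
      α₂ᾱ₁ : α₂ ⊗ ᾱ₁ ≡ fromℤ h ⊕ θ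
      α₂ᾱ₂ : α₂ ⊗ ᾱ₂ ≡ fromℤ f₂

  det-swap : ∀ a₁ a₂ → det a₂ a₁ ≡ - det a₁ a₂
  det-swap a₁ a₂ = lemma (re a₁) (im a₁) (re a₂) (im a₂)
    where
    lemma : ∀ a b c d → c * b - d * a ≡ - (a * d - b * c)
    lemma = solve-∀ ℚ-ring

  private
    im-of-relation : ∀ N s t w → fromℚ N ⊗ θ ≡ fromℤ s ⊗ fromℚ N ⊕ fromℤ t ⊗ w →
      N * (½ * C) ≡ toℚ t * im w
    im-of-relation N s t w eq = begin
      N * (½ * C) ≡⟨ cong (N *_) θ-im ⟨
      N * im θ ≡⟨ im-fromℚ⊗ N θ ⟨
      im (fromℚ N ⊗ θ) ≡⟨ cong im eq ⟩
      im (fromℤ s ⊗ fromℚ N ⊕ fromℤ t ⊗ w) ≡⟨ im-⊕ (fromℤ s ⊗ fromℚ N) (fromℤ t ⊗ w) ⟩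
      im (fromℤ s ⊗ fromℚ N) + im (fromℤ t ⊗ w) ≡⟨ cong₂ _+_ (im-fromℚ⊗ (toℚ s) (fromℚ N)) (im-fromℚ⊗ (toℚ t) w) ⟩
      toℚ s * 0ℚ + toℚ t * im w ≡⟨ lemma (toℚ s) (toℚ t) (im w) ⟩
      toℚ t * im w ∎
      where
      lemma : ∀ s t w → s * 0ℚ + t * w ≡ t * w
      lemma = solve-∀ ℚ-ring

    im-θ⊗ : ∀ z → im (θ ⊗ z) ≡ ½ * toℚ p * im z + ½ * C * re z
    im-θ⊗ z = cong₂ (λ x y → x * im z + y * re z) θ-re θ-im

    -- Multiplying by τ(α) turns the left side into a rational multiple of θ. Taking imaginary parts
    -- then expresses N(α) by t and im(τ(α)α′) alone.
    norm-relation : ∀ α α′ s t → θ ⊗ α ≡ fromℤ s ⊗ α ⊕ fromℤ t ⊗ α′ →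
      fromℚ (Nm α) ⊗ θ ≡ fromℤ s ⊗ fromℚ (Nm α) ⊕ fromℤ t ⊗ (τ α ⊗ α′)
    norm-relation α α′ s t eq = begin
      fromℚ (Nm α) ⊗ θ ≡⟨ cong (_⊗ θ) (fromℚ-Nm α) ⟨
      α ⊗ τ α ⊗ θ ≡⟨ lhs α (τ α) θ ⟩
      θ ⊗ α ⊗ τ α ≡⟨ cong (_⊗ τ α) eq ⟩
      (fromℤ s ⊗ α ⊕ fromℤ t ⊗ α′) ⊗ τ α ≡⟨ rhs (fromℤ s) (fromℤ t) α (τ α) α′ ⟩
      fromℤ s ⊗ (α ⊗ τ α) ⊕ fromℤ t ⊗ (τ α ⊗ α′) ≡⟨ cong (λ x → fromℤ s ⊗ x ⊕ fromℤ t ⊗ (τ α ⊗ α′)) (fromℚ-Nm α) ⟩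
      fromℤ s ⊗ fromℚ (Nm α) ⊕ fromℤ t ⊗ (τ α ⊗ α′) ∎
      where
      lhs : ∀ a a′ t → a ⊗ a′ ⊗ t ≡ t ⊗ a ⊗ a′
      lhs = solve 3 (λ a a′ t → a :* a′ :* t := t :* a :* a′) refl
      rhs : ∀ s t a a′ b → (s ⊗ a ⊕ t ⊗ b) ⊗ a′ ≡ s ⊗ (a ⊗ a′) ⊕ t ⊗ (a′ ⊗ b)
      rhs = solve 5 (λ s t a a′ b → (s :* a :+ t :* b) :* a′ := s :* (a :* a′) :+ t :* (a′ :* b)) refl

  -- The norm form is read off from the matrix of multiplication by θ: N(α₁) = tν, N(α₂) = -t′ν and
  -- τ(α₁)α₂ = ν(-s + θ). Everything follows from imaginary parts, since im(τ(α₁)α₂) = ν·c/2 by the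
  -- choice of ν.
  module StableLattice (α₁ α₂ : K) (s t s′ t′ : ℤ) (ν : ℚ) (ν≢0 : ν ≢ 0ℚ) (ν-det : ν * (½ * C) ≡ det α₁ α₂)
    (θα₁ : θ ⊗ α₁ ≡ fromℤ s ⊗ α₁ ⊕ fromℤ t ⊗ α₂)
    (θα₂ : θ ⊗ α₂ ≡ fromℤ s′ ⊗ α₂ ⊕ fromℤ t′ ⊗ α₁) where

    private
      H : ℚ
      H = ½ * C

      z : K
      z = τ α₁ ⊗ α₂

      im-z : im z ≡ ν * H
      im-z = trans (sym (det≡im α₁ α₂)) (sym ν-det)

    Nm-α₁ : Nm α₁ ≡ toℚ t * ν
    Nm-α₁ = *-cancelˡ ½C≢0 (begin
      H * Nm α₁ ≡⟨ ℚ.*-comm H (Nm α₁) ⟩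
      Nm α₁ * H ≡⟨ im-of-relation (Nm α₁) s t z (norm-relation α₁ α₂ s t θα₁) ⟩
      toℚ t * im z ≡⟨ cong (toℚ t *_) im-z ⟩
      toℚ t * (ν * H) ≡⟨ shuffle (toℚ t) ν H ⟩
      H * (toℚ t * ν) ∎)
      where
      shuffle : ∀ t ν h → t * (ν * h) ≡ h * (t * ν)
      shuffle = solve-∀ ℚ-ring

    Nm-α₂ : Nm α₂ ≡ - toℚ t′ * ν
    Nm-α₂ = *-cancelˡ ½C≢0 (begin
      H * Nm α₂ ≡⟨ ℚ.*-comm H (Nm α₂) ⟩
      Nm α₂ * H ≡⟨ im-of-relation (Nm α₂) s′ t′ (τ α₂ ⊗ α₁) (norm-relation α₂ α₁ s′ t′ θα₂) ⟩
      toℚ t′ * im (τ α₂ ⊗ α₁) ≡⟨ cong (toℚ t′ *_) (det≡im α₂ α₁) ⟨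
      toℚ t′ * det α₂ α₁ ≡⟨ cong (toℚ t′ *_) (det-swap α₁ α₂) ⟩
      toℚ t′ * - det α₁ α₂ ≡⟨ cong (λ d → toℚ t′ * - d) ν-det ⟨
      toℚ t′ * - (ν * H) ≡⟨ shuffle (toℚ t′) ν H ⟩
      H * (- toℚ t′ * ν) ∎)
      where
      shuffle : ∀ t ν h → t * - (ν * h) ≡ h * (- t * ν)
      shuffle = solve-∀ ℚ-ring

    private
      im-θz : im (θ ⊗ z) ≡ toℚ s′ * im z
      im-θz = begin
        im (θ ⊗ z) ≡⟨ cong im rearrange ⟩
        im (fromℤ s′ ⊗ z ⊕ fromℤ t′ ⊗ fromℚ (Nm α₁)) ≡⟨ im-⊕ (fromℤ s′ ⊗ z) (fromℤ t′ ⊗ fromℚ (Nm α₁)) ⟩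
        im (fromℤ s′ ⊗ z) + im (fromℤ t′ ⊗ fromℚ (Nm α₁)) ≡⟨ cong₂ _+_ (im-fromℚ⊗ (toℚ s′) z) (im-fromℚ⊗ (toℚ t′) (fromℚ (Nm α₁))) ⟩
        toℚ s′ * im z + toℚ t′ * 0ℚ ≡⟨ drop (toℚ s′) (toℚ t′) (im z) ⟩
        toℚ s′ * im z ∎
        where
        drop : ∀ s t x → s * x + t * 0ℚ ≡ s * x
        drop = solve-∀ ℚ-ring
        distribute : ∀ a′ s b t a → a′ ⊗ (s ⊗ b ⊕ t ⊗ a) ≡ s ⊗ (a′ ⊗ b) ⊕ t ⊗ (a ⊗ a′)
        distribute = solve 5 (λ a′ s b t a → a′ :* (s :* b :+ t :* a) := s :* (a′ :* b) :+ t :* (a :* a′)) refl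
        rearrange : θ ⊗ z ≡ fromℤ s′ ⊗ z ⊕ fromℤ t′ ⊗ fromℚ (Nm α₁)
        rearrange = begin
          θ ⊗ (τ α₁ ⊗ α₂) ≡⟨ ⊗-swap θ (τ α₁) α₂ ⟩
          τ α₁ ⊗ (θ ⊗ α₂) ≡⟨ cong (τ α₁ ⊗_) θα₂ ⟩
          τ α₁ ⊗ (fromℤ s′ ⊗ α₂ ⊕ fromℤ t′ ⊗ α₁) ≡⟨ distribute (τ α₁) (fromℤ s′) α₂ (fromℤ t′) α₁ ⟩
          fromℤ s′ ⊗ z ⊕ fromℤ t′ ⊗ (α₁ ⊗ τ α₁) ≡⟨ cong (λ x → fromℤ s′ ⊗ z ⊕ fromℤ t′ ⊗ x) (fromℚ-Nm α₁) ⟩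
          fromℤ s′ ⊗ z ⊕ fromℤ t′ ⊗ fromℚ (Nm α₁) ∎

      im-pz-θz : toℚ p * im z - im (θ ⊗ z) ≡ toℚ s * im z
      im-pz-θz = begin
        toℚ p * im z - im (θ ⊗ z) ≡⟨ cong (_- im (θ ⊗ z)) (im-fromℚ⊗ (toℚ p) z) ⟨
        im (fromℤ p ⊗ z) - im (θ ⊗ z) ≡⟨⟩
        im (fromℤ p ⊗ z ⊖ θ ⊗ z) ≡⟨ cong im rearrange ⟩
        im (fromℤ s ⊗ z ⊕ fromℤ t ⊗ fromℚ (Nm α₂)) ≡⟨ im-⊕ (fromℤ s ⊗ z) (fromℤ t ⊗ fromℚ (Nm α₂)) ⟩
        im (fromℤ s ⊗ z) + im (fromℤ t ⊗ fromℚ (Nm α₂)) ≡⟨ cong₂ _+_ (im-fromℚ⊗ (toℚ s) z) (im-fromℚ⊗ (toℚ t) (fromℚ (Nm α₂))) ⟩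
        toℚ s * im z + toℚ t * 0ℚ ≡⟨ drop (toℚ s) (toℚ t) (im z) ⟩
        toℚ s * im z ∎
        where
        drop : ∀ s t x → s * x + t * 0ℚ ≡ s * x
        drop = solve-∀ ℚ-ring
        factor : ∀ p t a b → p ⊗ (a ⊗ b) ⊖ t ⊗ (a ⊗ b) ≡ ((p ⊖ t) ⊗ a) ⊗ b
        factor = solve 4 (λ p t a b → p :* (a :* b) :- t :* (a :* b) := ((p :- t) :* a) :* b) refl
        distribute : ∀ s a′ t b′ b → (s ⊗ a′ ⊕ t ⊗ b′) ⊗ b ≡ s ⊗ (a′ ⊗ b) ⊕ t ⊗ (b ⊗ b′)
        distribute = solve 5 (λ s a′ t b′ b → (s :* a′ :+ t :* b′) :* b := s :* (a′ :* b) :+ t :* (b :* b′)) refl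
        conjugate : τ (θ ⊗ α₁) ≡ fromℤ s ⊗ τ α₁ ⊕ fromℤ t ⊗ τ α₂
        conjugate = trans (cong τ θα₁) (trans (τ-⊕ (fromℤ s ⊗ α₁) (fromℤ t ⊗ α₂))
          (cong₂ _⊕_ (τ-⊗ (fromℤ s) α₁) (τ-⊗ (fromℤ t) α₂)))
        rearrange : fromℤ p ⊗ z ⊖ θ ⊗ z ≡ fromℤ s ⊗ z ⊕ fromℤ t ⊗ fromℚ (Nm α₂)
        rearrange = begin
          fromℤ p ⊗ (τ α₁ ⊗ α₂) ⊖ θ ⊗ (τ α₁ ⊗ α₂) ≡⟨ factor (fromℤ p) θ (τ α₁) α₂ ⟩
          ((fromℤ p ⊖ θ) ⊗ τ α₁) ⊗ α₂ ≡⟨ cong (λ x → (x ⊗ τ α₁) ⊗ α₂) θ-conjugate ⟨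
          (τ θ ⊗ τ α₁) ⊗ α₂ ≡⟨ cong (_⊗ α₂) (τ-⊗ θ α₁) ⟨
          τ (θ ⊗ α₁) ⊗ α₂ ≡⟨ cong (_⊗ α₂) conjugate ⟩
          (fromℤ s ⊗ τ α₁ ⊕ fromℤ t ⊗ τ α₂) ⊗ α₂ ≡⟨ distribute (fromℤ s) (τ α₁) (fromℤ t) (τ α₂) α₂ ⟩
          fromℤ s ⊗ z ⊕ fromℤ t ⊗ (α₂ ⊗ τ α₂) ≡⟨ cong (λ x → fromℤ s ⊗ z ⊕ fromℤ t ⊗ x) (fromℚ-Nm α₂) ⟩
          fromℤ s ⊗ z ⊕ fromℤ t ⊗ fromℚ (Nm α₂) ∎

      im-z≢0 : im z ≢ 0ℚ
      im-z≢0 eq = *-≢0 ν≢0 ½C≢0 (trans (sym im-z) eq)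

    -- The trace of multiplication by θ. With z = τ(α₁)α₂, applying θ to the factor α₂ gives im(θz)
    -- = s′·im z, and applying τ(θ) = p - θ to the factor τ(α₁) gives im((p - θ)z) = s·im z.
    trace-relation : s′ ≡ ℤ.- s ℤ.+ p
    trace-relation = toℚ-injective (*-cancelˡ im-z≢0 (begin
      im z * toℚ s′ ≡⟨ ℚ.*-comm (im z) (toℚ s′) ⟩
      toℚ s′ * im z ≡⟨ isolate (toℚ p) (im z) (toℚ s′) ⟩
      toℚ p * im z - (toℚ p * im z - toℚ s′ * im z) ≡⟨ cong (λ x → toℚ p * im z - (toℚ p * im z - x)) im-θz ⟨
      toℚ p * im z - (toℚ p * im z - im (θ ⊗ z)) ≡⟨ cong (λ x → toℚ p * im z - x) im-pz-θz ⟩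
      toℚ p * im z - toℚ s * im z ≡⟨ collect (toℚ p) (toℚ s) (im z) ⟩
      im z * (- toℚ s + toℚ p) ≡⟨ cong (im z *_) (trans (toℚ-+ (ℤ.- s) p) (cong (_+ toℚ p) (toℚ-neg s))) ⟨
      im z * toℚ (ℤ.- s ℤ.+ p) ∎))
      where
      isolate : ∀ p x s → s * x ≡ p * x - (p * x - s * x)
      isolate = solve-∀ ℚ-ring
      collect : ∀ p s x → p * x - s * x ≡ x * (- s + p)
      collect = solve-∀ ℚ-ring

    -- The imaginary part is known. The real part is extracted from im(θz) = (p/2)·im z + (c/2)·re
    -- z, whose left side is s′·im z.
    τα₁⊗α₂ : τ α₁ ⊗ α₂ ≡ fromℚ ν ⊗ (fromℤ (ℤ.- s) ⊕ θ)
    τα₁⊗α₂ = K-≡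
      (trans (*-cancelˡ ½C≢0 (begin
          H * re z ≡⟨ isolate (½ * toℚ p * im z) (H * re z) ⟩
          (½ * toℚ p * im z + H * re z) - ½ * toℚ p * im z ≡⟨ cong (_- ½ * toℚ p * im z) (trans (sym (im-θ⊗ z)) im-θz) ⟩
          toℚ s′ * im z - ½ * toℚ p * im z ≡⟨ cong (λ x → x * im z - ½ * toℚ p * im z) s′-value ⟩
          (toℚ (ℤ.- s) + toℚ p) * im z - ½ * toℚ p * im z ≡⟨ cong (λ x → (toℚ (ℤ.- s) + toℚ p) * x - ½ * toℚ p * x) im-z ⟩
          (toℚ (ℤ.- s) + toℚ p) * (ν * H) - ½ * toℚ p * (ν * H) ≡⟨ collect (toℚ (ℤ.- s)) (toℚ p) ν H ⟩
          H * (ν * (toℚ (ℤ.- s) + ½ * toℚ p)) ≡⟨ cong (λ x → H * (ν * (toℚ (ℤ.- s) + x))) θ-re ⟨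
          H * (ν * (toℚ (ℤ.- s) + re θ)) ∎))
        (sym (re-fromℚ⊗ ν (fromℤ (ℤ.- s) ⊕ θ))))
      (begin
        im z ≡⟨ im-z ⟩
        ν * H ≡⟨ cong (ν *_) (trans (ℚ.+-identityˡ (im θ)) θ-im) ⟨
        ν * (0ℚ + im θ) ≡⟨ im-fromℚ⊗ ν (fromℤ (ℤ.- s) ⊕ θ) ⟨
        im (fromℚ ν ⊗ (fromℤ (ℤ.- s) ⊕ θ)) ∎)
      where
      s′-value : toℚ s′ ≡ toℚ (ℤ.- s) + toℚ p
      s′-value = trans (cong toℚ trace-relation) (toℚ-+ (ℤ.- s) p)
      isolate : ∀ x y → y ≡ (x + y) - x
      isolate = solve-∀ ℚ-ring
      collect : ∀ s p ν h → (s + p) * (ν * h) - ½ * p * (ν * h) ≡ h * (ν * (s + ½ * p))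
      collect = solve-∀ ℚ-ring


  Stable : K → K → Set
  Stable α₁ α₂ = ∀ o x → O o → span α₁ α₂ x → span α₁ α₂ (o ⊗ x)

  ideal⇒stable : ∀ {α₁ α₂} → IsIdeal c α₁ α₂ → Stable α₁ α₂
  ideal⇒stable (_ , stable) o x o∈O = stable o x (≐⇒⊆ O≐Order o o∈O)

  stable-intro : ∀ α₁ α₂ → span α₁ α₂ (θ ⊗ α₁) → span α₁ α₂ (θ ⊗ α₂) → Stable α₁ α₂
  stable-intro α₁ α₂ θα₁∈ θα₂∈ o x o∈O x∈ =
    span-⊆ (⊗ʳ-preimage (span-isSubgroup α₁ α₂) x) {one} {θ}
      (subst (span α₁ α₂) (sym (⊗-identityˡ x)) x∈)
      (span-⊆ (⊗ˡ-preimage (span-isSubgroup α₁ α₂) θ) {α₁} {α₂} θα₁∈ θα₂∈ x x∈) o o∈O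

  -- If o𝔞 ⊆ 𝔞, then o = o·1 lies in (o𝔞)𝔞⁻¹ ⊆ 𝔞𝔞⁻¹ = O. This is where invertibility enters the
  -- construction of the norm form.
  stabilizer⊆order : ∀ α₁ α₂ γ₁ γ₂ → Gen ((α₁ ∷ α₂ ∷ []) ·g (γ₁ ∷ γ₂ ∷ [])) ≐ Order c →
    ∀ o → (∀ x → span α₁ α₂ x → span α₁ α₂ (o ⊗ x)) → O o
  stabilizer⊆order α₁ α₂ γ₁ γ₂ inverse o o-stable = subst O
    (⊗-identityʳ o)
    (product-⊆ α₁ α₂ γ₁ γ₂ (⊗ˡ-preimage order-subgroup o)
      (λ x y x∈ y∈ → subst O (solve 3 (λ o x y → (o :* x) :* y := o :* (x :* y)) refl o x y)
        (≐⇒⊇ O≐Order ((o ⊗ x) ⊗ y) (≐⇒⊆ inverse ((o ⊗ x) ⊗ y)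
          (product-intro α₁ α₂ γ₁ γ₂ (o ⊗ x) y (o-stable x x∈) y∈))))
      one (≐⇒⊇ inverse one (≐⇒⊆ O≐Order one 1∈order)))

  -- With q = 1/gcd(f₀, f₁, f₂), the element q(θ + h) stabilises the ideal, so
  -- invertibility forces q to be an integer.
  module _ {α₁ α₂ : K} {h f₀ f₂ : ℤ}
    (stabilizer⊆O : ∀ o → (∀ x → span α₁ α₂ x → span α₁ α₂ (o ⊗ x)) → O o)
    (θα₁ : θ ⊗ α₁ ≡ fromℤ (ℤ.- h) ⊗ α₁ ⊕ fromℤ f₀ ⊗ α₂)
    (θα₂ : θ ⊗ α₂ ≡ fromℤ (h ℤ.+ p) ⊗ α₂ ⊕ fromℤ (ℤ.- f₂) ⊗ α₁) where

    scaled-integral : ∀ q g₀ g₁ g₂ → q * toℚ f₀ ≡ toℚ g₀ → q * toℚ (+ 2 ℤ.* h ℤ.+ p) ≡ toℚ g₁ →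
      q * toℚ f₂ ≡ toℚ g₂ → ∃[ m ] q ≡ toℚ m
    scaled-integral q g₀ g₁ g₂ eq₀ eq₁ eq₂ =
      let n , im-o≡ = order-im o o∈O in n , *-cancelˡ ½C≢0 (begin
        ½ * C * q ≡⟨ ℚ.*-comm (½ * C) q ⟩
        q * (½ * C) ≡⟨ cong (q *_) θ-im ⟨
        q * im θ ≡⟨ cong (q *_) (ℚ.+-identityʳ (im θ)) ⟨
        q * (im θ + 0ℚ) ≡⟨ im-fromℚ⊗ q (θ ⊕ fromℤ h) ⟨
        im o ≡⟨ im-o≡ ⟩
        toℚ n * (½ * C) ≡⟨ ℚ.*-comm (toℚ n) (½ * C) ⟩
        ½ * C * toℚ n ∎)
      where
      o : K
      o = fromℚ q ⊗ (θ ⊕ fromℤ h)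
      lift : ∀ f g → q * toℚ f ≡ toℚ g → fromℚ q ⊗ fromℤ f ≡ fromℤ g
      lift f g eq = trans (sym (fromℚ-* q (toℚ f))) (cong fromℚ eq)
      oα₁ : o ⊗ α₁ ≡ fromℤ g₀ ⊗ α₂
      oα₁ = begin
        o ⊗ α₁ ≡⟨ expand (fromℚ q) θ (fromℤ h) α₁ ⟩
        fromℚ q ⊗ (θ ⊗ α₁ ⊕ fromℤ h ⊗ α₁) ≡⟨ cong (λ x → fromℚ q ⊗ (x ⊕ fromℤ h ⊗ α₁)) θα₁ ⟩
        fromℚ q ⊗ (fromℤ (ℤ.- h) ⊗ α₁ ⊕ fromℤ f₀ ⊗ α₂ ⊕ fromℤ h ⊗ α₁) ≡⟨ cong (λ x → fromℚ q ⊗ (x ⊗ α₁ ⊕ fromℤ f₀ ⊗ α₂ ⊕ fromℤ h ⊗ α₁)) (fromℤ-neg h) ⟩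
        fromℚ q ⊗ (neg (fromℤ h) ⊗ α₁ ⊕ fromℤ f₀ ⊗ α₂ ⊕ fromℤ h ⊗ α₁) ≡⟨ collect (fromℚ q) (fromℤ h) (fromℤ f₀) α₁ α₂ ⟩
        (fromℚ q ⊗ fromℤ f₀) ⊗ α₂ ≡⟨ cong (_⊗ α₂) (lift f₀ g₀ eq₀) ⟩
        fromℤ g₀ ⊗ α₂ ∎
        where
        expand : ∀ q t h a → q ⊗ (t ⊕ h) ⊗ a ≡ q ⊗ (t ⊗ a ⊕ h ⊗ a)
        expand = solve 4 (λ q t h a → q :* (t :+ h) :* a := q :* (t :* a :+ h :* a)) refl
        collect : ∀ q h f a b → q ⊗ (neg h ⊗ a ⊕ f ⊗ b ⊕ h ⊗ a) ≡ (q ⊗ f) ⊗ b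
        collect = solve 5 (λ q h f a b → q :* ((:- h) :* a :+ f :* b :+ h :* a) := (q :* f) :* b) refl
      f₁-value : fromℤ (h ℤ.+ p) ⊕ fromℤ h ≡ fromℤ (+ 2 ℤ.* h ℤ.+ p)
      f₁-value = trans (sym (fromℤ-+ (h ℤ.+ p) h)) (cong fromℤ (lemma h p))
        where
        lemma : ∀ h p → h ℤ.+ p ℤ.+ h ≡ + 2 ℤ.* h ℤ.+ p
        lemma = ℤ-Tactic.solve-∀
      oα₂ : o ⊗ α₂ ≡ fromℤ g₁ ⊗ α₂ ⊖ fromℤ g₂ ⊗ α₁
      oα₂ = begin
        o ⊗ α₂ ≡⟨ expand (fromℚ q) θ (fromℤ h) α₂ ⟩
        fromℚ q ⊗ (θ ⊗ α₂ ⊕ fromℤ h ⊗ α₂) ≡⟨ cong (λ x → fromℚ q ⊗ (x ⊕ fromℤ h ⊗ α₂)) θα₂ ⟩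
        fromℚ q ⊗ (fromℤ (h ℤ.+ p) ⊗ α₂ ⊕ fromℤ (ℤ.- f₂) ⊗ α₁ ⊕ fromℤ h ⊗ α₂) ≡⟨ cong (λ x → fromℚ q ⊗ (fromℤ (h ℤ.+ p) ⊗ α₂ ⊕ x ⊗ α₁ ⊕ fromℤ h ⊗ α₂)) (fromℤ-neg f₂) ⟩
        fromℚ q ⊗ (fromℤ (h ℤ.+ p) ⊗ α₂ ⊕ neg (fromℤ f₂) ⊗ α₁ ⊕ fromℤ h ⊗ α₂) ≡⟨ collect (fromℚ q) (fromℤ (h ℤ.+ p)) (fromℤ h) (fromℤ f₂) α₁ α₂ ⟩
        (fromℚ q ⊗ (fromℤ (h ℤ.+ p) ⊕ fromℤ h)) ⊗ α₂ ⊖ (fromℚ q ⊗ fromℤ f₂) ⊗ α₁ ≡⟨ cong₂ (λ x y → x ⊗ α₂ ⊖ y ⊗ α₁) (trans (cong (fromℚ q ⊗_) f₁-value) (lift (+ 2 ℤ.* h ℤ.+ p) g₁ eq₁)) (lift f₂ g₂ eq₂) ⟩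
        fromℤ g₁ ⊗ α₂ ⊖ fromℤ g₂ ⊗ α₁ ∎
        where
        expand : ∀ q t h a → q ⊗ (t ⊕ h) ⊗ a ≡ q ⊗ (t ⊗ a ⊕ h ⊗ a)
        expand = solve 4 (λ q t h a → q :* (t :+ h) :* a := q :* (t :* a :+ h :* a)) refl
        collect : ∀ q k h f a b → q ⊗ (k ⊗ b ⊕ neg f ⊗ a ⊕ h ⊗ b) ≡ (q ⊗ (k ⊕ h)) ⊗ b ⊖ (q ⊗ f) ⊗ a
        collect = solve 6 (λ q k h f a b → q :* (k :* b :+ (:- f) :* a :+ h :* b) := (q :* (k :+ h)) :* b :- (q :* f) :* a) refl
      o∈O : O o
      o∈O = stabilizer⊆O o (λ x x∈ → span-⊆ (⊗ˡ-preimage (span-isSubgroup α₁ α₂) o) {α₁} {α₂}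
        (subst (span α₁ α₂) (sym oα₁) (ℤ-closed (span-isSubgroup α₁ α₂) g₀ α₂ (α₂∈span α₁ α₂)))
        (subst (span α₁ α₂) (sym oα₂) (⊖-closed (span-isSubgroup α₁ α₂) (fromℤ g₁ ⊗ α₂) (fromℤ g₂ ⊗ α₁)
          (ℤ-closed (span-isSubgroup α₁ α₂) g₁ α₂ (α₂∈span α₁ α₂))
          (ℤ-closed (span-isSubgroup α₁ α₂) g₂ α₁ (α₁∈span α₁ α₂)))) x x∈)

    coefficients-coprime : ∃[ u₀ ] ∃[ u₁ ] ∃[ u₂ ]
      (u₀ ℤ.* f₀ ℤ.+ u₁ ℤ.* (+ 2 ℤ.* h ℤ.+ p) ℤ.+ u₂ ℤ.* f₂ ≡ + 1)
    coefficients-coprime = go (bezout₃ f₀ (+ 2 ℤ.* h ℤ.+ p) f₂)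
      where
      f₁ = + 2 ℤ.* h ℤ.+ p
      go : (∃[ g ] ∃[ v₀ ] ∃[ v₁ ] ∃[ v₂ ] ∃[ u₀ ] ∃[ u₁ ] ∃[ u₂ ]
          (f₀ ≡ + g ℤ.* v₀ × f₁ ≡ + g ℤ.* v₁ × f₂ ≡ + g ℤ.* v₂ × u₀ ℤ.* v₀ ℤ.+ u₁ ℤ.* v₁ ℤ.+ u₂ ℤ.* v₂ ≡ + 1)) →
        ∃[ u₀ ] ∃[ u₁ ] ∃[ u₂ ] (u₀ ℤ.* f₀ ℤ.+ u₁ ℤ.* f₁ ℤ.+ u₂ ℤ.* f₂ ≡ + 1)
      -- If the gcd is 0, all three coefficients vanish and every rational q qualifies; q = ½ is not
      -- an integer.
      go (zero , v₀ , v₁ , v₂ , _ , _ , _ , f₀≡ , f₁≡ , f₂≡ , _) =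
        ⊥-elim (½-not-integral (scaled-integral ½ (+ 0) (+ 0) (+ 0)
          (vanish f₀ v₀ f₀≡) (vanish f₁ v₁ f₁≡) (vanish f₂ v₂ f₂≡)))
        where
        vanish : ∀ f v → f ≡ + 0 ℤ.* v → ½ * toℚ f ≡ 0ℚ
        vanish f v eq = trans (cong (λ i → ½ * toℚ i) (trans eq (ℤ.*-zeroˡ v))) refl
        ½-not-integral : ¬ (∃[ m ] ½ ≡ toℚ m)
        ½-not-integral (m , eq) = 2m≢1 (unit-abs (+ 2) m (toℚ-injective
          (trans (toℚ-* (+ 2) m) (cong (toℚ (+ 2) *_) (sym eq)))))
          where
          2m≢1 : 2 ≢ 1
          2m≢1 ()
      go (g@(suc _) , v₀ , v₁ , v₂ , u₀ , u₁ , u₂ , f₀≡ , f₁≡ , f₂≡ , eq) =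
        rescale (scaled-integral (recip (toℚ (+ g))) v₀ v₁ v₂
          (divide f₀ v₀ f₀≡) (divide f₁ v₁ f₁≡) (divide f₂ v₂ f₂≡))
        where
        g≢0 : toℚ (+ g) ≢ 0ℚ
        g≢0 = toℚ-nonzero {+ g} (λ ())
        divide : ∀ f v → f ≡ + g ℤ.* v → recip (toℚ (+ g)) * toℚ f ≡ toℚ v
        divide f v eq = *-cancelˡ g≢0 (begin
          toℚ (+ g) * (recip (toℚ (+ g)) * toℚ f) ≡⟨ ℚ.*-assoc (toℚ (+ g)) (recip (toℚ (+ g))) (toℚ f) ⟨
          toℚ (+ g) * recip (toℚ (+ g)) * toℚ f ≡⟨ cong (_* toℚ f) (recip-inverse g≢0) ⟩
          1ℚ * toℚ f ≡⟨ ℚ.*-identityˡ (toℚ f) ⟩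
          toℚ f ≡⟨ cong toℚ eq ⟩
          toℚ (+ g ℤ.* v) ≡⟨ toℚ-* (+ g) v ⟩
          toℚ (+ g) * toℚ v ∎)
        rescale : ∃[ m ] recip (toℚ (+ g)) ≡ toℚ m → ∃[ u₀ ] ∃[ u₁ ] ∃[ u₂ ] (u₀ ℤ.* f₀ ℤ.+ u₁ ℤ.* f₁ ℤ.+ u₂ ℤ.* f₂ ≡ + 1)
        -- 1/g is the integer m, so scaling the Bézout coefficients by m makes the combination equal
        -- to gm = 1.
        rescale (m , m≡) = m ℤ.* u₀ , m ℤ.* u₁ , m ℤ.* u₂ , (begin
          m ℤ.* u₀ ℤ.* f₀ ℤ.+ m ℤ.* u₁ ℤ.* f₁ ℤ.+ m ℤ.* u₂ ℤ.* f₂ ≡⟨ combine m u₀ u₁ u₂ (+ g) v₀ v₁ v₂ f₀≡ f₁≡ f₂≡ ⟩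
          + g ℤ.* m ℤ.* (u₀ ℤ.* v₀ ℤ.+ u₁ ℤ.* v₁ ℤ.+ u₂ ℤ.* v₂) ≡⟨ cong (+ g ℤ.* m ℤ.*_) eq ⟩
          + g ℤ.* m ℤ.* + 1 ≡⟨ ℤ.*-identityʳ (+ g ℤ.* m) ⟩
          + g ℤ.* m ≡⟨ toℚ-injective (trans (toℚ-* (+ g) m) (trans (cong (toℚ (+ g) *_) (sym m≡)) (recip-inverse g≢0))) ⟩
          + 1 ∎)
          where
          combine : ∀ m u₀ u₁ u₂ g v₀ v₁ v₂ {f₀ f₁ f₂} → f₀ ≡ g ℤ.* v₀ → f₁ ≡ g ℤ.* v₁ → f₂ ≡ g ℤ.* v₂ →
            m ℤ.* u₀ ℤ.* f₀ ℤ.+ m ℤ.* u₁ ℤ.* f₁ ℤ.+ m ℤ.* u₂ ℤ.* f₂ ≡ g ℤ.* m ℤ.* (u₀ ℤ.* v₀ ℤ.+ u₁ ℤ.* v₁ ℤ.+ u₂ ℤ.* v₂)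
          combine m u₀ u₁ u₂ g v₀ v₁ v₂ refl refl refl = lemma m u₀ u₁ u₂ g v₀ v₁ v₂
            where
            lemma : ∀ m u₀ u₁ u₂ g v₀ v₁ v₂ →
              m ℤ.* u₀ ℤ.* (g ℤ.* v₀) ℤ.+ m ℤ.* u₁ ℤ.* (g ℤ.* v₁) ℤ.+ m ℤ.* u₂ ℤ.* (g ℤ.* v₂) ≡ g ℤ.* m ℤ.* (u₀ ℤ.* v₀ ℤ.+ u₁ ℤ.* v₁ ℤ.+ u₂ ℤ.* v₂)
            lemma = ℤ-Tactic.solve-∀

  private
    normForm-products : ∀ α₁ α₂ s t s′ t′ →
      θ ⊗ α₁ ≡ fromℤ s ⊗ α₁ ⊕ fromℤ t ⊗ α₂ → θ ⊗ α₂ ≡ fromℤ s′ ⊗ α₂ ⊕ fromℤ t′ ⊗ α₁ →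
      Indep α₁ α₂ → (∀ o → (∀ x → span α₁ α₂ x → span α₁ α₂ (o ⊗ x)) → O o) → NormForm α₁ α₂
    normForm-products α₁ α₂ s t s′ t′ θα₁ θα₂ indep stabilizer⊆O = record
      { ν = ν ; μ = μ ; ν*μ≡1 = recip-inverse ν≢0 ; ν-det = ν-det
      ; f₀ = t ; h = ℤ.- s ; f₂ = ℤ.- t′
      ; u₀ = proj₁ coprime ; u₁ = proj₁ (proj₂ coprime) ; u₂ = proj₁ (proj₂ (proj₂ coprime))
      ; coprime = proj₂ (proj₂ (proj₂ coprime))
      ; α₁ᾱ₁ = trans (⊗-swap α₁ (fromℚ μ) (τ α₁)) (trans (cong (fromℚ μ ⊗_) (fromℚ-Nm α₁))
          (trans (cong (λ q → fromℚ μ ⊗ fromℚ q) Nm-α₁) (divide (toℚ t))))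
      ; α₁ᾱ₂ = trans (⊗-swap α₁ (fromℚ μ) (τ α₂)) (trans (cong (fromℚ μ ⊗_) α₁⊗τα₂) (cancel (fromℤ (ℤ.- s) ⊕ τ θ)))
      ; α₂ᾱ₁ = trans (swap′ α₂ (fromℚ μ) (τ α₁))
          (trans (cong (fromℚ μ ⊗_) τα₁⊗α₂) (cancel (fromℤ (ℤ.- s) ⊕ θ)))
      ; α₂ᾱ₂ = trans (⊗-swap α₂ (fromℚ μ) (τ α₂)) (trans (cong (fromℚ μ ⊗_) (fromℚ-Nm α₂))
          (trans (cong (λ q → fromℚ μ ⊗ fromℚ q) (trans Nm-α₂ (cong (_* ν) (sym (toℚ-neg t′)))))
            (divide (toℚ (ℤ.- t′))))) }
      where
      ν = signedNorm α₁ α₂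
      ν≢0 = signedNorm≢0 {α₁} {α₂} indep
      ν-det = signedNorm-det α₁ α₂
      μ = recip ν
      open StableLattice α₁ α₂ s t s′ t′ ν ν≢0 ν-det θα₁ θα₂
      swap′ : ∀ a m b → a ⊗ (m ⊗ b) ≡ m ⊗ (b ⊗ a)
      swap′ = solve 3 (λ a m b → a :* (m :* b) := m :* (b :* a)) refl
      divide : ∀ q → fromℚ μ ⊗ fromℚ (q * ν) ≡ fromℚ q
      divide q = trans (sym (fromℚ-* μ (q * ν))) (cong fromℚ (begin
        μ * (q * ν) ≡⟨ shuffle μ q ν ⟩
        ν * μ * q ≡⟨ cong (_* q) (recip-inverse ν≢0) ⟩
        1ℚ * q ≡⟨ ℚ.*-identityˡ q ⟩
        q ∎))
        where
        shuffle : ∀ μ q ν → μ * (q * ν) ≡ ν * μ * q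
        shuffle = solve-∀ ℚ-ring
      cancel : ∀ x → fromℚ μ ⊗ (fromℚ ν ⊗ x) ≡ x
      cancel x = begin
        fromℚ μ ⊗ (fromℚ ν ⊗ x) ≡⟨ assoc (fromℚ μ) (fromℚ ν) x ⟩
        fromℚ ν ⊗ fromℚ μ ⊗ x ≡⟨ cong (_⊗ x) (fromℚ-* ν μ) ⟨
        fromℚ (ν * μ) ⊗ x ≡⟨ cong (λ q → fromℚ q ⊗ x) (recip-inverse ν≢0) ⟩
        one ⊗ x ≡⟨ ⊗-identityˡ x ⟩
        x ∎
        where
        assoc : ∀ m n x → m ⊗ (n ⊗ x) ≡ n ⊗ m ⊗ x
        assoc = solve 3 (λ m n x → m :* (n :* x) := n :* m :* x) refl
      α₁⊗τα₂ : α₁ ⊗ τ α₂ ≡ fromℚ ν ⊗ (fromℤ (ℤ.- s) ⊕ τ θ)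
      α₁⊗τα₂ = begin
        α₁ ⊗ τ α₂ ≡⟨ cong (_⊗ τ α₂) (τ-involutive α₁) ⟨
        τ (τ α₁) ⊗ τ α₂ ≡⟨ τ-⊗ (τ α₁) α₂ ⟨
        τ (τ α₁ ⊗ α₂) ≡⟨ cong τ τα₁⊗α₂ ⟩
        τ (fromℚ ν ⊗ (fromℤ (ℤ.- s) ⊕ θ)) ≡⟨ τ-⊗ (fromℚ ν) (fromℤ (ℤ.- s) ⊕ θ) ⟩
        fromℚ ν ⊗ τ (fromℤ (ℤ.- s) ⊕ θ) ≡⟨ cong (fromℚ ν ⊗_) (τ-⊕ (fromℤ (ℤ.- s)) θ) ⟩
        fromℚ ν ⊗ (fromℤ (ℤ.- s) ⊕ τ θ) ∎
      coprime = coefficients-coprime {α₁} {α₂} {ℤ.- s} {t} {ℤ.- t′} stabilizer⊆O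
        (trans θα₁ (cong (λ i → fromℤ i ⊗ α₁ ⊕ fromℤ t ⊗ α₂) (sym (ℤ.neg-involutive s))))
        (trans θα₂ (cong₂ (λ i j → fromℤ i ⊗ α₂ ⊕ fromℤ j ⊗ α₁)
          trace-relation (sym (ℤ.neg-involutive t′))))

  opaque
    ideal⇒normForm : ∀ α₁ α₂ → IsIdeal c α₁ α₂ → Invertible c α₁ α₂ → NormForm α₁ α₂
    ideal⇒normForm α₁ α₂ ideal@(indep , _) (γ₁ , γ₂ , _ , inverse) =
     let s , t , θα₁ = span-elim α₁ α₂ (θ ⊗ α₁) (stable θ α₁ θ∈order (α₁∈span α₁ α₂))
         t′ , s′ , θα₂ = span-elim α₁ α₂ (θ ⊗ α₂) (stable θ α₂ θ∈order (α₂∈span α₁ α₂))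
     in normForm-products α₁ α₂ s t s′ t′ θα₁ (trans θα₂ (⊕-comm (fromℤ t′ ⊗ α₁) (fromℤ s′ ⊗ α₂))) indep
          (stabilizer⊆order α₁ α₂ γ₁ γ₂ inverse)
     where
     stable : Stable α₁ α₂
     stable = ideal⇒stable ideal

  -- Inverse ideals

  •-isSubgroup : ∀ ρ {A : Sub} → IsSubgroup A → IsSubgroup (ρ • A)
  •-isSubgroup ρ A-subgroup = record
    { 0-closed = fromℚ 0ℚ , 0-closed A-subgroup , solve 1 (λ r → r :* con (+ 0) := con (+ 0)) refl ρ
    ; ⊕-closed = λ { x y (x′ , x′∈ , eq) (y′ , y′∈ , eq′) → x′ ⊕ y′ , ⊕-closed A-subgroup x′ y′ x′∈ y′∈ ,
        trans (solve 3 (λ r x y → r :* (x :+ y) := r :* x :+ r :* y) refl ρ x′ y′) (cong₂ _⊕_ eq eq′) }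
    ; neg-closed = λ { x (x′ , x′∈ , eq) → neg x′ , neg-closed A-subgroup x′ x′∈ ,
        trans (solve 2 (λ r x → r :* (:- x) := :- (r :* x)) refl ρ x′) (cong neg eq) } }

  -- Having imaginary part in ℤd, packaged as a predicate on `K` so that it propagates from
  -- generators like membership in a lattice.
  record ImMultiple (d : ℚ) (z : K) : Set where
    constructor imMultiple
    field
      multiplier : ℤ
      im≡        : im z ≡ toℚ multiplier * d

  imMultiple-isSubgroup : ∀ d → IsSubgroup (ImMultiple d)
  imMultiple-isSubgroup d = record
    { 0-closed = imMultiple (+ 0) (sym (ℚ.*-zeroˡ d))
    ; ⊕-closed = λ { x y (imMultiple m eq) (imMultiple n eq′) → imMultiple (m ℤ.+ n)
        (trans (cong₂ _+_ eq eq′) (trans (sym (ℚ.*-distribʳ-+ d (toℚ m) (toℚ n))) (cong (_* d) (sym (toℚ-+ m n))))) }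
    ; neg-closed = λ { x (imMultiple m eq) → imMultiple (ℤ.- m)
        (trans (cong -_ eq) (trans (ℚ.neg-distribˡ-* (toℚ m) d) (cong (_* d) (sym (toℚ-neg m))))) } }

  module _ {α₁ α₂ : K} (F : NormForm α₁ α₂) where
    open NormForm F

    private
      span-α span-ᾱ : Sub
      span-α = span α₁ α₂
      span-ᾱ = span ᾱ₁ ᾱ₂

      ᾱ-subgroup : IsSubgroup span-ᾱ
      ᾱ-subgroup = span-isSubgroup ᾱ₁ ᾱ₂

    conjugate∈dual : ∀ x → span-α x → span-ᾱ (fromℚ μ ⊗ τ x)
    conjugate∈dual = span-⊆ (τ-preimage (⊗ˡ-preimage ᾱ-subgroup (fromℚ μ))) {α₁} {α₂}
      (α₁∈span ᾱ₁ ᾱ₂) (α₂∈span ᾱ₁ ᾱ₂)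

    conjugate-dual : ∀ y → span-ᾱ y → (fromℚ μ • span-α) (τ y)
    conjugate-dual = span-⊆ (τ-preimage (•-isSubgroup (fromℚ μ) (span-isSubgroup α₁ α₂))) {ᾱ₁} {ᾱ₂}
      (α₁ , α₁∈span α₁ α₂ , conjugate-twice α₁) (α₂ , α₂∈span α₁ α₂ , conjugate-twice α₂)
      where
      conjugate-twice : ∀ α → fromℚ μ ⊗ α ≡ τ (fromℚ μ ⊗ τ α)
      conjugate-twice α = sym (trans (τ-⊗ (fromℚ μ) (τ α)) (cong (fromℚ μ ⊗_) (τ-involutive α)))

    product∈order : ∀ x y → span-α x → span-ᾱ y → O (x ⊗ y)
    product∈order x y x∈ y∈ = span-⊆ (⊗ʳ-preimage order-subgroup y) {α₁} {α₂}
      (span-⊆ (⊗ˡ-preimage order-subgroup α₁) {ᾱ₁} {ᾱ₂}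
        (subst O (sym α₁ᾱ₁) (ℤ∈order f₀))
        (subst O (sym α₁ᾱ₂) (⊕-closed order-subgroup (fromℤ h) (τ θ) (ℤ∈order h) τθ∈order)) y y∈)
      (span-⊆ (⊗ˡ-preimage order-subgroup α₂) {ᾱ₁} {ᾱ₂}
        (subst O (sym α₂ᾱ₁) (⊕-closed order-subgroup (fromℤ h) θ (ℤ∈order h) θ∈order))
        (subst O (sym α₂ᾱ₂) (ℤ∈order f₂)) y y∈)
      x x∈

    dual-trace : (α₁ ⊗ ᾱ₂) ⊕ (α₂ ⊗ ᾱ₁) ≡ fromℤ (+ 2 ℤ.* h ℤ.+ p)
    dual-trace = begin
      (α₁ ⊗ ᾱ₂) ⊕ (α₂ ⊗ ᾱ₁) ≡⟨ cong₂ _⊕_ α₁ᾱ₂ α₂ᾱ₁ ⟩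
      (fromℤ h ⊕ τ θ) ⊕ (fromℤ h ⊕ θ) ≡⟨ cong (λ x → (fromℤ h ⊕ x) ⊕ (fromℤ h ⊕ θ)) θ-conjugate ⟩
      (fromℤ h ⊕ (fromℤ p ⊖ θ)) ⊕ (fromℤ h ⊕ θ) ≡⟨ collect (fromℤ h) (fromℤ p) θ ⟩
      fromℤ (+ 2) ⊗ fromℤ h ⊕ fromℤ p ≡⟨ cong (_⊕ fromℤ p) (fromℤ-* (+ 2) h) ⟨
      fromℤ (+ 2 ℤ.* h) ⊕ fromℤ p ≡⟨ fromℤ-+ (+ 2 ℤ.* h) p ⟨
      fromℤ (+ 2 ℤ.* h ℤ.+ p) ∎
      where
      collect : ∀ h p t → (h ⊕ (p ⊖ t)) ⊕ (h ⊕ t) ≡ fromℤ (+ 2) ⊗ h ⊕ p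
      collect = solve 3 (λ h p t → (h :+ (p :- t)) :+ (h :+ t) := con (+ 2) :* h :+ p) refl

    dual-combination : fromℤ u₀ ⊗ (α₁ ⊗ ᾱ₁) ⊕ fromℤ u₁ ⊗ ((α₁ ⊗ ᾱ₂) ⊕ (α₂ ⊗ ᾱ₁)) ⊕ fromℤ u₂ ⊗ (α₂ ⊗ ᾱ₂) ≡ one
    dual-combination = begin
      fromℤ u₀ ⊗ (α₁ ⊗ ᾱ₁) ⊕ fromℤ u₁ ⊗ ((α₁ ⊗ ᾱ₂) ⊕ (α₂ ⊗ ᾱ₁)) ⊕ fromℤ u₂ ⊗ (α₂ ⊗ ᾱ₂)
        ≡⟨ cong (λ x → fromℤ u₀ ⊗ (α₁ ⊗ ᾱ₁) ⊕ fromℤ u₁ ⊗ x ⊕ fromℤ u₂ ⊗ (α₂ ⊗ ᾱ₂)) dual-trace ⟩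
      fromℤ u₀ ⊗ (α₁ ⊗ ᾱ₁) ⊕ fromℤ u₁ ⊗ fromℤ f₁ ⊕ fromℤ u₂ ⊗ (α₂ ⊗ ᾱ₂)
        ≡⟨ cong₂ (λ x y → fromℤ u₀ ⊗ x ⊕ fromℤ u₁ ⊗ fromℤ f₁ ⊕ fromℤ u₂ ⊗ y) α₁ᾱ₁ α₂ᾱ₂ ⟩
      fromℤ u₀ ⊗ fromℤ f₀ ⊕ fromℤ u₁ ⊗ fromℤ f₁ ⊕ fromℤ u₂ ⊗ fromℤ f₂
        ≡⟨ cong₂ _⊕_ (fromℤ-sum-of-products u₀ f₀ u₁ f₁) (fromℤ-* u₂ f₂) ⟨
      fromℤ (u₀ ℤ.* f₀ ℤ.+ u₁ ℤ.* f₁) ⊕ fromℤ (u₂ ℤ.* f₂)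
        ≡⟨ fromℤ-+ (u₀ ℤ.* f₀ ℤ.+ u₁ ℤ.* f₁) (u₂ ℤ.* f₂) ⟨
      fromℤ (u₀ ℤ.* f₀ ℤ.+ u₁ ℤ.* f₁ ℤ.+ u₂ ℤ.* f₂)
        ≡⟨ cong fromℤ coprime ⟩
      one ∎
      where
      f₁ = + 2 ℤ.* h ℤ.+ p

    -- Replaces cancellation, as ᾱ₁ and ᾱ₂ may both be zero divisors: in z = z·1 the factor 1 is a
    -- combination of ᾱ₁ and ᾱ₂ by `dual-combination`.
    dual-vanish : ∀ z → z ⊗ ᾱ₁ ≡ fromℚ 0ℚ → z ⊗ ᾱ₂ ≡ fromℚ 0ℚ → z ≡ fromℚ 0ℚ
    dual-vanish z zᾱ₁≡0 zᾱ₂≡0 = begin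
      z ≡⟨ ⊗-identityʳ z ⟨
      z ⊗ one ≡⟨ cong (z ⊗_) dual-combination ⟨
      z ⊗ (fromℤ u₀ ⊗ (α₁ ⊗ ᾱ₁) ⊕ fromℤ u₁ ⊗ ((α₁ ⊗ ᾱ₂) ⊕ (α₂ ⊗ ᾱ₁)) ⊕ fromℤ u₂ ⊗ (α₂ ⊗ ᾱ₂))
        ≡⟨ regroup z (fromℤ u₀) (fromℤ u₁) (fromℤ u₂) α₁ α₂ ᾱ₁ ᾱ₂ ⟩
      (fromℤ u₀ ⊗ α₁ ⊕ fromℤ u₁ ⊗ α₂) ⊗ (z ⊗ ᾱ₁) ⊕ (fromℤ u₁ ⊗ α₁ ⊕ fromℤ u₂ ⊗ α₂) ⊗ (z ⊗ ᾱ₂)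
        ≡⟨ cong₂ (λ x y → (fromℤ u₀ ⊗ α₁ ⊕ fromℤ u₁ ⊗ α₂) ⊗ x ⊕ (fromℤ u₁ ⊗ α₁ ⊕ fromℤ u₂ ⊗ α₂) ⊗ y) zᾱ₁≡0 zᾱ₂≡0 ⟩
      (fromℤ u₀ ⊗ α₁ ⊕ fromℤ u₁ ⊗ α₂) ⊗ fromℚ 0ℚ ⊕ (fromℤ u₁ ⊗ α₁ ⊕ fromℤ u₂ ⊗ α₂) ⊗ fromℚ 0ℚ
        ≡⟨ solve 2 (λ x y → x :* con (+ 0) :+ y :* con (+ 0) := con (+ 0)) refl (fromℤ u₀ ⊗ α₁ ⊕ fromℤ u₁ ⊗ α₂) (fromℤ u₁ ⊗ α₁ ⊕ fromℤ u₂ ⊗ α₂) ⟩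
      fromℚ 0ℚ ∎
      where
      regroup : ∀ z u₀ u₁ u₂ a b a′ b′ → z ⊗ (u₀ ⊗ (a ⊗ a′) ⊕ u₁ ⊗ ((a ⊗ b′) ⊕ (b ⊗ a′)) ⊕ u₂ ⊗ (b ⊗ b′))
        ≡ (u₀ ⊗ a ⊕ u₁ ⊗ b) ⊗ (z ⊗ a′) ⊕ (u₁ ⊗ a ⊕ u₂ ⊗ b) ⊗ (z ⊗ b′)
      regroup = solve 8 (λ z u₀ u₁ u₂ a b a′ b′ → z :* (u₀ :* (a :* a′) :+ u₁ :* ((a :* b′) :+ (b :* a′)) :+ u₂ :* (b :* b′))
        := (u₀ :* a :+ u₁ :* b) :* (z :* a′) :+ (u₁ :* a :+ u₂ :* b) :* (z :* b′)) refl

    -- An induction principle for O: the element 1 is given by `dual-combination`, and θ = α₂ᾱ₁ - h.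
    order⊆product : ∀ {P} → IsSubgroup P → (∀ x y → span-α x → span-ᾱ y → P (x ⊗ y)) → ∀ o → O o → P o
    order⊆product {P} P-subgroup products = span-⊆ P-subgroup {one} {θ} P-one P-θ
      where
      p₁₁ : P (α₁ ⊗ ᾱ₁)
      p₁₁ = products α₁ ᾱ₁ (α₁∈span α₁ α₂) (α₁∈span ᾱ₁ ᾱ₂)
      p₁₂ : P (α₁ ⊗ ᾱ₂)
      p₁₂ = products α₁ ᾱ₂ (α₁∈span α₁ α₂) (α₂∈span ᾱ₁ ᾱ₂)
      p₂₁ : P (α₂ ⊗ ᾱ₁)
      p₂₁ = products α₂ ᾱ₁ (α₂∈span α₁ α₂) (α₁∈span ᾱ₁ ᾱ₂)
      p₂₂ : P (α₂ ⊗ ᾱ₂)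
      p₂₂ = products α₂ ᾱ₂ (α₂∈span α₁ α₂) (α₂∈span ᾱ₁ ᾱ₂)
      P-one : P one
      P-one = subst P dual-combination
        (⊕-closed P-subgroup (fromℤ u₀ ⊗ (α₁ ⊗ ᾱ₁) ⊕ fromℤ u₁ ⊗ ((α₁ ⊗ ᾱ₂) ⊕ (α₂ ⊗ ᾱ₁))) (fromℤ u₂ ⊗ (α₂ ⊗ ᾱ₂))
          (⊕-closed P-subgroup (fromℤ u₀ ⊗ (α₁ ⊗ ᾱ₁)) (fromℤ u₁ ⊗ ((α₁ ⊗ ᾱ₂) ⊕ (α₂ ⊗ ᾱ₁)))
            (ℤ-closed P-subgroup u₀ (α₁ ⊗ ᾱ₁) p₁₁)
            (ℤ-closed P-subgroup u₁ ((α₁ ⊗ ᾱ₂) ⊕ (α₂ ⊗ ᾱ₁)) (⊕-closed P-subgroup (α₁ ⊗ ᾱ₂) (α₂ ⊗ ᾱ₁) p₁₂ p₂₁)))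
          (ℤ-closed P-subgroup u₂ (α₂ ⊗ ᾱ₂) p₂₂))
      P-θ : P θ
      P-θ = subst P (trans (cong (λ x → x ⊖ fromℤ h ⊗ one) α₂ᾱ₁)
          (solve 2 (λ h t → (h :+ t) :- h :* con (+ 1) := t) refl (fromℤ h) θ))
        (⊖-closed P-subgroup (α₂ ⊗ ᾱ₁) (fromℤ h ⊗ one) p₂₁ (ℤ-closed P-subgroup h one P-one))

    -- On μτ(α), multiplication by θ is multiplication by p minus the conjugate of the action of θ
    -- on α, because θ = p - τ(θ).
    dual-stable : Stable α₁ α₂ → Stable ᾱ₁ ᾱ₂
    dual-stable stable = stable-intro ᾱ₁ ᾱ₂ (θᾱ∈ α₁ (α₁∈span α₁ α₂)) (θᾱ∈ α₂ (α₂∈span α₁ α₂))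
      where
      θᾱ∈ : ∀ α → span-α α → span-ᾱ (θ ⊗ (fromℚ μ ⊗ τ α))
      θᾱ∈ α α∈ = subst span-ᾱ (sym (begin
          θ ⊗ (fromℚ μ ⊗ τ α) ≡⟨ reflect θ (fromℤ p) (fromℚ μ) (τ α) ⟩
          fromℤ p ⊗ (fromℚ μ ⊗ τ α) ⊖ fromℚ μ ⊗ ((fromℤ p ⊖ θ) ⊗ τ α) ≡⟨ cong (λ x → fromℤ p ⊗ (fromℚ μ ⊗ τ α) ⊖ fromℚ μ ⊗ (x ⊗ τ α)) θ-conjugate ⟨
          fromℤ p ⊗ (fromℚ μ ⊗ τ α) ⊖ fromℚ μ ⊗ (τ θ ⊗ τ α) ≡⟨ cong (λ x → fromℤ p ⊗ (fromℚ μ ⊗ τ α) ⊖ fromℚ μ ⊗ x) (τ-⊗ θ α) ⟨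
          fromℤ p ⊗ (fromℚ μ ⊗ τ α) ⊖ fromℚ μ ⊗ τ (θ ⊗ α) ∎))
        (⊖-closed ᾱ-subgroup (fromℤ p ⊗ (fromℚ μ ⊗ τ α)) (fromℚ μ ⊗ τ (θ ⊗ α))
          (ℤ-closed ᾱ-subgroup p (fromℚ μ ⊗ τ α) (conjugate∈dual α α∈))
          (conjugate∈dual (θ ⊗ α) (stable θ α θ∈order α∈)))
        where
        reflect : ∀ t p m a → t ⊗ (m ⊗ a) ≡ p ⊗ (m ⊗ a) ⊖ m ⊗ ((p ⊖ t) ⊗ a)
        reflect = solve 4 (λ t p m a → t :* (m :* a) := p :* (m :* a) :- m :* ((p :- t) :* a)) refl

    ν≢0 : ν ≢ 0ℚ
    ν≢0 ν≡0 = <⇒≢0 {1ℚ} (ℚ.*<* (ℤ.+<+ (s≤s z≤n))) (trans (sym ν*μ≡1) (trans (cong (_* μ) ν≡0) (ℚ.*-zeroˡ μ)))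

    μ≢0 : μ ≢ 0ℚ
    μ≢0 μ≡0 = <⇒≢0 {1ℚ} (ℚ.*<* (ℤ.+<+ (s≤s z≤n))) (trans (sym ν*μ≡1) (trans (cong (ν *_) μ≡0) (ℚ.*-zeroʳ ν)))

    independent : Indep α₁ α₂
    independent det≡0 = *-≢0 ν≢0 ½C≢0 (trans ν-det det≡0)

    dual-independent : Indep ᾱ₁ ᾱ₂
    dual-independent det≡0 = *-≢0 (*-≢0 μ≢0 μ≢0) independent (begin
      μ * μ * det α₁ α₂ ≡⟨ lemma μ (re α₁) (im α₁) (re α₂) (im α₂) ⟩
      - det (scale μ (τ α₁)) (scale μ (τ α₂)) ≡⟨ cong₂ (λ x y → - det x y) (scale≡⊗ μ (τ α₁)) (scale≡⊗ μ (τ α₂)) ⟩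
      - det ᾱ₁ ᾱ₂ ≡⟨ cong -_ det≡0 ⟩
      0ℚ ∎)
      where
      lemma : ∀ m a b c d → m * m * (a * d - b * c) ≡ - ((m * a) * (m * - d) - (m * - b) * (m * c))
      lemma = solve-∀ ℚ-ring

    dual-isInverse : Stable α₁ α₂ → IsInverse c α₁ α₂ ᾱ₁ ᾱ₂
    dual-isInverse stable =
      (dual-independent , λ o x o∈ x∈ → dual-stable stable o x (≐⇒⊇ O≐Order o o∈) x∈) ,
      ≐-trans (≐-intro (product-⊆ α₁ α₂ ᾱ₁ ᾱ₂ order-subgroup product∈order)
        (order⊆product (Gen-isSubgroup ((α₁ ∷ α₂ ∷ []) ·g (ᾱ₁ ∷ ᾱ₂ ∷ []))) (product-intro α₁ α₂ ᾱ₁ ᾱ₂))) O≐Order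

    -- Uniqueness of inverses: y = 1·y, with 1 a sum of products x·x̄, and (x·x̄)y = (xy)x̄ with xy
    -- in O; the other inclusion is symmetric. `NormCond` supplies an inverse of its own, and this
    -- allows it to be evaluated with the ᾱᵢ.
    inverse≐dual : Stable α₁ α₂ → ∀ γ₁ γ₂ → IsInverse c α₁ α₂ γ₁ γ₂ → span γ₁ γ₂ ≐ span-ᾱ
    inverse≐dual stable γ₁ γ₂ (γ-ideal , inverse) = ≐-intro γ⊆ᾱ ᾱ⊆γ
      where
      rotate : ∀ x y z → (x ⊗ y) ⊗ z ≡ (x ⊗ z) ⊗ y
      rotate = solve 3 (λ x y z → (x :* y) :* z := (x :* z) :* y) refl
      γ⊆ᾱ : ∀ y → span γ₁ γ₂ y → span-ᾱ y
      γ⊆ᾱ y y∈ = subst span-ᾱ (⊗-identityˡ y) (order⊆product (⊗ʳ-preimage ᾱ-subgroup y)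
        (λ x x̄ x∈ x̄∈ → subst span-ᾱ (rotate x y x̄) (dual-stable stable (x ⊗ y) x̄
          (≐⇒⊇ O≐Order (x ⊗ y) (≐⇒⊆ inverse (x ⊗ y) (product-intro α₁ α₂ γ₁ γ₂ x y x∈ y∈))) x̄∈))
        one 1∈order)
      ᾱ⊆γ : ∀ x̄ → span-ᾱ x̄ → span γ₁ γ₂ x̄
      ᾱ⊆γ x̄ x̄∈ = subst (span γ₁ γ₂) (⊗-identityˡ x̄) (product-⊆ α₁ α₂ γ₁ γ₂
        (⊗ʳ-preimage (span-isSubgroup γ₁ γ₂) x̄)
        (λ x y x∈ y∈ → subst (span γ₁ γ₂) (rotate x x̄ y)
          (ideal⇒stable {γ₁} {γ₂} γ-ideal (x ⊗ x̄) y (product∈order x x̄ x∈ x̄∈) y∈))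
        one (≐⇒⊇ inverse one (≐⇒⊆ O≐Order one 1∈order)))

  -- The norm of β𝔞⁻³

  scaledCube-cong : ∀ β γ₁ γ₂ ε₁ ε₂ → span γ₁ γ₂ ≐ span ε₁ ε₂ →
    Gen (map (β ⊗_) (cubeGens γ₁ γ₂)) ≐ Gen (map (β ⊗_) (cubeGens ε₁ ε₂))
  scaledCube-cong β γ₁ γ₂ ε₁ ε₂ γ≐ε = ≐-intro
    (scaledCube-⊆ γ₁ γ₂ β (Gen-isSubgroup (map (β ⊗_) (cubeGens ε₁ ε₂)))
      (λ x y z x∈ y∈ z∈ → scaledCube-intro ε₁ ε₂ β x y z (≐⇒⊆ γ≐ε x x∈) (≐⇒⊆ γ≐ε y y∈) (≐⇒⊆ γ≐ε z z∈)))
    (scaledCube-⊆ ε₁ ε₂ β (Gen-isSubgroup (map (β ⊗_) (cubeGens γ₁ γ₂)))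
      (λ x y z x∈ y∈ z∈ → scaledCube-intro γ₁ γ₂ β x y z (≐⇒⊇ γ≐ε x x∈) (≐⇒⊇ γ≐ε y y∈) (≐⇒⊇ γ≐ε z z∈)))

  𝐍≡ : ∀ δ₁ δ₂ → 𝐍 c δ₁ δ₂ ≡ ℚ.∣ det δ₁ δ₂ ∣ * recip (½ * C)
  𝐍≡ δ₁ δ₂ = cong (λ q → ℚ.∣ det δ₁ δ₂ ∣ * recip q) (begin
    ℚ.∣ det one (ordBasis₂ c) ∣ ≡⟨ cong (λ t → ℚ.∣ det one t ∣) θ≡ordBasis₂ ⟨
    ℚ.∣ det one θ ∣ ≡⟨ cong ℚ.∣_∣ det-1-θ ⟩
    ℚ.∣ ½ * C ∣ ≡⟨ ∣p∣-pos 0<½C ⟩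
    ½ * C ∎)

  -- Λ = β𝔞⁻³ satisfies Λ·τ(Λ) = qO with q = N(β)/ν³; comparing imaginary parts,
  -- ℤ·det(δ₁, δ₂) = ℤ·q·c/2.
  module _ {α₁ α₂ : K} (F : NormForm α₁ α₂) (β δ₁ δ₂ : K)
    (δ≐Λ : span δ₁ δ₂ ≐ Gen (map (β ⊗_) (cubeGens (NormForm.ᾱ₁ F) (NormForm.ᾱ₂ F)))) where
    open NormForm F

    private
      H q d : ℚ
      H = ½ * C
      q = Nm β * (μ * μ * μ)
      d = det δ₁ δ₂

      Λ : Sub
      Λ = Gen (map (β ⊗_) (cubeGens ᾱ₁ ᾱ₂))

      δ₁∈Λ : Λ δ₁
      δ₁∈Λ = ≐⇒⊆ δ≐Λ δ₁ (α₁∈span δ₁ δ₂)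

      δ₂∈Λ : Λ δ₂
      δ₂∈Λ = ≐⇒⊆ δ≐Λ δ₂ (α₂∈span δ₁ δ₂)

      fromℚ-q : β ⊗ τ β ⊗ (fromℚ μ ⊗ fromℚ μ ⊗ fromℚ μ) ≡ fromℚ q
      fromℚ-q = begin
        β ⊗ τ β ⊗ (fromℚ μ ⊗ fromℚ μ ⊗ fromℚ μ) ≡⟨ cong₂ _⊗_ (fromℚ-Nm β) (cong (_⊗ fromℚ μ) (sym (fromℚ-* μ μ))) ⟩
        fromℚ (Nm β) ⊗ (fromℚ (μ * μ) ⊗ fromℚ μ) ≡⟨ cong (fromℚ (Nm β) ⊗_) (fromℚ-* (μ * μ) μ) ⟨
        fromℚ (Nm β) ⊗ fromℚ (μ * μ * μ) ≡⟨ fromℚ-* (Nm β) (μ * μ * μ) ⟨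
        fromℚ q ∎

      qO : Sub
      qO = fromℚ q • O

      qO-subgroup : IsSubgroup qO
      qO-subgroup = •-isSubgroup (fromℚ q) order-subgroup

      τ-triple : ∀ b x y z → τ (b ⊗ (x ⊗ y ⊗ z)) ≡ τ b ⊗ (τ x ⊗ τ y ⊗ τ z)
      τ-triple b x y z = trans (τ-⊗ b (x ⊗ y ⊗ z)) (cong (τ b ⊗_)
        (trans (τ-⊗ (x ⊗ y) z) (cong (_⊗ τ z) (τ-⊗ x y))))

      -- Each conjugate τ(x) is μ times an element of 𝔞. The three factors μ and βτ(β) collect into
      -- q, and what remains is a product of three elements of 𝔞𝔞⁻¹ = O.
      generator-product : ∀ x y z x′ y′ z′ → span ᾱ₁ ᾱ₂ x → span ᾱ₁ ᾱ₂ y → span ᾱ₁ ᾱ₂ z →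
        span ᾱ₁ ᾱ₂ x′ → span ᾱ₁ ᾱ₂ y′ → span ᾱ₁ ᾱ₂ z′ →
        qO (τ (β ⊗ (x ⊗ y ⊗ z)) ⊗ (β ⊗ (x′ ⊗ y′ ⊗ z′)))
      generator-product x y z x′ y′ z′ x∈ y∈ z∈ x′∈ y′∈ z′∈ =
        go (conjugate-dual F x x∈) (conjugate-dual F y y∈) (conjugate-dual F z z∈)
        where
        M = fromℚ μ
        go : (M • span α₁ α₂) (τ x) → (M • span α₁ α₂) (τ y) → (M • span α₁ α₂) (τ z) →
          qO (τ (β ⊗ (x ⊗ y ⊗ z)) ⊗ (β ⊗ (x′ ⊗ y′ ⊗ z′)))
        go (a , a∈ , eqa) (b , b∈ , eqb) (e , e∈ , eqe) =
          (a ⊗ x′) ⊗ (b ⊗ y′) ⊗ (e ⊗ z′) ,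
          order-⊗ ((a ⊗ x′) ⊗ (b ⊗ y′)) (e ⊗ z′)
            (order-⊗ (a ⊗ x′) (b ⊗ y′) (product∈order F a x′ a∈ x′∈) (product∈order F b y′ b∈ y′∈))
            (product∈order F e z′ e∈ z′∈) ,
          (begin
            fromℚ q ⊗ ((a ⊗ x′) ⊗ (b ⊗ y′) ⊗ (e ⊗ z′)) ≡⟨ cong (_⊗ ((a ⊗ x′) ⊗ (b ⊗ y′) ⊗ (e ⊗ z′))) fromℚ-q ⟨
            β ⊗ τ β ⊗ (M ⊗ M ⊗ M) ⊗ ((a ⊗ x′) ⊗ (b ⊗ y′) ⊗ (e ⊗ z′)) ≡⟨ regroup β (τ β) M a b e x′ y′ z′ ⟩
            (τ β ⊗ ((M ⊗ a) ⊗ (M ⊗ b) ⊗ (M ⊗ e))) ⊗ (β ⊗ (x′ ⊗ y′ ⊗ z′)) ≡⟨ cong (λ t → (τ β ⊗ t) ⊗ (β ⊗ (x′ ⊗ y′ ⊗ z′))) (cong₂ _⊗_ (cong₂ _⊗_ eqa eqb) eqe) ⟩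
            (τ β ⊗ (τ x ⊗ τ y ⊗ τ z)) ⊗ (β ⊗ (x′ ⊗ y′ ⊗ z′)) ≡⟨ cong (_⊗ (β ⊗ (x′ ⊗ y′ ⊗ z′))) (τ-triple β x y z) ⟨
            τ (β ⊗ (x ⊗ y ⊗ z)) ⊗ (β ⊗ (x′ ⊗ y′ ⊗ z′)) ∎)
          where
          regroup : ∀ β β′ m a b e x y z → β ⊗ β′ ⊗ (m ⊗ m ⊗ m) ⊗ ((a ⊗ x) ⊗ (b ⊗ y) ⊗ (e ⊗ z))
            ≡ (β′ ⊗ ((m ⊗ a) ⊗ (m ⊗ b) ⊗ (m ⊗ e))) ⊗ (β ⊗ (x ⊗ y ⊗ z))
          regroup = solve 9 (λ β β′ m a b e x y z → β :* β′ :* (m :* m :* m) :* ((a :* x) :* (b :* y) :* (e :* z))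
            := (β′ :* ((m :* a) :* (m :* b) :* (m :* e))) :* (β :* (x :* y :* z))) refl

      Λ-product : ∀ x y → Λ x → Λ y → qO (τ x ⊗ y)
      Λ-product x y x∈ y∈ = scaledCube-⊆ ᾱ₁ ᾱ₂ β (τ-preimage (⊗ʳ-preimage qO-subgroup y))
        (λ u v w u∈ v∈ w∈ → scaledCube-⊆ ᾱ₁ ᾱ₂ β (⊗ˡ-preimage qO-subgroup (τ (β ⊗ (u ⊗ v ⊗ w))))
          (λ u′ v′ w′ u′∈ v′∈ w′∈ → generator-product u v w u′ v′ w′ u∈ v∈ w∈ u′∈ v′∈ w′∈) y y∈)
        x x∈

      d-multiple : ∃[ m ] d ≡ toℚ m * (q * H)
      d-multiple = go (Λ-product δ₁ δ₂ δ₁∈Λ δ₂∈Λ)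
        where
        go : qO (τ δ₁ ⊗ δ₂) → ∃[ m ] d ≡ toℚ m * (q * H)
        go (o , o∈ , eq) = finish (order-im o o∈)
          where
          shuffle : ∀ q m h → q * (m * h) ≡ m * (q * h)
          shuffle = solve-∀ ℚ-ring
          finish : ∃[ m ] im o ≡ toℚ m * H → ∃[ m ] d ≡ toℚ m * (q * H)
          finish (m , im-o) = m , (begin
            d ≡⟨ det≡im δ₁ δ₂ ⟩
            im (τ δ₁ ⊗ δ₂) ≡⟨ cong im eq ⟨
            im (fromℚ q ⊗ o) ≡⟨ im-fromℚ⊗ q o ⟩
            q * im o ≡⟨ cong (q *_) im-o ⟩
            q * (toℚ m * H) ≡⟨ shuffle q (toℚ m) H ⟩
            toℚ m * (q * H) ∎)

      P : Sub
      P = ImMultiple d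

      P-subgroup : IsSubgroup P
      P-subgroup = imMultiple-isSubgroup d

      P-self : ∀ δ → P (τ δ ⊗ δ)
      P-self δ = imMultiple (+ 0) (trans (sym (det≡im δ δ)) (lemma (re δ) (im δ) d))
        where
        lemma : ∀ a b d → a * b - b * a ≡ 0ℚ * d
        lemma = solve-∀ ℚ-ring

      -- (x, y) ↦ im(τ(x)y) is alternating, so on the lattice spanned by δ₁ and δ₂ all its values
      -- are integral multiples of its value d at the basis.
      Λ-imaginary : ∀ x y → Λ x → Λ y → P (τ x ⊗ y)
      Λ-imaginary x y x∈ y∈ = span-⊆ (τ-preimage (⊗ʳ-preimage P-subgroup y)) {δ₁} {δ₂}
        (span-⊆ (⊗ˡ-preimage P-subgroup (τ δ₁)) {δ₁} {δ₂}
          (P-self δ₁) (imMultiple (+ 1) (trans (sym (det≡im δ₁ δ₂)) (sym (ℚ.*-identityˡ d)))) y (≐⇒⊇ δ≐Λ y y∈))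
        (span-⊆ (⊗ˡ-preimage P-subgroup (τ δ₂)) {δ₁} {δ₂}
          (imMultiple (ℤ.- + 1) (trans (sym (det≡im δ₂ δ₁)) (antisymmetric (re δ₁) (im δ₁) (re δ₂) (im δ₂))))
          (P-self δ₂) y (≐⇒⊇ δ≐Λ y y∈))
        x (≐⇒⊇ δ≐Λ x x∈)
        where
        antisymmetric : ∀ a b c d → c * b - d * a ≡ - 1ℚ * (a * d - b * c)
        antisymmetric = solve-∀ ℚ-ring

      -- Three factors are needed because Λ is built from a cube. Each of them is expanded into
      -- products x·x′ of 𝔞 with its inverse; conjugating the x back into the inverse ideal exhibits
      -- both sides as elements of Λ.
      order-imaginary : ∀ o₁ o₂ o₃ → O o₁ → O o₂ → O o₃ → P (fromℚ q ⊗ (o₁ ⊗ o₂ ⊗ o₃))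
      order-imaginary o₁ o₂ o₃ o₁∈ o₂∈ o₃∈ =
        order⊆product F (⊗ʳ-preimage (⊗ʳ-preimage (⊗ˡ-preimage P-subgroup Q) o₃) o₂) (λ x x′ x∈ x′∈ →
        order⊆product F (⊗ˡ-preimage (⊗ʳ-preimage (⊗ˡ-preimage P-subgroup Q) o₃) (x ⊗ x′)) (λ y y′ y∈ y′∈ →
        order⊆product F (⊗ˡ-preimage (⊗ˡ-preimage P-subgroup Q) (x ⊗ x′ ⊗ (y ⊗ y′))) (λ z z′ z∈ z′∈ →
          subst P (conjugate x y z x′ y′ z′)
            (Λ-imaginary (β ⊗ ((M ⊗ τ x) ⊗ (M ⊗ τ y) ⊗ (M ⊗ τ z))) (β ⊗ (x′ ⊗ y′ ⊗ z′))
              (scaledCube-intro ᾱ₁ ᾱ₂ β (M ⊗ τ x) (M ⊗ τ y) (M ⊗ τ z)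
                (conjugate∈dual F x x∈) (conjugate∈dual F y y∈) (conjugate∈dual F z z∈))
              (scaledCube-intro ᾱ₁ ᾱ₂ β x′ y′ z′ x′∈ y′∈ z′∈)))
        o₃ o₃∈) o₂ o₂∈) o₁ o₁∈
        where
        M = fromℚ μ
        Q = fromℚ q
        τ-Mτ : ∀ x → τ (M ⊗ τ x) ≡ M ⊗ x
        τ-Mτ x = trans (τ-⊗ M (τ x)) (cong (M ⊗_) (τ-involutive x))
        conjugate : ∀ x y z x′ y′ z′ →
          τ (β ⊗ ((M ⊗ τ x) ⊗ (M ⊗ τ y) ⊗ (M ⊗ τ z))) ⊗ (β ⊗ (x′ ⊗ y′ ⊗ z′)) ≡ Q ⊗ (x ⊗ x′ ⊗ (y ⊗ y′) ⊗ (z ⊗ z′))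
        conjugate x y z x′ y′ z′ = begin
          τ (β ⊗ ((M ⊗ τ x) ⊗ (M ⊗ τ y) ⊗ (M ⊗ τ z))) ⊗ (β ⊗ (x′ ⊗ y′ ⊗ z′))
            ≡⟨ cong (_⊗ (β ⊗ (x′ ⊗ y′ ⊗ z′))) (τ-triple β (M ⊗ τ x) (M ⊗ τ y) (M ⊗ τ z)) ⟩
          (τ β ⊗ (τ (M ⊗ τ x) ⊗ τ (M ⊗ τ y) ⊗ τ (M ⊗ τ z))) ⊗ (β ⊗ (x′ ⊗ y′ ⊗ z′))
            ≡⟨ cong (λ t → (τ β ⊗ t) ⊗ (β ⊗ (x′ ⊗ y′ ⊗ z′))) (cong₂ _⊗_ (cong₂ _⊗_ (τ-Mτ x) (τ-Mτ y)) (τ-Mτ z)) ⟩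
          (τ β ⊗ ((M ⊗ x) ⊗ (M ⊗ y) ⊗ (M ⊗ z))) ⊗ (β ⊗ (x′ ⊗ y′ ⊗ z′))
            ≡⟨ regroup β (τ β) M x y z x′ y′ z′ ⟩
          β ⊗ τ β ⊗ (M ⊗ M ⊗ M) ⊗ (x ⊗ x′ ⊗ (y ⊗ y′) ⊗ (z ⊗ z′))
            ≡⟨ cong (_⊗ (x ⊗ x′ ⊗ (y ⊗ y′) ⊗ (z ⊗ z′))) fromℚ-q ⟩
          Q ⊗ (x ⊗ x′ ⊗ (y ⊗ y′) ⊗ (z ⊗ z′)) ∎
          where
          regroup : ∀ β β′ m a b e x y z → (β′ ⊗ ((m ⊗ a) ⊗ (m ⊗ b) ⊗ (m ⊗ e))) ⊗ (β ⊗ (x ⊗ y ⊗ z))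
            ≡ β ⊗ β′ ⊗ (m ⊗ m ⊗ m) ⊗ (a ⊗ x ⊗ (b ⊗ y) ⊗ (e ⊗ z))
          regroup = solve 9 (λ β β′ m a b e x y z → (β′ :* ((m :* a) :* (m :* b) :* (m :* e))) :* (β :* (x :* y :* z))
            := β :* β′ :* (m :* m :* m) :* (a :* x :* (b :* y) :* (e :* z))) refl

      qH-multiple : ∃[ m ] q * H ≡ toℚ m * d
      qH-multiple = go (order-imaginary one one θ 1∈order 1∈order θ∈order)
        where
        go : P (fromℚ q ⊗ (one ⊗ one ⊗ θ)) → ∃[ m ] q * H ≡ toℚ m * d
        go (imMultiple m eq) = m , (begin
          q * H ≡⟨ cong (q *_) θ-im ⟨
          q * im θ ≡⟨ im-fromℚ⊗ q θ ⟨
          im (fromℚ q ⊗ θ) ≡⟨ cong im (units (fromℚ q) θ) ⟨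
          im (fromℚ q ⊗ (one ⊗ one ⊗ θ)) ≡⟨ eq ⟩
          toℚ m * d ∎)
          where
          units : ∀ q t → q ⊗ (one ⊗ one ⊗ t) ≡ q ⊗ t
          units = solve 2 (λ q t → q :* (con (+ 1) :* con (+ 1) :* t) := q :* t) refl

    cubeNorm≢0 : Indep δ₁ δ₂ → q ≢ 0ℚ
    cubeNorm≢0 d≢0 q≡0 = go d-multiple
      where
      lemma : ∀ m h → m * (0ℚ * h) ≡ 0ℚ
      lemma = solve-∀ ℚ-ring
      go : ¬ (∃[ m ] d ≡ toℚ m * (q * H))
      go (m , eq) = d≢0 (trans eq (trans (cong (λ x → toℚ m * (x * H)) q≡0) (lemma (toℚ m) H)))

    cube-independent : q ≢ 0ℚ → Indep δ₁ δ₂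
    cube-independent q≢0 d≡0 = go qH-multiple
      where
      go : ¬ (∃[ m ] q * H ≡ toℚ m * d)
      go (m , eq) = *-≢0 q≢0 ½C≢0 (trans eq (trans (cong (toℚ m *_) d≡0) (ℚ.*-zeroʳ (toℚ m))))

    -- d and q·c/2 are integral multiples of one another, hence equal up to a sign, which the
    -- absolute value in `𝐍` removes.
    cubeNorm : q ≢ 0ℚ → 𝐍 c δ₁ δ₂ ≡ ℚ.∣ q ∣
    cubeNorm q≢0 = go d-multiple qH-multiple
      where
      go : ∃[ m ] d ≡ toℚ m * (q * H) → ∃[ m ] q * H ≡ toℚ m * d → 𝐍 c δ₁ δ₂ ≡ ℚ.∣ q ∣
      go (m , d≡) (m′ , qH≡) = begin
        𝐍 c δ₁ δ₂ ≡⟨ 𝐍≡ δ₁ δ₂ ⟩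
        ℚ.∣ d ∣ * recip H ≡⟨ cong (_* recip H) (∣d∣≡ (abs≡1⇒±1 m (unit-abs m m′ mm′≡1))) ⟩
        ℚ.∣ q * H ∣ * recip H ≡⟨ cong (_* recip H) (ℚ.∣p*q∣≡∣p∣*∣q∣ q H) ⟩
        ℚ.∣ q ∣ * ℚ.∣ H ∣ * recip H ≡⟨ cong (λ x → ℚ.∣ q ∣ * x * recip H) (∣p∣-pos 0<½C) ⟩
        ℚ.∣ q ∣ * H * recip H ≡⟨ ℚ.*-assoc ℚ.∣ q ∣ H (recip H) ⟩
        ℚ.∣ q ∣ * (H * recip H) ≡⟨ cong (ℚ.∣ q ∣ *_) (recip-inverse ½C≢0) ⟩
        ℚ.∣ q ∣ * 1ℚ ≡⟨ ℚ.*-identityʳ ℚ.∣ q ∣ ⟩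
        ℚ.∣ q ∣ ∎
        where
        mm′≡1 : m ℤ.* m′ ≡ + 1
        mm′≡1 = toℚ-injective (*-cancelˡ (*-≢0 q≢0 ½C≢0) (begin
          q * H * toℚ (m ℤ.* m′) ≡⟨ cong (q * H *_) (toℚ-* m m′) ⟩
          q * H * (toℚ m * toℚ m′) ≡⟨ shuffle (q * H) (toℚ m) (toℚ m′) ⟩
          toℚ m′ * (toℚ m * (q * H)) ≡⟨ cong (toℚ m′ *_) d≡ ⟨
          toℚ m′ * d ≡⟨ qH≡ ⟨
          q * H ≡⟨ ℚ.*-identityʳ (q * H) ⟨
          q * H * 1ℚ ∎))
          where
          shuffle : ∀ x m n → x * (m * n) ≡ n * (m * x)
          shuffle = solve-∀ ℚ-ring
        ∣d∣≡ : m ≡ + 1 ⊎ m ≡ ℤ.- + 1 → ℚ.∣ d ∣ ≡ ℚ.∣ q * H ∣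
        ∣d∣≡ (inj₁ m≡1) = cong ℚ.∣_∣ (trans d≡ (trans (cong (λ i → toℚ i * (q * H)) m≡1) (ℚ.*-identityˡ (q * H))))
        ∣d∣≡ (inj₂ m≡-1) = trans (cong ℚ.∣_∣ (trans d≡ (trans (cong (λ i → toℚ i * (q * H)) m≡-1) (lemma (q * H)))))
          (ℚ.∣-p∣≡∣p∣ (q * H))
          where
          lemma : ∀ x → - 1ℚ * x ≡ - x
          lemma = solve-∀ ℚ-ring

  -- Cubic forms and their Hessians

  -- The shape of `ΨForm` with the scalar and the conjugated basis as free arguments, so that
  -- substitutions and scaling by ρ become operations on the arguments.
  cubicForm : K → K → K → Form ℚ
  cubicForm g A B = form (Tr (g ⊗ A ⊗ A ⊗ A)) (Tr (g ⊗ fromℤ (+ 3) ⊗ A ⊗ A ⊗ B))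
                         (Tr (g ⊗ fromℤ (+ 3) ⊗ A ⊗ B ⊗ B)) (Tr (g ⊗ B ⊗ B ⊗ B))

  cubicForm-neg : ∀ g A B → cubicForm (neg g) (neg A) (neg B) ≡ cubicForm g A B
  cubicForm-neg g A B = form-≡ (cong Tr (edge g A)) (cong Tr (middle g (fromℤ (+ 3)) A A B))
    (cong Tr (middle g (fromℤ (+ 3)) A B B)) (cong Tr (edge g B))
    where
    edge : ∀ g a → neg g ⊗ neg a ⊗ neg a ⊗ neg a ≡ g ⊗ a ⊗ a ⊗ a
    edge = solve 2 (λ g a → (:- g) :* (:- a) :* (:- a) :* (:- a) := g :* a :* a :* a) refl
    middle : ∀ g t a b c → neg g ⊗ t ⊗ neg a ⊗ neg b ⊗ neg c ≡ g ⊗ t ⊗ a ⊗ b ⊗ c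
    middle = solve 5 (λ g t a b c → (:- g) :* t :* (:- a) :* (:- b) :* (:- c) := g :* t :* a :* b :* c) refl

  inv-inverse : ∀ x → Unit x → x ⊗ inv x ≡ one
  inv-inverse x unit = begin
    x ⊗ scale (recip (Nm x)) (τ x) ≡⟨ cong (x ⊗_) (scale≡⊗ (recip (Nm x)) (τ x)) ⟩
    x ⊗ (fromℚ (recip (Nm x)) ⊗ τ x) ≡⟨ swap x (fromℚ (recip (Nm x))) (τ x) ⟩
    x ⊗ τ x ⊗ fromℚ (recip (Nm x)) ≡⟨ cong (_⊗ fromℚ (recip (Nm x))) (fromℚ-Nm x) ⟩
    fromℚ (Nm x) ⊗ fromℚ (recip (Nm x)) ≡⟨ fromℚ-* (Nm x) (recip (Nm x)) ⟨
    fromℚ (Nm x * recip (Nm x)) ≡⟨ cong fromℚ (recip-inverse unit) ⟩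
    one ∎
    where
    swap : ∀ x r y → x ⊗ (r ⊗ y) ≡ x ⊗ y ⊗ r
    swap = solve 3 (λ x r y → x :* (r :* y) := x :* y :* r) refl

  sqrtΔ-unit : Unit sqrtΔ
  sqrtΔ-unit eq = toℚ-nonzero D≢0 (trans (lemma Dq) (trans (cong -_ eq) refl))
    where
    lemma : ∀ D → D ≡ - (0ℚ * 0ℚ + D * 1ℚ * - 1ℚ)
    lemma = solve-∀ ℚ-ring

  opaque
    S√ : K
    S√ = fromℚ C ⊗ sqrtΔ

    S√≡ : S√ ≡ fromℚ C ⊗ sqrtΔ
    S√≡ = refl

  -- Since C·re x = (c/2)·Tr x, the trace of x is the θ-coordinate of c√Δ·x whenever that product
  -- lies in O.
  im-S√⊗ : ∀ x → im (S√ ⊗ x) ≡ C * re x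
  im-S√⊗ x = trans (cong (λ s → im (s ⊗ x)) S√≡) (lemma C Dq (re x) (im x))
    where
    lemma : ∀ C D r i → (C * 0ℚ + D * 0ℚ * 1ℚ) * i + (C * 1ℚ + 0ℚ * 0ℚ) * r ≡ C * r
    lemma = solve-∀ ℚ-ring

  θ⊖τθ : θ ⊖ τ θ ≡ S√
  θ⊖τθ = trans (K-≡ (real (re θ) C Dq) (trans (cong (λ i → i + - - i) θ-im) (imaginary C))) (sym S√≡)
    where
    real : ∀ r C D → r + - r ≡ C * 0ℚ + D * 0ℚ * 1ℚ
    real = solve-∀ ℚ-ring
    imaginary : ∀ C → ½ * C + - - (½ * C) ≡ C * 1ℚ + 0ℚ * 0ℚ
    imaginary = solve-∀ ℚ-ring

  τ-S√ : τ S√ ≡ neg S√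
  τ-S√ = trans (cong τ S√≡) (trans (τ-⊗ (fromℚ C) sqrtΔ) (trans (lemma (fromℚ C) sqrtΔ) (cong neg (sym S√≡))))
    where
    lemma : ∀ c s → c ⊗ neg s ≡ neg (c ⊗ s)
    lemma = solve 2 (λ c s → c :* (:- s) := :- (c :* s)) refl

  -- The coefficient β/(c√Δ 𝐍³) of ΨForm, with 𝐍 replaced by any rational r.
  opaque
    coefficient : ℚ → K → K
    coefficient r β = scale (recip (toℚ (+ c) * (r * r * r))) (β ⊗ inv sqrtΔ)

    coefficient≡ : ∀ r β → coefficient r β ≡ scale (recip (toℚ (+ c) * (r * r * r))) (β ⊗ inv sqrtΔ)
    coefficient≡ r β = refl

    ΨForm≡cubicForm : ∀ a₁ a₂ β → ΨForm c a₁ a₂ β ≡ cubicForm (coefficient (𝐍 c a₁ a₂) β) (τ a₁) (τ a₂)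
    ΨForm≡cubicForm a₁ a₂ β = refl

  -- From here on the scalar g of a cubic form is handled through the equation c√Δ·g = β·μ³, which
  -- `IsCoefficient` records; r = ν gives it for a basis, and r = -ν for the negated one.
  S√-coefficient : ∀ r r′ β → r * r′ ≡ 1ℚ → S√ ⊗ coefficient r β ≡ β ⊗ (fromℚ r′ ⊗ fromℚ r′ ⊗ fromℚ r′)
  S√-coefficient r r′ β rr′≡1 = begin
    S√ ⊗ coefficient r β ≡⟨ cong₂ _⊗_ S√≡ (trans (coefficient≡ r β) (scale≡⊗ R (β ⊗ inv sqrtΔ))) ⟩
    (fromℚ C ⊗ sqrtΔ) ⊗ (fromℚ R ⊗ (β ⊗ inv sqrtΔ)) ≡⟨ regroup (fromℚ C) sqrtΔ (fromℚ R) β (inv sqrtΔ) ⟩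
    β ⊗ (fromℚ C ⊗ fromℚ R) ⊗ (sqrtΔ ⊗ inv sqrtΔ) ≡⟨ cong (λ x → β ⊗ (fromℚ C ⊗ fromℚ R) ⊗ x) (inv-inverse sqrtΔ sqrtΔ-unit) ⟩
    β ⊗ (fromℚ C ⊗ fromℚ R) ⊗ one ≡⟨ ⊗-identityʳ (β ⊗ (fromℚ C ⊗ fromℚ R)) ⟩
    β ⊗ (fromℚ C ⊗ fromℚ R) ≡⟨ cong (β ⊗_) (fromℚ-* C R) ⟨
    β ⊗ fromℚ (C * R) ≡⟨ cong (λ x → β ⊗ fromℚ x) CR≡ ⟩
    β ⊗ fromℚ (r′ * r′ * r′) ≡⟨ cong (β ⊗_) (trans (fromℚ-* (r′ * r′) r′) (cong (_⊗ fromℚ r′) (fromℚ-* r′ r′))) ⟩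
    β ⊗ (fromℚ r′ ⊗ fromℚ r′ ⊗ fromℚ r′) ∎
    where
    R : ℚ
    R = recip (toℚ (+ c) * (r * r * r))
    regroup : ∀ c s r b i → (c ⊗ s) ⊗ (r ⊗ (b ⊗ i)) ≡ b ⊗ (c ⊗ r) ⊗ (s ⊗ i)
    regroup = solve 5 (λ c s r b i → (c :* s) :* (r :* (b :* i)) := b :* (c :* r) :* (s :* i)) refl
    C≢0 : C ≢ 0ℚ
    C≢0 = <⇒≢0 0<C
    R≡ : R ≡ recip C * (r′ * r′ * r′)
    R≡ = recip-unique {toℚ (+ c) * (r * r * r)} {recip C * (r′ * r′ * r′)} (begin
      toℚ (+ c) * (r * r * r) * (recip C * (r′ * r′ * r′)) ≡⟨ cong (λ x → x * (r * r * r) * (recip C * (r′ * r′ * r′))) C≡toℚ ⟨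
      C * (r * r * r) * (recip C * (r′ * r′ * r′)) ≡⟨ shuffle C r (recip C) r′ ⟩
      C * recip C * ((r * r′) * (r * r′) * (r * r′)) ≡⟨ cong₂ (λ x y → x * (y * y * y)) (recip-inverse C≢0) rr′≡1 ⟩
      1ℚ ∎)
      where
      shuffle : ∀ c r c′ r′ → c * (r * r * r) * (c′ * (r′ * r′ * r′)) ≡ c * c′ * ((r * r′) * (r * r′) * (r * r′))
      shuffle = solve-∀ ℚ-ring
    CR≡ : C * R ≡ r′ * r′ * r′
    CR≡ = begin
      C * R ≡⟨ cong (C *_) R≡ ⟩
      C * (recip C * (r′ * r′ * r′)) ≡⟨ ℚ.*-assoc C (recip C) (r′ * r′ * r′) ⟨
      C * recip C * (r′ * r′ * r′) ≡⟨ cong (_* (r′ * r′ * r′)) (recip-inverse C≢0) ⟩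
      1ℚ * (r′ * r′ * r′) ≡⟨ ℚ.*-identityˡ (r′ * r′ * r′) ⟩
      r′ * r′ * r′ ∎

  Tr-integral : ∀ T → O (S√ ⊗ T) → ∃[ m ] Tr T ≡ toℚ m
  Tr-integral T ST∈O = go (order-im (S√ ⊗ T) ST∈O)
    where
    lemma : ∀ C r → ½ * C * (r + r) ≡ C * r
    lemma = solve-∀ ℚ-ring
    go : ∃[ m ] im (S√ ⊗ T) ≡ toℚ m * (½ * C) → ∃[ m ] Tr T ≡ toℚ m
    go (m , eq) = m , *-cancelˡ ½C≢0 (begin
      ½ * C * (re T + re T) ≡⟨ lemma C (re T) ⟩
      C * re T ≡⟨ im-S√⊗ T ⟨
      im (S√ ⊗ T) ≡⟨ eq ⟩
      toℚ m * (½ * C) ≡⟨ ℚ.*-comm (toℚ m) (½ * C) ⟩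
      ½ * C * toℚ m ∎)

  Tr-fromℤ⊗ : ∀ m x → Tr (fromℤ m ⊗ x) ≡ toℚ m * Tr x
  Tr-fromℤ⊗ m x = trans (cong₂ _+_ (re-fromℚ⊗ (toℚ m) x) (re-fromℚ⊗ (toℚ m) x))
    (sym (ℚ.*-distribˡ-+ (toℚ m) (re x) (re x)))

  -- The traces are taken without the binomial factor 3: their integrality is what puts the form in
  -- L∨ and not merely in L.
  record HasCoefficients (g A B : K) (q₀ q₁ q₂ q₃ : ℤ) : Set where
    constructor hasCoefficients
    field
      Tr₀ : Tr (g ⊗ A ⊗ A ⊗ A) ≡ toℚ q₀
      Tr₁ : Tr (g ⊗ A ⊗ A ⊗ B) ≡ toℚ q₁
      Tr₂ : Tr (g ⊗ A ⊗ B ⊗ B) ≡ toℚ q₂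
      Tr₃ : Tr (g ⊗ B ⊗ B ⊗ B) ≡ toℚ q₃

  cubicForm-coefficients : ∀ {g A B q₀ q₁ q₂ q₃} → HasCoefficients g A B q₀ q₁ q₂ q₃ →
    embed (form q₀ (+ 3 ℤ.* q₁) (+ 3 ℤ.* q₂) q₃) ≡ cubicForm g A B
  cubicForm-coefficients {g} {A} {B} {q₁ = q₁} {q₂} (hasCoefficients t₀ t₁ t₂ t₃) =
    form-≡ (sym t₀) (middle q₁ A A B t₁) (middle q₂ A B B t₂) (sym t₃)
    where
    pull : ∀ g t a b c → g ⊗ t ⊗ a ⊗ b ⊗ c ≡ t ⊗ (g ⊗ a ⊗ b ⊗ c)
    pull = solve 5 (λ g t a b c → g :* t :* a :* b :* c := t :* (g :* a :* b :* c)) refl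
    middle : ∀ q a b c → Tr (g ⊗ a ⊗ b ⊗ c) ≡ toℚ q → toℚ (+ 3 ℤ.* q) ≡ Tr (g ⊗ fromℤ (+ 3) ⊗ a ⊗ b ⊗ c)
    middle q a b c eq = begin
      toℚ (+ 3 ℤ.* q) ≡⟨ toℚ-* (+ 3) q ⟩
      toℚ (+ 3) * toℚ q ≡⟨ cong (toℚ (+ 3) *_) eq ⟨
      toℚ (+ 3) * Tr (g ⊗ a ⊗ b ⊗ c) ≡⟨ Tr-fromℤ⊗ (+ 3) (g ⊗ a ⊗ b ⊗ c) ⟨
      Tr (fromℤ (+ 3) ⊗ (g ⊗ a ⊗ b ⊗ c)) ≡⟨ cong Tr (pull g (fromℤ (+ 3)) a b c) ⟨
      Tr (g ⊗ fromℤ (+ 3) ⊗ a ⊗ b ⊗ c) ∎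

  module _ {α₁ α₂ : K} (F : NormForm α₁ α₂) where
    open NormForm F

    private
      M N : K
      M = fromℚ μ
      N = fromℚ ν

    N⊗M≡1 : fromℚ ν ⊗ fromℚ μ ≡ one
    N⊗M≡1 = trans (sym (fromℚ-* ν μ)) (cong fromℚ ν*μ≡1)

    α⊗τα : ∀ α α′ x → α ⊗ (M ⊗ τ α′) ≡ x → α ⊗ τ α′ ≡ N ⊗ x
    α⊗τα α α′ x eq = begin
      α ⊗ τ α′ ≡⟨ ⊗-identityˡ (α ⊗ τ α′) ⟨
      one ⊗ (α ⊗ τ α′) ≡⟨ cong (_⊗ (α ⊗ τ α′)) N⊗M≡1 ⟨
      N ⊗ M ⊗ (α ⊗ τ α′) ≡⟨ regroup N M α (τ α′) ⟩
      N ⊗ (α ⊗ (M ⊗ τ α′)) ≡⟨ cong (N ⊗_) eq ⟩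
      N ⊗ x ∎
      where
      regroup : ∀ n m a b → n ⊗ m ⊗ (a ⊗ b) ≡ n ⊗ (a ⊗ (m ⊗ b))
      regroup = solve 4 (λ n m a b → n :* m :* (a :* b) := n :* (a :* (m :* b))) refl

    -- The product of α₁, α₂, ᾱ₁, ᾱ₂ grouped in two ways; one of the groupings is the norm of h + θ.
    f₀f₂≡ : f₀ ℤ.* f₂ ≡ h ℤ.* h ℤ.+ h ℤ.* p ℤ.+ e
    f₀f₂≡ = toℚ-injective (cong re (begin
      fromℤ (f₀ ℤ.* f₂) ≡⟨ fromℤ-* f₀ f₂ ⟩
      fromℤ f₀ ⊗ fromℤ f₂ ≡⟨ cong₂ _⊗_ α₁ᾱ₁ α₂ᾱ₂ ⟨
      (α₁ ⊗ ᾱ₁) ⊗ (α₂ ⊗ ᾱ₂) ≡⟨ exchange α₁ ᾱ₁ α₂ ᾱ₂ ⟩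
      (α₂ ⊗ ᾱ₁) ⊗ (α₁ ⊗ ᾱ₂) ≡⟨ cong₂ _⊗_ α₂ᾱ₁ α₁ᾱ₂ ⟩
      (fromℤ h ⊕ θ) ⊗ (fromℤ h ⊕ τ θ) ≡⟨ norm-h+θ h ⟩
      fromℤ (h ℤ.* h ℤ.+ h ℤ.* p ℤ.+ e) ∎))
      where
      exchange : ∀ a b c d → (a ⊗ b) ⊗ (c ⊗ d) ≡ (c ⊗ b) ⊗ (a ⊗ d)
      exchange = solve 4 (λ a b c d → (a :* b) :* (c :* d) := (c :* b) :* (a :* d)) refl

    private
      f₁ : ℤ
      f₁ = + 2 ℤ.* h ℤ.+ p

    -- Completing the square leaves p² - 4e, the discriminant of the minimal polynomial of θ.
    normForm-discriminant : f₁ ℤ.* f₁ ℤ.- + 4 ℤ.* (f₀ ℤ.* f₂) ≡ + c ℤ.* + c ℤ.* D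
    normForm-discriminant = begin
      f₁ ℤ.* f₁ ℤ.- + 4 ℤ.* (f₀ ℤ.* f₂) ≡⟨ cong (λ i → f₁ ℤ.* f₁ ℤ.- + 4 ℤ.* i) f₀f₂≡ ⟩
      f₁ ℤ.* f₁ ℤ.- + 4 ℤ.* (h ℤ.* h ℤ.+ h ℤ.* p ℤ.+ e) ≡⟨ complete h p e ⟩
      p ℤ.* p ℤ.- + 4 ℤ.* e ≡⟨ cong₂ (λ i j → i ℤ.* i ℤ.- + 4 ℤ.* j) p≡cD e≡ccκ ⟩
      (+ c ℤ.* D) ℤ.* (+ c ℤ.* D) ℤ.- + 4 ℤ.* (+ c ℤ.* + c ℤ.* κ) ≡⟨ factor (+ c) D κ ⟩
      + c ℤ.* + c ℤ.* (D ℤ.* D ℤ.- + 4 ℤ.* κ) ≡⟨ cong (λ i → + c ℤ.* + c ℤ.* (D ℤ.* D ℤ.- i)) 4κ≡D²-D ⟩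
      + c ℤ.* + c ℤ.* (D ℤ.* D ℤ.- (D ℤ.* D ℤ.- D)) ≡⟨ cancel (+ c) D ⟩
      + c ℤ.* + c ℤ.* D ∎
      where
      complete : ∀ h p e → (+ 2 ℤ.* h ℤ.+ p) ℤ.* (+ 2 ℤ.* h ℤ.+ p) ℤ.- + 4 ℤ.* (h ℤ.* h ℤ.+ h ℤ.* p ℤ.+ e) ≡ p ℤ.* p ℤ.- + 4 ℤ.* e
      complete = ℤ-Tactic.solve-∀
      factor : ∀ c D k → (c ℤ.* D) ℤ.* (c ℤ.* D) ℤ.- + 4 ℤ.* (c ℤ.* c ℤ.* k) ≡ c ℤ.* c ℤ.* (D ℤ.* D ℤ.- + 4 ℤ.* k)
      factor = ℤ-Tactic.solve-∀
      cancel : ∀ c D → c ℤ.* c ℤ.* (D ℤ.* D ℤ.- (D ℤ.* D ℤ.- D)) ≡ c ℤ.* c ℤ.* D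
      cancel = ℤ-Tactic.solve-∀

    module _ (β g : K) (g-coefficient : S√ ⊗ g ≡ β ⊗ (fromℚ μ ⊗ fromℚ μ ⊗ fromℚ μ)) where

      private
        A B : K
        A = τ α₁
        B = τ α₂

      S√⊗g⊗ : ∀ x y z → S√ ⊗ (g ⊗ τ x ⊗ τ y ⊗ τ z) ≡ β ⊗ ((M ⊗ τ x) ⊗ (M ⊗ τ y) ⊗ (M ⊗ τ z))
      S√⊗g⊗ x y z = begin
        S√ ⊗ (g ⊗ τ x ⊗ τ y ⊗ τ z) ≡⟨ assoc S√ g (τ x) (τ y) (τ z) ⟩
        (S√ ⊗ g) ⊗ (τ x ⊗ τ y ⊗ τ z) ≡⟨ cong (_⊗ (τ x ⊗ τ y ⊗ τ z)) g-coefficient ⟩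
        (β ⊗ (M ⊗ M ⊗ M)) ⊗ (τ x ⊗ τ y ⊗ τ z) ≡⟨ distribute β M (τ x) (τ y) (τ z) ⟩
        β ⊗ ((M ⊗ τ x) ⊗ (M ⊗ τ y) ⊗ (M ⊗ τ z)) ∎
        where
        assoc : ∀ s g x y z → s ⊗ (g ⊗ x ⊗ y ⊗ z) ≡ (s ⊗ g) ⊗ (x ⊗ y ⊗ z)
        assoc = solve 5 (λ s g x y z → s :* (g :* x :* y :* z) := (s :* g) :* (x :* y :* z)) refl
        distribute : ∀ b m x y z → (b ⊗ (m ⊗ m ⊗ m)) ⊗ (x ⊗ y ⊗ z) ≡ b ⊗ ((m ⊗ x) ⊗ (m ⊗ y) ⊗ (m ⊗ z))
        distribute = solve 5 (λ b m x y z → (b :* (m :* m :* m)) :* (x :* y :* z) := b :* ((m :* x) :* (m :* y) :* (m :* z))) refl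

      module _ (β∈cube : InCube α₁ α₂ β) where

        -- β lies in 𝔞³, and three factors from 𝔞⁻¹ bring it into O.
        cube⊗dual³ : ∀ x y z → span ᾱ₁ ᾱ₂ x → span ᾱ₁ ᾱ₂ y → span ᾱ₁ ᾱ₂ z → O (β ⊗ (x ⊗ y ⊗ z))
        cube⊗dual³ x y z x∈ y∈ z∈ = cube-⊆ α₁ α₂ (⊗ʳ-preimage order-subgroup (x ⊗ y ⊗ z))
          (λ u v w u∈ v∈ w∈ → subst O (exchange u v w x y z)
            (order-⊗ ((u ⊗ x) ⊗ (v ⊗ y)) (w ⊗ z) (order-⊗ (u ⊗ x) (v ⊗ y)
              (product∈order F u x u∈ x∈) (product∈order F v y v∈ y∈)) (product∈order F w z w∈ z∈)))
          β β∈cube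
          where
          exchange : ∀ u v w x y z → (u ⊗ x) ⊗ (v ⊗ y) ⊗ (w ⊗ z) ≡ (u ⊗ v ⊗ w) ⊗ (x ⊗ y ⊗ z)
          exchange = solve 6 (λ u v w x y z → (u :* x) :* (v :* y) :* (w :* z) := (u :* v :* w) :* (x :* y :* z)) refl

        private
          integral : ∀ x y z → span α₁ α₂ x → span α₁ α₂ y → span α₁ α₂ z → ∃[ m ] Tr (g ⊗ τ x ⊗ τ y ⊗ τ z) ≡ toℚ m
          integral x y z x∈ y∈ z∈ = Tr-integral (g ⊗ τ x ⊗ τ y ⊗ τ z) (subst O (sym (S√⊗g⊗ x y z))
            (cube⊗dual³ (M ⊗ τ x) (M ⊗ τ y) (M ⊗ τ z) (conjugate∈dual F x x∈) (conjugate∈dual F y y∈) (conjugate∈dual F z z∈)))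

        coefficients : ∃[ q₀ ] ∃[ q₁ ] ∃[ q₂ ] ∃[ q₃ ] HasCoefficients g (τ α₁) (τ α₂) q₀ q₁ q₂ q₃
        coefficients = go (integral α₁ α₁ α₁ a₁ a₁ a₁) (integral α₁ α₁ α₂ a₁ a₁ a₂) (integral α₁ α₂ α₂ a₁ a₂ a₂) (integral α₂ α₂ α₂ a₂ a₂ a₂)
          where
          a₁ = α₁∈span α₁ α₂
          a₂ = α₂∈span α₁ α₂
          go : ∃[ m ] Tr (g ⊗ A ⊗ A ⊗ A) ≡ toℚ m → ∃[ m ] Tr (g ⊗ A ⊗ A ⊗ B) ≡ toℚ m →
            ∃[ m ] Tr (g ⊗ A ⊗ B ⊗ B) ≡ toℚ m → ∃[ m ] Tr (g ⊗ B ⊗ B ⊗ B) ≡ toℚ m →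
            ∃[ q₀ ] ∃[ q₁ ] ∃[ q₂ ] ∃[ q₃ ] HasCoefficients g (τ α₁) (τ α₂) q₀ q₁ q₂ q₃
          go (q₀ , t₀) (q₁ , t₁) (q₂ , t₂) (q₃ , t₃) = q₀ , q₁ , q₂ , q₃ , hasCoefficients t₀ t₁ t₂ t₃

      private
        -- The cubic is gℓ³ + τ(g)ℓ′³ with ℓ = Au + Bv and ℓ′ its conjugate. The Hessian of such a
        -- sum is -g·τ(g)·W²·ℓℓ′, where W is the determinant of the two linear forms; ℓℓ′ is the
        -- norm of α₁u + α₂v.
        W : K
        W = A ⊗ α₂ ⊖ α₁ ⊗ B

        W≡ : W ≡ N ⊗ S√
        W≡ = begin
          τ α₁ ⊗ α₂ ⊖ α₁ ⊗ τ α₂ ≡⟨ cong (_⊖ α₁ ⊗ τ α₂) (⊗-comm (τ α₁) α₂) ⟩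
          α₂ ⊗ τ α₁ ⊖ α₁ ⊗ τ α₂ ≡⟨ cong₂ _⊖_ (α⊗τα α₂ α₁ (fromℤ h ⊕ θ) α₂ᾱ₁) (α⊗τα α₁ α₂ (fromℤ h ⊕ τ θ) α₁ᾱ₂) ⟩
          N ⊗ (fromℤ h ⊕ θ) ⊖ N ⊗ (fromℤ h ⊕ τ θ) ≡⟨ collect N (fromℤ h) θ (τ θ) ⟩
          N ⊗ (θ ⊖ τ θ) ≡⟨ cong (N ⊗_) θ⊖τθ ⟩
          N ⊗ S√ ∎
          where
          collect : ∀ n h t t′ → n ⊗ (h ⊕ t) ⊖ n ⊗ (h ⊕ t′) ≡ n ⊗ (t ⊖ t′)
          collect = solve 4 (λ n h t t′ → n :* (h :+ t) :- n :* (h :+ t′) := n :* (t :- t′)) refl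

        -- The sign comes from τ(c√Δ) = -c√Δ and will cancel the sign in the formula for the
        -- Hessian.
        S√²gg′ : (S√ ⊗ g) ⊗ (S√ ⊗ τ g) ≡ neg (fromℚ (Nm β) ⊗ ((M ⊗ M ⊗ M) ⊗ (M ⊗ M ⊗ M)))
        S√²gg′ = begin
          (S√ ⊗ g) ⊗ (S√ ⊗ τ g) ≡⟨ sign (S√ ⊗ g) S√ (τ g) ⟩
          neg ((S√ ⊗ g) ⊗ (neg S√ ⊗ τ g)) ≡⟨ cong (λ x → neg ((S√ ⊗ g) ⊗ (x ⊗ τ g))) τ-S√ ⟨
          neg ((S√ ⊗ g) ⊗ (τ S√ ⊗ τ g)) ≡⟨ cong (λ x → neg ((S√ ⊗ g) ⊗ x)) (τ-⊗ S√ g) ⟨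
          neg ((S√ ⊗ g) ⊗ τ (S√ ⊗ g)) ≡⟨ cong (λ x → neg (x ⊗ τ x)) g-coefficient ⟩
          neg ((β ⊗ M³) ⊗ τ (β ⊗ M³)) ≡⟨ cong (λ x → neg ((β ⊗ M³) ⊗ x)) (τ-⊗ β M³) ⟩
          neg ((β ⊗ M³) ⊗ (τ β ⊗ τ M³)) ≡⟨ cong (λ x → neg ((β ⊗ M³) ⊗ (τ β ⊗ x))) (trans (τ-⊗ (M ⊗ M) M) (cong (_⊗ M) (τ-⊗ M M))) ⟩
          neg ((β ⊗ M³) ⊗ (τ β ⊗ M³)) ≡⟨ exchange β M³ (τ β) ⟩
          neg (β ⊗ τ β ⊗ (M³ ⊗ M³)) ≡⟨ cong (λ x → neg (x ⊗ (M³ ⊗ M³))) (fromℚ-Nm β) ⟩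
          neg (fromℚ (Nm β) ⊗ (M³ ⊗ M³)) ∎
          where
          M³ = M ⊗ M ⊗ M
          sign : ∀ x s y → x ⊗ (s ⊗ y) ≡ neg (x ⊗ (neg s ⊗ y))
          sign = solve 3 (λ x s y → x :* (s :* y) := :- (x :* ((:- s) :* y))) refl
          exchange : ∀ b m b′ → neg ((b ⊗ m) ⊗ (b′ ⊗ m)) ≡ neg (b ⊗ b′ ⊗ (m ⊗ m))
          exchange = solve 3 (λ b m b′ → :- ((b :* m) :* (b′ :* m)) := :- (b :* b′ :* (m :* m))) refl

      module _ (b : ℕ) (Nβ : Nm β * (μ * μ * μ) ≡ toℚ (+ b)) where

        private
          -- W² and ℓℓ′ contribute ν³, which cancels three of the six factors μ coming from g·τ(g).
          -- The remaining N(β)μ³ is b.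
          hessian-value : ∀ x → neg (g ⊗ τ g ⊗ (N ⊗ x) ⊗ (W ⊗ W)) ≡ fromℤ (+ b) ⊗ x
          hessian-value x = begin
            neg (g ⊗ τ g ⊗ (N ⊗ x) ⊗ (W ⊗ W)) ≡⟨ cong (λ w → neg (g ⊗ τ g ⊗ (N ⊗ x) ⊗ (w ⊗ w))) W≡ ⟩
            neg (g ⊗ τ g ⊗ (N ⊗ x) ⊗ ((N ⊗ S√) ⊗ (N ⊗ S√))) ≡⟨ regroup g (τ g) N x S√ ⟩
            neg ((S√ ⊗ g) ⊗ (S√ ⊗ τ g)) ⊗ (N ⊗ N ⊗ N) ⊗ x ≡⟨ cong (λ y → neg y ⊗ (N ⊗ N ⊗ N) ⊗ x) S√²gg′ ⟩
            neg (neg (Nb ⊗ ((M ⊗ M ⊗ M) ⊗ (M ⊗ M ⊗ M)))) ⊗ (N ⊗ N ⊗ N) ⊗ x ≡⟨ pair Nb M N x ⟩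
            Nb ⊗ (M ⊗ M ⊗ M) ⊗ ((N ⊗ M) ⊗ (N ⊗ M) ⊗ (N ⊗ M)) ⊗ x ≡⟨ cong (λ y → Nb ⊗ (M ⊗ M ⊗ M) ⊗ (y ⊗ y ⊗ y) ⊗ x) N⊗M≡1 ⟩
            Nb ⊗ (M ⊗ M ⊗ M) ⊗ (one ⊗ one ⊗ one) ⊗ x ≡⟨ units (Nb ⊗ (M ⊗ M ⊗ M)) x ⟩
            Nb ⊗ (M ⊗ M ⊗ M) ⊗ x ≡⟨ cong (_⊗ x) value ⟩
            fromℤ (+ b) ⊗ x ∎
            where
            Nb = fromℚ (Nm β)
            regroup : ∀ g g′ n x s → neg (g ⊗ g′ ⊗ (n ⊗ x) ⊗ ((n ⊗ s) ⊗ (n ⊗ s))) ≡ neg ((s ⊗ g) ⊗ (s ⊗ g′)) ⊗ (n ⊗ n ⊗ n) ⊗ x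
            regroup = solve 5 (λ g g′ n x s → :- (g :* g′ :* (n :* x) :* ((n :* s) :* (n :* s))) := (:- ((s :* g) :* (s :* g′))) :* (n :* n :* n) :* x) refl
            pair : ∀ b m n x → neg (neg (b ⊗ ((m ⊗ m ⊗ m) ⊗ (m ⊗ m ⊗ m)))) ⊗ (n ⊗ n ⊗ n) ⊗ x ≡ b ⊗ (m ⊗ m ⊗ m) ⊗ ((n ⊗ m) ⊗ (n ⊗ m) ⊗ (n ⊗ m)) ⊗ x
            pair = solve 4 (λ b m n x → (:- (:- (b :* ((m :* m :* m) :* (m :* m :* m))))) :* (n :* n :* n) :* x := b :* (m :* m :* m) :* ((n :* m) :* (n :* m) :* (n :* m)) :* x) refl
            units : ∀ y x → y ⊗ (one ⊗ one ⊗ one) ⊗ x ≡ y ⊗ x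
            units = solve 2 (λ y x → y :* (con (+ 1) :* con (+ 1) :* con (+ 1)) :* x := y :* x) refl
            value : Nb ⊗ (M ⊗ M ⊗ M) ≡ fromℤ (+ b)
            value = begin
              Nb ⊗ (M ⊗ M ⊗ M) ≡⟨ cong (λ y → Nb ⊗ (y ⊗ M)) (fromℚ-* μ μ) ⟨
              Nb ⊗ (fromℚ (μ * μ) ⊗ M) ≡⟨ cong (Nb ⊗_) (fromℚ-* (μ * μ) μ) ⟨
              Nb ⊗ fromℚ (μ * μ * μ) ≡⟨ fromℚ-* (Nm β) (μ * μ * μ) ⟨
              fromℚ (Nm β * (μ * μ * μ)) ≡⟨ cong fromℚ Nβ ⟩
              fromℤ (+ b) ∎

          trace-value : ∀ x y z q → Tr (g ⊗ τ x ⊗ τ y ⊗ τ z) ≡ toℚ q → fromℤ q ≡ g ⊗ τ x ⊗ τ y ⊗ τ z ⊕ τ g ⊗ x ⊗ y ⊗ z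
          trace-value x y z q eq = begin
            fromℤ q ≡⟨ cong fromℚ eq ⟨
            fromℚ (Tr (g ⊗ τ x ⊗ τ y ⊗ τ z)) ≡⟨ fromℚ-Tr (g ⊗ τ x ⊗ τ y ⊗ τ z) ⟨
            g ⊗ τ x ⊗ τ y ⊗ τ z ⊕ τ (g ⊗ τ x ⊗ τ y ⊗ τ z) ≡⟨ cong (g ⊗ τ x ⊗ τ y ⊗ τ z ⊕_) conjugate ⟩
            g ⊗ τ x ⊗ τ y ⊗ τ z ⊕ τ g ⊗ x ⊗ y ⊗ z ∎
            where
            conjugate : τ (g ⊗ τ x ⊗ τ y ⊗ τ z) ≡ τ g ⊗ x ⊗ y ⊗ z
            conjugate = begin
              τ (g ⊗ τ x ⊗ τ y ⊗ τ z) ≡⟨ τ-⊗ (g ⊗ τ x ⊗ τ y) (τ z) ⟩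
              τ (g ⊗ τ x ⊗ τ y) ⊗ τ (τ z) ≡⟨ cong (_⊗ τ (τ z)) (τ-⊗ (g ⊗ τ x) (τ y)) ⟩
              τ (g ⊗ τ x) ⊗ τ (τ y) ⊗ τ (τ z) ≡⟨ cong (λ u → u ⊗ τ (τ y) ⊗ τ (τ z)) (τ-⊗ g (τ x)) ⟩
              τ g ⊗ τ (τ x) ⊗ τ (τ y) ⊗ τ (τ z) ≡⟨ cong₂ _⊗_ (cong₂ (λ u v → τ g ⊗ u ⊗ v) (τ-involutive x) (τ-involutive y)) (τ-involutive z) ⟩
              τ g ⊗ x ⊗ y ⊗ z ∎

          hessian : ∀ i j k l f {t₀ t₁ t₂ t₃ x : K} → fromℤ i ≡ t₀ → fromℤ j ≡ t₁ → fromℤ k ≡ t₂ → fromℤ l ≡ t₃ →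
            t₀ ⊗ t₁ ⊖ t₂ ⊗ t₃ ≡ neg (g ⊗ τ g ⊗ x ⊗ (W ⊗ W)) → x ≡ N ⊗ fromℤ f → i ℤ.* j ℤ.- k ℤ.* l ≡ + b ℤ.* f
          hessian i j k l f {t₀} {t₁} {t₂} {t₃} {x} i≡ j≡ k≡ l≡ identity x≡ = toℚ-injective (cong re (begin
            fromℤ (i ℤ.* j ℤ.- k ℤ.* l) ≡⟨ fromℤ-minor i j k l ⟩
            fromℤ i ⊗ fromℤ j ⊖ fromℤ k ⊗ fromℤ l ≡⟨ cong₂ _⊖_ (cong₂ _⊗_ i≡ j≡) (cong₂ _⊗_ k≡ l≡) ⟩
            t₀ ⊗ t₁ ⊖ t₂ ⊗ t₃ ≡⟨ identity ⟩
            neg (g ⊗ τ g ⊗ x ⊗ (W ⊗ W)) ≡⟨ cong (λ y → neg (g ⊗ τ g ⊗ y ⊗ (W ⊗ W))) x≡ ⟩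
            neg (g ⊗ τ g ⊗ (N ⊗ fromℤ f) ⊗ (W ⊗ W)) ≡⟨ hessian-value (fromℤ f) ⟩
            fromℤ (+ b) ⊗ fromℤ f ≡⟨ fromℤ-* (+ b) f ⟨
            fromℤ (+ b ℤ.* f) ∎))

        module _ {q₀ q₁ q₂ q₃ : ℤ} (coeffs : HasCoefficients g (τ α₁) (τ α₂) q₀ q₁ q₂ q₃) where

          private
            open HasCoefficients coeffs
            v₀ : fromℤ q₀ ≡ g ⊗ A ⊗ A ⊗ A ⊕ τ g ⊗ α₁ ⊗ α₁ ⊗ α₁
            v₀ = trace-value α₁ α₁ α₁ q₀ Tr₀
            v₁ : fromℤ q₁ ≡ g ⊗ A ⊗ A ⊗ B ⊕ τ g ⊗ α₁ ⊗ α₁ ⊗ α₂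
            v₁ = trace-value α₁ α₁ α₂ q₁ Tr₁
            v₂ : fromℤ q₂ ≡ g ⊗ A ⊗ B ⊗ B ⊕ τ g ⊗ α₁ ⊗ α₂ ⊗ α₂
            v₂ = trace-value α₁ α₂ α₂ q₂ Tr₂
            v₃ : fromℤ q₃ ≡ g ⊗ B ⊗ B ⊗ B ⊕ τ g ⊗ α₂ ⊗ α₂ ⊗ α₂
            v₃ = trace-value α₂ α₂ α₂ q₃ Tr₃

          hessian₀ : q₁ ℤ.* q₁ ℤ.- q₀ ℤ.* q₂ ≡ + b ℤ.* f₀
          hessian₀ = hessian q₁ q₁ q₀ q₂ f₀ v₁ v₁ v₀ v₂ (identity g (τ g) A α₁ B α₂) (α⊗τα α₁ α₁ (fromℤ f₀) α₁ᾱ₁)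
            where
            identity : ∀ g g′ A A′ B B′ →
              (g ⊗ A ⊗ A ⊗ B ⊕ g′ ⊗ A′ ⊗ A′ ⊗ B′) ⊗ (g ⊗ A ⊗ A ⊗ B ⊕ g′ ⊗ A′ ⊗ A′ ⊗ B′)
              ⊖ (g ⊗ A ⊗ A ⊗ A ⊕ g′ ⊗ A′ ⊗ A′ ⊗ A′) ⊗ (g ⊗ A ⊗ B ⊗ B ⊕ g′ ⊗ A′ ⊗ B′ ⊗ B′)
              ≡ neg (g ⊗ g′ ⊗ (A′ ⊗ A) ⊗ ((A ⊗ B′ ⊖ A′ ⊗ B) ⊗ (A ⊗ B′ ⊖ A′ ⊗ B)))
            identity = solve 6 (λ g g′ A A′ B B′ →
              (g :* A :* A :* B :+ g′ :* A′ :* A′ :* B′) :* (g :* A :* A :* B :+ g′ :* A′ :* A′ :* B′)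
              :- (g :* A :* A :* A :+ g′ :* A′ :* A′ :* A′) :* (g :* A :* B :* B :+ g′ :* A′ :* B′ :* B′)
              := :- (g :* g′ :* (A′ :* A) :* ((A :* B′ :- A′ :* B) :* (A :* B′ :- A′ :* B)))) refl

          hessian₁ : q₁ ℤ.* q₂ ℤ.- q₀ ℤ.* q₃ ≡ + b ℤ.* (+ 2 ℤ.* h ℤ.+ p)
          hessian₁ = hessian q₁ q₂ q₀ q₃ (+ 2 ℤ.* h ℤ.+ p) v₁ v₂ v₀ v₃ (identity g (τ g) A α₁ B α₂) trace
            where
            identity : ∀ g g′ A A′ B B′ →
              (g ⊗ A ⊗ A ⊗ B ⊕ g′ ⊗ A′ ⊗ A′ ⊗ B′) ⊗ (g ⊗ A ⊗ B ⊗ B ⊕ g′ ⊗ A′ ⊗ B′ ⊗ B′)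
              ⊖ (g ⊗ A ⊗ A ⊗ A ⊕ g′ ⊗ A′ ⊗ A′ ⊗ A′) ⊗ (g ⊗ B ⊗ B ⊗ B ⊕ g′ ⊗ B′ ⊗ B′ ⊗ B′)
              ≡ neg (g ⊗ g′ ⊗ (A′ ⊗ B ⊕ B′ ⊗ A) ⊗ ((A ⊗ B′ ⊖ A′ ⊗ B) ⊗ (A ⊗ B′ ⊖ A′ ⊗ B)))
            identity = solve 6 (λ g g′ A A′ B B′ →
              (g :* A :* A :* B :+ g′ :* A′ :* A′ :* B′) :* (g :* A :* B :* B :+ g′ :* A′ :* B′ :* B′)
              :- (g :* A :* A :* A :+ g′ :* A′ :* A′ :* A′) :* (g :* B :* B :* B :+ g′ :* B′ :* B′ :* B′)
              := :- (g :* g′ :* (A′ :* B :+ B′ :* A) :* ((A :* B′ :- A′ :* B) :* (A :* B′ :- A′ :* B)))) refl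
            trace : α₁ ⊗ τ α₂ ⊕ α₂ ⊗ τ α₁ ≡ N ⊗ fromℤ (+ 2 ℤ.* h ℤ.+ p)
            trace = begin
              α₁ ⊗ τ α₂ ⊕ α₂ ⊗ τ α₁ ≡⟨ cong₂ _⊕_ (α⊗τα α₁ α₂ (α₁ ⊗ ᾱ₂) refl) (α⊗τα α₂ α₁ (α₂ ⊗ ᾱ₁) refl) ⟩
              N ⊗ (α₁ ⊗ ᾱ₂) ⊕ N ⊗ (α₂ ⊗ ᾱ₁) ≡⟨ factor N (α₁ ⊗ ᾱ₂) (α₂ ⊗ ᾱ₁) ⟩
              N ⊗ ((α₁ ⊗ ᾱ₂) ⊕ (α₂ ⊗ ᾱ₁)) ≡⟨ cong (N ⊗_) (dual-trace F) ⟩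
              N ⊗ fromℤ (+ 2 ℤ.* h ℤ.+ p) ∎
              where
              factor : ∀ n x y → n ⊗ x ⊕ n ⊗ y ≡ n ⊗ (x ⊕ y)
              factor = solve 3 (λ n x y → n :* x :+ n :* y := n :* (x :+ y)) refl

          hessian₂ : q₂ ℤ.* q₂ ℤ.- q₁ ℤ.* q₃ ≡ + b ℤ.* f₂
          hessian₂ = hessian q₂ q₂ q₁ q₃ f₂ v₂ v₂ v₁ v₃ (identity g (τ g) A α₁ B α₂) (α⊗τα α₂ α₂ (fromℤ f₂) α₂ᾱ₂)
            where
            identity : ∀ g g′ A A′ B B′ →
              (g ⊗ A ⊗ B ⊗ B ⊕ g′ ⊗ A′ ⊗ B′ ⊗ B′) ⊗ (g ⊗ A ⊗ B ⊗ B ⊕ g′ ⊗ A′ ⊗ B′ ⊗ B′)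
              ⊖ (g ⊗ A ⊗ A ⊗ B ⊕ g′ ⊗ A′ ⊗ A′ ⊗ B′) ⊗ (g ⊗ B ⊗ B ⊗ B ⊕ g′ ⊗ B′ ⊗ B′ ⊗ B′)
              ≡ neg (g ⊗ g′ ⊗ (B′ ⊗ B) ⊗ ((A ⊗ B′ ⊖ A′ ⊗ B) ⊗ (A ⊗ B′ ⊖ A′ ⊗ B)))
            identity = solve 6 (λ g g′ A A′ B B′ →
              (g :* A :* B :* B :+ g′ :* A′ :* B′ :* B′) :* (g :* A :* B :* B :+ g′ :* A′ :* B′ :* B′)
              :- (g :* A :* A :* B :+ g′ :* A′ :* A′ :* B′) :* (g :* B :* B :* B :+ g′ :* B′ :* B′ :* B′)
              := :- (g :* g′ :* (B′ :* B) :* ((A :* B′ :- A′ :* B) :* (A :* B′ :- A′ :* B)))) refl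

  -- Oriented bases

  product-cong : ∀ α₁ α₂ a₁ a₂ γ₁ γ₂ → span α₁ α₂ ≐ span a₁ a₂ →
    Gen ((α₁ ∷ α₂ ∷ []) ·g (γ₁ ∷ γ₂ ∷ [])) ≐ Gen ((a₁ ∷ a₂ ∷ []) ·g (γ₁ ∷ γ₂ ∷ []))
  product-cong α₁ α₂ a₁ a₂ γ₁ γ₂ α≐a = ≐-intro
    (product-⊆ α₁ α₂ γ₁ γ₂ (Gen-isSubgroup ((a₁ ∷ a₂ ∷ []) ·g (γ₁ ∷ γ₂ ∷ [])))
      (λ x y x∈ y∈ → product-intro a₁ a₂ γ₁ γ₂ x y (≐⇒⊆ α≐a x x∈) y∈))
    (product-⊆ a₁ a₂ γ₁ γ₂ (Gen-isSubgroup ((α₁ ∷ α₂ ∷ []) ·g (γ₁ ∷ γ₂ ∷ [])))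
      (λ x y x∈ y∈ → product-intro α₁ α₂ γ₁ γ₂ x y (≐⇒⊇ α≐a x x∈) y∈))

  inCube-cong : ∀ α₁ α₂ a₁ a₂ → span α₁ α₂ ≐ span a₁ a₂ → ∀ β → InCube α₁ α₂ β → InCube a₁ a₂ β
  inCube-cong α₁ α₂ a₁ a₂ α≐a = cube-⊆ α₁ α₂ (Gen-isSubgroup (cubeGens a₁ a₂))
    (λ x y z x∈ y∈ z∈ → cube-intro a₁ a₂ x y z (≐⇒⊆ α≐a x x∈) (≐⇒⊆ α≐a y y∈) (≐⇒⊆ α≐a z z∈))

  isIdeal-cong : ∀ α₁ α₂ a₁ a₂ → span α₁ α₂ ≐ span a₁ a₂ → Indep a₁ a₂ → IsIdeal c α₁ α₂ → IsIdeal c a₁ a₂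
  isIdeal-cong α₁ α₂ a₁ a₂ α≐a indep (_ , stable) =
    indep , λ o x o∈ x∈ → ≐⇒⊆ α≐a (o ⊗ x) (stable o x o∈ (≐⇒⊇ α≐a x x∈))

  isInverse-cong : ∀ α₁ α₂ a₁ a₂ γ₁ γ₂ → span α₁ α₂ ≐ span a₁ a₂ →
    IsInverse c α₁ α₂ γ₁ γ₂ → IsInverse c a₁ a₂ γ₁ γ₂
  isInverse-cong α₁ α₂ a₁ a₂ γ₁ γ₂ α≐a (γ-ideal , inverse) =
    γ-ideal , ≐-trans (≐-sym (product-cong α₁ α₂ a₁ a₂ γ₁ γ₂ α≐a)) inverse

  det-neg : ∀ a₁ a₂ → det (neg a₁) (neg a₂) ≡ det a₁ a₂
  det-neg a₁ a₂ = lemma (re a₁) (im a₁) (re a₂) (im a₂)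
    where
    lemma : ∀ a b c d → - a * - d - - b * - c ≡ a * d - b * c
    lemma = solve-∀ ℚ-ring

  neg-involutive : ∀ x → neg (neg x) ≡ x
  neg-involutive = solve 1 (λ x → :- (:- x) := x) refl

  span-neg : ∀ a₁ a₂ → span (neg a₁) (neg a₂) ≐ span a₁ a₂
  span-neg a₁ a₂ = ≐-intro
    (span-⊆ (span-isSubgroup a₁ a₂) {neg a₁} {neg a₂}
      (neg-closed (span-isSubgroup a₁ a₂) a₁ (α₁∈span a₁ a₂)) (neg-closed (span-isSubgroup a₁ a₂) a₂ (α₂∈span a₁ a₂)))
    (span-⊆ (span-isSubgroup (neg a₁) (neg a₂)) {a₁} {a₂}
      (subst (span (neg a₁) (neg a₂)) (neg-involutive a₁) (neg-closed (span-isSubgroup (neg a₁) (neg a₂)) (neg a₁) (α₁∈span (neg a₁) (neg a₂))))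
      (subst (span (neg a₁) (neg a₂)) (neg-involutive a₂) (neg-closed (span-isSubgroup (neg a₁) (neg a₂)) (neg a₂) (α₂∈span (neg a₁) (neg a₂)))))

  span-swap : ∀ a₁ a₂ → span a₂ a₁ ≐ span a₁ a₂
  span-swap a₁ a₂ = ≐-intro
    (span-⊆ (span-isSubgroup a₁ a₂) {a₂} {a₁} (α₂∈span a₁ a₂) (α₁∈span a₁ a₂))
    (span-⊆ (span-isSubgroup a₂ a₁) {a₁} {a₂} (α₂∈span a₂ a₁) (α₁∈span a₂ a₁))

  private
    -- a₁τ(a₂) - a₂τ(a₁) is -2·det(a₁, a₂)·√Δ, so the quotient by √Δ is rational and the orientation
    -- condition amounts to N(β)·det(a₁, a₂) > 0.
    orientation-value : ∀ β a₁ a₂ → fromℚ (Nm β) ⊗ (a₁ ⊗ τ a₂ ⊖ a₂ ⊗ τ a₁) ⊗ inv sqrtΔ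
      ≡ fromℚ (- (Nm β * det a₁ a₂ + Nm β * det a₁ a₂))
    orientation-value β a₁ a₂ = begin
      fromℚ (Nm β) ⊗ (a₁ ⊗ τ a₂ ⊖ a₂ ⊗ τ a₁) ⊗ inv sqrtΔ ≡⟨ cong (λ x → fromℚ (Nm β) ⊗ x ⊗ inv sqrtΔ) (difference a₁ a₂) ⟩
      fromℚ (Nm β) ⊗ (fromℚ (- (d + d)) ⊗ sqrtΔ) ⊗ inv sqrtΔ ≡⟨ regroup (fromℚ (Nm β)) (fromℚ (- (d + d))) sqrtΔ (inv sqrtΔ) ⟩
      (fromℚ (Nm β) ⊗ fromℚ (- (d + d))) ⊗ (sqrtΔ ⊗ inv sqrtΔ) ≡⟨ cong₂ _⊗_ (sym (fromℚ-* (Nm β) (- (d + d)))) (inv-inverse sqrtΔ sqrtΔ-unit) ⟩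
      fromℚ (Nm β * - (d + d)) ⊗ one ≡⟨ ⊗-identityʳ (fromℚ (Nm β * - (d + d))) ⟩
      fromℚ (Nm β * - (d + d)) ≡⟨ cong fromℚ (distribute (Nm β) d) ⟩
      fromℚ (- (Nm β * d + Nm β * d)) ∎
      where
      d = det a₁ a₂
      regroup : ∀ n x s i → n ⊗ (x ⊗ s) ⊗ i ≡ (n ⊗ x) ⊗ (s ⊗ i)
      regroup = solve 4 (λ n x s i → n :* (x :* s) :* i := (n :* x) :* (s :* i)) refl
      distribute : ∀ n d → n * - (d + d) ≡ - (n * d + n * d)
      distribute = solve-∀ ℚ-ring
      difference : ∀ x y → x ⊗ τ y ⊖ y ⊗ τ x ≡ fromℚ (- (det x y + det x y)) ⊗ sqrtΔ
      difference (a +s b) (c +s d) = K-≡ (real Dq a b c d) (imaginary a b c d)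
        where
        real : ∀ D a b c d → (a * c + D * b * - d) + - (c * a + D * d * - b)
          ≡ - (a * d - b * c + (a * d - b * c)) * 0ℚ + D * 0ℚ * 1ℚ
        real = solve-∀ ℚ-ring
        imaginary : ∀ a b c d → (a * - d + b * c) + - (c * - b + d * a)
          ≡ - (a * d - b * c + (a * d - b * c)) * 1ℚ + 0ℚ * 0ℚ
        imaginary = solve-∀ ℚ-ring

  Positive : K → K → K → Set
  Positive β a₁ a₂ = 0ℚ < Nm β * det a₁ a₂

  positive⇒negRational : ∀ β a₁ a₂ → Positive β a₁ a₂ →
    IsNegRational (fromℚ (Nm β) ⊗ (a₁ ⊗ τ a₂ ⊖ a₂ ⊗ τ a₁) ⊗ inv sqrtΔ)
  positive⇒negRational β a₁ a₂ 0<r = subst IsNegRational (sym (orientation-value β a₁ a₂))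
    (refl , ℚ.neg-antimono-< (ℚ.+-mono-< 0<r 0<r))

  negRational⇒positive : ∀ β a₁ a₂ → IsNegRational (fromℚ (Nm β) ⊗ (a₁ ⊗ τ a₂ ⊖ a₂ ⊗ τ a₁) ⊗ inv sqrtΔ) →
    Positive β a₁ a₂
  negRational⇒positive β a₁ a₂ negative = halve (Nm β * det a₁ a₂)
    (proj₂ (subst IsNegRational (orientation-value β a₁ a₂) negative))
    where
    halve : ∀ r → - (r + r) < 0ℚ → 0ℚ < r
    halve r -2r<0 = subst (0ℚ <_) (lemma r) (*-pos {½} (ℚ.*<* (ℤ.+<+ (s≤s z≤n))) (neg-pos -2r<0))
      where
      lemma : ∀ r → ½ * - (- (r + r)) ≡ r
      lemma = solve-∀ ℚ-ring

  positive-neg : ∀ β a₁ a₂ → Positive β a₁ a₂ → Positive β (neg a₁) (neg a₂)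
  positive-neg β a₁ a₂ = subst (λ d → 0ℚ < Nm β * d) (sym (det-neg a₁ a₂))

  positive⇒indep : ∀ β a₁ a₂ → Positive β a₁ a₂ → Indep a₁ a₂
  positive⇒indep β a₁ a₂ pos d≡0 = <⇒≢0 pos (trans (cong (Nm β *_) d≡0) (ℚ.*-zeroʳ (Nm β)))

  S√-cancel : ∀ x y → S√ ⊗ x ≡ S√ ⊗ y → x ≡ y
  S√-cancel x y eq = K-≡
    (*-cancelˡ C≢0 (trans (sym (im-S√⊗ x)) (trans (cong im eq) (im-S√⊗ y))))
    (*-cancelˡ (*-≢0 C≢0 (toℚ-nonzero D≢0)) (trans (sym (re-S√⊗ x)) (trans (cong re eq) (re-S√⊗ y))))
    where
    C≢0 : C ≢ 0ℚ
    C≢0 = <⇒≢0 0<C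
    re-S√⊗ : ∀ x → re (S√ ⊗ x) ≡ C * Dq * im x
    re-S√⊗ x = trans (cong (λ s → re (s ⊗ x)) S√≡) (lemma C Dq (re x) (im x))
      where
      lemma : ∀ C D r i → (C * 0ℚ + D * 0ℚ * 1ℚ) * r + D * (C * 1ℚ + 0ℚ * 0ℚ) * i ≡ C * D * i
      lemma = solve-∀ ℚ-ring

  -- The conditions in `S` on a pair, for a fixed conductor and without n, so that they can be
  -- transported to another basis of the same ideal.
  record Datum (b : ℕ) (α₁ α₂ β : K) : Set where
    constructor datum
    field
      ideal      : IsIdeal c α₁ α₂
      invertible : Invertible c α₁ α₂
      β∈cube     : InCube α₁ α₂ β
      norm       : NormCond b c α₁ α₂ β

  datum-cong : ∀ b α₁ α₂ a₁ a₂ β → span α₁ α₂ ≐ span a₁ a₂ → Indep a₁ a₂ → Datum b α₁ α₂ β → Datum b a₁ a₂ β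
  datum-cong b α₁ α₂ a₁ a₂ β α≐a indep (datum ideal (γ₁ , γ₂ , inverse) β∈ (ε₁ , ε₂ , inverse′ , rest)) = datum
    (isIdeal-cong α₁ α₂ a₁ a₂ α≐a indep ideal)
    (γ₁ , γ₂ , isInverse-cong α₁ α₂ a₁ a₂ γ₁ γ₂ α≐a inverse)
    (inCube-cong α₁ α₂ a₁ a₂ α≐a β β∈)
    (ε₁ , ε₂ , isInverse-cong α₁ α₂ a₁ a₂ ε₁ ε₂ α≐a inverse′ , rest)

  datum-normForm : ∀ {b α₁ α₂ β} → Datum b α₁ α₂ β → NormForm α₁ α₂
  datum-normForm {α₁ = α₁} {α₂} d = ideal⇒normForm α₁ α₂ (Datum.ideal d) (Datum.invertible d)

  datum-stable : ∀ {b α₁ α₂ β} → Datum b α₁ α₂ β → Stable α₁ α₂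
  datum-stable d = ideal⇒stable (Datum.ideal d)

  module _ {b : ℕ} {α₁ α₂ β : K} (stable : Stable α₁ α₂) (F : NormForm α₁ α₂) where
    open NormForm F

    private
      q : ℚ
      q = Nm β * (μ * μ * μ)

    module _ (norm : NormCond b c α₁ α₂ β) where

      private
        cubeNorm-facts : q ≢ 0ℚ × ℚ.∣ q ∣ ≡ toℚ (+ b)
        cubeNorm-facts = go norm
          where
          go : NormCond b c α₁ α₂ β → q ≢ 0ℚ × ℚ.∣ q ∣ ≡ toℚ (+ b)
          go (γ₁ , γ₂ , inverse , δ₁ , δ₂ , indep , δ≐ , 𝐍≡b) = q≢0 , trans (sym (cubeNorm F β δ₁ δ₂ δ≐Λ q≢0)) 𝐍≡b
            where
            δ≐Λ : span δ₁ δ₂ ≐ Gen (map (β ⊗_) (cubeGens ᾱ₁ ᾱ₂))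
            δ≐Λ = ≐-trans δ≐ (scaledCube-cong β γ₁ γ₂ ᾱ₁ ᾱ₂ (inverse≐dual F stable γ₁ γ₂ inverse))
            q≢0 : q ≢ 0ℚ
            q≢0 = cubeNorm≢0 F β δ₁ δ₂ δ≐Λ indep

      Nm-β≢0 : Nm β ≢ 0ℚ
      Nm-β≢0 Nβ≡0 = proj₁ cubeNorm-facts (trans (cong (_* (μ * μ * μ)) Nβ≡0) (ℚ.*-zeroˡ (μ * μ * μ)))

      -- The norm condition gives |q| = b only. As det = ν·c/2, the positive number N(β)·det equals
      -- q·ν⁴·c/2, so q itself is positive.
      positive⇒norm : Positive β α₁ α₂ → q ≡ toℚ (+ b)
      positive⇒norm pos = trans (sym (∣p∣-pos 0<q)) (proj₂ cubeNorm-facts)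
        where
        0<q : 0ℚ < q
        0<q = pos-cancelʳ {ν * ν * (ν * ν) * (½ * C)}
          (*-pos (*-pos (square-pos (ν≢0 F)) (square-pos (ν≢0 F))) 0<½C)
          (subst (0ℚ <_) (begin
            Nm β * det α₁ α₂ ≡⟨ cong (Nm β *_) ν-det ⟨
            Nm β * (ν * (½ * C)) ≡⟨ insert (Nm β) ν (½ * C) ⟩
            Nm β * (ν * (½ * C)) * (1ℚ * 1ℚ * 1ℚ) ≡⟨ cong (λ x → Nm β * (ν * (½ * C)) * (x * x * x)) ν*μ≡1 ⟨
            Nm β * (ν * (½ * C)) * ((ν * μ) * (ν * μ) * (ν * μ)) ≡⟨ regroup (Nm β) ν μ (½ * C) ⟩
            Nm β * (μ * μ * μ) * (ν * ν * (ν * ν) * (½ * C)) ∎) pos)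
          where
          insert : ∀ n v h → n * (v * h) ≡ n * (v * h) * (1ℚ * 1ℚ * 1ℚ)
          insert = solve-∀ ℚ-ring
          regroup : ∀ n v m h → n * (v * h) * ((v * m) * (v * m) * (v * m)) ≡ n * (m * m * m) * (v * v * (v * v) * h)
          regroup = solve-∀ ℚ-ring

  private
    𝐍-positive : ∀ a₁ a₂ → (F : NormForm a₁ a₂) → 0ℚ < det a₁ a₂ → 𝐍 c a₁ a₂ ≡ NormForm.ν F
    𝐍-positive a₁ a₂ F pos = begin
      𝐍 c a₁ a₂ ≡⟨ 𝐍≡ a₁ a₂ ⟩
      ℚ.∣ det a₁ a₂ ∣ * recip (½ * C) ≡⟨ cong (_* recip (½ * C)) (∣p∣-pos pos) ⟩
      det a₁ a₂ * recip (½ * C) ≡⟨ cong (_* recip (½ * C)) ν-det ⟨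
      ν * (½ * C) * recip (½ * C) ≡⟨ ℚ.*-assoc ν (½ * C) (recip (½ * C)) ⟩
      ν * (½ * C * recip (½ * C)) ≡⟨ cong (ν *_) (recip-inverse ½C≢0) ⟩
      ν * 1ℚ ≡⟨ ℚ.*-identityʳ ν ⟩
      ν ∎
      where open NormForm F

    𝐍-negative : ∀ a₁ a₂ → (F : NormForm a₁ a₂) → det a₁ a₂ < 0ℚ → 𝐍 c a₁ a₂ ≡ - NormForm.ν F
    𝐍-negative a₁ a₂ F negative = begin
      𝐍 c a₁ a₂ ≡⟨ 𝐍≡ a₁ a₂ ⟩
      ℚ.∣ det a₁ a₂ ∣ * recip (½ * C) ≡⟨ cong (_* recip (½ * C)) (∣p∣-neg negative) ⟩
      - det a₁ a₂ * recip (½ * C) ≡⟨ cong (λ x → - x * recip (½ * C)) ν-det ⟨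
      - (ν * (½ * C)) * recip (½ * C) ≡⟨ regroup ν (½ * C) (recip (½ * C)) ⟩
      - ν * (½ * C * recip (½ * C)) ≡⟨ cong (- ν *_) (recip-inverse ½C≢0) ⟩
      - ν * 1ℚ ≡⟨ ℚ.*-identityʳ (- ν) ⟩
      - ν ∎
      where
      open NormForm F
      regroup : ∀ v h r → - (v * h) * r ≡ - v * (h * r)
      regroup = solve-∀ ℚ-ring

  IsCoefficient : ∀ {α₁ α₂} → NormForm α₁ α₂ → K → K → Set
  IsCoefficient F β g = S√ ⊗ g ≡ β ⊗ (fromℚ (NormForm.μ F) ⊗ fromℚ (NormForm.μ F) ⊗ fromℚ (NormForm.μ F))

  coefficient-isCoefficient : ∀ {α₁ α₂} (F : NormForm α₁ α₂) β → IsCoefficient F β (coefficient (NormForm.ν F) β)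
  coefficient-isCoefficient F β = S√-coefficient (NormForm.ν F) (NormForm.μ F) β (NormForm.ν*μ≡1 F)

  ΨForm-positive : ∀ a₁ a₂ (F : NormForm a₁ a₂) β g → IsCoefficient F β g → 0ℚ < det a₁ a₂ →
    ΨForm c a₁ a₂ β ≡ cubicForm g (τ a₁) (τ a₂)
  ΨForm-positive a₁ a₂ F β g g-coefficient pos = begin
    ΨForm c a₁ a₂ β ≡⟨ ΨForm≡cubicForm a₁ a₂ β ⟩
    cubicForm (coefficient (𝐍 c a₁ a₂) β) (τ a₁) (τ a₂) ≡⟨ cong (λ r → cubicForm (coefficient r β) (τ a₁) (τ a₂)) (𝐍-positive a₁ a₂ F pos) ⟩
    cubicForm (coefficient ν β) (τ a₁) (τ a₂) ≡⟨ cong (λ x → cubicForm x (τ a₁) (τ a₂)) (S√-cancel (coefficient ν β) g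
                                                                (trans (coefficient-isCoefficient F β) (sym g-coefficient))) ⟩
    cubicForm g (τ a₁) (τ a₂) ∎
    where open NormForm F

  -- For det < 0 the ideal norm is −ν, and the sign moves to the basis because the form is odd in it.
  ΨForm-negative : ∀ a₁ a₂ (F : NormForm a₁ a₂) β g → IsCoefficient F β g → det a₁ a₂ < 0ℚ →
    ΨForm c (neg a₁) (neg a₂) β ≡ cubicForm g (τ a₁) (τ a₂)
  ΨForm-negative a₁ a₂ F β g g-coefficient negative = begin
    ΨForm c (neg a₁) (neg a₂) β ≡⟨ ΨForm≡cubicForm (neg a₁) (neg a₂) β ⟩
    cubicForm (coefficient (𝐍 c (neg a₁) (neg a₂)) β) (neg A) (neg B) ≡⟨ cong (λ r → cubicForm (coefficient r β) (neg A) (neg B)) 𝐍-value ⟩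
    cubicForm (coefficient (- ν) β) (neg A) (neg B) ≡⟨ cong (λ x → cubicForm x (neg A) (neg B)) coefficient-value ⟩
    cubicForm (neg g) (neg A) (neg B) ≡⟨ cubicForm-neg g A B ⟩
    cubicForm g A B ∎
    where
    open NormForm F
    A = τ a₁
    B = τ a₂
    M = fromℚ μ
    𝐍-value : 𝐍 c (neg a₁) (neg a₂) ≡ - ν
    𝐍-value = trans (cong (λ d → ℚ.∣ d ∣ * recip ℚ.∣ det one (ordBasis₂ c) ∣) (det-neg a₁ a₂)) (𝐍-negative a₁ a₂ F negative)
    coefficient-value : coefficient (- ν) β ≡ neg g
    coefficient-value = S√-cancel (coefficient (- ν) β) (neg g) (begin
      S√ ⊗ coefficient (- ν) β ≡⟨ S√-coefficient (- ν) (- μ) β (trans (signs ν μ) ν*μ≡1) ⟩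
      β ⊗ (neg M ⊗ neg M ⊗ neg M) ≡⟨ odd β M ⟩
      neg (β ⊗ (M ⊗ M ⊗ M)) ≡⟨ cong neg g-coefficient ⟨
      neg (S√ ⊗ g) ≡⟨ move S√ g ⟩
      S√ ⊗ neg g ∎)
      where
      signs : ∀ v m → - v * - m ≡ v * m
      signs = solve-∀ ℚ-ring
      odd : ∀ b m → b ⊗ (neg m ⊗ neg m ⊗ neg m) ≡ neg (b ⊗ (m ⊗ m ⊗ m))
      odd = solve 2 (λ b m → b :* ((:- m) :* (:- m) :* (:- m)) := :- (b :* (m :* m :* m))) refl
      move : ∀ s g → neg (s ⊗ g) ≡ s ⊗ neg g
      move = solve 2 (λ s g → :- (s :* g) := s :* (:- g)) refl

  -- Stands in for `ΨRel`, whose `𝐍` is an absolute value, with the signed ν instead. `realise` and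
  -- `unrealise` pass between the two, negating the basis when its determinant is negative.
  record Realisation (b : ℕ) (α₁ α₂ β : K) (x : L) : Set where
    constructor realisation
    field
      a₁ a₂         : K
      basis         : span a₁ a₂ ≐ span α₁ α₂
      positive      : Positive β a₁ a₂
      normForm      : NormForm a₁ a₂
      g             : K
      g-coefficient : IsCoefficient normForm β g
      embed≡        : embed x ≡ cubicForm g (τ a₁) (τ a₂)

  module _ {b : ℕ} {α₁ α₂ β : K} (d : Datum b α₁ α₂ β) where

    admissible-datum : ∀ a₁ a₂ → span a₁ a₂ ≐ span α₁ α₂ → Positive β a₁ a₂ → Datum b a₁ a₂ β
    admissible-datum a₁ a₂ a≐α pos = datum-cong b α₁ α₂ a₁ a₂ β (≐-sym a≐α) (positive⇒indep β a₁ a₂ pos) d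

    positiveBasis : ∃[ a₁ ] ∃[ a₂ ] (span a₁ a₂ ≐ span α₁ α₂ × Positive β a₁ a₂)
    positiveBasis = go (ℚ.<-cmp (Nm β * det α₁ α₂) 0ℚ)
      where
      go : _ → ∃[ a₁ ] ∃[ a₂ ] (span a₁ a₂ ≐ span α₁ α₂ × Positive β a₁ a₂)
      go (tri> _ _ pos) = α₁ , α₂ , ≐-intro (λ _ p → p) (λ _ p → p) , pos
      go (tri≈ _ eq _) = ⊥-elim (*-≢0 (Nm-β≢0 {b = b} {α₁} {α₂} {β} (datum-stable d) (datum-normForm d) (Datum.norm d)) (proj₁ (Datum.ideal d)) eq)
      go (tri< negative _ _) = α₂ , α₁ , span-swap α₁ α₂ ,
        subst (0ℚ <_) (trans (lemma (Nm β) (det α₁ α₂)) (cong (Nm β *_) (sym (det-swap α₁ α₂)))) (neg-pos negative)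
        where
        lemma : ∀ n d → - (n * d) ≡ n * - d
        lemma = solve-∀ ℚ-ring

    realise : ∀ a₁ a₂ → span a₁ a₂ ≐ span α₁ α₂ → Positive β a₁ a₂ → ∀ x → embed x ≡ ΨForm c a₁ a₂ β →
      Realisation b α₁ α₂ β x
    realise a₁ a₂ a≐α pos x eq = go (ℚ.<-cmp (det a₁ a₂) 0ℚ)
      where
      go : _ → Realisation b α₁ α₂ β x
      go (tri> _ _ 0<d) = realisation a₁ a₂ a≐α pos F (coefficient (NormForm.ν F) β) (coefficient-isCoefficient F β)
        (trans eq (ΨForm-positive a₁ a₂ F β (coefficient (NormForm.ν F) β) (coefficient-isCoefficient F β) 0<d))
        where
        F : NormForm a₁ a₂
        F = datum-normForm (admissible-datum a₁ a₂ a≐α pos)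
      go (tri≈ _ d≡0 _) = ⊥-elim (positive⇒indep β a₁ a₂ pos d≡0)
      go (tri< d<0 _ _) = realisation (neg a₁) (neg a₂) a′≐α pos′ F (coefficient (NormForm.ν F) β) (coefficient-isCoefficient F β)
        (trans eq (trans (cong₂ (λ u v → ΨForm c u v β) (sym (neg-involutive a₁)) (sym (neg-involutive a₂)))
          (ΨForm-negative (neg a₁) (neg a₂) F β (coefficient (NormForm.ν F) β) (coefficient-isCoefficient F β)
            (subst (_< 0ℚ) (sym (det-neg a₁ a₂)) d<0))))
        where
        a′≐α : span (neg a₁) (neg a₂) ≐ span α₁ α₂
        a′≐α = ≐-trans (span-neg a₁ a₂) a≐α
        pos′ : Positive β (neg a₁) (neg a₂)
        pos′ = positive-neg β a₁ a₂ pos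
        F : NormForm (neg a₁) (neg a₂)
        F = datum-normForm (admissible-datum (neg a₁) (neg a₂) a′≐α pos′)

    unrealise : ∀ {x} → Realisation b α₁ α₂ β x →
      ∃[ a₁ ] ∃[ a₂ ] (span a₁ a₂ ≐ span α₁ α₂ × Positive β a₁ a₂ × embed x ≡ ΨForm c a₁ a₂ β)
    unrealise {x} (realisation a₁ a₂ a≐α pos F g g-coefficient eq) = go (ℚ.<-cmp (det a₁ a₂) 0ℚ)
      where
      go : _ → ∃[ a₁ ] ∃[ a₂ ] (span a₁ a₂ ≐ span α₁ α₂ × Positive β a₁ a₂ × embed x ≡ ΨForm c a₁ a₂ β)
      go (tri> _ _ 0<d) = a₁ , a₂ , a≐α , pos , trans eq (sym (ΨForm-positive a₁ a₂ F β g g-coefficient 0<d))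
      go (tri≈ _ d≡0 _) = ⊥-elim (positive⇒indep β a₁ a₂ pos d≡0)
      go (tri< d<0 _ _) = neg a₁ , neg a₂ , ≐-trans (span-neg a₁ a₂) a≐α , positive-neg β a₁ a₂ pos ,
        trans eq (sym (ΨForm-negative a₁ a₂ F β g g-coefficient d<0))

  -- Change of basis

  embed-injective : ∀ {x y} → embed x ≡ embed y → x ≡ y
  embed-injective eq = form-≡ (toℚ-injective (cong x0 eq)) (toℚ-injective (cong x1 eq))
    (toℚ-injective (cong x2 eq)) (toℚ-injective (cong x3 eq))

  Tr-⊕ : ∀ x y → Tr (x ⊕ y) ≡ Tr x + Tr y
  Tr-⊕ x y = lemma (re x) (re y)
    where
    lemma : ∀ a b → a + b + (a + b) ≡ a + a + (b + b)
    lemma = solve-∀ ℚ-ring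

  Tr-neg : ∀ x → Tr (neg x) ≡ - Tr x
  Tr-neg x = sym (ℚ.neg-distrib-+ (re x) (re x))

  private
    Tr-combination : ∀ a b c d i j k l t₀ t₁ t₂ t₃ →
      toℚ a ≡ Tr t₀ → toℚ b ≡ Tr t₁ → toℚ c ≡ Tr t₂ → toℚ d ≡ Tr t₃ →
      toℚ (i ℤ.* a ℤ.+ j ℤ.* b ℤ.+ k ℤ.* c ℤ.+ l ℤ.* d) ≡
      Tr (fromℤ i ⊗ t₀ ⊕ fromℤ j ⊗ t₁ ⊕ fromℤ k ⊗ t₂ ⊕ fromℤ l ⊗ t₃)
    Tr-combination a b c d i j k l t₀ t₁ t₂ t₃ a≡ b≡ c≡ d≡ = begin
      toℚ (i ℤ.* a ℤ.+ j ℤ.* b ℤ.+ k ℤ.* c ℤ.+ l ℤ.* d)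
        ≡⟨ toℚ-+ (i ℤ.* a ℤ.+ j ℤ.* b ℤ.+ k ℤ.* c) (l ℤ.* d) ⟩
      toℚ (i ℤ.* a ℤ.+ j ℤ.* b ℤ.+ k ℤ.* c) + toℚ (l ℤ.* d)
        ≡⟨ cong₂ _+_ (trans (toℚ-+ (i ℤ.* a ℤ.+ j ℤ.* b) (k ℤ.* c)) (cong₂ _+_ (trans (toℚ-+ (i ℤ.* a) (j ℤ.* b))
             (cong₂ _+_ (term i a t₀ a≡) (term j b t₁ b≡))) (term k c t₂ c≡))) (term l d t₃ d≡) ⟩
      Tr (fromℤ i ⊗ t₀) + Tr (fromℤ j ⊗ t₁) + Tr (fromℤ k ⊗ t₂) + Tr (fromℤ l ⊗ t₃)
        ≡⟨ cong (λ x → x + Tr (fromℤ k ⊗ t₂) + Tr (fromℤ l ⊗ t₃)) (Tr-⊕ (fromℤ i ⊗ t₀) (fromℤ j ⊗ t₁)) ⟨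
      Tr (fromℤ i ⊗ t₀ ⊕ fromℤ j ⊗ t₁) + Tr (fromℤ k ⊗ t₂) + Tr (fromℤ l ⊗ t₃)
        ≡⟨ cong (λ x → x + Tr (fromℤ l ⊗ t₃)) (Tr-⊕ (fromℤ i ⊗ t₀ ⊕ fromℤ j ⊗ t₁) (fromℤ k ⊗ t₂)) ⟨
      Tr (fromℤ i ⊗ t₀ ⊕ fromℤ j ⊗ t₁ ⊕ fromℤ k ⊗ t₂) + Tr (fromℤ l ⊗ t₃)
        ≡⟨ Tr-⊕ (fromℤ i ⊗ t₀ ⊕ fromℤ j ⊗ t₁ ⊕ fromℤ k ⊗ t₂) (fromℤ l ⊗ t₃) ⟨
      Tr (fromℤ i ⊗ t₀ ⊕ fromℤ j ⊗ t₁ ⊕ fromℤ k ⊗ t₂ ⊕ fromℤ l ⊗ t₃) ∎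
      where
      term : ∀ i a t → toℚ a ≡ Tr t → toℚ (i ℤ.* a) ≡ Tr (fromℤ i ⊗ t)
      term i a t eq = trans (toℚ-* i a) (trans (cong (toℚ i *_) eq) (sym (Tr-fromℤ⊗ i t)))

    fromℤ-scaled : ∀ n i j k → fromℤ (n ℤ.* (i ℤ.* j ℤ.* k)) ≡ fromℤ n ⊗ (fromℤ i ⊗ fromℤ j ⊗ fromℤ k)
    fromℤ-scaled n i j k = trans (fromℤ-* n (i ℤ.* j ℤ.* k)) (cong (fromℤ n ⊗_) (fromℤ-*₃ i j k))

    fromℤ-mixed : ∀ i j k l m n → fromℤ (i ℤ.* j ℤ.* k ℤ.+ + 2 ℤ.* (l ℤ.* m ℤ.* n))
      ≡ fromℤ i ⊗ fromℤ j ⊗ fromℤ k ⊕ fromℤ (+ 2) ⊗ (fromℤ l ⊗ fromℤ m ⊗ fromℤ n)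
    fromℤ-mixed i j k l m n = trans (fromℤ-+ (i ℤ.* j ℤ.* k) (+ 2 ℤ.* (l ℤ.* m ℤ.* n)))
      (cong₂ _⊕_ (fromℤ-*₃ i j k) (fromℤ-scaled (+ 2) l m n))

    cong₄ : ∀ {i i′ j j′ k k′ l l′} t₀ t₁ t₂ t₃ → i ≡ i′ → j ≡ j′ → k ≡ k′ → l ≡ l′ →
      i ⊗ t₀ ⊕ j ⊗ t₁ ⊕ k ⊗ t₂ ⊕ l ⊗ t₃ ≡ i′ ⊗ t₀ ⊕ j′ ⊗ t₁ ⊕ k′ ⊗ t₂ ⊕ l′ ⊗ t₃
    cong₄ t₀ t₁ t₂ t₃ refl refl refl refl = refl

  -- The substitution in (Au + Bv)³ recombines A and B by the rows of the matrix. Coefficients are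
  -- compared as integral combinations of the four traces.
  act-cubicForm : ∀ p q r s det1 g A B x → embed x ≡ cubicForm g A B →
    embed (act (mat p q r s det1) x) ≡
    cubicForm g (fromℤ p ⊗ A ⊕ fromℤ q ⊗ B) (fromℤ r ⊗ A ⊕ fromℤ s ⊗ B)
  act-cubicForm p q r s det1 g A B (form a b c d) eq = form-≡
    (component (p ℤ.* p ℤ.* p) (p ℤ.* p ℤ.* q) (p ℤ.* q ℤ.* q) (q ℤ.* q ℤ.* q) (edge-ℤ p q a b c d)
      (fromℤ-*₃ p p p) (fromℤ-*₃ p p q) (fromℤ-*₃ p q q) (fromℤ-*₃ q q q) (edge (fromℤ p) (fromℤ q) g A B))
    (component (+ 3 ℤ.* (p ℤ.* p ℤ.* r)) (p ℤ.* p ℤ.* s ℤ.+ + 2 ℤ.* (p ℤ.* q ℤ.* r))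
      (q ℤ.* q ℤ.* r ℤ.+ + 2 ℤ.* (p ℤ.* q ℤ.* s)) (+ 3 ℤ.* (q ℤ.* q ℤ.* s)) (middle₁-ℤ p q r s a b c d)
      (fromℤ-scaled (+ 3) p p r) (fromℤ-mixed p p s p q r) (fromℤ-mixed q q r p q s) (fromℤ-scaled (+ 3) q q s)
      (middle₁ (fromℤ p) (fromℤ q) (fromℤ r) (fromℤ s) g A B))
    (component (+ 3 ℤ.* (p ℤ.* r ℤ.* r)) (r ℤ.* r ℤ.* q ℤ.+ + 2 ℤ.* (p ℤ.* r ℤ.* s))
      (s ℤ.* s ℤ.* p ℤ.+ + 2 ℤ.* (q ℤ.* r ℤ.* s)) (+ 3 ℤ.* (q ℤ.* s ℤ.* s)) (middle₂-ℤ p q r s a b c d)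
      (fromℤ-scaled (+ 3) p r r) (fromℤ-mixed r r q p r s) (fromℤ-mixed s s p q r s) (fromℤ-scaled (+ 3) q s s)
      (middle₂ (fromℤ p) (fromℤ q) (fromℤ r) (fromℤ s) g A B))
    (component (r ℤ.* r ℤ.* r) (r ℤ.* r ℤ.* s) (r ℤ.* s ℤ.* s) (s ℤ.* s ℤ.* s) (edge-ℤ r s a b c d)
      (fromℤ-*₃ r r r) (fromℤ-*₃ r r s) (fromℤ-*₃ r s s) (fromℤ-*₃ s s s) (edge (fromℤ r) (fromℤ s) g A B))
    where
    t₀ t₁ t₂ t₃ : K
    t₀ = g ⊗ A ⊗ A ⊗ A
    t₁ = g ⊗ fromℤ (+ 3) ⊗ A ⊗ A ⊗ B
    t₂ = g ⊗ fromℤ (+ 3) ⊗ A ⊗ B ⊗ B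
    t₃ = g ⊗ B ⊗ B ⊗ B
    component : ∀ i j k l {y} {T i′ j′ k′ l′ : K} → y ≡ i ℤ.* a ℤ.+ j ℤ.* b ℤ.+ k ℤ.* c ℤ.+ l ℤ.* d →
      fromℤ i ≡ i′ → fromℤ j ≡ j′ → fromℤ k ≡ k′ → fromℤ l ≡ l′ → T ≡ i′ ⊗ t₀ ⊕ j′ ⊗ t₁ ⊕ k′ ⊗ t₂ ⊕ l′ ⊗ t₃ →
      toℚ y ≡ Tr T
    component i j k l {y} {T} y≡ i≡ j≡ k≡ l≡ T≡ = begin
      toℚ y ≡⟨ cong toℚ y≡ ⟩
      toℚ (i ℤ.* a ℤ.+ j ℤ.* b ℤ.+ k ℤ.* c ℤ.+ l ℤ.* d) ≡⟨ Tr-combination a b c d i j k l t₀ t₁ t₂ t₃ (cong x0 eq) (cong x1 eq) (cong x2 eq) (cong x3 eq) ⟩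
      Tr (fromℤ i ⊗ t₀ ⊕ fromℤ j ⊗ t₁ ⊕ fromℤ k ⊗ t₂ ⊕ fromℤ l ⊗ t₃) ≡⟨ cong Tr (trans (cong₄ t₀ t₁ t₂ t₃ i≡ j≡ k≡ l≡) (sym T≡)) ⟩
      Tr T ∎
    edge-ℤ : ∀ p q a b c d →
      a ℤ.* (p ℤ.* p ℤ.* p) ℤ.+ (b ℤ.* (p ℤ.* p ℤ.* q) ℤ.+ (c ℤ.* (p ℤ.* q ℤ.* q) ℤ.+ d ℤ.* (q ℤ.* q ℤ.* q)))
      ≡ p ℤ.* p ℤ.* p ℤ.* a ℤ.+ p ℤ.* p ℤ.* q ℤ.* b ℤ.+ p ℤ.* q ℤ.* q ℤ.* c ℤ.+ q ℤ.* q ℤ.* q ℤ.* d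
    edge-ℤ = ℤ-Tactic.solve-∀
    middle₁-ℤ : ∀ p q r s a b c d →
      a ℤ.* (p ℤ.* p ℤ.* r ℤ.+ (p ℤ.* r ℤ.+ r ℤ.* p) ℤ.* p) ℤ.+ (b ℤ.* (p ℤ.* p ℤ.* s ℤ.+ (p ℤ.* r ℤ.+ r ℤ.* p) ℤ.* q)
      ℤ.+ (c ℤ.* (p ℤ.* q ℤ.* s ℤ.+ (p ℤ.* s ℤ.+ r ℤ.* q) ℤ.* q) ℤ.+ d ℤ.* (q ℤ.* q ℤ.* s ℤ.+ (q ℤ.* s ℤ.+ s ℤ.* q) ℤ.* q)))
      ≡ + 3 ℤ.* (p ℤ.* p ℤ.* r) ℤ.* a ℤ.+ (p ℤ.* p ℤ.* s ℤ.+ + 2 ℤ.* (p ℤ.* q ℤ.* r)) ℤ.* b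
        ℤ.+ (q ℤ.* q ℤ.* r ℤ.+ + 2 ℤ.* (p ℤ.* q ℤ.* s)) ℤ.* c ℤ.+ + 3 ℤ.* (q ℤ.* q ℤ.* s) ℤ.* d
    middle₁-ℤ = ℤ-Tactic.solve-∀
    middle₂-ℤ : ∀ p q r s a b c d →
      a ℤ.* ((p ℤ.* r ℤ.+ r ℤ.* p) ℤ.* r ℤ.+ r ℤ.* r ℤ.* p) ℤ.+ (b ℤ.* ((p ℤ.* r ℤ.+ r ℤ.* p) ℤ.* s ℤ.+ r ℤ.* r ℤ.* q)
      ℤ.+ (c ℤ.* ((p ℤ.* s ℤ.+ r ℤ.* q) ℤ.* s ℤ.+ r ℤ.* s ℤ.* q) ℤ.+ d ℤ.* ((q ℤ.* s ℤ.+ s ℤ.* q) ℤ.* s ℤ.+ s ℤ.* s ℤ.* q)))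
      ≡ + 3 ℤ.* (p ℤ.* r ℤ.* r) ℤ.* a ℤ.+ (r ℤ.* r ℤ.* q ℤ.+ + 2 ℤ.* (p ℤ.* r ℤ.* s)) ℤ.* b
        ℤ.+ (s ℤ.* s ℤ.* p ℤ.+ + 2 ℤ.* (q ℤ.* r ℤ.* s)) ℤ.* c ℤ.+ + 3 ℤ.* (q ℤ.* s ℤ.* s) ℤ.* d
    middle₂-ℤ = ℤ-Tactic.solve-∀
    edge : ∀ p q g A B → g ⊗ (p ⊗ A ⊕ q ⊗ B) ⊗ (p ⊗ A ⊕ q ⊗ B) ⊗ (p ⊗ A ⊕ q ⊗ B)
      ≡ p ⊗ p ⊗ p ⊗ (g ⊗ A ⊗ A ⊗ A) ⊕ p ⊗ p ⊗ q ⊗ (g ⊗ fromℤ (+ 3) ⊗ A ⊗ A ⊗ B)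
        ⊕ p ⊗ q ⊗ q ⊗ (g ⊗ fromℤ (+ 3) ⊗ A ⊗ B ⊗ B) ⊕ q ⊗ q ⊗ q ⊗ (g ⊗ B ⊗ B ⊗ B)
    edge = solve 5 (λ p q g A B → g :* (p :* A :+ q :* B) :* (p :* A :+ q :* B) :* (p :* A :+ q :* B)
      := p :* p :* p :* (g :* A :* A :* A) :+ p :* p :* q :* (g :* con (+ 3) :* A :* A :* B)
        :+ p :* q :* q :* (g :* con (+ 3) :* A :* B :* B) :+ q :* q :* q :* (g :* B :* B :* B)) refl
    middle₁ : ∀ p q r s g A B → g ⊗ fromℤ (+ 3) ⊗ (p ⊗ A ⊕ q ⊗ B) ⊗ (p ⊗ A ⊕ q ⊗ B) ⊗ (r ⊗ A ⊕ s ⊗ B)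
      ≡ fromℤ (+ 3) ⊗ (p ⊗ p ⊗ r) ⊗ (g ⊗ A ⊗ A ⊗ A) ⊕ (p ⊗ p ⊗ s ⊕ fromℤ (+ 2) ⊗ (p ⊗ q ⊗ r)) ⊗ (g ⊗ fromℤ (+ 3) ⊗ A ⊗ A ⊗ B)
        ⊕ (q ⊗ q ⊗ r ⊕ fromℤ (+ 2) ⊗ (p ⊗ q ⊗ s)) ⊗ (g ⊗ fromℤ (+ 3) ⊗ A ⊗ B ⊗ B) ⊕ fromℤ (+ 3) ⊗ (q ⊗ q ⊗ s) ⊗ (g ⊗ B ⊗ B ⊗ B)
    middle₁ = solve 7 (λ p q r s g A B → g :* con (+ 3) :* (p :* A :+ q :* B) :* (p :* A :+ q :* B) :* (r :* A :+ s :* B)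
      := con (+ 3) :* (p :* p :* r) :* (g :* A :* A :* A) :+ (p :* p :* s :+ con (+ 2) :* (p :* q :* r)) :* (g :* con (+ 3) :* A :* A :* B)
        :+ (q :* q :* r :+ con (+ 2) :* (p :* q :* s)) :* (g :* con (+ 3) :* A :* B :* B) :+ con (+ 3) :* (q :* q :* s) :* (g :* B :* B :* B)) refl
    middle₂ : ∀ p q r s g A B → g ⊗ fromℤ (+ 3) ⊗ (p ⊗ A ⊕ q ⊗ B) ⊗ (r ⊗ A ⊕ s ⊗ B) ⊗ (r ⊗ A ⊕ s ⊗ B)
      ≡ fromℤ (+ 3) ⊗ (p ⊗ r ⊗ r) ⊗ (g ⊗ A ⊗ A ⊗ A) ⊕ (r ⊗ r ⊗ q ⊕ fromℤ (+ 2) ⊗ (p ⊗ r ⊗ s)) ⊗ (g ⊗ fromℤ (+ 3) ⊗ A ⊗ A ⊗ B)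
        ⊕ (s ⊗ s ⊗ p ⊕ fromℤ (+ 2) ⊗ (q ⊗ r ⊗ s)) ⊗ (g ⊗ fromℤ (+ 3) ⊗ A ⊗ B ⊗ B) ⊕ fromℤ (+ 3) ⊗ (q ⊗ s ⊗ s) ⊗ (g ⊗ B ⊗ B ⊗ B)
    middle₂ = solve 7 (λ p q r s g A B → g :* con (+ 3) :* (p :* A :+ q :* B) :* (r :* A :+ s :* B) :* (r :* A :+ s :* B)
      := con (+ 3) :* (p :* r :* r) :* (g :* A :* A :* A) :+ (r :* r :* q :+ con (+ 2) :* (p :* r :* s)) :* (g :* con (+ 3) :* A :* A :* B)
        :+ (s :* s :* p :+ con (+ 2) :* (q :* r :* s)) :* (g :* con (+ 3) :* A :* B :* B) :+ con (+ 3) :* (q :* s :* s) :* (g :* B :* B :* B)) refl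

  det-⊗ : ∀ ρ x y → det (ρ ⊗ x) (ρ ⊗ y) ≡ Nm ρ * det x y
  det-⊗ ρ x y = lemma Dq (re ρ) (im ρ) (re x) (im x) (re y) (im y)
    where
    lemma : ∀ D r i a b c d → (r * a + D * i * b) * (r * d + i * c) - (r * b + i * a) * (r * c + D * i * d)
      ≡ (r * r + D * i * - i) * (a * d - b * c)
    lemma = solve-∀ ℚ-ring

  Nm-⊗ : ∀ x y → Nm (x ⊗ y) ≡ Nm x * Nm y
  Nm-⊗ x y = lemma Dq (re x) (im x) (re y) (im y)
    where
    lemma : ∀ D a b c d → (a * c + D * b * d) * (a * c + D * b * d) + D * (a * d + b * c) * - (a * d + b * c)
      ≡ (a * a + D * b * - b) * (c * c + D * d * - d)
    lemma = solve-∀ ℚ-ring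

  det-basis : ∀ p q r s x y → det (fromℤ p ⊗ x ⊕ fromℤ q ⊗ y) (fromℤ r ⊗ x ⊕ fromℤ s ⊗ y) ≡ toℚ (p ℤ.* s ℤ.- q ℤ.* r) * det x y
  det-basis p q r s x y = begin
    det (fromℤ p ⊗ x ⊕ fromℤ q ⊗ y) (fromℤ r ⊗ x ⊕ fromℤ s ⊗ y)
      ≡⟨ cong₂ det (cong₂ _⊕_ (scale≡⊗ (toℚ p) x) (scale≡⊗ (toℚ q) y)) (cong₂ _⊕_ (scale≡⊗ (toℚ r) x) (scale≡⊗ (toℚ s) y)) ⟨
    det (scale (toℚ p) x ⊕ scale (toℚ q) y) (scale (toℚ r) x ⊕ scale (toℚ s) y)
      ≡⟨ lemma (toℚ p) (toℚ q) (toℚ r) (toℚ s) (re x) (im x) (re y) (im y) ⟩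
    (toℚ p * toℚ s + - (toℚ q * toℚ r)) * det x y
      ≡⟨ cong (_* det x y) (trans (toℚ-+ (p ℤ.* s) (ℤ.- (q ℤ.* r))) (cong₂ _+_ (toℚ-* p s) (trans (toℚ-neg (q ℤ.* r)) (cong -_ (toℚ-* q r))))) ⟨
    toℚ (p ℤ.* s ℤ.- q ℤ.* r) * det x y ∎
    where
    lemma : ∀ p q r s a b c d → (p * a + q * c) * (r * b + s * d) - (p * b + q * d) * (r * a + s * c)
      ≡ (p * s + - (q * r)) * (a * d - b * c)
    lemma = solve-∀ ℚ-ring

  -- The two traces are linear in the coordinates of y, with determinant a nonzero multiple of
  -- Δ·det(a₁, a₂); the proof is Cramer's rule.
  Tr-nondegenerate : ∀ a₁ a₂ y → Indep a₁ a₂ → Tr (y ⊗ τ a₁) ≡ 0ℚ → Tr (y ⊗ τ a₂) ≡ 0ℚ → y ≡ fromℚ 0ℚ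
  Tr-nondegenerate a₁ a₂ y indep tr₁ tr₂ = K-≡
    (p*q≡0⇒q≡0 indep (trans (real Dq (re y) (im y) (re a₁) (im a₁) (re a₂) (im a₂))
      (trans (cong₂ (λ u v → ½ * (im a₂ * u - im a₁ * v)) tr₁ tr₂) (zero-combination (im a₂) (im a₁)))))
    (p*q≡0⇒q≡0 (*-≢0 (toℚ-nonzero D≢0) indep) (trans (imaginary Dq (re y) (im y) (re a₁) (im a₁) (re a₂) (im a₂))
      (trans (cong₂ (λ u v → ½ * (re a₂ * u - re a₁ * v)) tr₁ tr₂) (zero-combination (re a₂) (re a₁)))))
    where
    zero-combination : ∀ u v → ½ * (u * 0ℚ - v * 0ℚ) ≡ 0ℚ
    zero-combination = solve-∀ ℚ-ring
    real : ∀ D r i a b c d → (a * d - b * c) * r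
      ≡ ½ * (d * (r * a + D * i * - b + (r * a + D * i * - b)) - b * (r * c + D * i * - d + (r * c + D * i * - d)))
    real = solve-∀ ℚ-ring
    imaginary : ∀ D r i a b c d → D * (a * d - b * c) * i
      ≡ ½ * (c * (r * a + D * i * - b + (r * a + D * i * - b)) - a * (r * c + D * i * - d + (r * c + D * i * - d)))
    imaginary = solve-∀ ℚ-ring

  module _ {α₁ α₂ : K} (F : NormForm α₁ α₂) where
    open NormForm F

    conjugate-vanish : ∀ z → z ⊗ τ α₁ ≡ fromℚ 0ℚ → z ⊗ τ α₂ ≡ fromℚ 0ℚ → z ≡ fromℚ 0ℚ
    conjugate-vanish z zA≡0 zB≡0 = dual-vanish F z (scaled (τ α₁) zA≡0) (scaled (τ α₂) zB≡0)
      where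
      scaled : ∀ A → z ⊗ A ≡ fromℚ 0ℚ → z ⊗ (fromℚ μ ⊗ A) ≡ fromℚ 0ℚ
      scaled A eq = begin
        z ⊗ (fromℚ μ ⊗ A) ≡⟨ ⊗-swap z (fromℚ μ) A ⟩
        fromℚ μ ⊗ (z ⊗ A) ≡⟨ cong (fromℚ μ ⊗_) eq ⟩
        fromℚ μ ⊗ fromℚ 0ℚ ≡⟨ solve 1 (λ m → m :* con (+ 0) := con (+ 0)) refl (fromℚ μ) ⟩
        fromℚ 0ℚ ∎

    private
      A B : K
      A = τ α₁
      B = τ α₂

    -- Pairing with A and B, the trace detects δAA, δAB and δBB, which therefore vanish.
    -- `conjugate-vanish` then strips the factors A and B, which need not be invertible.
    cubic-nondegenerate : ∀ δ → Tr (δ ⊗ A ⊗ A ⊗ A) ≡ 0ℚ → Tr (δ ⊗ A ⊗ A ⊗ B) ≡ 0ℚ →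
      Tr (δ ⊗ A ⊗ B ⊗ B) ≡ 0ℚ → Tr (δ ⊗ B ⊗ B ⊗ B) ≡ 0ℚ → δ ≡ fromℚ 0ℚ
    cubic-nondegenerate δ tr₀ tr₁ tr₂ tr₃ = conjugate-vanish δ
      (conjugate-vanish (δ ⊗ A) δAA≡0 δAB≡0)
      (conjugate-vanish (δ ⊗ B) (trans (rotate δ B A) δAB≡0) δBB≡0)
      where
      rotate : ∀ d x y → d ⊗ x ⊗ y ≡ d ⊗ y ⊗ x
      rotate = solve 3 (λ d x y → d :* x :* y := d :* y :* x) refl
      δAA≡0 : δ ⊗ A ⊗ A ≡ fromℚ 0ℚ
      δAA≡0 = Tr-nondegenerate α₁ α₂ (δ ⊗ A ⊗ A) (independent F) tr₀ tr₁
      δAB≡0 : δ ⊗ A ⊗ B ≡ fromℚ 0ℚ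
      δAB≡0 = Tr-nondegenerate α₁ α₂ (δ ⊗ A ⊗ B) (independent F) (trans (cong Tr (rotate (δ ⊗ A) B A)) tr₁) tr₂
      δBB≡0 : δ ⊗ B ⊗ B ≡ fromℚ 0ℚ
      δBB≡0 = Tr-nondegenerate α₁ α₂ (δ ⊗ B ⊗ B) (independent F) (trans (cong Tr (lemma δ B A)) tr₂) tr₃
        where
        lemma : ∀ d b a → d ⊗ b ⊗ b ⊗ a ≡ d ⊗ a ⊗ b ⊗ b
        lemma = solve 3 (λ d b a → d :* b :* b :* a := d :* a :* b :* b) refl

  -- Classes of pairs (𝔞, β)

  -- A realisation together with its integral coefficients and the value of N(β)/ν³: the data from
  -- which the invariants of the form are computed.
  record Presentation (b : ℕ) (α₁ α₂ β : K) (x : L) : Set where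
    constructor presentation
    field
      a₁ a₂         : K
      basis         : span a₁ a₂ ≐ span α₁ α₂
      positive      : Positive β a₁ a₂
      normForm      : NormForm a₁ a₂
      g             : K
      g-coefficient : IsCoefficient normForm β g
      q₀ q₁ q₂ q₃   : ℤ
      coeffs        : HasCoefficients g (τ a₁) (τ a₂) q₀ q₁ q₂ q₃
      x≡            : x ≡ form q₀ (+ 3 ℤ.* q₁) (+ 3 ℤ.* q₂) q₃
      Nm-β          : Nm β * (NormForm.μ normForm * NormForm.μ normForm * NormForm.μ normForm) ≡ toℚ (+ b)

    embed≡ : embed x ≡ cubicForm g (τ a₁) (τ a₂)
    embed≡ = trans (cong embed x≡) (cubicForm-coefficients coeffs)

  module _ {b : ℕ} {α₁ α₂ β : K} (d : Datum b α₁ α₂ β) where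

    private
      basis-norm : ∀ a₁ a₂ (a≐α : span a₁ a₂ ≐ span α₁ α₂) (pos : Positive β a₁ a₂) (F : NormForm a₁ a₂) →
        Nm β * (NormForm.μ F * NormForm.μ F * NormForm.μ F) ≡ toℚ (+ b)
      basis-norm a₁ a₂ a≐α pos F = positive⇒norm {b} {a₁} {a₂} {β} (datum-stable a-datum) F (Datum.norm a-datum) pos
        where
        a-datum : Datum b a₁ a₂ β
        a-datum = admissible-datum d a₁ a₂ a≐α pos

      basis-cube : ∀ a₁ a₂ → span a₁ a₂ ≐ span α₁ α₂ → Positive β a₁ a₂ → InCube a₁ a₂ β
      basis-cube a₁ a₂ a≐α pos = Datum.β∈cube (admissible-datum d a₁ a₂ a≐α pos)

    opaque
      present : ∀ x → Realisation b α₁ α₂ β x → Presentation b α₁ α₂ β x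
      present x (realisation a₁ a₂ a≐α pos F g g-coefficient embed≡) =
        go (coefficients F β g g-coefficient (basis-cube a₁ a₂ a≐α pos))
        where
        go : ∃[ q₀ ] ∃[ q₁ ] ∃[ q₂ ] ∃[ q₃ ] HasCoefficients g (τ a₁) (τ a₂) q₀ q₁ q₂ q₃ → Presentation b α₁ α₂ β x
        go (q₀ , q₁ , q₂ , q₃ , coeffs) = presentation a₁ a₂ a≐α pos F g g-coefficient q₀ q₁ q₂ q₃ coeffs
          (embed-injective (trans embed≡ (sym (cubicForm-coefficients coeffs)))) (basis-norm a₁ a₂ a≐α pos F)

    private
      integral-form : ∀ a₁ a₂ → span a₁ a₂ ≐ span α₁ α₂ → Positive β a₁ a₂ → (F : NormForm a₁ a₂) → ∀ g →
        IsCoefficient F β g → ∃[ x ] embed x ≡ cubicForm g (τ a₁) (τ a₂)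
      integral-form a₁ a₂ a≐α pos F g g-coefficient = finish (coefficients F β g g-coefficient (basis-cube a₁ a₂ a≐α pos))
        where
        finish : ∃[ q₀ ] ∃[ q₁ ] ∃[ q₂ ] ∃[ q₃ ] HasCoefficients g (τ a₁) (τ a₂) q₀ q₁ q₂ q₃ → ∃[ x ] embed x ≡ cubicForm g (τ a₁) (τ a₂)
        finish (q₀ , q₁ , q₂ , q₃ , coeffs) = form q₀ (+ 3 ℤ.* q₁) (+ 3 ℤ.* q₂) q₃ , cubicForm-coefficients coeffs

      transport : ∀ {X Y : Form ℚ} → X ≡ Y → ∃[ x ] embed x ≡ X → ∃[ x ] embed x ≡ Y
      transport X≡Y (x , eq) = x , trans eq X≡Y

      realisable-positive : ∀ a₁ a₂ → span a₁ a₂ ≐ span α₁ α₂ → Positive β a₁ a₂ → 0ℚ < det a₁ a₂ →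
        (F : NormForm a₁ a₂) → ∀ g → IsCoefficient F β g → ∃[ x ] embed x ≡ ΨForm c a₁ a₂ β
      realisable-positive a₁ a₂ a≐α pos 0<d F g g-coefficient =
        transport (sym (ΨForm-positive a₁ a₂ F β g g-coefficient 0<d)) (integral-form a₁ a₂ a≐α pos F g g-coefficient)

      realisable-negative : ∀ a₁ a₂ → span a₁ a₂ ≐ span α₁ α₂ → Positive β a₁ a₂ → det a₁ a₂ < 0ℚ →
        (F : NormForm a₁ a₂) → ∀ g → IsCoefficient F β g → ∃[ x ] embed x ≡ ΨForm c (neg a₁) (neg a₂) β
      realisable-negative a₁ a₂ a≐α pos d<0 F g g-coefficient =
        transport (sym (ΨForm-negative a₁ a₂ F β g g-coefficient d<0)) (integral-form a₁ a₂ a≐α pos F g g-coefficient)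

    opaque
      realisable : ∀ a₁ a₂ → span a₁ a₂ ≐ span α₁ α₂ → Positive β a₁ a₂ → ∃[ x ] embed x ≡ ΨForm c a₁ a₂ β
      realisable a₁ a₂ a≐α pos = go (ℚ.<-cmp (det a₁ a₂) 0ℚ)
        where
        positive-case : Datum b a₁ a₂ β → 0ℚ < det a₁ a₂ → ∃[ x ] embed x ≡ ΨForm c a₁ a₂ β
        positive-case a-datum 0<d = realisable-positive a₁ a₂ a≐α pos 0<d (datum-normForm a-datum) _
          (coefficient-isCoefficient (datum-normForm a-datum) β)
        negative-case : span (neg a₁) (neg a₂) ≐ span α₁ α₂ → Datum b (neg a₁) (neg a₂) β → det a₁ a₂ < 0ℚ →
          ∃[ x ] embed x ≡ ΨForm c a₁ a₂ β
        negative-case a′≐α a-datum d<0 = transport (cong₂ (λ u v → ΨForm c u v β) (neg-involutive a₁) (neg-involutive a₂))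
          (realisable-negative (neg a₁) (neg a₂) a′≐α (positive-neg β a₁ a₂ pos) (subst (_< 0ℚ) (sym (det-neg a₁ a₂)) d<0)
            (datum-normForm a-datum) _ (coefficient-isCoefficient (datum-normForm a-datum) β))
        go : Tri (det a₁ a₂ < 0ℚ) (det a₁ a₂ ≡ 0ℚ) (0ℚ < det a₁ a₂) → ∃[ x ] embed x ≡ ΨForm c a₁ a₂ β
        go (tri> _ _ 0<d) = positive-case (admissible-datum d a₁ a₂ a≐α pos) 0<d
        go (tri≈ _ d≡0 _) = ⊥-elim (positive⇒indep β a₁ a₂ pos d≡0)
        go (tri< d<0 _ _) = negative-case (≐-trans (span-neg a₁ a₂) a≐α)
          (admissible-datum d (neg a₁) (neg a₂) (≐-trans (span-neg a₁ a₂) a≐α) (positive-neg β a₁ a₂ pos)) d<0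

  presentation⇒invariants : ∀ {b α₁ α₂ β x} (P : Presentation b α₁ α₂ β x) → let open NormForm (Presentation.normForm P) in
    FormInvariants D b c x f₀ (+ 2 ℤ.* h ℤ.+ p) f₂
  presentation⇒invariants {b} {β = β} P = record
    { q₀ = q₀ ; q₁ = q₁ ; q₂ = q₂ ; q₃ = q₃ ; x≡ = x≡
    ; hessian₀ = hessian₀ normForm β g g-coefficient b Nm-β coeffs
    ; hessian₁ = hessian₁ normForm β g g-coefficient b Nm-β coeffs
    ; hessian₂ = hessian₂ normForm β g g-coefficient b Nm-β coeffs
    ; u₀ = u₀ ; u₁ = u₁ ; u₂ = u₂ ; coprime = coprime
    ; discriminant = normForm-discriminant normForm }
    where
    open Presentation P
    open NormForm normForm

  module _ {b₁ b₂ b₁′ b₂′ : K} (G : NormForm b₁ b₂) (F : NormForm b₁′ b₂′) where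
    private
      module F = NormForm F
      module G = NormForm G

    μ-scaled : ∀ r → det b₁ b₂ ≡ r * det b₁′ b₂′ → G.μ * r ≡ F.μ
    μ-scaled r det≡ = begin
      G.μ * r ≡⟨ ℚ.*-identityʳ (G.μ * r) ⟨
      G.μ * r * 1ℚ ≡⟨ cong (G.μ * r *_) F.ν*μ≡1 ⟨
      G.μ * r * (F.ν * F.μ) ≡⟨ regroup G.μ r F.ν F.μ ⟩
      r * F.ν * G.μ * F.μ ≡⟨ cong (λ x → x * G.μ * F.μ) ν≡ ⟨
      G.ν * G.μ * F.μ ≡⟨ cong (_* F.μ) G.ν*μ≡1 ⟩
      1ℚ * F.μ ≡⟨ ℚ.*-identityˡ F.μ ⟩
      F.μ ∎
      where
      regroup : ∀ m r n k → m * r * (n * k) ≡ r * n * m * k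
      regroup = solve-∀ ℚ-ring
      ν≡ : G.ν ≡ r * F.ν
      ν≡ = *-cancelˡ ½C≢0 (begin
        ½ * C * G.ν ≡⟨ ℚ.*-comm (½ * C) G.ν ⟩
        G.ν * (½ * C) ≡⟨ G.ν-det ⟩
        det b₁ b₂ ≡⟨ det≡ ⟩
        r * det b₁′ b₂′ ≡⟨ cong (r *_) F.ν-det ⟨
        r * (F.ν * (½ * C)) ≡⟨ shuffle r F.ν (½ * C) ⟩
        ½ * C * (r * F.ν) ∎)
        where
        shuffle : ∀ r n h → r * (n * h) ≡ h * (r * n)
        shuffle = solve-∀ ℚ-ring

    -- Multiplying 𝔞 by ρ and β by ρ³ changes the coefficient by τ(ρ)⁻³.
    scaled-coefficient : ∀ ρ β β′ g′ → det b₁ b₂ ≡ Nm ρ * det b₁′ b₂′ → cube ρ ⊗ β ≡ β′ → IsCoefficient G β′ g′ →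
      IsCoefficient F β (g′ ⊗ (τ ρ ⊗ τ ρ ⊗ τ ρ))
    scaled-coefficient ρ β β′ g′ det≡ ρ³β≡β′ g′-coefficient = begin
      S√ ⊗ (g′ ⊗ (τ ρ ⊗ τ ρ ⊗ τ ρ)) ≡⟨ ⊗-assoc S√ g′ (τ ρ ⊗ τ ρ ⊗ τ ρ) ⟨
      (S√ ⊗ g′) ⊗ (τ ρ ⊗ τ ρ ⊗ τ ρ) ≡⟨ cong (_⊗ (τ ρ ⊗ τ ρ ⊗ τ ρ)) g′-coefficient ⟩
      (β′ ⊗ (M′ ⊗ M′ ⊗ M′)) ⊗ (τ ρ ⊗ τ ρ ⊗ τ ρ) ≡⟨ cong (λ x → (x ⊗ (M′ ⊗ M′ ⊗ M′)) ⊗ (τ ρ ⊗ τ ρ ⊗ τ ρ)) ρ³β≡β′ ⟨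
      ((ρ ⊗ ρ ⊗ ρ ⊗ β) ⊗ (M′ ⊗ M′ ⊗ M′)) ⊗ (τ ρ ⊗ τ ρ ⊗ τ ρ) ≡⟨ regroup ρ (τ ρ) β M′ ⟩
      β ⊗ ((M′ ⊗ (ρ ⊗ τ ρ)) ⊗ (M′ ⊗ (ρ ⊗ τ ρ)) ⊗ (M′ ⊗ (ρ ⊗ τ ρ))) ≡⟨ cong (λ m → β ⊗ (m ⊗ m ⊗ m)) M′Nρ≡M ⟩
      β ⊗ (M ⊗ M ⊗ M) ∎
      where
      M = fromℚ F.μ
      M′ = fromℚ G.μ
      regroup : ∀ r r′ b m → ((r ⊗ r ⊗ r ⊗ b) ⊗ (m ⊗ m ⊗ m)) ⊗ (r′ ⊗ r′ ⊗ r′) ≡ b ⊗ ((m ⊗ (r ⊗ r′)) ⊗ (m ⊗ (r ⊗ r′)) ⊗ (m ⊗ (r ⊗ r′)))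
      regroup = solve 4 (λ r r′ b m → ((r :* r :* r :* b) :* (m :* m :* m)) :* (r′ :* r′ :* r′) := b :* ((m :* (r :* r′)) :* (m :* (r :* r′)) :* (m :* (r :* r′)))) refl
      M′Nρ≡M : M′ ⊗ (ρ ⊗ τ ρ) ≡ M
      M′Nρ≡M = begin
        M′ ⊗ (ρ ⊗ τ ρ) ≡⟨ cong (M′ ⊗_) (fromℚ-Nm ρ) ⟩
        M′ ⊗ fromℚ (Nm ρ) ≡⟨ fromℚ-* G.μ (Nm ρ) ⟨
        fromℚ (G.μ * Nm ρ) ≡⟨ cong fromℚ (μ-scaled (Nm ρ) det≡) ⟩
        M ∎

  cubicForm-scaled : ∀ g t A B → cubicForm g (t ⊗ A) (t ⊗ B) ≡ cubicForm (g ⊗ (t ⊗ t ⊗ t)) A B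
  cubicForm-scaled g t A B = form-≡ (cong Tr (edge g t A)) (cong Tr (middle g (fromℤ (+ 3)) t A A B))
    (cong Tr (middle g (fromℤ (+ 3)) t A B B)) (cong Tr (edge g t B))
    where
    edge : ∀ g t a → g ⊗ (t ⊗ a) ⊗ (t ⊗ a) ⊗ (t ⊗ a) ≡ g ⊗ (t ⊗ t ⊗ t) ⊗ a ⊗ a ⊗ a
    edge = solve 3 (λ g t a → g :* (t :* a) :* (t :* a) :* (t :* a) := g :* (t :* t :* t) :* a :* a :* a) refl
    middle : ∀ g n t a b c → g ⊗ n ⊗ (t ⊗ a) ⊗ (t ⊗ b) ⊗ (t ⊗ c) ≡ g ⊗ (t ⊗ t ⊗ t) ⊗ n ⊗ a ⊗ b ⊗ c
    middle = solve 6 (λ g n t a b c → g :* n :* (t :* a) :* (t :* b) :* (t :* c) := g :* (t :* t :* t) :* n :* a :* b :* c) refl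

  τ-combination : ∀ m n a b → τ (fromℤ m ⊗ a ⊕ fromℤ n ⊗ b) ≡ fromℤ m ⊗ τ a ⊕ fromℤ n ⊗ τ b
  τ-combination m n a b = trans (τ-⊕ (fromℤ m ⊗ a) (fromℤ n ⊗ b)) (cong₂ _⊕_ (τ-⊗ (fromℤ m) a) (τ-⊗ (fromℤ n) b))

  module _ {b : ℕ} {α₁ α₂ β α₁′ α₂′ β′ : K} {x y : L}
    (P : Presentation b α₁ α₂ β x) (Q : Presentation b α₁′ α₂′ β′ y)
    (ρ : K) (ρ-unit : Unit ρ) (ρα≐α′ : (ρ • span α₁ α₂) ≐ span α₁′ α₂′) (ρ³β≡β′ : cube ρ ⊗ β ≡ β′) where
    private
      module P = Presentation P
      module Q = Presentation Q

      Combination : K → K → K → Set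
      Combination a₁ a₂ z = ∃[ m ] ∃[ n ] z ≡ fromℤ m ⊗ a₁ ⊕ fromℤ n ⊗ a₂

      forward : ∀ z → span Q.a₁ Q.a₂ z → ∃[ m ] ∃[ n ] z ≡ ρ ⊗ (fromℤ m ⊗ P.a₁ ⊕ fromℤ n ⊗ P.a₂)
      forward z z∈ = go (≐⇒⊇ ρα≐α′ z (≐⇒⊆ Q.basis z z∈))
        where
        finish : ∀ w → ρ ⊗ w ≡ z → Combination P.a₁ P.a₂ w → ∃[ m ] ∃[ n ] z ≡ ρ ⊗ (fromℤ m ⊗ P.a₁ ⊕ fromℤ n ⊗ P.a₂)
        finish w eq (m , n , eq′) = m , n , trans (sym eq) (cong (ρ ⊗_) eq′)
        go : (ρ • span α₁ α₂) z → ∃[ m ] ∃[ n ] z ≡ ρ ⊗ (fromℤ m ⊗ P.a₁ ⊕ fromℤ n ⊗ P.a₂)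
        go (w , w∈ , eq) = finish w eq (span-elim P.a₁ P.a₂ w (≐⇒⊇ P.basis w w∈))

      backward : ∀ z → span P.a₁ P.a₂ z → Combination Q.a₁ Q.a₂ (ρ ⊗ z)
      backward z z∈ = span-elim Q.a₁ Q.a₂ (ρ ⊗ z) (≐⇒⊇ Q.basis (ρ ⊗ z) (≐⇒⊆ ρα≐α′ (ρ ⊗ z)
        (z , ≐⇒⊆ P.basis z z∈ , refl)))

      d d′ : ℚ
      d = det P.a₁ P.a₂
      d′ = det Q.a₁ Q.a₂

      -- Comparing determinants in both directions gives kk′ = 1, so k = ±1. The two orientations
      -- fix the sign, because N(β′)·d′ = k·N(ρ)⁴·N(β)·d. With k = 1 the scalars of the two forms
      -- differ exactly by τ(ρ)³.
      conclude : ∀ m n r s m′ n′ r′ s′ →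
        Q.a₁ ≡ ρ ⊗ (fromℤ m ⊗ P.a₁ ⊕ fromℤ n ⊗ P.a₂) → Q.a₂ ≡ ρ ⊗ (fromℤ r ⊗ P.a₁ ⊕ fromℤ s ⊗ P.a₂) →
        ρ ⊗ P.a₁ ≡ fromℤ m′ ⊗ Q.a₁ ⊕ fromℤ n′ ⊗ Q.a₂ → ρ ⊗ P.a₂ ≡ fromℤ r′ ⊗ Q.a₁ ⊕ fromℤ s′ ⊗ Q.a₂ → x ∼Γ y
      conclude m n r s m′ n′ r′ s′ eq₁ eq₂ eq₁′ eq₂′ = mat m n r s k≡1 , embed-injective (begin
        embed (act (mat m n r s k≡1) x)
          ≡⟨ act-cubicForm m n r s k≡1 P.g (τ P.a₁) (τ P.a₂) x P.embed≡ ⟩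
        cubicForm P.g (fromℤ m ⊗ τ P.a₁ ⊕ fromℤ n ⊗ τ P.a₂) (fromℤ r ⊗ τ P.a₁ ⊕ fromℤ s ⊗ τ P.a₂)
          ≡⟨ cong₂ (cubicForm P.g) (τ-combination m n P.a₁ P.a₂) (τ-combination r s P.a₁ P.a₂) ⟨
        cubicForm P.g (τ w₁) (τ w₂)
          ≡⟨ cong (λ u → cubicForm u (τ w₁) (τ w₂)) g≡ ⟨
        cubicForm (Q.g ⊗ (τ ρ ⊗ τ ρ ⊗ τ ρ)) (τ w₁) (τ w₂)
          ≡⟨ cubicForm-scaled Q.g (τ ρ) (τ w₁) (τ w₂) ⟨
        cubicForm Q.g (τ ρ ⊗ τ w₁) (τ ρ ⊗ τ w₂)
          ≡⟨ cong₂ (cubicForm Q.g) (trans (cong τ eq₁) (τ-⊗ ρ w₁)) (trans (cong τ eq₂) (τ-⊗ ρ w₂)) ⟨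
        cubicForm Q.g (τ Q.a₁) (τ Q.a₂)
          ≡⟨ Q.embed≡ ⟨
        embed y ∎)
        where
        w₁ = fromℤ m ⊗ P.a₁ ⊕ fromℤ n ⊗ P.a₂
        w₂ = fromℤ r ⊗ P.a₁ ⊕ fromℤ s ⊗ P.a₂
        k k′ : ℤ
        k = m ℤ.* s ℤ.- n ℤ.* r
        k′ = m′ ℤ.* s′ ℤ.- n′ ℤ.* r′
        d′≡ : d′ ≡ Nm ρ * (toℚ k * d)
        d′≡ = trans (cong₂ det eq₁ eq₂) (trans (det-⊗ ρ w₁ w₂) (cong (Nm ρ *_) (det-basis m n r s P.a₁ P.a₂)))
        Nρd≡ : Nm ρ * d ≡ toℚ k′ * d′
        Nρd≡ = trans (sym (det-⊗ ρ P.a₁ P.a₂)) (trans (cong₂ det eq₁′ eq₂′) (det-basis m′ n′ r′ s′ Q.a₁ Q.a₂))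
        kk′≡1 : k ℤ.* k′ ≡ + 1
        kk′≡1 = toℚ-injective (*-cancelˡ (*-≢0 ρ-unit (independent P.normForm)) (begin
          Nm ρ * d * toℚ (k ℤ.* k′) ≡⟨ cong (Nm ρ * d *_) (toℚ-* k k′) ⟩
          Nm ρ * d * (toℚ k * toℚ k′) ≡⟨ shuffle (Nm ρ) d (toℚ k) (toℚ k′) ⟩
          toℚ k′ * (Nm ρ * (toℚ k * d)) ≡⟨ cong (toℚ k′ *_) d′≡ ⟨
          toℚ k′ * d′ ≡⟨ Nρd≡ ⟨
          Nm ρ * d ≡⟨ ℚ.*-identityʳ (Nm ρ * d) ⟨
          Nm ρ * d * 1ℚ ∎))
          where
          shuffle : ∀ n d i f → n * d * (i * f) ≡ f * (n * (i * d))
          shuffle = solve-∀ ℚ-ring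
        0<k : 0ℚ < toℚ k
        0<k = pos-cancelʳ {Nm ρ * Nm ρ * (Nm ρ * Nm ρ) * (Nm β * d)}
          (*-pos (*-pos (square-pos ρ-unit) (square-pos ρ-unit)) P.positive)
          (subst (0ℚ <_) (begin
            Nm β′ * d′ ≡⟨ cong₂ _*_ (sym Nm-β′) d′≡ ⟩
            Nm ρ * Nm ρ * Nm ρ * Nm β * (Nm ρ * (toℚ k * d)) ≡⟨ regroup (Nm ρ) (Nm β) (toℚ k) d ⟩
            toℚ k * (Nm ρ * Nm ρ * (Nm ρ * Nm ρ) * (Nm β * d)) ∎) Q.positive)
          where
          regroup : ∀ r b i d → r * r * r * b * (r * (i * d)) ≡ i * (r * r * (r * r) * (b * d))
          regroup = solve-∀ ℚ-ring
          Nm-β′ : Nm ρ * Nm ρ * Nm ρ * Nm β ≡ Nm β′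
          Nm-β′ = sym (begin
            Nm β′ ≡⟨ cong Nm ρ³β≡β′ ⟨
            Nm (ρ ⊗ ρ ⊗ ρ ⊗ β) ≡⟨ Nm-⊗ (ρ ⊗ ρ ⊗ ρ) β ⟩
            Nm (ρ ⊗ ρ ⊗ ρ) * Nm β ≡⟨ cong (_* Nm β) (trans (Nm-⊗ (ρ ⊗ ρ) ρ) (cong (_* Nm ρ) (Nm-⊗ ρ ρ))) ⟩
            Nm ρ * Nm ρ * Nm ρ * Nm β ∎)
        k≡1 : k ≡ + 1
        k≡1 = decide (abs≡1⇒±1 k (unit-abs k k′ kk′≡1))
          where
          decide : k ≡ + 1 ⊎ k ≡ ℤ.- + 1 → k ≡ + 1
          decide (inj₁ eq) = eq
          decide (inj₂ eq) = ⊥-elim (ℚ.<-asym 0<k (subst (λ i → toℚ i < 0ℚ) (sym eq) (ℚ.*<* ℤ.-<+)))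
        g≡ : Q.g ⊗ (τ ρ ⊗ τ ρ ⊗ τ ρ) ≡ P.g
        g≡ = S√-cancel (Q.g ⊗ (τ ρ ⊗ τ ρ ⊗ τ ρ)) P.g (trans
          (scaled-coefficient Q.normForm P.normForm ρ β β′ Q.g
            (trans d′≡ (cong (Nm ρ *_) (trans (cong (λ i → toℚ i * d) k≡1) (ℚ.*-identityˡ d)))) ρ³β≡β′ Q.g-coefficient)
          (sym P.g-coefficient))

    equivalent⇒∼Γ : x ∼Γ y
    equivalent⇒∼Γ = go (forward Q.a₁ (α₁∈span Q.a₁ Q.a₂)) (forward Q.a₂ (α₂∈span Q.a₁ Q.a₂))
      (backward P.a₁ (α₁∈span P.a₁ P.a₂)) (backward P.a₂ (α₂∈span P.a₁ P.a₂))
      where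
      go : (∃[ m ] ∃[ n ] Q.a₁ ≡ ρ ⊗ (fromℤ m ⊗ P.a₁ ⊕ fromℤ n ⊗ P.a₂)) →
        (∃[ m ] ∃[ n ] Q.a₂ ≡ ρ ⊗ (fromℤ m ⊗ P.a₁ ⊕ fromℤ n ⊗ P.a₂)) →
        Combination Q.a₁ Q.a₂ (ρ ⊗ P.a₁) → Combination Q.a₁ Q.a₂ (ρ ⊗ P.a₂) → x ∼Γ y
      go (m , n , eq₁) (r , s , eq₂) (m′ , n′ , eq₁′) (r′ , s′ , eq₂′) =
        conclude m n r s m′ n′ r′ s′ eq₁ eq₂ eq₁′ eq₂′

  -- Two presentations of one form have the same primitive Hessian, so the products αᵢᾱⱼ agree;
  -- hence the bases are proportional, by ρ = Σ uᵢⱼ bᵢāⱼ where Σ uᵢⱼ aᵢāⱼ = 1.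
  module _ {b : ℕ} {α₁ α₂ β α₁′ α₂′ β′ : K} {x : L}
    (P : Presentation b α₁ α₂ β x) (Q : Presentation b α₁′ α₂′ β′ x)
    (f₀≡ : NormForm.f₀ (Presentation.normForm P) ≡ NormForm.f₀ (Presentation.normForm Q))
    (h≡ : NormForm.h (Presentation.normForm P) ≡ NormForm.h (Presentation.normForm Q))
    (f₂≡ : NormForm.f₂ (Presentation.normForm P) ≡ NormForm.f₂ (Presentation.normForm Q)) where
    private
      module P = Presentation P
      module Q = Presentation Q
      module F = NormForm P.normForm
      module G = NormForm Q.normForm

      a₁ a₂ b₁ b₂ ā₁ ā₂ b̄₁ b̄₂ : K
      a₁ = P.a₁
      a₂ = P.a₂
      b₁ = Q.a₁
      b₂ = Q.a₂
      ā₁ = F.ᾱ₁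
      ā₂ = F.ᾱ₂
      b̄₁ = G.ᾱ₁
      b̄₂ = G.ᾱ₂

      -- The difference is annihilated by b̄₁ and b̄₂, because bᵢb̄ⱼ = aᵢāⱼ.
      collinear : b₂ ⊗ a₁ ≡ b₁ ⊗ a₂
      collinear = begin
        b₂ ⊗ a₁ ≡⟨ split (b₂ ⊗ a₁) (b₁ ⊗ a₂) ⟩
        (b₂ ⊗ a₁ ⊖ b₁ ⊗ a₂) ⊕ b₁ ⊗ a₂ ≡⟨ cong (_⊕ b₁ ⊗ a₂) difference≡0 ⟩
        fromℚ 0ℚ ⊕ b₁ ⊗ a₂ ≡⟨ ⊕-identityˡ (b₁ ⊗ a₂) ⟩
        b₁ ⊗ a₂ ∎
        where
        split : ∀ x y → x ≡ (x ⊖ y) ⊕ y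
        split = solve 2 (λ x y → x := (x :- y) :+ y) refl
        step : ∀ ā b̄ → b₂ ⊗ b̄ ≡ a₂ ⊗ ā → b₁ ⊗ b̄ ≡ a₁ ⊗ ā → (b₂ ⊗ a₁ ⊖ b₁ ⊗ a₂) ⊗ b̄ ≡ fromℚ 0ℚ
        step ā b̄ eq₂ eq₁ = begin
          (b₂ ⊗ a₁ ⊖ b₁ ⊗ a₂) ⊗ b̄ ≡⟨ distribute b₂ a₁ b₁ a₂ b̄ ⟩
          (b₂ ⊗ b̄) ⊗ a₁ ⊖ (b₁ ⊗ b̄) ⊗ a₂ ≡⟨ cong₂ (λ u v → u ⊗ a₁ ⊖ v ⊗ a₂) eq₂ eq₁ ⟩
          (a₂ ⊗ ā) ⊗ a₁ ⊖ (a₁ ⊗ ā) ⊗ a₂ ≡⟨ cancel a₁ a₂ ā ⟩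
          fromℚ 0ℚ ∎
          where
          distribute : ∀ b₂ a₁ b₁ a₂ c → (b₂ ⊗ a₁ ⊖ b₁ ⊗ a₂) ⊗ c ≡ (b₂ ⊗ c) ⊗ a₁ ⊖ (b₁ ⊗ c) ⊗ a₂
          distribute = solve 5 (λ b₂ a₁ b₁ a₂ c → (b₂ :* a₁ :- b₁ :* a₂) :* c := (b₂ :* c) :* a₁ :- (b₁ :* c) :* a₂) refl
          cancel : ∀ a₁ a₂ c → (a₂ ⊗ c) ⊗ a₁ ⊖ (a₁ ⊗ c) ⊗ a₂ ≡ fromℚ 0ℚ
          cancel = solve 3 (λ a₁ a₂ c → (a₂ :* c) :* a₁ :- (a₁ :* c) :* a₂ := con (+ 0)) refl
        difference≡0 : b₂ ⊗ a₁ ⊖ b₁ ⊗ a₂ ≡ fromℚ 0ℚ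
        difference≡0 = dual-vanish Q.normForm (b₂ ⊗ a₁ ⊖ b₁ ⊗ a₂)
          (step ā₁ b̄₁ (trans G.α₂ᾱ₁ (trans (cong (λ i → fromℤ i ⊕ θ) (sym h≡)) (sym F.α₂ᾱ₁)))
                      (trans G.α₁ᾱ₁ (trans (cong fromℤ (sym f₀≡)) (sym F.α₁ᾱ₁))))
          (step ā₂ b̄₂ (trans G.α₂ᾱ₂ (trans (cong fromℤ (sym f₂≡)) (sym F.α₂ᾱ₂)))
                      (trans G.α₁ᾱ₂ (trans (cong (λ i → fromℤ i ⊕ τ θ) (sym h≡)) (sym F.α₁ᾱ₂))))

      U₀ U₁ U₂ : K
      U₀ = fromℤ F.u₀
      U₁ = fromℤ F.u₁
      U₂ = fromℤ F.u₂

      ρ : K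
      ρ = U₀ ⊗ (b₁ ⊗ ā₁) ⊕ U₁ ⊗ ((b₁ ⊗ ā₂) ⊕ (b₂ ⊗ ā₁)) ⊕ U₂ ⊗ (b₂ ⊗ ā₂)

      -- `collinear` trades b₂a₁ for b₁a₂, after which b₁ factors out of the sum that represents 1.
      ρa₁≡b₁ : ρ ⊗ a₁ ≡ b₁
      ρa₁≡b₁ = begin
        ρ ⊗ a₁
          ≡⟨ isolate U₀ U₁ U₂ a₁ b₁ b₂ ā₁ ā₂ ⟩
        U₀ ⊗ (b₁ ⊗ ā₁) ⊗ a₁ ⊕ U₁ ⊗ (b₁ ⊗ ā₂) ⊗ a₁ ⊕ (U₁ ⊗ ā₁ ⊕ U₂ ⊗ ā₂) ⊗ (b₂ ⊗ a₁)
          ≡⟨ cong (λ u → U₀ ⊗ (b₁ ⊗ ā₁) ⊗ a₁ ⊕ U₁ ⊗ (b₁ ⊗ ā₂) ⊗ a₁ ⊕ (U₁ ⊗ ā₁ ⊕ U₂ ⊗ ā₂) ⊗ u) collinear ⟩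
        U₀ ⊗ (b₁ ⊗ ā₁) ⊗ a₁ ⊕ U₁ ⊗ (b₁ ⊗ ā₂) ⊗ a₁ ⊕ (U₁ ⊗ ā₁ ⊕ U₂ ⊗ ā₂) ⊗ (b₁ ⊗ a₂)
          ≡⟨ collect U₀ U₁ U₂ a₁ a₂ b₁ ā₁ ā₂ ⟩
        b₁ ⊗ (U₀ ⊗ (a₁ ⊗ ā₁) ⊕ U₁ ⊗ ((a₁ ⊗ ā₂) ⊕ (a₂ ⊗ ā₁)) ⊕ U₂ ⊗ (a₂ ⊗ ā₂))
          ≡⟨ cong (b₁ ⊗_) (dual-combination P.normForm) ⟩
        b₁ ⊗ one
          ≡⟨ ⊗-identityʳ b₁ ⟩
        b₁ ∎
        where
        isolate : ∀ u₀ u₁ u₂ a₁ b₁ b₂ ā₁ ā₂ → (u₀ ⊗ (b₁ ⊗ ā₁) ⊕ u₁ ⊗ ((b₁ ⊗ ā₂) ⊕ (b₂ ⊗ ā₁)) ⊕ u₂ ⊗ (b₂ ⊗ ā₂)) ⊗ a₁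
          ≡ u₀ ⊗ (b₁ ⊗ ā₁) ⊗ a₁ ⊕ u₁ ⊗ (b₁ ⊗ ā₂) ⊗ a₁ ⊕ (u₁ ⊗ ā₁ ⊕ u₂ ⊗ ā₂) ⊗ (b₂ ⊗ a₁)
        isolate = solve 8 (λ u₀ u₁ u₂ a₁ b₁ b₂ ā₁ ā₂ → (u₀ :* (b₁ :* ā₁) :+ u₁ :* ((b₁ :* ā₂) :+ (b₂ :* ā₁)) :+ u₂ :* (b₂ :* ā₂)) :* a₁
          := u₀ :* (b₁ :* ā₁) :* a₁ :+ u₁ :* (b₁ :* ā₂) :* a₁ :+ (u₁ :* ā₁ :+ u₂ :* ā₂) :* (b₂ :* a₁)) refl
        collect : ∀ u₀ u₁ u₂ a₁ a₂ b₁ ā₁ ā₂ → u₀ ⊗ (b₁ ⊗ ā₁) ⊗ a₁ ⊕ u₁ ⊗ (b₁ ⊗ ā₂) ⊗ a₁ ⊕ (u₁ ⊗ ā₁ ⊕ u₂ ⊗ ā₂) ⊗ (b₁ ⊗ a₂)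
          ≡ b₁ ⊗ (u₀ ⊗ (a₁ ⊗ ā₁) ⊕ u₁ ⊗ ((a₁ ⊗ ā₂) ⊕ (a₂ ⊗ ā₁)) ⊕ u₂ ⊗ (a₂ ⊗ ā₂))
        collect = solve 8 (λ u₀ u₁ u₂ a₁ a₂ b₁ ā₁ ā₂ → u₀ :* (b₁ :* ā₁) :* a₁ :+ u₁ :* (b₁ :* ā₂) :* a₁ :+ (u₁ :* ā₁ :+ u₂ :* ā₂) :* (b₁ :* a₂)
          := b₁ :* (u₀ :* (a₁ :* ā₁) :+ u₁ :* ((a₁ :* ā₂) :+ (a₂ :* ā₁)) :+ u₂ :* (a₂ :* ā₂))) refl

      ρa₂≡b₂ : ρ ⊗ a₂ ≡ b₂
      ρa₂≡b₂ = begin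
        ρ ⊗ a₂
          ≡⟨ isolate U₀ U₁ U₂ a₂ b₁ b₂ ā₁ ā₂ ⟩
        (U₀ ⊗ ā₁ ⊕ U₁ ⊗ ā₂) ⊗ (b₁ ⊗ a₂) ⊕ U₁ ⊗ (b₂ ⊗ ā₁) ⊗ a₂ ⊕ U₂ ⊗ (b₂ ⊗ ā₂) ⊗ a₂
          ≡⟨ cong (λ u → (U₀ ⊗ ā₁ ⊕ U₁ ⊗ ā₂) ⊗ u ⊕ U₁ ⊗ (b₂ ⊗ ā₁) ⊗ a₂ ⊕ U₂ ⊗ (b₂ ⊗ ā₂) ⊗ a₂) collinear ⟨
        (U₀ ⊗ ā₁ ⊕ U₁ ⊗ ā₂) ⊗ (b₂ ⊗ a₁) ⊕ U₁ ⊗ (b₂ ⊗ ā₁) ⊗ a₂ ⊕ U₂ ⊗ (b₂ ⊗ ā₂) ⊗ a₂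
          ≡⟨ collect U₀ U₁ U₂ a₁ a₂ b₂ ā₁ ā₂ ⟩
        b₂ ⊗ (U₀ ⊗ (a₁ ⊗ ā₁) ⊕ U₁ ⊗ ((a₁ ⊗ ā₂) ⊕ (a₂ ⊗ ā₁)) ⊕ U₂ ⊗ (a₂ ⊗ ā₂))
          ≡⟨ cong (b₂ ⊗_) (dual-combination P.normForm) ⟩
        b₂ ⊗ one
          ≡⟨ ⊗-identityʳ b₂ ⟩
        b₂ ∎
        where
        isolate : ∀ u₀ u₁ u₂ a₂ b₁ b₂ ā₁ ā₂ → (u₀ ⊗ (b₁ ⊗ ā₁) ⊕ u₁ ⊗ ((b₁ ⊗ ā₂) ⊕ (b₂ ⊗ ā₁)) ⊕ u₂ ⊗ (b₂ ⊗ ā₂)) ⊗ a₂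
          ≡ (u₀ ⊗ ā₁ ⊕ u₁ ⊗ ā₂) ⊗ (b₁ ⊗ a₂) ⊕ u₁ ⊗ (b₂ ⊗ ā₁) ⊗ a₂ ⊕ u₂ ⊗ (b₂ ⊗ ā₂) ⊗ a₂
        isolate = solve 8 (λ u₀ u₁ u₂ a₂ b₁ b₂ ā₁ ā₂ → (u₀ :* (b₁ :* ā₁) :+ u₁ :* ((b₁ :* ā₂) :+ (b₂ :* ā₁)) :+ u₂ :* (b₂ :* ā₂)) :* a₂
          := (u₀ :* ā₁ :+ u₁ :* ā₂) :* (b₁ :* a₂) :+ u₁ :* (b₂ :* ā₁) :* a₂ :+ u₂ :* (b₂ :* ā₂) :* a₂) refl
        collect : ∀ u₀ u₁ u₂ a₁ a₂ b₂ ā₁ ā₂ → (u₀ ⊗ ā₁ ⊕ u₁ ⊗ ā₂) ⊗ (b₂ ⊗ a₁) ⊕ u₁ ⊗ (b₂ ⊗ ā₁) ⊗ a₂ ⊕ u₂ ⊗ (b₂ ⊗ ā₂) ⊗ a₂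
          ≡ b₂ ⊗ (u₀ ⊗ (a₁ ⊗ ā₁) ⊕ u₁ ⊗ ((a₁ ⊗ ā₂) ⊕ (a₂ ⊗ ā₁)) ⊕ u₂ ⊗ (a₂ ⊗ ā₂))
        collect = solve 8 (λ u₀ u₁ u₂ a₁ a₂ b₂ ā₁ ā₂ → (u₀ :* ā₁ :+ u₁ :* ā₂) :* (b₂ :* a₁) :+ u₁ :* (b₂ :* ā₁) :* a₂ :+ u₂ :* (b₂ :* ā₂) :* a₂
          := b₂ :* (u₀ :* (a₁ :* ā₁) :+ u₁ :* ((a₁ :* ā₂) :+ (a₂ :* ā₁)) :+ u₂ :* (a₂ :* ā₂))) refl

      det-b : det b₁ b₂ ≡ Nm ρ * det a₁ a₂
      det-b = trans (cong₂ det (sym ρa₁≡b₁) (sym ρa₂≡b₂)) (det-⊗ ρ a₁ a₂)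

      ρ-unit : Unit ρ
      ρ-unit Nρ≡0 = independent Q.normForm (trans det-b (trans (cong (_* det a₁ a₂) Nρ≡0) (ℚ.*-zeroˡ (det a₁ a₂))))

      g′ : K
      g′ = Q.g ⊗ (τ ρ ⊗ τ ρ ⊗ τ ρ)

      -- Since bᵢ = ρaᵢ, the second presentation in terms of the aᵢ has scalar `g′`. Both scalars
      -- have the same four traces against a₁ and a₂, and these determine the scalar.
      g′≡g : g′ ≡ P.g
      g′≡g = begin
        g′ ≡⟨ solve 2 (λ x y → x := (x :- y) :+ y) refl g′ P.g ⟩
        (g′ ⊖ P.g) ⊕ P.g ≡⟨ cong (_⊕ P.g) (cubic-nondegenerate P.normForm (g′ ⊖ P.g)
                                      (vanish a₁ a₁ a₁ b₁ b₁ b₁ ρa₁≡b₁ ρa₁≡b₁ ρa₁≡b₁ (trans QC.Tr₀ (trans (cong toℚ (sym q₀≡)) (sym PC.Tr₀))))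
                                      (vanish a₁ a₁ a₂ b₁ b₁ b₂ ρa₁≡b₁ ρa₁≡b₁ ρa₂≡b₂ (trans QC.Tr₁ (trans (cong toℚ (sym q₁≡)) (sym PC.Tr₁))))
                                      (vanish a₁ a₂ a₂ b₁ b₂ b₂ ρa₁≡b₁ ρa₂≡b₂ ρa₂≡b₂ (trans QC.Tr₂ (trans (cong toℚ (sym q₂≡)) (sym PC.Tr₂))))
                                      (vanish a₂ a₂ a₂ b₂ b₂ b₂ ρa₂≡b₂ ρa₂≡b₂ ρa₂≡b₂ (trans QC.Tr₃ (trans (cong toℚ (sym q₃≡)) (sym PC.Tr₃))))) ⟩
        fromℚ 0ℚ ⊕ P.g ≡⟨ ⊕-identityˡ P.g ⟩
        P.g ∎
        where
        module PC = HasCoefficients P.coeffs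
        module QC = HasCoefficients Q.coeffs
        qs = tripled-form-injective (trans (sym P.x≡) Q.x≡)
        q₀≡ = proj₁ qs
        q₁≡ = proj₁ (proj₂ qs)
        q₂≡ = proj₁ (proj₂ (proj₂ qs))
        q₃≡ = proj₂ (proj₂ (proj₂ qs))
        regroup : ∀ g t x y z → g ⊗ (t ⊗ x) ⊗ (t ⊗ y) ⊗ (t ⊗ z) ≡ g ⊗ (t ⊗ t ⊗ t) ⊗ x ⊗ y ⊗ z
        regroup = solve 5 (λ g t x y z → g :* (t :* x) :* (t :* y) :* (t :* z) := g :* (t :* t :* t) :* x :* y :* z) refl
        distribute : ∀ g′ g x y z → (g′ ⊖ g) ⊗ x ⊗ y ⊗ z ≡ g′ ⊗ x ⊗ y ⊗ z ⊕ neg (g ⊗ x ⊗ y ⊗ z)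
        distribute = solve 5 (λ g′ g x y z → (g′ :- g) :* x :* y :* z := g′ :* x :* y :* z :+ :- (g :* x :* y :* z)) refl
        vanish : ∀ u v w u′ v′ w′ → ρ ⊗ u ≡ u′ → ρ ⊗ v ≡ v′ → ρ ⊗ w ≡ w′ →
          Tr (Q.g ⊗ τ u′ ⊗ τ v′ ⊗ τ w′) ≡ Tr (P.g ⊗ τ u ⊗ τ v ⊗ τ w) → Tr ((g′ ⊖ P.g) ⊗ τ u ⊗ τ v ⊗ τ w) ≡ 0ℚ
        vanish u v w _ _ _ refl refl refl eq = begin
          Tr ((g′ ⊖ P.g) ⊗ τ u ⊗ τ v ⊗ τ w) ≡⟨ cong Tr (distribute g′ P.g (τ u) (τ v) (τ w)) ⟩
          Tr (g′ ⊗ τ u ⊗ τ v ⊗ τ w ⊕ neg (P.g ⊗ τ u ⊗ τ v ⊗ τ w)) ≡⟨ Tr-⊕ (g′ ⊗ τ u ⊗ τ v ⊗ τ w) (neg (P.g ⊗ τ u ⊗ τ v ⊗ τ w)) ⟩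
          Tr (g′ ⊗ τ u ⊗ τ v ⊗ τ w) + Tr (neg (P.g ⊗ τ u ⊗ τ v ⊗ τ w)) ≡⟨ cong₂ _+_ (cong Tr (sym (regroup Q.g (τ ρ) (τ u) (τ v) (τ w)))) (Tr-neg (P.g ⊗ τ u ⊗ τ v ⊗ τ w)) ⟩
          Tr (Q.g ⊗ (τ ρ ⊗ τ u) ⊗ (τ ρ ⊗ τ v) ⊗ (τ ρ ⊗ τ w)) + - Tr (P.g ⊗ τ u ⊗ τ v ⊗ τ w)
            ≡⟨ cong (λ z → Tr z + - Tr (P.g ⊗ τ u ⊗ τ v ⊗ τ w)) (cong₂ _⊗_ (cong₂ (λ y z → Q.g ⊗ y ⊗ z) (τ-⊗ ρ u) (τ-⊗ ρ v)) (τ-⊗ ρ w)) ⟨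
          Tr (Q.g ⊗ τ (ρ ⊗ u) ⊗ τ (ρ ⊗ v) ⊗ τ (ρ ⊗ w)) + - Tr (P.g ⊗ τ u ⊗ τ v ⊗ τ w) ≡⟨ cong (_+ - Tr (P.g ⊗ τ u ⊗ τ v ⊗ τ w)) eq ⟩
          Tr (P.g ⊗ τ u ⊗ τ v ⊗ τ w) + - Tr (P.g ⊗ τ u ⊗ τ v ⊗ τ w) ≡⟨ ℚ.+-inverseʳ (Tr (P.g ⊗ τ u ⊗ τ v ⊗ τ w)) ⟩
          0ℚ ∎

      M N M′ : K
      M = fromℚ F.μ
      N = fromℚ F.ν
      M′ = fromℚ G.μ

      M′Nρ≡M : M′ ⊗ (ρ ⊗ τ ρ) ≡ M
      M′Nρ≡M = trans (cong (M′ ⊗_) (fromℚ-Nm ρ)) (trans (sym (fromℚ-* G.μ (Nm ρ)))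
        (cong fromℚ (μ-scaled Q.normForm P.normForm (Nm ρ) det-b)))

      -- β is recovered from its scalar as c√Δ·g·ν³; the factor N(ρ) reconciles the values of ν of
      -- the two bases.
      ρ³β≡β′ : cube ρ ⊗ β ≡ β′
      ρ³β≡β′ = begin
        cube ρ ⊗ β ≡⟨ ⊗-one³ (cube ρ ⊗ β) ⟨
        cube ρ ⊗ β ⊗ (one ⊗ one ⊗ one) ≡⟨ cong (λ u → cube ρ ⊗ β ⊗ (u ⊗ u ⊗ u)) (N⊗M≡1 P.normForm) ⟨
        cube ρ ⊗ β ⊗ ((N ⊗ M) ⊗ (N ⊗ M) ⊗ (N ⊗ M)) ≡⟨ regroup₁ ρ β N M ⟩
        (ρ ⊗ ρ ⊗ ρ) ⊗ (β ⊗ (M ⊗ M ⊗ M)) ⊗ (N ⊗ N ⊗ N) ≡⟨ cong (λ u → (ρ ⊗ ρ ⊗ ρ) ⊗ u ⊗ (N ⊗ N ⊗ N)) P.g-coefficient ⟨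
        (ρ ⊗ ρ ⊗ ρ) ⊗ (S√ ⊗ P.g) ⊗ (N ⊗ N ⊗ N) ≡⟨ cong (λ u → (ρ ⊗ ρ ⊗ ρ) ⊗ (S√ ⊗ u) ⊗ (N ⊗ N ⊗ N)) g′≡g ⟨
        (ρ ⊗ ρ ⊗ ρ) ⊗ (S√ ⊗ (Q.g ⊗ (τ ρ ⊗ τ ρ ⊗ τ ρ))) ⊗ (N ⊗ N ⊗ N) ≡⟨ regroup₂ ρ (τ ρ) S√ Q.g N ⟩
        (S√ ⊗ Q.g) ⊗ ((ρ ⊗ τ ρ) ⊗ (ρ ⊗ τ ρ) ⊗ (ρ ⊗ τ ρ)) ⊗ (N ⊗ N ⊗ N) ≡⟨ cong (λ u → u ⊗ ((ρ ⊗ τ ρ) ⊗ (ρ ⊗ τ ρ) ⊗ (ρ ⊗ τ ρ)) ⊗ (N ⊗ N ⊗ N)) Q.g-coefficient ⟩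
        (β′ ⊗ (M′ ⊗ M′ ⊗ M′)) ⊗ ((ρ ⊗ τ ρ) ⊗ (ρ ⊗ τ ρ) ⊗ (ρ ⊗ τ ρ)) ⊗ (N ⊗ N ⊗ N) ≡⟨ regroup₃ β′ M′ (ρ ⊗ τ ρ) N ⟩
        β′ ⊗ ((N ⊗ (M′ ⊗ (ρ ⊗ τ ρ))) ⊗ (N ⊗ (M′ ⊗ (ρ ⊗ τ ρ))) ⊗ (N ⊗ (M′ ⊗ (ρ ⊗ τ ρ)))) ≡⟨ cong (λ u → β′ ⊗ ((N ⊗ u) ⊗ (N ⊗ u) ⊗ (N ⊗ u))) M′Nρ≡M ⟩
        β′ ⊗ ((N ⊗ M) ⊗ (N ⊗ M) ⊗ (N ⊗ M)) ≡⟨ cong (λ u → β′ ⊗ (u ⊗ u ⊗ u)) (N⊗M≡1 P.normForm) ⟩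
        β′ ⊗ (one ⊗ one ⊗ one) ≡⟨ ⊗-one³ β′ ⟩
        β′ ∎
        where
        regroup₁ : ∀ r b n m → r ⊗ r ⊗ r ⊗ b ⊗ ((n ⊗ m) ⊗ (n ⊗ m) ⊗ (n ⊗ m)) ≡ (r ⊗ r ⊗ r) ⊗ (b ⊗ (m ⊗ m ⊗ m)) ⊗ (n ⊗ n ⊗ n)
        regroup₁ = solve 4 (λ r b n m → r :* r :* r :* b :* ((n :* m) :* (n :* m) :* (n :* m)) := (r :* r :* r) :* (b :* (m :* m :* m)) :* (n :* n :* n)) refl
        regroup₂ : ∀ r r′ s g n → (r ⊗ r ⊗ r) ⊗ (s ⊗ (g ⊗ (r′ ⊗ r′ ⊗ r′))) ⊗ (n ⊗ n ⊗ n) ≡ (s ⊗ g) ⊗ ((r ⊗ r′) ⊗ (r ⊗ r′) ⊗ (r ⊗ r′)) ⊗ (n ⊗ n ⊗ n)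
        regroup₂ = solve 5 (λ r r′ s g n → (r :* r :* r) :* (s :* (g :* (r′ :* r′ :* r′))) :* (n :* n :* n) := (s :* g) :* ((r :* r′) :* (r :* r′) :* (r :* r′)) :* (n :* n :* n)) refl
        regroup₃ : ∀ b m t n → (b ⊗ (m ⊗ m ⊗ m)) ⊗ (t ⊗ t ⊗ t) ⊗ (n ⊗ n ⊗ n) ≡ b ⊗ ((n ⊗ (m ⊗ t)) ⊗ (n ⊗ (m ⊗ t)) ⊗ (n ⊗ (m ⊗ t)))
        regroup₃ = solve 4 (λ b m t n → (b :* (m :* m :* m)) :* (t :* t :* t) :* (n :* n :* n) := b :* ((n :* (m :* t)) :* (n :* (m :* t)) :* (n :* (m :* t)))) refl

      ρα≐α′ : (ρ • span α₁ α₂) ≐ span α₁′ α₂′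
      ρα≐α′ = ≐-intro
        (λ { z (w , w∈ , refl) → ≐⇒⊆ Q.basis (ρ ⊗ w) (span-⊆ (⊗ˡ-preimage (span-isSubgroup b₁ b₂) ρ) {a₁} {a₂}
          (subst (span b₁ b₂) (sym ρa₁≡b₁) (α₁∈span b₁ b₂)) (subst (span b₁ b₂) (sym ρa₂≡b₂) (α₂∈span b₁ b₂)) w (≐⇒⊇ P.basis w w∈)) })
        (λ z z∈ → span-⊆ (•-isSubgroup ρ (span-isSubgroup α₁ α₂)) {b₁} {b₂}
          (a₁ , ≐⇒⊆ P.basis a₁ (α₁∈span a₁ a₂) , ρa₁≡b₁) (a₂ , ≐⇒⊆ P.basis a₂ (α₂∈span a₁ a₂) , ρa₂≡b₂) z (≐⇒⊇ Q.basis z z∈))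

    proportional : ∃[ ρ ] (Unit ρ × ((ρ • span α₁ α₂) ≐ span α₁′ α₂′) × cube ρ ⊗ β ≡ β′)
    proportional = ρ , ρ-unit , ρα≐α′ , ρ³β≡β′

  module _ {b : ℕ} {α₁ α₂ β : K} (d : Datum b α₁ α₂ β) where

    -- The pair (𝔞, β) stays and only the basis moves, by a matrix of determinant 1, so μ and with
    -- it the scalar g are unchanged.
    act-realisation : ∀ γ x → Presentation b α₁ α₂ β x → Realisation b α₁ α₂ β (act γ x)
    act-realisation (mat m n r s det1) x P = realisation a₁′ a₂′ (≐-trans a′≐a basis) positive′ F′ g g-coefficient′
      (trans (act-cubicForm m n r s det1 g (τ a₁) (τ a₂) x embed≡)
        (sym (cong₂ (cubicForm g) (τ-combination m n a₁ a₂) (τ-combination r s a₁ a₂))))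
      where
      open Presentation P
      a₁′ a₂′ : K
      a₁′ = fromℤ m ⊗ a₁ ⊕ fromℤ n ⊗ a₂
      a₂′ = fromℤ r ⊗ a₁ ⊕ fromℤ s ⊗ a₂
      det1K : fromℤ m ⊗ fromℤ s ⊖ fromℤ n ⊗ fromℤ r ≡ one
      det1K = trans (sym (fromℤ-minor m s n r)) (cong fromℤ det1)
      span-a′ : IsSubgroup (span a₁′ a₂′)
      span-a′ = span-isSubgroup a₁′ a₂′
      difference∈ : ∀ i j → span a₁′ a₂′ (fromℤ i ⊗ a₁′ ⊖ fromℤ j ⊗ a₂′)
      difference∈ i j = ⊖-closed span-a′ (fromℤ i ⊗ a₁′) (fromℤ j ⊗ a₂′)
        (ℤ-closed span-a′ i a₁′ (α₁∈span a₁′ a₂′)) (ℤ-closed span-a′ j a₂′ (α₂∈span a₁′ a₂′))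
      unit⊗ : ∀ x → (fromℤ m ⊗ fromℤ s ⊖ fromℤ n ⊗ fromℤ r) ⊗ x ≡ x
      unit⊗ x = trans (cong (_⊗ x) det1K) (⊗-identityˡ x)
      a′≐a : span a₁′ a₂′ ≐ span a₁ a₂
      a′≐a = ≐-intro
        (span-⊆ (span-isSubgroup a₁ a₂) {a₁′} {a₂′} (span-intro a₁ a₂ m n) (span-intro a₁ a₂ r s))
        (span-⊆ span-a′ {a₁} {a₂}
          (subst (span a₁′ a₂′) (trans (first (fromℤ m) (fromℤ n) (fromℤ r) (fromℤ s) a₁ a₂) (unit⊗ a₁)) (difference∈ s n))
          (subst (span a₁′ a₂′) (trans (second (fromℤ m) (fromℤ n) (fromℤ r) (fromℤ s) a₁ a₂) (unit⊗ a₂))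
            (⊖-closed span-a′ (fromℤ m ⊗ a₂′) (fromℤ r ⊗ a₁′)
              (ℤ-closed span-a′ m a₂′ (α₂∈span a₁′ a₂′)) (ℤ-closed span-a′ r a₁′ (α₁∈span a₁′ a₂′)))))
        where
        first : ∀ m n r s a b → s ⊗ (m ⊗ a ⊕ n ⊗ b) ⊖ n ⊗ (r ⊗ a ⊕ s ⊗ b) ≡ (m ⊗ s ⊖ n ⊗ r) ⊗ a
        first = solve 6 (λ m n r s a b → s :* (m :* a :+ n :* b) :- n :* (r :* a :+ s :* b) := (m :* s :- n :* r) :* a) refl
        second : ∀ m n r s a b → m ⊗ (r ⊗ a ⊕ s ⊗ b) ⊖ r ⊗ (m ⊗ a ⊕ n ⊗ b) ≡ (m ⊗ s ⊖ n ⊗ r) ⊗ b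
        second = solve 6 (λ m n r s a b → m :* (r :* a :+ s :* b) :- r :* (m :* a :+ n :* b) := (m :* s :- n :* r) :* b) refl
      det≡ : det a₁′ a₂′ ≡ det a₁ a₂
      det≡ = trans (det-basis m n r s a₁ a₂) (trans (cong (λ i → toℚ i * det a₁ a₂) det1) (ℚ.*-identityˡ (det a₁ a₂)))
      positive′ : Positive β a₁′ a₂′
      positive′ = subst (λ u → 0ℚ < Nm β * u) (sym det≡) positive
      F′ : NormForm a₁′ a₂′
      F′ = datum-normForm (admissible-datum d a₁′ a₂′ (≐-trans a′≐a basis) positive′)
      μ≡ : NormForm.μ normForm ≡ NormForm.μ F′
      μ≡ = trans (sym (μ-scaled F′ normForm 1ℚ (trans det≡ (sym (ℚ.*-identityˡ (det a₁ a₂)))))) (ℚ.*-identityʳ (NormForm.μ F′))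
      g-coefficient′ : IsCoefficient F′ β g
      g-coefficient′ = trans g-coefficient (cong (λ u → β ⊗ (fromℚ u ⊗ fromℚ u ⊗ fromℚ u)) μ≡)

  -- Reconstruction of (𝔞, β) from a form

  0∈span : ∀ a₁ a₂ → span a₁ a₂ (fromℚ 0ℚ)
  0∈span a₁ a₂ = 0-closed (span-isSubgroup a₁ a₂)

  private
    -- `NormCond` requires a two-element basis of β𝔞⁻³, which is given by eight generators. The
    -- integers a and k may be zero here; independence is obtained separately from
    -- `cube-independent`.
    TriangularBasis : Sub → Set
    TriangularBasis A = ∃[ a ] ∃[ b ] ∃[ k ] (span (fromℤ a) (fromℤ b ⊕ fromℤ k ⊗ θ) ≐ A)

    -- One step of the Hermite normal form: δ₂ and i + jθ are combined so that only one of them keeps a θ-component.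
    extend : ∀ {m} (gs : Vec K m) i j → TriangularBasis (Gen gs) → TriangularBasis (Gen ((fromℤ i ⊕ fromℤ j ⊗ θ) ∷ gs))
    extend gs i j (a , b , k , δ≐gs) = go (bezout k j)
      where
      g δ₁ δ₂ : K
      g = fromℤ i ⊕ fromℤ j ⊗ θ
      δ₁ = fromℤ a
      δ₂ = fromℤ b ⊕ fromℤ k ⊗ θ
      target : IsSubgroup (Gen (g ∷ gs))
      target = Gen-isSubgroup (g ∷ gs)
      g∈ : Gen (g ∷ gs) g
      g∈ = Gen-lookup (g ∷ gs) zero
      δ₁∈ : Gen (g ∷ gs) δ₁
      δ₁∈ = Gen-there g {gs} (≐⇒⊆ δ≐gs δ₁ (α₁∈span δ₁ δ₂))
      δ₂∈ : Gen (g ∷ gs) δ₂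
      δ₂∈ = Gen-there g {gs} (≐⇒⊆ δ≐gs δ₂ (α₂∈span δ₁ δ₂))
      go : ∃[ d ] ∃[ u ] ∃[ v ] ∃[ r ] ∃[ s ] (k ≡ + d ℤ.* u × j ≡ + d ℤ.* v × r ℤ.* u ℤ.+ s ℤ.* v ≡ + 1) →
        TriangularBasis (Gen (g ∷ gs))
      -- The matrix with rows (r, s) and (v, -u) is unimodular. Applied to (δ₂, g), its first row
      -- has θ-component d, and its second eliminates θ and leaves the integer w, which a second gcd
      -- merges with a.
      go (d , u , v , r , s , k≡ , j≡ , ru+sv≡1) = finish (bezout a (v ℤ.* b ℤ.- u ℤ.* i))
        where
        U V R W : K
        U = fromℤ u
        V = fromℤ v
        R = fromℤ r
        W = fromℤ s
        RU+WV≡1 : R ⊗ U ⊕ W ⊗ V ≡ one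
        RU+WV≡1 = trans (sym (fromℤ-sum-of-products r u s v)) (cong fromℤ ru+sv≡1)
        w : ℤ
        w = v ℤ.* b ℤ.- u ℤ.* i
        fromℤ-k : fromℤ k ≡ fromℤ (+ d) ⊗ U
        fromℤ-k = trans (cong fromℤ k≡) (fromℤ-* (+ d) u)
        fromℤ-j : fromℤ j ≡ fromℤ (+ d) ⊗ V
        fromℤ-j = trans (cong fromℤ j≡) (fromℤ-* (+ d) v)
        w≡ : fromℤ w ≡ V ⊗ δ₂ ⊖ U ⊗ g
        w≡ = begin
          fromℤ w ≡⟨ fromℤ-minor v b u i ⟩
          V ⊗ fromℤ b ⊖ U ⊗ fromℤ i ≡⟨ eliminate (fromℤ (+ d)) U V (fromℤ b) (fromℤ i) θ ⟩
          V ⊗ (fromℤ b ⊕ fromℤ (+ d) ⊗ U ⊗ θ) ⊖ U ⊗ (fromℤ i ⊕ fromℤ (+ d) ⊗ V ⊗ θ) ≡⟨ cong₂ (λ x y → V ⊗ (fromℤ b ⊕ x ⊗ θ) ⊖ U ⊗ (fromℤ i ⊕ y ⊗ θ)) fromℤ-k fromℤ-j ⟨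
          V ⊗ δ₂ ⊖ U ⊗ g ∎
          where
          eliminate : ∀ d u v b i t → v ⊗ b ⊖ u ⊗ i ≡ v ⊗ (b ⊕ d ⊗ u ⊗ t) ⊖ u ⊗ (i ⊕ d ⊗ v ⊗ t)
          eliminate = solve 6 (λ d u v b i t → v :* b :- u :* i := v :* (b :+ d :* u :* t) :- u :* (i :+ d :* v :* t)) refl
        finish : ∃[ d′ ] ∃[ u′ ] ∃[ v′ ] ∃[ r′ ] ∃[ s′ ] (a ≡ + d′ ℤ.* u′ × w ≡ + d′ ℤ.* v′ × r′ ℤ.* u′ ℤ.+ s′ ℤ.* v′ ≡ + 1) →
          TriangularBasis (Gen (g ∷ gs))
        finish (d′ , u′ , v′ , r′ , s′ , a≡ , w≡d′v′ , eq) = + d′ , r ℤ.* b ℤ.+ s ℤ.* i , + d , ≐-intro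
          (span-⊆ target {ε₁} {ε₂}
            (subst (Gen (g ∷ gs)) (sym ε₁≡) (⊕-closed target (fromℤ r′ ⊗ δ₁) (fromℤ s′ ⊗ fromℤ w)
              (ℤ-closed target r′ δ₁ δ₁∈) (ℤ-closed target s′ (fromℤ w) (subst (Gen (g ∷ gs)) (sym w≡)
                (⊖-closed target (V ⊗ δ₂) (U ⊗ g) (ℤ-closed target v δ₂ δ₂∈) (ℤ-closed target u g g∈))))))
            (subst (Gen (g ∷ gs)) (sym ε₂≡) (⊕-closed target (R ⊗ δ₂) (W ⊗ g) (ℤ-closed target r δ₂ δ₂∈) (ℤ-closed target s g g∈))))
          backward
          where
          ε₁ ε₂ : K
          ε₁ = fromℤ (+ d′)
          ε₂ = fromℤ (r ℤ.* b ℤ.+ s ℤ.* i) ⊕ fromℤ (+ d) ⊗ θ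
          source : IsSubgroup (span ε₁ ε₂)
          source = span-isSubgroup ε₁ ε₂
          ε₁≡ : ε₁ ≡ fromℤ r′ ⊗ δ₁ ⊕ fromℤ s′ ⊗ fromℤ w
          ε₁≡ = begin
            fromℤ (+ d′) ≡⟨ cong fromℤ (sym (trans (combine (+ d′) r′ u′ s′ v′) (trans (cong (+ d′ ℤ.*_) eq) (ℤ.*-identityʳ (+ d′))))) ⟩
            fromℤ (r′ ℤ.* (+ d′ ℤ.* u′) ℤ.+ s′ ℤ.* (+ d′ ℤ.* v′)) ≡⟨ cong₂ (λ x y → fromℤ (r′ ℤ.* x ℤ.+ s′ ℤ.* y)) a≡ w≡d′v′ ⟨
            fromℤ (r′ ℤ.* a ℤ.+ s′ ℤ.* w) ≡⟨ fromℤ-sum-of-products r′ a s′ w ⟩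
            fromℤ r′ ⊗ δ₁ ⊕ fromℤ s′ ⊗ fromℤ w ∎
            where
            combine : ∀ d r u s v → r ℤ.* (d ℤ.* u) ℤ.+ s ℤ.* (d ℤ.* v) ≡ d ℤ.* (r ℤ.* u ℤ.+ s ℤ.* v)
            combine = ℤ-Tactic.solve-∀
          ε₂≡ : ε₂ ≡ R ⊗ δ₂ ⊕ W ⊗ g
          ε₂≡ = begin
            fromℤ (r ℤ.* b ℤ.+ s ℤ.* i) ⊕ fromℤ (+ d) ⊗ θ ≡⟨ cong₂ _⊕_ (fromℤ-sum-of-products r b s i) (trans (sym (⊗-identityˡ (fromℤ (+ d) ⊗ θ))) (cong (λ x → x ⊗ (fromℤ (+ d) ⊗ θ)) (sym RU+WV≡1))) ⟩
            (R ⊗ fromℤ b ⊕ W ⊗ fromℤ i) ⊕ (R ⊗ U ⊕ W ⊗ V) ⊗ (fromℤ (+ d) ⊗ θ) ≡⟨ collect R W U V (fromℤ b) (fromℤ i) (fromℤ (+ d)) θ ⟩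
            R ⊗ (fromℤ b ⊕ fromℤ (+ d) ⊗ U ⊗ θ) ⊕ W ⊗ (fromℤ i ⊕ fromℤ (+ d) ⊗ V ⊗ θ) ≡⟨ cong₂ (λ x y → R ⊗ (fromℤ b ⊕ x ⊗ θ) ⊕ W ⊗ (fromℤ i ⊕ y ⊗ θ)) fromℤ-k fromℤ-j ⟨
            R ⊗ δ₂ ⊕ W ⊗ g ∎
            where
            collect : ∀ r s u v b i d t → (r ⊗ b ⊕ s ⊗ i) ⊕ (r ⊗ u ⊕ s ⊗ v) ⊗ (d ⊗ t) ≡ r ⊗ (b ⊕ d ⊗ u ⊗ t) ⊕ s ⊗ (i ⊕ d ⊗ v ⊗ t)
            collect = solve 8 (λ r s u v b i d t → (r :* b :+ s :* i) :+ (r :* u :+ s :* v) :* (d :* t) := r :* (b :+ d :* u :* t) :+ s :* (i :+ d :* v :* t)) refl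
          multiple∈ : ∀ n y → n ≡ + d′ ℤ.* y → span ε₁ ε₂ (fromℤ n)
          multiple∈ n y n≡ = subst (span ε₁ ε₂) (sym (trans (cong fromℤ (trans n≡ (ℤ.*-comm (+ d′) y))) (fromℤ-* y (+ d′))))
            (ℤ-closed source y ε₁ (α₁∈span ε₁ ε₂))
          w∈ : span ε₁ ε₂ (fromℤ w)
          w∈ = multiple∈ w v′ w≡d′v′
          expand : ∀ x → (R ⊗ U ⊕ W ⊗ V) ⊗ x ≡ x
          expand x = trans (cong (_⊗ x) RU+WV≡1) (⊗-identityˡ x)
          δ₂∈′ : span ε₁ ε₂ δ₂
          δ₂∈′ = subst (span ε₁ ε₂) (begin
              U ⊗ ε₂ ⊕ W ⊗ fromℤ w ≡⟨ cong₂ (λ x y → U ⊗ x ⊕ W ⊗ y) ε₂≡ w≡ ⟩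
              U ⊗ (R ⊗ δ₂ ⊕ W ⊗ g) ⊕ W ⊗ (V ⊗ δ₂ ⊖ U ⊗ g) ≡⟨ recover U V R W δ₂ g ⟩
              (R ⊗ U ⊕ W ⊗ V) ⊗ δ₂ ≡⟨ expand δ₂ ⟩
              δ₂ ∎)
            (⊕-closed source (U ⊗ ε₂) (W ⊗ fromℤ w) (ℤ-closed source u ε₂ (α₂∈span ε₁ ε₂)) (ℤ-closed source s (fromℤ w) w∈))
            where
            recover : ∀ u v r s x g → u ⊗ (r ⊗ x ⊕ s ⊗ g) ⊕ s ⊗ (v ⊗ x ⊖ u ⊗ g) ≡ (r ⊗ u ⊕ s ⊗ v) ⊗ x
            recover = solve 6 (λ u v r s x g → u :* (r :* x :+ s :* g) :+ s :* (v :* x :- u :* g) := (r :* u :+ s :* v) :* x) refl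
          g∈′ : span ε₁ ε₂ g
          g∈′ = subst (span ε₁ ε₂) (begin
              V ⊗ ε₂ ⊖ R ⊗ fromℤ w ≡⟨ cong₂ (λ x y → V ⊗ x ⊖ R ⊗ y) ε₂≡ w≡ ⟩
              V ⊗ (R ⊗ δ₂ ⊕ W ⊗ g) ⊖ R ⊗ (V ⊗ δ₂ ⊖ U ⊗ g) ≡⟨ recover U V R W δ₂ g ⟩
              (R ⊗ U ⊕ W ⊗ V) ⊗ g ≡⟨ expand g ⟩
              g ∎)
            (⊖-closed source (V ⊗ ε₂) (R ⊗ fromℤ w) (ℤ-closed source v ε₂ (α₂∈span ε₁ ε₂)) (ℤ-closed source r (fromℤ w) w∈))
            where
            recover : ∀ u v r s x g → v ⊗ (r ⊗ x ⊕ s ⊗ g) ⊖ r ⊗ (v ⊗ x ⊖ u ⊗ g) ≡ (r ⊗ u ⊕ s ⊗ v) ⊗ g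
            recover = solve 6 (λ u v r s x g → v :* (r :* x :+ s :* g) :- r :* (v :* x :- u :* g) := (r :* u :+ s :* v) :* g) refl
          backward : ∀ x → Gen (g ∷ gs) x → span ε₁ ε₂ x
          backward x (m ∷ ms , refl) = ⊕-closed source (fromℤ m ⊗ g) (linComb ms gs) (ℤ-closed source m g g∈′)
            (span-⊆ source {δ₁} {δ₂} (multiple∈ a u′ a≡) δ₂∈′ (linComb ms gs) (≐⇒⊇ δ≐gs (linComb ms gs) (ms , refl)))

    triangularBasis : ∀ {m} (gs : Vec K m) → All O gs → TriangularBasis (Gen gs)
    triangularBasis [] [] = + 0 , + 0 , + 0 , ≐-intro
      (span-⊆ (Gen-isSubgroup []) {fromℤ (+ 0)} {fromℤ (+ 0) ⊕ fromℤ (+ 0) ⊗ θ} ([] , refl)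
        ([] , solve 1 (λ t → con (+ 0) := con (+ 0) :+ con (+ 0) :* t) refl θ))
      (λ { x ([] , refl) → 0∈span (fromℤ (+ 0)) (fromℤ (+ 0) ⊕ fromℤ (+ 0) ⊗ θ) })
    triangularBasis (g ∷ gs) (g∈O ∷ gs∈O) = go (order-elim g g∈O)
      where
      go : ∃[ i ] ∃[ j ] g ≡ fromℤ i ⊕ fromℤ j ⊗ θ → TriangularBasis (Gen (g ∷ gs))
      go (i , j , g≡) = subst (λ y → TriangularBasis (Gen (y ∷ gs))) (sym g≡) (extend gs i j (triangularBasis gs gs∈O))

  opaque
    lattice-basis : ∀ {m} (gs : Vec K m) → All O gs → ∃[ δ₁ ] ∃[ δ₂ ] (span δ₁ δ₂ ≐ Gen gs)
    lattice-basis gs gs∈O = go (triangularBasis gs gs∈O)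
      where
      go : TriangularBasis (Gen gs) → ∃[ δ₁ ] ∃[ δ₂ ] (span δ₁ δ₂ ≐ Gen gs)
      go (a , b , k , basis) = fromℤ a , fromℤ b ⊕ fromℤ k ⊗ θ , basis

  Tr-value : ∀ T m n → S√ ⊗ T ≡ fromℤ m ⊕ fromℤ n ⊗ θ → Tr T ≡ toℚ n
  Tr-value T m n eq = *-cancelˡ ½C≢0 (begin
    ½ * C * (re T + re T) ≡⟨ double C (re T) ⟩
    C * re T ≡⟨ im-S√⊗ T ⟨
    im (S√ ⊗ T) ≡⟨ cong im eq ⟩
    im (fromℤ m ⊕ fromℤ n ⊗ θ) ≡⟨ im-⊕ (fromℤ m) (fromℤ n ⊗ θ) ⟩
    0ℚ + im (fromℤ n ⊗ θ) ≡⟨ ℚ.+-identityˡ (im (fromℤ n ⊗ θ)) ⟩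
    im (fromℤ n ⊗ θ) ≡⟨ im-fromℚ⊗ (toℚ n) θ ⟩
    toℚ n * im θ ≡⟨ cong (toℚ n *_) θ-im ⟩
    toℚ n * (½ * C) ≡⟨ ℚ.*-comm (toℚ n) (½ * C) ⟩
    ½ * C * toℚ n ∎)
    where
    double : ∀ C r → ½ * C * (r + r) ≡ C * r
    double = solve-∀ ℚ-ring

  module _ {f₀ h f₂ u₀ u₁ u₂ : ℤ} (f₀≢0 : f₀ ≢ + 0)
    (f₀f₂≡ : f₀ ℤ.* f₂ ≡ h ℤ.* h ℤ.+ h ℤ.* p ℤ.+ e)
    (coprime : u₀ ℤ.* f₀ ℤ.+ u₁ ℤ.* (+ 2 ℤ.* h ℤ.+ p) ℤ.+ u₂ ℤ.* f₂ ≡ + 1) where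

    private
      a₁ a₂ F₀ F₁ F₂ : K
      a₁ = fromℤ f₀
      a₂ = fromℤ h ⊕ θ
      F₀ = fromℤ f₀
      F₁ = fromℤ (+ 2 ℤ.* h ℤ.+ p)
      F₂ = fromℤ f₂

      ν μ : ℚ
      ν = toℚ f₀
      μ = recip ν

      M : K
      M = fromℚ μ

      toℚf₀≢0 : ν ≢ 0ℚ
      toℚf₀≢0 = toℚ-nonzero f₀≢0

      F₀M≡1 : F₀ ⊗ M ≡ one
      F₀M≡1 = trans (sym (fromℚ-* ν μ)) (cong fromℚ (recip-inverse toℚf₀≢0))

      MF₀≡1 : M ⊗ F₀ ≡ one
      MF₀≡1 = trans (⊗-comm M F₀) F₀M≡1


      τa₂ : τ a₂ ≡ fromℤ h ⊕ τ θ
      τa₂ = τ-⊕ (fromℤ h) θ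

      a₂τa₂ : a₂ ⊗ τ a₂ ≡ F₀ ⊗ F₂
      a₂τa₂ = trans (cong (a₂ ⊗_) τa₂) (trans (norm-h+θ h) (trans (cong fromℤ (sym f₀f₂≡)) (fromℤ-* f₀ f₂)))

      det-a : det a₁ a₂ ≡ ν * (½ * C)
      det-a = trans (lemma ν (toℚ h) (re θ) (im θ)) (cong (ν *_) θ-im)
        where
        lemma : ∀ v h r i → v * (0ℚ + i) - 0ℚ * (h + r) ≡ v * i
        lemma = solve-∀ ℚ-ring

    -- det(f₀, h + θ) = f₀·c/2, so ν = f₀ and ᾱ₁ = 1; N(h + θ) = f₀f₂ supplies the remaining
    -- product.
    explicit-normForm : NormForm (fromℤ f₀) (fromℤ h ⊕ θ)
    explicit-normForm = record
      { ν = ν ; μ = μ ; ν*μ≡1 = recip-inverse toℚf₀≢0 ; ν-det = sym det-a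
      ; f₀ = f₀ ; h = h ; f₂ = f₂ ; u₀ = u₀ ; u₁ = u₁ ; u₂ = u₂ ; coprime = coprime
      ; α₁ᾱ₁ = trans (cong (F₀ ⊗_) MF₀≡1) (⊗-identityʳ F₀)
      ; α₁ᾱ₂ = trans (sym (⊗-assoc F₀ M (τ a₂))) (trans (cong (_⊗ τ a₂) F₀M≡1) (trans (⊗-identityˡ (τ a₂)) τa₂))
      ; α₂ᾱ₁ = trans (cong (a₂ ⊗_) MF₀≡1) (⊗-identityʳ a₂)
      ; α₂ᾱ₂ = trans (⊗-swap a₂ M (τ a₂)) (trans (cong (M ⊗_) a₂τa₂) (trans (sym (⊗-assoc M F₀ F₂)) (trans (cong (_⊗ F₂) MF₀≡1) (⊗-identityˡ F₂)))) }

    explicit-stable : Stable (fromℤ f₀) (fromℤ h ⊕ θ)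
    explicit-stable = stable-intro a₁ a₂
      (subst (span a₁ a₂) (sym θa₁) (⊖-closed sp (F₀ ⊗ a₂) (fromℤ h ⊗ a₁) (ℤ-closed sp f₀ a₂ (α₂∈span a₁ a₂)) (ℤ-closed sp h a₁ (α₁∈span a₁ a₂))))
      (subst (span a₁ a₂) (sym θa₂) (⊖-closed sp (fromℤ (h ℤ.+ p) ⊗ a₂) (F₂ ⊗ a₁) (ℤ-closed sp (h ℤ.+ p) a₂ (α₂∈span a₁ a₂)) (ℤ-closed sp f₂ a₁ (α₁∈span a₁ a₂))))
      where
      sp : IsSubgroup (span a₁ a₂)
      sp = span-isSubgroup a₁ a₂
      θa₁ : θ ⊗ a₁ ≡ F₀ ⊗ a₂ ⊖ fromℤ h ⊗ a₁
      θa₁ = solve 3 (λ t f h → t :* f := f :* (h :+ t) :- h :* f) refl θ F₀ (fromℤ h)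
      θa₂ : θ ⊗ a₂ ≡ fromℤ (h ℤ.+ p) ⊗ a₂ ⊖ F₂ ⊗ a₁
      θa₂ = begin
        θ ⊗ (fromℤ h ⊕ θ) ≡⟨ expand (fromℤ h) θ ⟩
        fromℤ h ⊗ θ ⊕ θ ⊗ θ ≡⟨ cong (fromℤ h ⊗ θ ⊕_) θ-square ⟩
        fromℤ h ⊗ θ ⊕ (fromℤ p ⊗ θ ⊖ fromℤ e) ≡⟨ complete (fromℤ h) (fromℤ p) (fromℤ e) θ ⟩
        (fromℤ h ⊕ fromℤ p) ⊗ (fromℤ h ⊕ θ) ⊖ (fromℤ h ⊗ fromℤ h ⊕ fromℤ h ⊗ fromℤ p ⊕ fromℤ e) ≡⟨ cong₂ (λ x y → x ⊗ (fromℤ h ⊕ θ) ⊖ y) (sym (fromℤ-+ h p)) constant ⟩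
        fromℤ (h ℤ.+ p) ⊗ a₂ ⊖ F₂ ⊗ a₁ ∎
        where
        expand : ∀ h t → t ⊗ (h ⊕ t) ≡ h ⊗ t ⊕ t ⊗ t
        expand = solve 2 (λ h t → t :* (h :+ t) := h :* t :+ t :* t) refl
        complete : ∀ h p e t → h ⊗ t ⊕ (p ⊗ t ⊖ e) ≡ (h ⊕ p) ⊗ (h ⊕ t) ⊖ (h ⊗ h ⊕ h ⊗ p ⊕ e)
        complete = solve 4 (λ h p e t → h :* t :+ (p :* t :- e) := (h :+ p) :* (h :+ t) :- (h :* h :+ h :* p :+ e)) refl
        constant : fromℤ h ⊗ fromℤ h ⊕ fromℤ h ⊗ fromℤ p ⊕ fromℤ e ≡ F₂ ⊗ F₀
        constant = begin
          fromℤ h ⊗ fromℤ h ⊕ fromℤ h ⊗ fromℤ p ⊕ fromℤ e ≡⟨ cong (_⊕ fromℤ e) (fromℤ-sum-of-products h h h p) ⟨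
          fromℤ (h ℤ.* h ℤ.+ h ℤ.* p) ⊕ fromℤ e ≡⟨ fromℤ-+ (h ℤ.* h ℤ.+ h ℤ.* p) e ⟨
          fromℤ (h ℤ.* h ℤ.+ h ℤ.* p ℤ.+ e) ≡⟨ cong fromℤ (trans (sym f₀f₂≡) (ℤ.*-comm f₀ f₂)) ⟩
          fromℤ (f₂ ℤ.* f₀) ≡⟨ fromℤ-* f₂ f₀ ⟩
          F₂ ⊗ F₀ ∎

    module _ (b : ℕ) (1≤b : 1 ℕ.≤ b) (q₀ q₁ q₂ q₃ : ℤ)
      (hessian₀ : q₁ ℤ.* q₁ ℤ.- q₀ ℤ.* q₂ ≡ + b ℤ.* f₀)
      (hessian₁ : q₁ ℤ.* q₂ ℤ.- q₀ ℤ.* q₃ ≡ + b ℤ.* (+ 2 ℤ.* h ℤ.+ p))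
      (hessian₂ : q₂ ℤ.* q₂ ℤ.- q₁ ℤ.* q₃ ≡ + b ℤ.* f₂) where

      private
        f₁ : ℤ
        f₁ = + 2 ℤ.* h ℤ.+ p

        b≢0 : + b ≢ + 0
        b≢0 b≡0 = ℕ.<⇒≢ 1≤b (sym (ℤ.+-injective b≡0))

        -- Up to sign the Hessian coefficients are the minors of the matrix with rows (q₀, q₁, q₂)
        -- and (q₁, q₂, q₃). Repeating one of the rows gives a vanishing 3×3 determinant, and after
        -- division by b this is the recurrence f₀qᵢ₊₂ = f₁qᵢ₊₁ - f₂qᵢ.
        divide-hessian : ∀ i j k → i ℤ.* (q₁ ℤ.* q₁ ℤ.- q₀ ℤ.* q₂)
            ≡ j ℤ.* (q₁ ℤ.* q₂ ℤ.- q₀ ℤ.* q₃) ℤ.- k ℤ.* (q₂ ℤ.* q₂ ℤ.- q₁ ℤ.* q₃) →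
          i ℤ.* f₀ ≡ j ℤ.* f₁ ℤ.- k ℤ.* f₂
        divide-hessian i j k syzygy = *-cancelˡℤ b≢0 (begin
          + b ℤ.* (i ℤ.* f₀) ≡⟨ pull (+ b) i f₀ ⟩
          i ℤ.* (+ b ℤ.* f₀) ≡⟨ cong (i ℤ.*_) hessian₀ ⟨
          i ℤ.* (q₁ ℤ.* q₁ ℤ.- q₀ ℤ.* q₂) ≡⟨ syzygy ⟩
          j ℤ.* (q₁ ℤ.* q₂ ℤ.- q₀ ℤ.* q₃) ℤ.- k ℤ.* (q₂ ℤ.* q₂ ℤ.- q₁ ℤ.* q₃) ≡⟨ cong₂ (λ x y → j ℤ.* x ℤ.- k ℤ.* y) hessian₁ hessian₂ ⟩
          j ℤ.* (+ b ℤ.* f₁) ℤ.- k ℤ.* (+ b ℤ.* f₂) ≡⟨ factor (+ b) j f₁ k f₂ ⟩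
          + b ℤ.* (j ℤ.* f₁ ℤ.- k ℤ.* f₂) ∎)
          where
          pull : ∀ b q f → b ℤ.* (q ℤ.* f) ≡ q ℤ.* (b ℤ.* f)
          pull = ℤ-Tactic.solve-∀
          factor : ∀ b q f q′ f′ → q ℤ.* (b ℤ.* f) ℤ.- q′ ℤ.* (b ℤ.* f′) ≡ b ℤ.* (q ℤ.* f ℤ.- q′ ℤ.* f′)
          factor = ℤ-Tactic.solve-∀

        relation₀ : q₂ ℤ.* f₀ ≡ q₁ ℤ.* f₁ ℤ.- q₀ ℤ.* f₂
        relation₀ = divide-hessian q₂ q₁ q₀ (syzygy q₀ q₁ q₂ q₃)
          where
          syzygy : ∀ q₀ q₁ q₂ q₃ → q₂ ℤ.* (q₁ ℤ.* q₁ ℤ.- q₀ ℤ.* q₂)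
            ≡ q₁ ℤ.* (q₁ ℤ.* q₂ ℤ.- q₀ ℤ.* q₃) ℤ.- q₀ ℤ.* (q₂ ℤ.* q₂ ℤ.- q₁ ℤ.* q₃)
          syzygy = ℤ-Tactic.solve-∀

        relation₁ : q₃ ℤ.* f₀ ≡ q₂ ℤ.* f₁ ℤ.- q₁ ℤ.* f₂
        relation₁ = divide-hessian q₃ q₂ q₁ (syzygy q₀ q₁ q₂ q₃)
          where
          syzygy : ∀ q₀ q₁ q₂ q₃ → q₃ ℤ.* (q₁ ℤ.* q₁ ℤ.- q₀ ℤ.* q₂)
            ≡ q₂ ℤ.* (q₁ ℤ.* q₂ ℤ.- q₀ ℤ.* q₃) ℤ.- q₁ ℤ.* (q₂ ℤ.* q₂ ℤ.- q₁ ℤ.* q₃)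
          syzygy = ℤ-Tactic.solve-∀

        -- The value of the quadratic form at (q₁, -q₀), which will be N(β)/f₀. Times b it is the
        -- value of the Hessian there, and that is the square of the Hessian's leading coefficient.
        norm-relation-ℤ : q₀ ℤ.* q₀ ℤ.* f₂ ℤ.- q₀ ℤ.* q₁ ℤ.* f₁ ℤ.+ q₁ ℤ.* q₁ ℤ.* f₀ ≡ + b ℤ.* f₀ ℤ.* f₀
        norm-relation-ℤ = *-cancelˡℤ b≢0 (begin
          + b ℤ.* (q₀ ℤ.* q₀ ℤ.* f₂ ℤ.- q₀ ℤ.* q₁ ℤ.* f₁ ℤ.+ q₁ ℤ.* q₁ ℤ.* f₀) ≡⟨ pull (+ b) q₀ q₁ f₀ f₁ f₂ ⟩
          q₀ ℤ.* q₀ ℤ.* (+ b ℤ.* f₂) ℤ.- q₀ ℤ.* q₁ ℤ.* (+ b ℤ.* f₁) ℤ.+ q₁ ℤ.* q₁ ℤ.* (+ b ℤ.* f₀)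
            ≡⟨ cong₂ (λ x y → x ℤ.+ q₁ ℤ.* q₁ ℤ.* y) (cong₂ (λ x y → q₀ ℤ.* q₀ ℤ.* x ℤ.- q₀ ℤ.* q₁ ℤ.* y) hessian₂ hessian₁) hessian₀ ⟨
          q₀ ℤ.* q₀ ℤ.* (q₂ ℤ.* q₂ ℤ.- q₁ ℤ.* q₃) ℤ.- q₀ ℤ.* q₁ ℤ.* (q₁ ℤ.* q₂ ℤ.- q₀ ℤ.* q₃) ℤ.+ q₁ ℤ.* q₁ ℤ.* (q₁ ℤ.* q₁ ℤ.- q₀ ℤ.* q₂)
            ≡⟨ square q₀ q₁ q₂ q₃ ⟩
          (q₁ ℤ.* q₁ ℤ.- q₀ ℤ.* q₂) ℤ.* (q₁ ℤ.* q₁ ℤ.- q₀ ℤ.* q₂) ≡⟨ cong (λ x → x ℤ.* x) hessian₀ ⟩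
          (+ b ℤ.* f₀) ℤ.* (+ b ℤ.* f₀) ≡⟨ regroup (+ b) f₀ ⟩
          + b ℤ.* (+ b ℤ.* f₀ ℤ.* f₀) ∎)
          where
          pull : ∀ b q₀ q₁ f₀ f₁ f₂ → b ℤ.* (q₀ ℤ.* q₀ ℤ.* f₂ ℤ.- q₀ ℤ.* q₁ ℤ.* f₁ ℤ.+ q₁ ℤ.* q₁ ℤ.* f₀)
            ≡ q₀ ℤ.* q₀ ℤ.* (b ℤ.* f₂) ℤ.- q₀ ℤ.* q₁ ℤ.* (b ℤ.* f₁) ℤ.+ q₁ ℤ.* q₁ ℤ.* (b ℤ.* f₀)
          pull = ℤ-Tactic.solve-∀
          square : ∀ q₀ q₁ q₂ q₃ → q₀ ℤ.* q₀ ℤ.* (q₂ ℤ.* q₂ ℤ.- q₁ ℤ.* q₃) ℤ.- q₀ ℤ.* q₁ ℤ.* (q₁ ℤ.* q₂ ℤ.- q₀ ℤ.* q₃) ℤ.+ q₁ ℤ.* q₁ ℤ.* (q₁ ℤ.* q₁ ℤ.- q₀ ℤ.* q₂)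
            ≡ (q₁ ℤ.* q₁ ℤ.- q₀ ℤ.* q₂) ℤ.* (q₁ ℤ.* q₁ ℤ.- q₀ ℤ.* q₂)
          square = ℤ-Tactic.solve-∀
          regroup : ∀ b f → (b ℤ.* f) ℤ.* (b ℤ.* f) ≡ b ℤ.* (b ℤ.* f ℤ.* f)
          regroup = ℤ-Tactic.solve-∀

        Q₀ Q₁ Q₂ Q₃ : K
        Q₀ = fromℤ q₀
        Q₁ = fromℤ q₁
        Q₂ = fromℤ q₂
        Q₃ = fromℤ q₃

        fromℤ-relation : ∀ i j k l → i ℤ.* f₀ ≡ j ℤ.* f₁ ℤ.- k ℤ.* l → fromℤ i ⊗ F₀ ≡ fromℤ j ⊗ F₁ ⊖ fromℤ k ⊗ fromℤ l
        fromℤ-relation i j k l eq = trans (sym (fromℤ-* i f₀)) (trans (cong fromℤ eq)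
          (fromℤ-minor j f₁ k l))

        ᾱ₂ : K
        ᾱ₂ = M ⊗ τ a₂

        F₀ᾱ₂ : F₀ ⊗ ᾱ₂ ≡ fromℤ h ⊕ τ θ
        F₀ᾱ₂ = NormForm.α₁ᾱ₂ explicit-normForm

        F₁≡ : F₁ ≡ F₀ ⊗ ᾱ₂ ⊕ a₂
        F₁≡ = begin
          F₁ ≡⟨ dual-trace explicit-normForm ⟨
          F₀ ⊗ ᾱ₂ ⊕ a₂ ⊗ (M ⊗ F₀) ≡⟨ cong (λ x → F₀ ⊗ ᾱ₂ ⊕ a₂ ⊗ x) MF₀≡1 ⟩
          F₀ ⊗ ᾱ₂ ⊕ a₂ ⊗ one ≡⟨ cong (F₀ ⊗ ᾱ₂ ⊕_) (⊗-identityʳ a₂) ⟩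
          F₀ ⊗ ᾱ₂ ⊕ a₂ ∎

        -- ᾱ₂ is a root of f₀X² - f₁X + f₂, the characteristic polynomial of the recurrence for the
        -- qᵢ.
        quadratic : F₀ ⊗ ᾱ₂ ⊗ ᾱ₂ ≡ F₁ ⊗ ᾱ₂ ⊖ F₂
        quadratic = begin
          F₀ ⊗ ᾱ₂ ⊗ ᾱ₂ ≡⟨ lemma (F₀ ⊗ ᾱ₂) a₂ ᾱ₂ ⟩
          (F₀ ⊗ ᾱ₂ ⊕ a₂) ⊗ ᾱ₂ ⊖ a₂ ⊗ ᾱ₂ ≡⟨ cong₂ (λ x y → x ⊗ ᾱ₂ ⊖ y) (sym F₁≡) (NormForm.α₂ᾱ₂ explicit-normForm) ⟩
          F₁ ⊗ ᾱ₂ ⊖ F₂ ∎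
          where
          lemma : ∀ x a y → x ⊗ y ≡ (x ⊕ a) ⊗ y ⊖ a ⊗ y
          lemma = solve 3 (λ x a y → x :* y := (x :+ a) :* y :- a :* y) refl

      -- As ᾱ₁ = 1, the elements β and βᾱ₂ must have θ-coordinates q₀ and q₁; these two conditions
      -- determine β.
      explicit-β : K
      explicit-β = fromℤ q₀ ⊗ (fromℤ h ⊕ θ) ⊖ fromℤ q₁ ⊗ fromℤ f₀

      private
        β : K
        β = explicit-β

        E : K → K → K
        E i j = i ⊗ F₂ ⊖ j ⊗ (F₀ ⊗ ᾱ₂)

        -- Multiplication by ᾱ₂ moves a pair (qᵢ, qᵢ₊₁) one step along the recurrence, so βᾱ₂, βᾱ₂²
        -- and βᾱ₂³ all have the same shape and lie in O.
        E-shift : ∀ i j k → k ⊗ F₀ ≡ j ⊗ F₁ ⊖ i ⊗ F₂ → E i j ⊗ ᾱ₂ ≡ E j k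
        E-shift i j k eq = begin
          (i ⊗ F₂ ⊖ j ⊗ (F₀ ⊗ ᾱ₂)) ⊗ ᾱ₂ ≡⟨ expand i j F₂ F₀ ᾱ₂ ⟩
          i ⊗ F₂ ⊗ ᾱ₂ ⊖ j ⊗ (F₀ ⊗ ᾱ₂ ⊗ ᾱ₂) ≡⟨ cong (λ x → i ⊗ F₂ ⊗ ᾱ₂ ⊖ j ⊗ x) quadratic ⟩
          i ⊗ F₂ ⊗ ᾱ₂ ⊖ j ⊗ (F₁ ⊗ ᾱ₂ ⊖ F₂) ≡⟨ collect i j F₁ F₂ ᾱ₂ ⟩
          j ⊗ F₂ ⊖ (j ⊗ F₁ ⊖ i ⊗ F₂) ⊗ ᾱ₂ ≡⟨ cong (λ x → j ⊗ F₂ ⊖ x ⊗ ᾱ₂) eq ⟨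
          j ⊗ F₂ ⊖ k ⊗ F₀ ⊗ ᾱ₂ ≡⟨ cong (λ x → j ⊗ F₂ ⊖ x) (⊗-assoc k F₀ ᾱ₂) ⟩
          j ⊗ F₂ ⊖ k ⊗ (F₀ ⊗ ᾱ₂) ∎
          where
          expand : ∀ i j f₂ f₀ y → (i ⊗ f₂ ⊖ j ⊗ (f₀ ⊗ y)) ⊗ y ≡ i ⊗ f₂ ⊗ y ⊖ j ⊗ (f₀ ⊗ y ⊗ y)
          expand = solve 5 (λ i j f₂ f₀ y → (i :* f₂ :- j :* (f₀ :* y)) :* y := i :* f₂ :* y :- j :* (f₀ :* y :* y)) refl
          collect : ∀ i j f₁ f₂ y → i ⊗ f₂ ⊗ y ⊖ j ⊗ (f₁ ⊗ y ⊖ f₂) ≡ j ⊗ f₂ ⊖ (j ⊗ f₁ ⊖ i ⊗ f₂) ⊗ y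
          collect = solve 5 (λ i j f₁ f₂ y → i :* f₂ :* y :- j :* (f₁ :* y :- f₂) := j :* f₂ :- (j :* f₁ :- i :* f₂) :* y) refl

        InOrder : ℤ → K → Set
        InOrder n z = ∃[ m ] z ≡ fromℤ m ⊕ fromℤ n ⊗ θ

        E-order : ∀ i j → InOrder j (E (fromℤ i) (fromℤ j))
        E-order i j = i ℤ.* f₂ ℤ.- j ℤ.* (h ℤ.+ p) , (begin
          I ⊗ F₂ ⊖ I′ ⊗ (F₀ ⊗ ᾱ₂) ≡⟨ cong (λ x → I ⊗ F₂ ⊖ I′ ⊗ x) (trans F₀ᾱ₂ (cong (fromℤ h ⊕_) θ-conjugate)) ⟩
          I ⊗ F₂ ⊖ I′ ⊗ (fromℤ h ⊕ (fromℤ p ⊖ θ)) ≡⟨ collect I F₂ I′ (fromℤ h) (fromℤ p) θ ⟩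
          I ⊗ F₂ ⊖ I′ ⊗ (fromℤ h ⊕ fromℤ p) ⊕ I′ ⊗ θ ≡⟨ cong (_⊕ I′ ⊗ θ) constant ⟨
          fromℤ (i ℤ.* f₂ ℤ.- j ℤ.* (h ℤ.+ p)) ⊕ I′ ⊗ θ ∎)
          where
          I I′ : K
          I = fromℤ i
          I′ = fromℤ j
          collect : ∀ i f j h p t → i ⊗ f ⊖ j ⊗ (h ⊕ (p ⊖ t)) ≡ i ⊗ f ⊖ j ⊗ (h ⊕ p) ⊕ j ⊗ t
          collect = solve 6 (λ i f j h p t → i :* f :- j :* (h :+ (p :- t)) := i :* f :- j :* (h :+ p) :+ j :* t) refl
          constant : fromℤ (i ℤ.* f₂ ℤ.- j ℤ.* (h ℤ.+ p)) ≡ I ⊗ F₂ ⊖ I′ ⊗ (fromℤ h ⊕ fromℤ p)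
          constant = trans (fromℤ-minor i f₂ j (h ℤ.+ p)) (cong (λ x → I ⊗ F₂ ⊖ I′ ⊗ x) (fromℤ-+ h p))

        t₁ : β ⊗ ᾱ₂ ≡ E Q₀ Q₁
        t₁ = trans (expand Q₀ a₂ Q₁ F₀ ᾱ₂) (cong (λ x → Q₀ ⊗ x ⊖ Q₁ ⊗ (F₀ ⊗ ᾱ₂)) (NormForm.α₂ᾱ₂ explicit-normForm))
          where
          expand : ∀ q a q′ f y → (q ⊗ a ⊖ q′ ⊗ f) ⊗ y ≡ q ⊗ (a ⊗ y) ⊖ q′ ⊗ (f ⊗ y)
          expand = solve 5 (λ q a q′ f y → (q :* a :- q′ :* f) :* y := q :* (a :* y) :- q′ :* (f :* y)) refl

        t₂ : β ⊗ ᾱ₂ ⊗ ᾱ₂ ≡ E Q₁ Q₂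
        t₂ = trans (cong (_⊗ ᾱ₂) t₁) (E-shift Q₀ Q₁ Q₂ (fromℤ-relation q₂ q₁ q₀ f₂ relation₀))

        t₃ : β ⊗ ᾱ₂ ⊗ ᾱ₂ ⊗ ᾱ₂ ≡ E Q₂ Q₃
        t₃ = trans (cong (_⊗ ᾱ₂) t₂) (E-shift Q₁ Q₂ Q₃ (fromℤ-relation q₃ q₂ q₁ f₂ relation₁))

        order₀ : InOrder q₀ β
        order₀ = q₀ ℤ.* h ℤ.- q₁ ℤ.* f₀ , trans (collect Q₀ (fromℤ h) θ Q₁ F₀) (cong (_⊕ Q₀ ⊗ θ) (sym (fromℤ-minor q₀ h q₁ f₀)))
          where
          collect : ∀ q h t q′ f → q ⊗ (h ⊕ t) ⊖ q′ ⊗ f ≡ q ⊗ h ⊖ q′ ⊗ f ⊕ q ⊗ t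
          collect = solve 5 (λ q h t q′ f → q :* (h :+ t) :- q′ :* f := q :* h :- q′ :* f :+ q :* t) refl

        order₁ : InOrder q₁ (β ⊗ ᾱ₂)
        order₁ = subst (InOrder q₁) (sym t₁) (E-order q₀ q₁)

        order₂ : InOrder q₂ (β ⊗ ᾱ₂ ⊗ ᾱ₂)
        order₂ = subst (InOrder q₂) (sym t₂) (E-order q₁ q₂)

        order₃ : InOrder q₃ (β ⊗ ᾱ₂ ⊗ ᾱ₂ ⊗ ᾱ₂)
        order₃ = subst (InOrder q₃) (sym t₃) (E-order q₂ q₃)

        inOrder⇒O : ∀ n z → InOrder n z → O z
        inOrder⇒O n z (m , z≡) = subst O (sym z≡) (order-intro m n)

      private
        mono₁ : ∀ b y → b ⊗ (one ⊗ one ⊗ y) ≡ b ⊗ y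
        mono₁ = solve 2 (λ b y → b :* (con (+ 1) :* con (+ 1) :* y) := b :* y) refl
        mono₂ : ∀ b y → b ⊗ (one ⊗ y ⊗ y) ≡ b ⊗ y ⊗ y
        mono₂ = solve 2 (λ b y → b :* (con (+ 1) :* y :* y) := b :* y :* y) refl
        mono₃ : ∀ b y → b ⊗ (y ⊗ y ⊗ y) ≡ b ⊗ y ⊗ y ⊗ y
        mono₃ = solve 2 (λ b y → b :* (y :* y :* y) := b :* y :* y :* y) refl

      explicit-coefficients : ∀ g → IsCoefficient explicit-normForm explicit-β g →
        HasCoefficients g (τ (fromℤ f₀)) (τ (fromℤ h ⊕ θ)) q₀ q₁ q₂ q₃
      explicit-coefficients g g-coefficient = hasCoefficients
        (value a₁ a₁ a₁ q₀ order₀ (trans (cong (λ u → β ⊗ (u ⊗ u ⊗ u)) MF₀≡1) (⊗-one³ β)))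
        (value a₁ a₁ a₂ q₁ order₁ (trans (cong (λ u → β ⊗ (u ⊗ u ⊗ ᾱ₂)) MF₀≡1) (mono₁ β ᾱ₂)))
        (value a₁ a₂ a₂ q₂ order₂ (trans (cong (λ u → β ⊗ (u ⊗ ᾱ₂ ⊗ ᾱ₂)) MF₀≡1) (mono₂ β ᾱ₂)))
        (value a₂ a₂ a₂ q₃ order₃ (mono₃ β ᾱ₂))
        where
        value : ∀ x y z n {t} → InOrder n t → β ⊗ ((M ⊗ τ x) ⊗ (M ⊗ τ y) ⊗ (M ⊗ τ z)) ≡ t → Tr (g ⊗ τ x ⊗ τ y ⊗ τ z) ≡ toℚ n
        value x y z n (m , t≡) eq = Tr-value (g ⊗ τ x ⊗ τ y ⊗ τ z) m n
          (trans (S√⊗g⊗ explicit-normForm β g g-coefficient x y z) (trans eq t≡))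

      explicit-Nm : Nm explicit-β ≡ toℚ (+ b) * (toℚ f₀ * toℚ f₀ * toℚ f₀)
      explicit-Nm = cong re (begin
        fromℚ (Nm β) ≡⟨ fromℚ-Nm β ⟨
        β ⊗ τ β ≡⟨ cong (β ⊗_) conjugate ⟩
        (Q₀ ⊗ a₂ ⊖ Q₁ ⊗ F₀) ⊗ (Q₀ ⊗ τ a₂ ⊖ Q₁ ⊗ F₀) ≡⟨ expand Q₀ Q₁ F₀ a₂ (τ a₂) ⟩
        Q₀ ⊗ Q₀ ⊗ (a₂ ⊗ τ a₂) ⊖ Q₀ ⊗ Q₁ ⊗ F₀ ⊗ (τ a₂ ⊕ a₂) ⊕ Q₁ ⊗ Q₁ ⊗ F₀ ⊗ F₀ ≡⟨ cong₂ (λ x y → Q₀ ⊗ Q₀ ⊗ x ⊖ Q₀ ⊗ Q₁ ⊗ F₀ ⊗ y ⊕ Q₁ ⊗ Q₁ ⊗ F₀ ⊗ F₀) a₂τa₂ trace ⟩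
        Q₀ ⊗ Q₀ ⊗ (F₀ ⊗ F₂) ⊖ Q₀ ⊗ Q₁ ⊗ F₀ ⊗ F₁ ⊕ Q₁ ⊗ Q₁ ⊗ F₀ ⊗ F₀ ≡⟨ factor Q₀ Q₁ F₀ F₁ F₂ ⟩
        F₀ ⊗ (Q₀ ⊗ Q₀ ⊗ F₂ ⊖ Q₀ ⊗ Q₁ ⊗ F₁ ⊕ Q₁ ⊗ Q₁ ⊗ F₀) ≡⟨ cong (F₀ ⊗_) value ⟩
        F₀ ⊗ (fromℤ (+ b) ⊗ F₀ ⊗ F₀) ≡⟨ regroup (fromℤ (+ b)) F₀ ⟩
        fromℤ (+ b) ⊗ (F₀ ⊗ F₀ ⊗ F₀) ≡⟨ cong (λ x → fromℤ (+ b) ⊗ (x ⊗ F₀)) (fromℚ-* ν ν) ⟨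
        fromℤ (+ b) ⊗ (fromℚ (ν * ν) ⊗ F₀) ≡⟨ cong (fromℤ (+ b) ⊗_) (fromℚ-* (ν * ν) ν) ⟨
        fromℤ (+ b) ⊗ fromℚ (ν * ν * ν) ≡⟨ fromℚ-* (toℚ (+ b)) (ν * ν * ν) ⟨
        fromℚ (toℚ (+ b) * (ν * ν * ν)) ∎)
        where
        conjugate : τ β ≡ Q₀ ⊗ τ a₂ ⊖ Q₁ ⊗ F₀
        conjugate = trans (τ-⊕ (Q₀ ⊗ a₂) (neg (Q₁ ⊗ F₀))) (cong₂ _⊕_ (τ-⊗ Q₀ a₂) (cong neg (τ-⊗ Q₁ F₀)))
        expand : ∀ q r f a a′ → (q ⊗ a ⊖ r ⊗ f) ⊗ (q ⊗ a′ ⊖ r ⊗ f) ≡ q ⊗ q ⊗ (a ⊗ a′) ⊖ q ⊗ r ⊗ f ⊗ (a′ ⊕ a) ⊕ r ⊗ r ⊗ f ⊗ f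
        expand = solve 5 (λ q r f a a′ → (q :* a :- r :* f) :* (q :* a′ :- r :* f) := q :* q :* (a :* a′) :- q :* r :* f :* (a′ :+ a) :+ r :* r :* f :* f) refl
        trace : τ a₂ ⊕ a₂ ≡ F₁
        trace = trans (cong (_⊕ a₂) (trans τa₂ (sym F₀ᾱ₂))) (sym F₁≡)
        factor : ∀ q r f f₁ f₂ → q ⊗ q ⊗ (f ⊗ f₂) ⊖ q ⊗ r ⊗ f ⊗ f₁ ⊕ r ⊗ r ⊗ f ⊗ f ≡ f ⊗ (q ⊗ q ⊗ f₂ ⊖ q ⊗ r ⊗ f₁ ⊕ r ⊗ r ⊗ f)
        factor = solve 5 (λ q r f f₁ f₂ → q :* q :* (f :* f₂) :- q :* r :* f :* f₁ :+ r :* r :* f :* f := f :* (q :* q :* f₂ :- q :* r :* f₁ :+ r :* r :* f)) refl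
        regroup : ∀ b f → f ⊗ (b ⊗ f ⊗ f) ≡ b ⊗ (f ⊗ f ⊗ f)
        regroup = solve 2 (λ b f → f :* (b :* f :* f) := b :* (f :* f :* f)) refl
        value : Q₀ ⊗ Q₀ ⊗ F₂ ⊖ Q₀ ⊗ Q₁ ⊗ F₁ ⊕ Q₁ ⊗ Q₁ ⊗ F₀ ≡ fromℤ (+ b) ⊗ F₀ ⊗ F₀
        value = begin
          Q₀ ⊗ Q₀ ⊗ F₂ ⊖ Q₀ ⊗ Q₁ ⊗ F₁ ⊕ Q₁ ⊗ Q₁ ⊗ F₀
            ≡⟨ cong₂ _⊕_ (cong₂ _⊖_ (fromℤ-*₃ q₀ q₀ f₂) (fromℤ-*₃ q₀ q₁ f₁)) (fromℤ-*₃ q₁ q₁ f₀) ⟨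
          fromℤ (q₀ ℤ.* q₀ ℤ.* f₂) ⊖ fromℤ (q₀ ℤ.* q₁ ℤ.* f₁) ⊕ fromℤ (q₁ ℤ.* q₁ ℤ.* f₀)
            ≡⟨ cong (λ x → fromℤ (q₀ ℤ.* q₀ ℤ.* f₂) ⊕ x ⊕ fromℤ (q₁ ℤ.* q₁ ℤ.* f₀)) (fromℤ-neg (q₀ ℤ.* q₁ ℤ.* f₁)) ⟨
          fromℤ (q₀ ℤ.* q₀ ℤ.* f₂) ⊕ fromℤ (ℤ.- (q₀ ℤ.* q₁ ℤ.* f₁)) ⊕ fromℤ (q₁ ℤ.* q₁ ℤ.* f₀)
            ≡⟨ cong (_⊕ fromℤ (q₁ ℤ.* q₁ ℤ.* f₀)) (fromℤ-+ (q₀ ℤ.* q₀ ℤ.* f₂) (ℤ.- (q₀ ℤ.* q₁ ℤ.* f₁))) ⟨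
          fromℤ (q₀ ℤ.* q₀ ℤ.* f₂ ℤ.- q₀ ℤ.* q₁ ℤ.* f₁) ⊕ fromℤ (q₁ ℤ.* q₁ ℤ.* f₀)
            ≡⟨ fromℤ-+ (q₀ ℤ.* q₀ ℤ.* f₂ ℤ.- q₀ ℤ.* q₁ ℤ.* f₁) (q₁ ℤ.* q₁ ℤ.* f₀) ⟨
          fromℤ (q₀ ℤ.* q₀ ℤ.* f₂ ℤ.- q₀ ℤ.* q₁ ℤ.* f₁ ℤ.+ q₁ ℤ.* q₁ ℤ.* f₀)
            ≡⟨ cong fromℤ norm-relation-ℤ ⟩
          fromℤ (+ b ℤ.* f₀ ℤ.* f₀)
            ≡⟨ fromℤ-*₃ (+ b) f₀ f₀ ⟩
          fromℤ (+ b) ⊗ F₀ ⊗ F₀ ∎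

      explicit-positive : Positive explicit-β (fromℤ f₀) (fromℤ h ⊕ θ)
      explicit-positive = subst (0ℚ <_) (sym (trans (cong₂ _*_ explicit-Nm det-a) (regroup (toℚ (+ b)) ν (½ * C))))
        (*-pos (*-pos (toℚ-pos 1≤b) (*-pos (square-pos toℚf₀≢0) (square-pos toℚf₀≢0))) 0<½C)
        where
        regroup : ∀ b v h → b * (v * v * v) * (v * h) ≡ b * (v * v * (v * v)) * h
        regroup = solve-∀ ℚ-ring

      private
        power-order : ∀ x y z → span one ᾱ₂ x → span one ᾱ₂ y → span one ᾱ₂ z → O (β ⊗ (x ⊗ y ⊗ z))
        power-order = trilinear one ᾱ₂ (⊗ˡ-preimage order-subgroup β)
          (at (⊗-one³ β) o₀) (at (mono₁ β ᾱ₂) o₁) (at (mono₁′ β ᾱ₂) o₁) (at (mono₂ β ᾱ₂) o₂)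
          (at (mono₁″ β ᾱ₂) o₁) (at (mono₂′ β ᾱ₂) o₂) (at (mono₂″ β ᾱ₂) o₂) (at (mono₃ β ᾱ₂) o₃)
          where
          at : ∀ {w t} → w ≡ t → O t → O w
          at w≡t t∈ = subst O (sym w≡t) t∈
          o₀ : O β
          o₀ = inOrder⇒O q₀ β order₀
          o₁ : O (β ⊗ ᾱ₂)
          o₁ = inOrder⇒O q₁ (β ⊗ ᾱ₂) order₁
          o₂ : O (β ⊗ ᾱ₂ ⊗ ᾱ₂)
          o₂ = inOrder⇒O q₂ (β ⊗ ᾱ₂ ⊗ ᾱ₂) order₂
          o₃ : O (β ⊗ ᾱ₂ ⊗ ᾱ₂ ⊗ ᾱ₂)
          o₃ = inOrder⇒O q₃ (β ⊗ ᾱ₂ ⊗ ᾱ₂ ⊗ ᾱ₂) order₃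
          mono₁′ : ∀ b y → b ⊗ (one ⊗ y ⊗ one) ≡ b ⊗ y
          mono₁′ = solve 2 (λ b y → b :* (con (+ 1) :* y :* con (+ 1)) := b :* y) refl
          mono₁″ : ∀ b y → b ⊗ (y ⊗ one ⊗ one) ≡ b ⊗ y
          mono₁″ = solve 2 (λ b y → b :* (y :* con (+ 1) :* con (+ 1)) := b :* y) refl
          mono₂′ : ∀ b y → b ⊗ (y ⊗ one ⊗ y) ≡ b ⊗ y ⊗ y
          mono₂′ = solve 2 (λ b y → b :* (y :* con (+ 1) :* y) := b :* y :* y) refl
          mono₂″ : ∀ b y → b ⊗ (y ⊗ y ⊗ one) ≡ b ⊗ y ⊗ y
          mono₂″ = solve 2 (λ b y → b :* (y :* y :* con (+ 1)) := b :* y :* y) refl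

        ᾱ₁ : K
        ᾱ₁ = M ⊗ F₀

        dual⊆ : ∀ x → span ᾱ₁ ᾱ₂ x → span one ᾱ₂ x
        dual⊆ x = subst (λ u → span u ᾱ₂ x) MF₀≡1

        dual-cube-order : ∀ x y z → span ᾱ₁ ᾱ₂ x → span ᾱ₁ ᾱ₂ y → span ᾱ₁ ᾱ₂ z → O (β ⊗ (x ⊗ y ⊗ z))
        dual-cube-order x y z x∈ y∈ z∈ = power-order x y z (dual⊆ x x∈) (dual⊆ y y∈) (dual⊆ z z∈)

        G : NormForm a₁ a₂
        G = explicit-normForm

      -- In β·1·1·1 each factor 1 is expanded in 𝔞𝔞⁻¹. The three factors from 𝔞⁻¹ together with β
      -- lie in O, which acts on 𝔞, and three factors from 𝔞 are left.
      explicit-inCube : InCube (fromℤ f₀) (fromℤ h ⊕ θ) explicit-β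
      explicit-inCube = subst P (trivial β) (products one one one 1∈order 1∈order 1∈order)
        where
        P : Sub
        P = Gen (cubeGens a₁ a₂)
        P-subgroup : IsSubgroup P
        P-subgroup = Gen-isSubgroup (cubeGens a₁ a₂)
        trivial : ∀ b → one ⊗ one ⊗ one ⊗ b ≡ b
        trivial = solve 1 (λ b → con (+ 1) :* con (+ 1) :* con (+ 1) :* b := b) refl
        order-closed : ∀ o x y z → O o → span a₁ a₂ x → span a₁ a₂ y → span a₁ a₂ z → P ((o ⊗ x) ⊗ y ⊗ z)
        order-closed o x y z o∈ x∈ y∈ z∈ = cube-intro a₁ a₂ (o ⊗ x) y z (explicit-stable o x o∈ x∈) y∈ z∈
        exchange : ∀ b x y z x′ y′ z′ → ((b ⊗ (x′ ⊗ y′ ⊗ z′)) ⊗ x) ⊗ y ⊗ z ≡ (x ⊗ x′) ⊗ (y ⊗ y′) ⊗ (z ⊗ z′) ⊗ b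
        exchange = solve 7 (λ b x y z x′ y′ z′ → ((b :* (x′ :* y′ :* z′)) :* x) :* y :* z := (x :* x′) :* (y :* y′) :* (z :* z′) :* b) refl
        products : ∀ o₁ o₂ o₃ → O o₁ → O o₂ → O o₃ → P (o₁ ⊗ o₂ ⊗ o₃ ⊗ β)
        products o₁ o₂ o₃ o₁∈ o₂∈ o₃∈ =
          order⊆product G (⊗ʳ-preimage (⊗ʳ-preimage (⊗ʳ-preimage P-subgroup β) o₃) o₂) (λ x x′ x∈ x′∈ →
          order⊆product G (⊗ˡ-preimage (⊗ʳ-preimage (⊗ʳ-preimage P-subgroup β) o₃) (x ⊗ x′)) (λ y y′ y∈ y′∈ →
          order⊆product G (⊗ˡ-preimage (⊗ʳ-preimage P-subgroup β) ((x ⊗ x′) ⊗ (y ⊗ y′))) (λ z z′ z∈ z′∈ →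
            subst P (exchange β x y z x′ y′ z′)
              (order-closed (β ⊗ (x′ ⊗ y′ ⊗ z′)) x y z (dual-cube-order x′ y′ z′ x′∈ y′∈ z′∈) x∈ y∈ z∈))
          o₃ o₃∈) o₂ o₂∈) o₁ o₁∈

      explicit-normCond : NormCond b c (fromℤ f₀) (fromℤ h ⊕ θ) explicit-β
      explicit-normCond = go (lattice-basis (map (β ⊗_) (cubeGens ᾱ₁ ᾱ₂))
        (d ᾱ₁ ᾱ₁ ᾱ₁ m₁ m₁ m₁ ∷ d ᾱ₁ ᾱ₁ ᾱ₂ m₁ m₁ m₂ ∷ d ᾱ₁ ᾱ₂ ᾱ₁ m₁ m₂ m₁ ∷ d ᾱ₁ ᾱ₂ ᾱ₂ m₁ m₂ m₂
        ∷ d ᾱ₂ ᾱ₁ ᾱ₁ m₂ m₁ m₁ ∷ d ᾱ₂ ᾱ₁ ᾱ₂ m₂ m₁ m₂ ∷ d ᾱ₂ ᾱ₂ ᾱ₁ m₂ m₂ m₁ ∷ d ᾱ₂ ᾱ₂ ᾱ₂ m₂ m₂ m₂ ∷ []))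
        where
        d = dual-cube-order
        m₁ = α₁∈span ᾱ₁ ᾱ₂
        m₂ = α₂∈span ᾱ₁ ᾱ₂
        q≡b : Nm β * (μ * μ * μ) ≡ toℚ (+ b)
        q≡b = begin
          Nm β * (μ * μ * μ) ≡⟨ cong (_* (μ * μ * μ)) explicit-Nm ⟩
          toℚ (+ b) * (ν * ν * ν) * (μ * μ * μ) ≡⟨ regroup (toℚ (+ b)) ν μ ⟩
          toℚ (+ b) * ((ν * μ) * (ν * μ) * (ν * μ)) ≡⟨ cong (λ x → toℚ (+ b) * (x * x * x)) (recip-inverse toℚf₀≢0) ⟩
          toℚ (+ b) * (1ℚ * 1ℚ * 1ℚ) ≡⟨ ℚ.*-identityʳ (toℚ (+ b)) ⟩
          toℚ (+ b) ∎
          where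
          regroup : ∀ b v m → b * (v * v * v) * (m * m * m) ≡ b * ((v * m) * (v * m) * (v * m))
          regroup = solve-∀ ℚ-ring
        q≢0 : Nm β * (μ * μ * μ) ≢ 0ℚ
        q≢0 q≡0 = <⇒≢0 (toℚ-pos 1≤b) (trans (sym q≡b) q≡0)
        go : ∃[ δ₁ ] ∃[ δ₂ ] (span δ₁ δ₂ ≐ Gen (map (β ⊗_) (cubeGens ᾱ₁ ᾱ₂))) → NormCond b c a₁ a₂ β
        go (δ₁ , δ₂ , δ≐Λ) = ᾱ₁ , ᾱ₂ , dual-isInverse G explicit-stable , δ₁ , δ₂ ,
          cube-independent G β δ₁ δ₂ δ≐Λ q≢0 , δ≐Λ ,
          trans (cubeNorm G β δ₁ δ₂ δ≐Λ q≢0) (trans (cong ℚ.∣_∣ q≡b) (∣p∣-pos (toℚ-pos 1≤b)))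

      explicit-datum : Datum b (fromℤ f₀) (fromℤ h ⊕ θ) explicit-β
      explicit-datum = datum
        (independent G , λ o x o∈ x∈ → explicit-stable o x (≐⇒⊇ O≐Order o o∈) x∈)
        (ᾱ₁ , ᾱ₂ , dual-isInverse G explicit-stable)
        explicit-inCube explicit-normCond

      private
        explicit-realisation : ∀ g → IsCoefficient explicit-normForm explicit-β g →
          Realisation b (fromℤ f₀) (fromℤ h ⊕ θ) explicit-β (form q₀ (+ 3 ℤ.* q₁) (+ 3 ℤ.* q₂) q₃)
        explicit-realisation g g-coefficient = realisation a₁ a₂ (≐-intro (λ _ x∈ → x∈) (λ _ x∈ → x∈)) explicit-positive
          explicit-normForm g g-coefficient (cubicForm-coefficients (explicit-coefficients g g-coefficient))

      opaque
        explicit-preimage : ∃[ α₁ ] ∃[ α₂ ] ∃[ β ] (Datum b α₁ α₂ β ×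
          Realisation b α₁ α₂ β (form q₀ (+ 3 ℤ.* q₁) (+ 3 ℤ.* q₂) q₃))
        explicit-preimage = fromℤ f₀ , fromℤ h ⊕ θ , explicit-β , explicit-datum ,
          explicit-realisation (coefficient (NormForm.ν explicit-normForm) explicit-β)
            (coefficient-isCoefficient explicit-normForm explicit-β)

-- Preparing a cubic form for reconstruction

module FormReduction where
  open import Data.Integer using (_+_; _*_; -_; _-_)
  open IntegerLemmas
  open FormInvariance
  open ≡-Reasoning

  -- k = (w/g)² is an integer, so the denominator u of w/g in lowest terms is a unit.
  square-quotient : ∀ g k w → + g ≢ + 0 → + g * + g * k ≡ w * w → ∃[ z ] k ≡ z * z
  square-quotient g k w g≢0 eq = go (bezout (+ g) w)
    where
    go : ∃[ d ] ∃[ u ] ∃[ v ] ∃[ r ] ∃[ s ] (+ g ≡ + d * u × w ≡ + d * v × r * u + s * v ≡ + 1) → ∃[ z ] k ≡ z * z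
    go (d , u , v , r , s , g≡ , w≡ , ru+sv≡1) = v , (begin
      k ≡⟨ ℤ.*-identityˡ k ⟨
      + 1 * k ≡⟨ cong (_* k) (unit-square (abs≡1⇒±1 u (unit-abs u y uy≡1))) ⟨
      u * u * k ≡⟨ uuk≡vv ⟩
      v * v ∎)
      where
      d≢0 : + d ≢ + 0
      d≢0 d≡0 = g≢0 (trans g≡ (trans (cong (_* u) d≡0) (ℤ.*-zeroˡ u)))
      uuk≡vv : u * u * k ≡ v * v
      uuk≡vv = *-cancelˡℤ d≢0 (*-cancelˡℤ d≢0 (begin
        + d * (+ d * (u * u * k)) ≡⟨ regroup (+ d) u k ⟩
        (+ d * u) * (+ d * u) * k ≡⟨ cong (λ i → i * i * k) g≡ ⟨
        + g * + g * k ≡⟨ eq ⟩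
        w * w ≡⟨ cong (λ i → i * i) w≡ ⟩
        (+ d * v) * (+ d * v) ≡⟨ regroup′ (+ d) v ⟩
        + d * (+ d * (v * v)) ∎))
        where
        regroup : ∀ d u k → d * (d * (u * u * k)) ≡ (d * u) * (d * u) * k
        regroup = ℤ-Tactic.solve-∀
        regroup′ : ∀ d v → (d * v) * (d * v) ≡ d * (d * (v * v))
        regroup′ = ℤ-Tactic.solve-∀
      y : ℤ
      -- The inverse of u comes from expanding 1 = (ru + sv)² and replacing v² by u²k.
      y = r * r * u + + 2 * (r * s * v) + s * s * (u * k)
      uy≡1 : u * y ≡ + 1
      uy≡1 = begin
        u * y ≡⟨ expand u v r s k ⟩
        u * (r * r * u + + 2 * (r * s * v)) + s * s * (u * u * k) ≡⟨ cong (λ i → u * (r * r * u + + 2 * (r * s * v)) + s * s * i) uuk≡vv ⟩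
        u * (r * r * u + + 2 * (r * s * v)) + s * s * (v * v) ≡⟨ collect u v r s ⟩
        (r * u + s * v) * (r * u + s * v) ≡⟨ cong (λ i → i * i) ru+sv≡1 ⟩
        + 1 ∎
        where
        expand : ∀ u v r s k → u * (r * r * u + + 2 * (r * s * v) + s * s * (u * k))
          ≡ u * (r * r * u + + 2 * (r * s * v)) + s * s * (u * u * k)
        expand = ℤ-Tactic.solve-∀
        collect : ∀ u v r s → u * (r * r * u + + 2 * (r * s * v)) + s * s * (v * v)
          ≡ (r * u + s * v) * (r * u + s * v)
        collect = ℤ-Tactic.solve-∀
      unit-square : u ≡ + 1 ⊎ u ≡ - + 1 → u * u ≡ + 1
      unit-square (inj₁ u≡1) = cong (λ i → i * i) u≡1
      unit-square (inj₂ u≡-1) = cong (λ i → i * i) u≡-1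

  module _ {D κ : ℤ} (4κ≡D²-D : + 4 * κ ≡ D * D - D) where

    -- Modulo 4 the number D² agrees with D, so f₁² agrees with c²D and hence with (cD)²; thus f₁
    -- and cD have the same parity.
    middle-parity : ∀ f₀ f₁ f₂ c → f₁ * f₁ - + 4 * (f₀ * f₂) ≡ c * c * D → ∃[ h ] f₁ ≡ + 2 * h + c * D
    middle-parity f₀ f₁ f₂ c eq = go (parity (f₁ - c * D))
      where
      add-back : ∀ f y → f ≡ (f - y) + y
      add-back = ℤ-Tactic.solve-∀
      go : ∃[ j ] (f₁ - c * D ≡ + 2 * j ⊎ f₁ - c * D ≡ + 2 * j + + 1) → ∃[ h ] f₁ ≡ + 2 * h + c * D
      go (j , inj₁ even) = j , trans (add-back f₁ (c * D)) (cong (_+ c * D) even)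
      -- The cross term 2(2j + 1)cD need not vanish mod 4. Doubling the equation makes it vanish and
      -- leaves 2(2j + 1)², which is 2 mod 4.
      go (j , inj₂ odd) = ⊥-elim (from-no (4 ℕ.∣? 2) (mod4 ((+ 2 * j + + 1) * c * D + + 2 * (j * j + j) + + 2 * (c * c * κ))
          (+ 2 * (f₀ * f₂)) (+ 2) (+ 0) (begin
        + 4 * ((+ 2 * j + + 1) * c * D + + 2 * (j * j + j) + + 2 * (c * c * κ)) + + 2
          ≡⟨ isolate j c D κ ⟩
        + 4 * ((+ 2 * j + + 1) * c * D + + 2 * (j * j + j)) + + 2 * (c * c * (+ 4 * κ)) + + 2
          ≡⟨ cong (λ i → + 4 * ((+ 2 * j + + 1) * c * D + + 2 * (j * j + j)) + + 2 * (c * c * i) + + 2) 4κ≡D²-D ⟩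
        + 4 * ((+ 2 * j + + 1) * c * D + + 2 * (j * j + j)) + + 2 * (c * c * (D * D - D)) + + 2
          ≡⟨ complete j c D ⟩
        + 2 * ((+ 2 * j + + 1 + c * D) * (+ 2 * j + + 1 + c * D) - c * c * D)
          ≡⟨ cong₂ (λ x y → + 2 * (x * x - y)) (trans (add-back f₁ (c * D)) (cong (_+ c * D) odd)) eq ⟨
        + 2 * (f₁ * f₁ - (f₁ * f₁ - + 4 * (f₀ * f₂)))
          ≡⟨ cancel f₁ (f₀ * f₂) ⟩
        + 4 * (+ 2 * (f₀ * f₂)) + + 0 ∎)))
        where
        isolate : ∀ j c D k → + 4 * ((+ 2 * j + + 1) * c * D + + 2 * (j * j + j) + + 2 * (c * c * k)) + + 2
          ≡ + 4 * ((+ 2 * j + + 1) * c * D + + 2 * (j * j + j)) + + 2 * (c * c * (+ 4 * k)) + + 2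
        isolate = ℤ-Tactic.solve-∀
        complete : ∀ j c D → + 4 * ((+ 2 * j + + 1) * c * D + + 2 * (j * j + j)) + + 2 * (c * c * (D * D - D)) + + 2
          ≡ + 2 * ((+ 2 * j + + 1 + c * D) * (+ 2 * j + + 1 + c * D) - c * c * D)
        complete = ℤ-Tactic.solve-∀
        cancel : ∀ f x → + 2 * (f * f - (f * f - + 4 * x)) ≡ + 4 * (+ 2 * x) + + 0
        cancel = ℤ-Tactic.solve-∀

    -- The right side is the norm of h + cω; that f₀ divides it is what makes ℤf₀ + ℤ(h + cω) stable
    -- under the order.
    outer-product : ∀ f₀ h f₂ c → (+ 2 * h + c * D) * (+ 2 * h + c * D) - + 4 * (f₀ * f₂) ≡ c * c * D →
      f₀ * f₂ ≡ h * h + h * (c * D) + c * c * κ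
    outer-product f₀ h f₂ c eq = *-cancelˡℤ {+ 4} (λ ()) (begin
      + 4 * (f₀ * f₂) ≡⟨ isolate ((+ 2 * h + c * D) * (+ 2 * h + c * D)) (+ 4 * (f₀ * f₂)) ⟩
      F * F - (F * F - + 4 * (f₀ * f₂)) ≡⟨ cong (λ i → F * F - i) eq ⟩
      F * F - c * c * D ≡⟨ complete h c D ⟩
      + 4 * (h * h + h * (c * D)) + c * c * (D * D - D) ≡⟨ cong (λ i → + 4 * (h * h + h * (c * D)) + c * c * i) 4κ≡D²-D ⟨
      + 4 * (h * h + h * (c * D)) + c * c * (+ 4 * κ) ≡⟨ factor h (c * D) c κ ⟩
      + 4 * (h * h + h * (c * D) + c * c * κ) ∎)
      where
      F : ℤ
      F = + 2 * h + c * D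
      isolate : ∀ x y → y ≡ x - (x - y)
      isolate = ℤ-Tactic.solve-∀
      complete : ∀ h c D → (+ 2 * h + c * D) * (+ 2 * h + c * D) - c * c * D
        ≡ + 4 * (h * h + h * (c * D)) + c * c * (D * D - D)
      complete = ℤ-Tactic.solve-∀
      factor : ∀ h p c k → + 4 * (h * h + h * p) + c * c * (+ 4 * k) ≡ + 4 * (h * h + h * p + c * c * k)
      factor = ℤ-Tactic.solve-∀

  triple : ℤ → ℤ → ℤ → ℤ → L
  triple q₀ q₁ q₂ q₃ = form q₀ (+ 3 * q₁) (+ 3 * q₂) q₃

  hessian-discriminant : ℤ → ℤ → ℤ → ℤ → ℤ
  hessian-discriminant q₀ q₁ q₂ q₃ = (q₁ * q₂ - q₀ * q₃) * (q₁ * q₂ - q₀ * q₃)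
    - + 4 * ((q₁ * q₁ - q₀ * q₂) * (q₂ * q₂ - q₁ * q₃))

  identityΓ swapΓ shiftΓ : SL2Z
  identityΓ = mat (+ 1) (+ 0) (+ 0) (+ 1) refl
  swapΓ = mat (+ 0) (+ 1) (- + 1) (+ 0) refl
  shiftΓ = mat (+ 1) (+ 1) (+ 0) (+ 1) refl

  act-identity : ∀ x → act identityΓ x ≡ x
  act-identity (form a b c d) = form-≡ (c₀ a b c d) (c₁ a b c d) (c₂ a b c d) (c₃ a b c d)
    where
    c₀ : ∀ a b c d → a * + 1 + (b * + 0 + (c * + 0 + d * + 0)) ≡ a
    c₀ = ℤ-Tactic.solve-∀
    c₁ : ∀ a b c d → a * + 0 + (b * + 1 + (c * + 0 + d * + 0)) ≡ b
    c₁ = ℤ-Tactic.solve-∀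
    c₂ : ∀ a b c d → a * + 0 + (b * + 0 + (c * + 1 + d * + 0)) ≡ c
    c₂ = ℤ-Tactic.solve-∀
    c₃ : ∀ a b c d → a * + 0 + (b * + 0 + (c * + 0 + d * + 1)) ≡ d
    c₃ = ℤ-Tactic.solve-∀

  act-swap : ∀ q₀ q₁ q₂ q₃ → act swapΓ (triple q₀ q₁ q₂ q₃) ≡ triple q₃ (- q₂) q₁ (- q₀)
  act-swap q₀ q₁ q₂ q₃ = form-≡ (c₀ q₀ q₁ q₂ q₃) (c₁ q₀ q₁ q₂ q₃) (c₂ q₀ q₁ q₂ q₃) (c₃ q₀ q₁ q₂ q₃)
    where
    c₀ : ∀ q₀ q₁ q₂ q₃ → q₀ * + 0 + (+ 3 * q₁ * + 0 + (+ 3 * q₂ * + 0 + q₃ * + 1)) ≡ q₃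
    c₀ = ℤ-Tactic.solve-∀
    c₁ : ∀ q₀ q₁ q₂ q₃ → q₀ * + 0 + (+ 3 * q₁ * + 0 + (+ 3 * q₂ * (- + 1) + q₃ * + 0)) ≡ + 3 * - q₂
    c₁ = ℤ-Tactic.solve-∀
    c₂ : ∀ q₀ q₁ q₂ q₃ → q₀ * + 0 + (+ 3 * q₁ * + 1 + (+ 3 * q₂ * + 0 + q₃ * + 0)) ≡ + 3 * q₁
    c₂ = ℤ-Tactic.solve-∀
    c₃ : ∀ q₀ q₁ q₂ q₃ → q₀ * (- + 1) + (+ 3 * q₁ * + 0 + (+ 3 * q₂ * + 0 + q₃ * + 0)) ≡ - q₀
    c₃ = ℤ-Tactic.solve-∀

  act-shift : ∀ q₀ q₁ q₂ q₃ → act shiftΓ (triple q₀ q₁ q₂ q₃)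
    ≡ triple (q₀ + + 3 * q₁ + + 3 * q₂ + q₃) (q₁ + + 2 * q₂ + q₃) (q₂ + q₃) q₃
  act-shift q₀ q₁ q₂ q₃ = form-≡ (c₀ q₀ q₁ q₂ q₃) (c₁ q₀ q₁ q₂ q₃) (c₂ q₀ q₁ q₂ q₃) (c₃ q₀ q₁ q₂ q₃)
    where
    c₀ : ∀ q₀ q₁ q₂ q₃ → q₀ * + 1 + (+ 3 * q₁ * + 1 + (+ 3 * q₂ * + 1 + q₃ * + 1)) ≡ q₀ + + 3 * q₁ + + 3 * q₂ + q₃
    c₀ = ℤ-Tactic.solve-∀
    c₁ : ∀ q₀ q₁ q₂ q₃ → q₀ * + 0 + (+ 3 * q₁ * + 1 + (+ 3 * q₂ * + 2 + q₃ * + 3)) ≡ + 3 * (q₁ + + 2 * q₂ + q₃)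
    c₁ = ℤ-Tactic.solve-∀
    c₂ : ∀ q₀ q₁ q₂ q₃ → q₀ * + 0 + (+ 3 * q₁ * + 0 + (+ 3 * q₂ * + 1 + q₃ * + 3)) ≡ + 3 * (q₂ + q₃)
    c₂ = ℤ-Tactic.solve-∀
    c₃ : ∀ q₀ q₁ q₂ q₃ → q₀ * + 0 + (+ 3 * q₁ * + 0 + (+ 3 * q₂ * + 0 + q₃ * + 1)) ≡ q₃
    c₃ = ℤ-Tactic.solve-∀

  -- The Hessian is covariant and a nonzero binary quadratic form is nonzero at one of (1,0), (0,1), (1,1).
  leading-nonzero : ∀ {n} q₀ q₁ q₂ q₃ → n ≢ + 0 → hessian-discriminant q₀ q₁ q₂ q₃ ≡ n →
    ∃[ r₀ ] ∃[ r₁ ] ∃[ r₂ ] ∃[ r₃ ] (triple q₀ q₁ q₂ q₃ ∼Γ triple r₀ r₁ r₂ r₃ ×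
      r₁ * r₁ - r₀ * r₂ ≢ + 0 × hessian-discriminant r₀ r₁ r₂ r₃ ≡ n)
  leading-nonzero {n} q₀ q₁ q₂ q₃ n≢0 eq = go (R₀ ℤ.≟ + 0) (R₂ ℤ.≟ + 0)
    where
    R₀ R₁ R₂ : ℤ
    R₀ = q₁ * q₁ - q₀ * q₂
    R₁ = q₁ * q₂ - q₀ * q₃
    R₂ = q₂ * q₂ - q₁ * q₃
    go : Dec (R₀ ≡ + 0) → Dec (R₂ ≡ + 0) → ∃[ r₀ ] ∃[ r₁ ] ∃[ r₂ ] ∃[ r₃ ] (triple q₀ q₁ q₂ q₃ ∼Γ triple r₀ r₁ r₂ r₃ ×
      r₁ * r₁ - r₀ * r₂ ≢ + 0 × hessian-discriminant r₀ r₁ r₂ r₃ ≡ n)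
    go (no R₀≢0) _ = q₀ , q₁ , q₂ , q₃ , (identityΓ , act-identity (triple q₀ q₁ q₂ q₃)) , R₀≢0 , eq
    go (yes _) (no R₂≢0) = q₃ , - q₂ , q₁ , - q₀ , (swapΓ , act-swap q₀ q₁ q₂ q₃) ,
      (λ eq′ → R₂≢0 (trans (leading q₁ q₂ q₃) eq′)) , trans (invariant q₀ q₁ q₂ q₃) eq
      where
      leading : ∀ q₁ q₂ q₃ → q₂ * q₂ - q₁ * q₃ ≡ (- q₂) * (- q₂) - q₃ * q₁
      leading = ℤ-Tactic.solve-∀
      invariant : ∀ q₀ q₁ q₂ q₃ → ((- q₂) * q₁ - q₃ * (- q₀)) * ((- q₂) * q₁ - q₃ * (- q₀))
          - + 4 * (((- q₂) * (- q₂) - q₃ * q₁) * (q₁ * q₁ - (- q₂) * (- q₀)))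
        ≡ (q₁ * q₂ - q₀ * q₃) * (q₁ * q₂ - q₀ * q₃) - + 4 * ((q₁ * q₁ - q₀ * q₂) * (q₂ * q₂ - q₁ * q₃))
      invariant = ℤ-Tactic.solve-∀
    go (yes R₀≡0) (yes R₂≡0) = q₀ + + 3 * q₁ + + 3 * q₂ + q₃ , q₁ + + 2 * q₂ + q₃ , q₂ + q₃ , q₃ ,
      (shiftΓ , act-shift q₀ q₁ q₂ q₃) , (λ eq′ → R₁≢0 (trans (sym sum≡R₁) (trans (leading q₀ q₁ q₂ q₃) eq′))) , trans (invariant q₀ q₁ q₂ q₃) eq
      where
      R₁≢0 : R₁ ≢ + 0
      R₁≢0 R₁≡0 = n≢0 (trans (sym eq) (cong₂ (λ x y → x * x - + 4 * y) R₁≡0 (trans (cong₂ _*_ R₀≡0 R₂≡0) refl)))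
      sum≡R₁ : R₀ + R₁ + R₂ ≡ R₁
      sum≡R₁ = trans (cong₂ (λ x y → x + R₁ + y) R₀≡0 R₂≡0) (trans (ℤ.+-identityʳ (+ 0 + R₁)) (ℤ.+-identityˡ R₁))
      leading : ∀ q₀ q₁ q₂ q₃ → (q₁ * q₁ - q₀ * q₂) + (q₁ * q₂ - q₀ * q₃) + (q₂ * q₂ - q₁ * q₃)
        ≡ (q₁ + + 2 * q₂ + q₃) * (q₁ + + 2 * q₂ + q₃) - (q₀ + + 3 * q₁ + + 3 * q₂ + q₃) * (q₂ + q₃)
      leading = ℤ-Tactic.solve-∀
      invariant : ∀ q₀ q₁ q₂ q₃ →
        ((q₁ + + 2 * q₂ + q₃) * (q₂ + q₃) - (q₀ + + 3 * q₁ + + 3 * q₂ + q₃) * q₃)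
          * ((q₁ + + 2 * q₂ + q₃) * (q₂ + q₃) - (q₀ + + 3 * q₁ + + 3 * q₂ + q₃) * q₃)
          - + 4 * (((q₁ + + 2 * q₂ + q₃) * (q₁ + + 2 * q₂ + q₃) - (q₀ + + 3 * q₁ + + 3 * q₂ + q₃) * (q₂ + q₃))
            * ((q₂ + q₃) * (q₂ + q₃) - (q₁ + + 2 * q₂ + q₃) * q₃))
        ≡ (q₁ * q₂ - q₀ * q₃) * (q₁ * q₂ - q₀ * q₃) - + 4 * ((q₁ * q₁ - q₀ * q₂) * (q₂ * q₂ - q₁ * q₃))
      invariant = ℤ-Tactic.solve-∀

  InLvee⇒triple : ∀ {n} x → InLvee n x → ∃[ q₀ ] ∃[ q₁ ] ∃[ q₂ ] ∃[ q₃ ] (x ≡ triple q₀ q₁ q₂ q₃ × hessian-discriminant q₀ q₁ q₂ q₃ ≡ n)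
  InLvee⇒triple {n} (form a b c d) (3∣b , 3∣c , disc≡) = go (∣ᵤ⇒∣ {+ 3} {b} 3∣b) (∣ᵤ⇒∣ {+ 3} {c} 3∣c)
    where
    go : _ → _ → ∃[ q₀ ] ∃[ q₁ ] ∃[ q₂ ] ∃[ q₃ ] (form a b c d ≡ triple q₀ q₁ q₂ q₃ × hessian-discriminant q₀ q₁ q₂ q₃ ≡ n)
    go (divides q₁ b≡) (divides q₂ c≡) = a , q₁ , q₂ , d , x≡ ,
      *-cancelˡℤ {+ 27} (λ ()) (ℤ.neg-injective (begin
        - (+ 27 * hessian-discriminant a q₁ q₂ d) ≡⟨ disc-hessian a q₁ q₂ d ⟨
        disc (triple a q₁ q₂ d) ≡⟨ cong disc x≡ ⟨
        disc (form a b c d) ≡⟨ disc≡ ⟩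
        - (+ 27 * n) ∎))
      where
      x≡ : form a b c d ≡ triple a q₁ q₂ d
      x≡ = form-≡ refl (trans b≡ (ℤ.*-comm q₁ (+ 3))) (trans c≡ (ℤ.*-comm q₂ (+ 3))) refl

-- The correspondence between classes of pairs and orbits of forms

module Main (D κ : ℤ) (4κ≡D²-D : + 4 ℤ.* κ ≡ D ℤ.* D ℤ.- D) (isDiscriminant : IsDiscriminant D) (n : ℤ) (n≢0 : n ≢ + 0) where
  open Alg D
  open FormInvariance
  open FormReduction
  open IntegerLemmas

  D≢0 : D ≢ + 0
  D≢0 = discriminant≢0 isDiscriminant

  module Conductor = QuadraticOrder D κ 4κ≡D²-D D≢0

  datum-of : (s : S n) (1≤c : 1 ℕ.≤ c s) → Conductor.Datum (c s) 1≤c (b s) (α₁ s) (α₂ s) (β s)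
  datum-of s 1≤c = Conductor.datum (ideal s) (invertible s) (β∈𝔞³ s) (norm s)

  presentation-of : (s : S n) (1≤c : 1 ℕ.≤ c s) → ∀ x → ΨRel s x →
    Conductor.Presentation (c s) 1≤c (b s) (α₁ s) (α₂ s) (β s) x
  presentation-of s 1≤c x (a₁ , a₂ , (a≐α , negative) , eq) = present (datum-of s 1≤c) x
    (realise (datum-of s 1≤c) a₁ a₂ a≐α (negRational⇒positive (β s) a₁ a₂ negative) x eq)
    where open Conductor (c s) 1≤c

  admissible-basis : ∀ (s : S n) → ∃[ a₁ ] ∃[ a₂ ] AdmBasis s a₁ a₂
  admissible-basis s = go (positiveBasis (datum-of s (c≥1 s)))
    where
    open Conductor (c s) (c≥1 s)
    go : ∃[ a₁ ] ∃[ a₂ ] (span a₁ a₂ ≐ span (α₁ s) (α₂ s) × Positive (β s) a₁ a₂) → ∃[ a₁ ] ∃[ a₂ ] AdmBasis s a₁ a₂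
    go (a₁ , a₂ , a≐α , positive) = a₁ , a₂ , a≐α , positive⇒negRational (β s) a₁ a₂ positive

  form-in-Lvee : ∀ (s : S n) a₁ a₂ → AdmBasis s a₁ a₂ → ∃[ x ] (embed x ≡ ΨForm (c s) a₁ a₂ (β s) × InLvee n x)
  form-in-Lvee s a₁ a₂ (a≐α , negative) =
    go (realisable (datum-of s (c≥1 s)) a₁ a₂ a≐α (negRational⇒positive (β s) a₁ a₂ negative))
    where
    open Conductor (c s) (c≥1 s)
    go : ∃[ x ] embed x ≡ ΨForm (c s) a₁ a₂ (β s) → ∃[ x ] (embed x ≡ ΨForm (c s) a₁ a₂ (β s) × InLvee n x)
    go (x , eq) = x , eq , invariants⇒InLvee
      (presentation⇒invariants (presentation-of s (c≥1 s) x (a₁ , a₂ , (a≐α , negative) , eq))) (bcΔ s)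

  private
    -- The two pairs live over conductors that are only propositionally equal, with two proofs of
    -- positivity. Both are identified before the statement for a single order applies.
    well-defined : ∀ {b k b′ k′} (1≤k : 1 ℕ.≤ k) (1≤k′ : 1 ℕ.≤ k′) {α₁ α₂ β α₁′ α₂′ β′ x y} →
      Conductor.Presentation k 1≤k b α₁ α₂ β x → Conductor.Presentation k′ 1≤k′ b′ α₁′ α₂′ β′ y → b ≡ b′ → k ≡ k′ →
      ∀ ρ → Unit ρ → (ρ • span α₁ α₂) ≐ span α₁′ α₂′ → cube ρ ⊗ β ≡ β′ → x ∼Γ y
    well-defined {k = k} 1≤k 1≤k′ P Q refl refl ρ unit ρα≐α′ ρ³β≡β′ = go 1≤k′ (ℕ.≤-irrelevant 1≤k 1≤k′) Q
      where
      go : ∀ 1≤k′ → 1≤k ≡ 1≤k′ → Conductor.Presentation k 1≤k′ _ _ _ _ _ → _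
      go _ refl Q = Conductor.equivalent⇒∼Γ k 1≤k P Q ρ unit ρα≐α′ ρ³β≡β′

    same-form : ∀ {b k b′ k′} (1≤k : 1 ℕ.≤ k) (1≤k′ : 1 ℕ.≤ k′) {α₁ α₂ β α₁′ α₂′ β′ x} →
      (P : Conductor.Presentation k 1≤k b α₁ α₂ β x) (Q : Conductor.Presentation k′ 1≤k′ b′ α₁′ α₂′ β′ x) →
      let module F = Conductor.NormForm k 1≤k (Conductor.Presentation.normForm P)
          module G = Conductor.NormForm k′ 1≤k′ (Conductor.Presentation.normForm Q) in
      b ≡ b′ → k ≡ k′ → F.f₀ ≡ G.f₀ → + 2 ℤ.* F.h ℤ.+ Conductor.p k 1≤k ≡ + 2 ℤ.* G.h ℤ.+ Conductor.p k′ 1≤k′ → F.f₂ ≡ G.f₂ →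
      ∃[ ρ ] (Unit ρ × ((ρ • span α₁ α₂) ≐ span α₁′ α₂′) × cube ρ ⊗ β ≡ β′)
    same-form {b} {k} 1≤k 1≤k′ {α₁} {α₂} {β} {α₁′} {α₂′} {β′} {x} P Q refl refl = go 1≤k′ (ℕ.≤-irrelevant 1≤k 1≤k′) Q
      where
      module F = Conductor.NormForm k 1≤k (Conductor.Presentation.normForm P)
      go : ∀ 1≤k′ → 1≤k ≡ 1≤k′ → (Q : Conductor.Presentation k 1≤k′ b α₁′ α₂′ β′ x) →
        let module G = Conductor.NormForm k 1≤k′ (Conductor.Presentation.normForm Q) in
        F.f₀ ≡ G.f₀ → + 2 ℤ.* F.h ℤ.+ Conductor.p k 1≤k ≡ + 2 ℤ.* G.h ℤ.+ Conductor.p k 1≤k′ → F.f₂ ≡ G.f₂ →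
        ∃[ ρ ] (Unit ρ × ((ρ • span α₁ α₂) ≐ span α₁′ α₂′) × cube ρ ⊗ β ≡ β′)
      go _ refl Q f₀≡ f₁≡ f₂≡ = Conductor.proportional k 1≤k P Q f₀≡
        (*-cancelˡℤ {+ 2} (λ ()) (+-cancelʳ (Conductor.p k 1≤k) _ _ f₁≡)) f₂≡
        where
        +-cancelʳ : ∀ i j k → j ℤ.+ i ≡ k ℤ.+ i → j ≡ k
        +-cancelʳ i j k eq = trans (add-back j i) (trans (cong (ℤ._- i) eq) (sym (add-back k i)))
          where
          add-back : ∀ j i → j ≡ j ℤ.+ i ℤ.- i
          add-back = ℤ-Tactic.solve-∀

  -- For the converse, γ is absorbed into the basis of the first pair, so that both pairs present
  -- the same form y and their invariants can be compared.
  classes : ∀ (s t : S n) x y → ΨRel s x → ΨRel t y → (s ∼S t ⇔ x ∼Γ y)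
  classes s t x y Ψx Ψy = mk⇔ forward backward
    where
    P : Conductor.Presentation (c s) (c≥1 s) (b s) (α₁ s) (α₂ s) (β s) x
    P = presentation-of s (c≥1 s) x Ψx
    Q : Conductor.Presentation (c t) (c≥1 t) (b t) (α₁ t) (α₂ t) (β t) y
    Q = presentation-of t (c≥1 t) y Ψy
    forward : s ∼S t → x ∼Γ y
    forward (b≡ , c≡ , ρ , unit , ρα≐α′ , ρ³β≡β′) = well-defined (c≥1 s) (c≥1 t) P Q b≡ c≡ ρ unit ρα≐α′ ρ³β≡β′
    compare : Conductor.Presentation (c s) (c≥1 s) (b s) (α₁ s) (α₂ s) (β s) y → s ∼S t
    compare P′ = go (invariants-unique D≢0 (b≥1 s) (Conductor.presentation⇒invariants (c s) (c≥1 s) P′)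
      (Conductor.presentation⇒invariants (c t) (c≥1 t) Q))
      where
      go : _ → s ∼S t
      go (b≡ , c≡ , f₀≡ , f₁≡ , f₂≡) = b≡ , c≡ , same-form (c≥1 s) (c≥1 t) P′ Q b≡ c≡ f₀≡ f₁≡ f₂≡
    backward : x ∼Γ y → s ∼S t
    backward (γ , eq) = compare (subst (Conductor.Presentation (c s) (c≥1 s) (b s) (α₁ s) (α₂ s) (β s)) eq
      (present (datum-of s (c≥1 s)) (act γ x) (act-realisation (datum-of s (c≥1 s)) γ x P)))
      where open Conductor (c s) (c≥1 s)

  -- That nD is a square expresses that D is the discriminant of ℚ(√n), or of ℚ ⊕ ℚ when n is a
  -- square.
  module _ (w : ℤ) (nD≡ww : n ℤ.* D ≡ w ℤ.* w) where
    open ≡-Reasoning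

    private
      reconstruct : ∀ q₀ q₁ q₂ q₃ g f₀ f₁ f₂ u₀ u₁ u₂ k → 1 ℕ.≤ g → 1 ℕ.≤ k → f₀ ≢ + 0 →
        q₁ ℤ.* q₁ ℤ.- q₀ ℤ.* q₂ ≡ + g ℤ.* f₀ → q₁ ℤ.* q₂ ℤ.- q₀ ℤ.* q₃ ≡ + g ℤ.* f₁ → q₂ ℤ.* q₂ ℤ.- q₁ ℤ.* q₃ ≡ + g ℤ.* f₂ →
        u₀ ℤ.* f₀ ℤ.+ u₁ ℤ.* f₁ ℤ.+ u₂ ℤ.* f₂ ≡ + 1 → f₁ ℤ.* f₁ ℤ.- + 4 ℤ.* (f₀ ℤ.* f₂) ≡ + k ℤ.* + k ℤ.* D →
        + (g ℕ.* k) ℤ.* + (g ℕ.* k) ℤ.* D ≡ n → Σ (S n) (λ s → ΨRel s (triple q₀ q₁ q₂ q₃))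
      reconstruct q₀ q₁ q₂ q₃ g f₀ f₁ f₂ u₀ u₁ u₂ k 1≤g 1≤k f₀≢0 hess₀ hess₁ hess₂ coprime discr gkΔ =
        go (middle-parity 4κ≡D²-D f₀ f₁ f₂ (+ k) discr)
        where
        open Conductor k 1≤k
        finish : ∃[ a₁ ] ∃[ a₂ ] ∃[ β ] (Datum g a₁ a₂ β × Realisation g a₁ a₂ β (triple q₀ q₁ q₂ q₃)) →
          Σ (S n) (λ s → ΨRel s (triple q₀ q₁ q₂ q₃))
        finish (a₁ , a₂ , β , d@(datum ideal invertible β∈ norm) , r) = package (unrealise d r)
          where
          package : ∃[ e₁ ] ∃[ e₂ ] (span e₁ e₂ ≐ span a₁ a₂ × Positive β e₁ e₂ × embed (triple q₀ q₁ q₂ q₃) ≡ ΨForm k e₁ e₂ β) →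
            Σ (S n) (λ s → ΨRel s (triple q₀ q₁ q₂ q₃))
          package (e₁ , e₂ , e≐a , positive , eq) = sElt g k 1≤g 1≤k gkΔ a₁ a₂ β ideal invertible β∈ norm ,
            e₁ , e₂ , (e≐a , positive⇒negRational β e₁ e₂ positive) , eq
        go : ∃[ h ] f₁ ≡ + 2 ℤ.* h ℤ.+ + k ℤ.* D → Σ (S n) (λ s → ΨRel s (triple q₀ q₁ q₂ q₃))
        go (h , f₁≡) = build f₁≡′
            (trans (outer-product 4κ≡D²-D f₀ h f₂ (+ k) (trans (cong (λ i → i ℤ.* i ℤ.- + 4 ℤ.* (f₀ ℤ.* f₂)) (sym f₁≡)) discr))
              (cong₂ (λ i j → h ℤ.* h ℤ.+ h ℤ.* i ℤ.+ j) (sym p≡cD) (sym e≡ccκ)))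
          where
          f₁≡′ : f₁ ≡ + 2 ℤ.* h ℤ.+ p
          f₁≡′ = trans f₁≡ (cong (λ i → + 2 ℤ.* h ℤ.+ i) (sym p≡cD))
          build : f₁ ≡ + 2 ℤ.* h ℤ.+ p → f₀ ℤ.* f₂ ≡ h ℤ.* h ℤ.+ h ℤ.* p ℤ.+ e → Σ (S n) (λ s → ΨRel s (triple q₀ q₁ q₂ q₃))
          build f₁≡ f₀f₂≡ = finish
            (explicit-preimage {f₀} {h} {f₂} {u₀} {u₁} {u₂} f₀≢0 f₀f₂≡ coprime′ g 1≤g q₀ q₁ q₂ q₃ hess₀ hess₁′ hess₂)
            where
            coprime′ : u₀ ℤ.* f₀ ℤ.+ u₁ ℤ.* (+ 2 ℤ.* h ℤ.+ p) ℤ.+ u₂ ℤ.* f₂ ≡ + 1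
            coprime′ = trans (cong (λ i → u₀ ℤ.* f₀ ℤ.+ u₁ ℤ.* i ℤ.+ u₂ ℤ.* f₂) (sym f₁≡)) coprime
            hess₁′ : q₁ ℤ.* q₂ ℤ.- q₀ ℤ.* q₃ ≡ + g ℤ.* (+ 2 ℤ.* h ℤ.+ p)
            hess₁′ = trans hess₁ (cong (+ g ℤ.*_) f₁≡)

      -- With g the content of the Hessian, the primitive part has discriminant m = n/g². Since nD
      -- is a square, so is mD, and `formDiscriminant` yields the conductor.
      preimage : ∀ q₀ q₁ q₂ q₃ → q₁ ℤ.* q₁ ℤ.- q₀ ℤ.* q₂ ≢ + 0 → hessian-discriminant q₀ q₁ q₂ q₃ ≡ n →
        Σ (S n) (λ s → ΨRel s (triple q₀ q₁ q₂ q₃))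
      preimage q₀ q₁ q₂ q₃ R₀≢0 eq = go (bezout₃ (q₁ ℤ.* q₁ ℤ.- q₀ ℤ.* q₂) (q₁ ℤ.* q₂ ℤ.- q₀ ℤ.* q₃) (q₂ ℤ.* q₂ ℤ.- q₁ ℤ.* q₃))
        where
        go : ∃[ g ] ∃[ f₀ ] ∃[ f₁ ] ∃[ f₂ ] ∃[ u₀ ] ∃[ u₁ ] ∃[ u₂ ]
          (q₁ ℤ.* q₁ ℤ.- q₀ ℤ.* q₂ ≡ + g ℤ.* f₀ × q₁ ℤ.* q₂ ℤ.- q₀ ℤ.* q₃ ≡ + g ℤ.* f₁ × q₂ ℤ.* q₂ ℤ.- q₁ ℤ.* q₃ ≡ + g ℤ.* f₂
            × u₀ ℤ.* f₀ ℤ.+ u₁ ℤ.* f₁ ℤ.+ u₂ ℤ.* f₂ ≡ + 1) → Σ (S n) (λ s → ΨRel s (triple q₀ q₁ q₂ q₃))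
        go (zero , f₀ , _ , _ , _ , _ , _ , R₀≡ , _) = ⊥-elim (R₀≢0 (trans R₀≡ (ℤ.*-zeroˡ f₀)))
        go (g@(suc _) , f₀ , f₁ , f₂ , u₀ , u₁ , u₂ , R₀≡ , R₁≡ , R₂≡ , coprime) =
          find-conductor (square-quotient g (m ℤ.* D) w (λ ()) (begin
            + g ℤ.* + g ℤ.* (m ℤ.* D) ≡⟨ ℤ.*-assoc (+ g ℤ.* + g) m D ⟨
            + g ℤ.* + g ℤ.* m ℤ.* D ≡⟨ cong (ℤ._* D) ggm≡n ⟩
            n ℤ.* D ≡⟨ nD≡ww ⟩
            w ℤ.* w ∎))
          where
          m : ℤ
          m = f₁ ℤ.* f₁ ℤ.- + 4 ℤ.* (f₀ ℤ.* f₂)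
          ggm≡n : + g ℤ.* + g ℤ.* m ≡ n
          ggm≡n = begin
            + g ℤ.* + g ℤ.* (f₁ ℤ.* f₁ ℤ.- + 4 ℤ.* (f₀ ℤ.* f₂)) ≡⟨ factor (+ g) f₀ f₁ f₂ ⟩
            (+ g ℤ.* f₁) ℤ.* (+ g ℤ.* f₁) ℤ.- + 4 ℤ.* ((+ g ℤ.* f₀) ℤ.* (+ g ℤ.* f₂)) ≡⟨ cong₂ (λ i j → i ℤ.* i ℤ.- + 4 ℤ.* j) R₁≡ (cong₂ ℤ._*_ R₀≡ R₂≡) ⟨
            hessian-discriminant q₀ q₁ q₂ q₃ ≡⟨ eq ⟩
            n ∎
            where
            factor : ∀ g f₀ f₁ f₂ → g ℤ.* g ℤ.* (f₁ ℤ.* f₁ ℤ.- + 4 ℤ.* (f₀ ℤ.* f₂))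
              ≡ (g ℤ.* f₁) ℤ.* (g ℤ.* f₁) ℤ.- + 4 ℤ.* ((g ℤ.* f₀) ℤ.* (g ℤ.* f₂))
            factor = ℤ-Tactic.solve-∀
          m≢0 : m ≢ + 0
          m≢0 m≡0 = n≢0 (trans (sym ggm≡n) (trans (cong (+ g ℤ.* + g ℤ.*_) m≡0) (ℤ.*-zeroʳ (+ g ℤ.* + g))))
          f₀≢0 : f₀ ≢ + 0
          f₀≢0 f₀≡0 = R₀≢0 (trans R₀≡ (trans (cong (+ g ℤ.*_) f₀≡0) (ℤ.*-zeroʳ (+ g))))
          find-conductor : ∃[ z ] m ℤ.* D ≡ z ℤ.* z → Σ (S n) (λ s → ΨRel s (triple q₀ q₁ q₂ q₃))
          find-conductor (z , mD≡zz) = finish (formDiscriminant {D} {m} isDiscriminant f₀ f₁ f₂ z refl m≢0 mD≡zz)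
            where
            finish : ∃[ k ] (1 ℕ.≤ k × m ≡ + k ℤ.* + k ℤ.* D) → Σ (S n) (λ s → ΨRel s (triple q₀ q₁ q₂ q₃))
            finish (k , 1≤k , m≡) = reconstruct q₀ q₁ q₂ q₃ g f₀ f₁ f₂ u₀ u₁ u₂ k (s≤s z≤n) 1≤k f₀≢0 R₀≡ R₁≡ R₂≡ coprime m≡ (begin
              + (g ℕ.* k) ℤ.* + (g ℕ.* k) ℤ.* D ≡⟨ cong (λ i → i ℤ.* i ℤ.* D) (ℤ.pos-* g k) ⟩
              (+ g ℤ.* + k) ℤ.* (+ g ℤ.* + k) ℤ.* D ≡⟨ regroup (+ g) (+ k) D ⟩
              + g ℤ.* + g ℤ.* (+ k ℤ.* + k ℤ.* D) ≡⟨ cong (+ g ℤ.* + g ℤ.*_) m≡ ⟨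
              + g ℤ.* + g ℤ.* m ≡⟨ ggm≡n ⟩
              n ∎)
              where
              regroup : ∀ g k D → (g ℤ.* k) ℤ.* (g ℤ.* k) ℤ.* D ≡ g ℤ.* g ℤ.* (k ℤ.* k ℤ.* D)
              regroup = ℤ-Tactic.solve-∀

    surjective : ∀ (x : L) → InLvee n x → Σ (S n) (λ s → ∃[ y ] (ΨRel s y × x ∼Γ y))
    surjective x x∈ = go (InLvee⇒triple x x∈)
      where
      go : ∃[ q₀ ] ∃[ q₁ ] ∃[ q₂ ] ∃[ q₃ ] (x ≡ triple q₀ q₁ q₂ q₃ × hessian-discriminant q₀ q₁ q₂ q₃ ≡ n) →
        Σ (S n) (λ s → ∃[ y ] (ΨRel s y × x ∼Γ y))
      go (q₀ , q₁ , q₂ , q₃ , refl , eq) = move (leading-nonzero q₀ q₁ q₂ q₃ n≢0 eq)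
        where
        move : ∃[ r₀ ] ∃[ r₁ ] ∃[ r₂ ] ∃[ r₃ ] (triple q₀ q₁ q₂ q₃ ∼Γ triple r₀ r₁ r₂ r₃ ×
          r₁ ℤ.* r₁ ℤ.- r₀ ℤ.* r₂ ≢ + 0 × hessian-discriminant r₀ r₁ r₂ r₃ ≡ n) → Σ (S n) (λ s → ∃[ y ] (ΨRel s y × triple q₀ q₁ q₂ q₃ ∼Γ y))
        move (r₀ , r₁ , r₂ , r₃ , q∼r , R₀≢0 , eq′) = attach (preimage r₀ r₁ r₂ r₃ R₀≢0 eq′)
          where
          attach : Σ (S n) (λ s → ΨRel s (triple r₀ r₁ r₂ r₃)) → Σ (S n) (λ s → ∃[ y ] (ΨRel s y × triple q₀ q₁ q₂ q₃ ∼Γ y))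
          attach (s , Ψs) = s , triple r₀ r₁ r₂ r₃ , Ψs , q∼r

open import Data.Integer using (_*_)

theorem3p1 : ∀ (n D : ℤ) → n ≢ + 0 → IsDiscriminant D → IsSquareℤ (n * D) →
  let open Alg D in
    -- every class has a Z-basis of 𝔞 with the required orientation
    (∀ (s : S n) → ∃[ a₁ ] ∃[ a₂ ] AdmBasis s a₁ a₂)
    -- the resulting form lies in L^∨(n)
    × (∀ (s : S n) a₁ a₂ → AdmBasis s a₁ a₂ →
         ∃[ x ] (embed x ≡ ΨForm (c s) a₁ a₂ (β s) × InLvee n x))
    -- well-defined on classes (⇐ direction: injective)
    × (∀ (s t : S n) x y → ΨRel s x → ΨRel t y → (s ∼S t ⇔ x ∼Γ y))
    -- surjective onto Γ \ L^∨(n)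
    × (∀ (x : L) → InLvee n x → Σ (S n) (λ s → ∃[ y ] (ΨRel s y × x ∼Γ y)))
theorem3p1 n D n≢0 isDiscriminant (w , nD≡ww) = admissible-basis , form-in-Lvee , classes , surjective w nD≡ww
  where
  quarter : ∃[ κ ] + 4 * κ ≡ D * D ℤ.- D
  quarter = IntegerLemmas.discriminant-quarter isDiscriminant
  open Main D (proj₁ quarter) (proj₂ quarter) isDiscriminant n n≢0
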